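{- Let $L:=L^{\mathrm{skew}}_{A_{n-1}}(P/Q)$, with the scalars $X_{T,S},Y_{S,T}$ attached to each edge $S\xrightarrow{i}T$. Then $L$ is $A_{n-1}$-structured (whenever $S\xrightarrow{i}T$, $\mathrm{wt}(T)=\mathrm{wt}(S)+\alpha_i$ with $\alpha_i=2\omega_i-\omega_{i-1}-\omega_{i+1}$, $\omega_0=\omega_n:=0$), and the scalars satisfy all DC relations. Consequently, on the vector space $V[L]$ the assignments $$x_i.v_T:=\sum_{U:\,T\xrightarrow{i}U}X_{U,T}v_U,\qquad y_i.v_T:=\sum_{S:\,S\xrightarrow{i}T}Y_{S,T}v_S,\qquad h_i.v_T:=(\#_i(T)-\#_{i+1}(T))v_T$$ ($1\le i\le n-1$) define a representation of $\mathfrak{sl}(n,\mathbb C)$; $\{v_T\}_{T\in L}$ is a weight basis, $v_T$ having weight $\mathrm{wt}(T)$; the character of $V[L]$ is $\vartheta_{P/Q}$; and $L$ with these scalars is the representation diagram of this basis (in particular $L$ is its supporting graph).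
   Context: Fix integers $m\ge n\ge 2$ and weakly decreasing $m$-tuples of nonnegative integers $P=(P_1,\dots,P_m)$ and $Q=(Q_1,\dots,Q_m)$ with $Q_r\le P_r$ for all $r$. The skew shape $P/Q$ is the set of cells $(r,c)$ (row $r$, column $c$, matrix convention) with $Q_r<c\le P_r$; assume no column of $P/Q$ contains more than $n$ cells. $L^{\mathrm{skew}}_{A_{n-1}}(P/Q)$ is the set of semistandard tableaux $T$ of shape $P/Q$ with entries in $\{1,\dots,n\}$ (entries weakly increase left to right along rows and strictly increase top to bottom down columns), partially ordered by $S\le T$ iff $S_{r,c}\ge T_{r,c}$ for every cell $(r,c)$. The Hasse diagram edges are colored: $S\to T$ is a covering iff $S,T$ differ in exactly one cell $(r,c)$ and $S_{r,c}=T_{r,c}+1$; this edge gets color $i:=T_{r,c}\in\{1,\dots,n-1\}$, written $S\xrightarrow{i}T$. For $1\le i\le n$, $\#_i(T)$ is the number of entries of $T$ equal to $i$; $\mathrm{wt}(T):=\sum_{i=1}^{n-1}(\#_i(T)-\#_{i+1}(T))\omega_i$ where $\omega_i$ are the fundamental weights of type $A_{n-1}$; $z^{\sum\mu_i\omega_i}:=\prod z_i^{\mu_i}$; $\vartheta_{P/Q}:=\sum_T z^{\mathrm{wt}(T)}$. GT parallelograms: for $0\le i\le n$ put $C_i:=\{i-(m-1),\dots,i-1,i\}$. To each tableau $T$ associate the integer array $(g_{i,j}(T))_{0\le i\le n,\,j\in C_i}$ defined by $g_{i,i+1-r}(T):=Q_r+|\{c:(r,c)\in P/Q,\ T_{r,c}\le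 i\}|$ for $1\le r\le m$. One has $S\xrightarrow{i}T$ iff the arrays of $S$ and $T$ agree except at exactly one position $(i,j)$, where $g_{i,j}(T)=g_{i,j}(S)+1$. Edge coefficients: for an edge $S\xrightarrow{i}T$ with differing position $(i,j)$, writing $g_{p,q}:=g_{p,q}(T)$, $$X_{T,S}:=-\frac{\prod_{k\in C_{i+1}}(g_{i,j}-g_{i+1,k}+j-k)}{\prod_{k\in C_i\setminus\{j\}}(g_{i,j}-g_{i,k}+j-k-1)},\qquad Y_{S,T}:=\frac{\prod_{k\in C_{i-1}}(g_{i,j}-g_{i-1,k}+j-k-1)}{\prod_{k\in C_i\setminus\{j\}}(g_{i,j}-g_{i,k}+j-k)}.$$ Modules: $x_i,y_i,h_i$ ($1\le i\le n-1$) are the Chevalley generators of $\mathfrak{sl}(n,\mathbb C)$; $V[L]$ is the complex vector space with basis $\{v_T\}_{T\in L}$. A weight basis is a basis of weight vectors. The supporting graph of a weight basis $\{v_r\}$ has an edge $s\xrightarrow{i}t$ iff the coefficient of $v_t$ in $x_i.v_s$ or the coefficient of $v_s$ in $y_i.v_t$ is nonzero; together with these coefficient pairs it is the representation diagram. Components and weights on colored posets: the $i$-component of $t$ is the set of elements reachable from $t$ by undirected paths of $i$-colored edges; with $l_i(t)$ its length, $\rho_i(t)$ the rank of $t$ in it, $m_i(t):=2\rho_i(t)-l_i(t)$. DC relations: for every diamond $R\xrightarrow{j}S$, $R\xrightarrow{i}T$, $S\xrightarrow{i}U$, $T\xrightarrow{j}U$ ($S\ne T$): $X_{U,S}Y_{T,U}=Y_{R,S}X_{T,R}$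 and $X_{U,T}Y_{S,U}=Y_{R,T}X_{S,R}$; and for every $T$ and color $i$ (crossing relation): $\sum_{S:S\xrightarrow{i}T}X_{T,S}Y_{S,T}-\sum_{U:T\xrightarrow{i}U}X_{U,T}Y_{T,U}=m_i(T)$. -}

module Defs where

open import Level using (Level; _⊔_)
open import Function using (_∘_; _⇔_)
open import Data.Bool using (if_then_else_; _∧_)
open import Data.Empty using (⊥; ⊥-elim)
open import Data.Unit using (⊤; tt)
open import Data.Product using (Σ; Σ-syntax; ∃; ∃-syntax; _×_; _,_; proj₁; proj₂)
open import Data.Product.Properties using () renaming (≡-dec to ×-≡-dec)
open import Data.Sum using (_⊎_; inj₁; inj₂)
open import Data.Maybe using (Maybe)
import Data.Maybe as Maybe
open import Data.Nat as ℕ using (ℕ; zero; suc; _∸_; z≤n; s≤s; z<s; s<s)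
import Data.Nat.Properties as ℕₚ
open import Data.Nat.ListAction using () renaming (sum to ∑ℕ)
open import Data.Integer as ℤ using (ℤ; +_; -[1+_]; 0ℤ; 1ℤ)
import Data.Integer.Properties as ℤₚ
open import Data.Integer.Tactic.RingSolver using (solve-∀)
open import Data.Rational as ℚ using (ℚ; 0ℚ)
open import Data.Rational.Literals using (fromℤ)
open import Data.Fin as Fin using (Fin; zero; suc; toℕ)
import Data.Fin.Properties as Finₚ
open import Data.Vec as Vec using (Vec; []; _∷_)
open import Data.Vec.Properties using () renaming (≡-dec to Vec-≡-dec)
import Data.Vec.Properties as Vecₚ
open import Data.List as List using (List; []; _∷_)
open import Data.List.Relation.Unary.All using (All; []; _∷_)
open import Data.List.Relation.Unary.All.Properties using (all-filter)
open import Relation.Nullary using (¬_; Dec; yes; no; does)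
open import Relation.Nullary.Decidable
  using (map′; recompute; dec⇒maybe; dec-true; dec-false; ¬?; _×-dec_; _→-dec_)
open import Relation.Unary using (Pred; Decidable)
open import Relation.Binary using (DecidableEquality; tri<; tri≈; tri>)
open import Relation.Binary.PropositionalEquality
  using (_≡_; _≢_; refl; sym; trans; cong; cong₂; subst; subst₂)
open import Relation.Binary.Construct.Closure.Equivalence using (EqClosure)
open import Algebra.Apartness.Bundles using (HeytingCommutativeRing; HeytingField)
open import Algebra.Bundles using (CommutativeRing)
open import Algebra.Module.Bundles using (LeftModule)
import Algebra.Properties.Monoid.Mult
import Algebra.Properties.AbelianGroup
import Algebra.Properties.CommutativeMonoid.Sum
import Algebra.Properties.Semiring.Sum
import Algebra.Construct.Pointwise as Pointwise

∑ℤ ∏ℤ : List ℤ → ℤ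
∑ℤ = List.foldr ℤ._+_ 0ℤ
∏ℤ = List.foldr ℤ._*_ 1ℤ

∑ℚ : List ℚ → ℚ
∑ℚ = List.foldr ℚ._+_ 0ℚ

------------------------------------------------------------------------
-- Type A_{n-1}: colors and weights

-- The color 1 ≤ i ≤ n-1 is represented by i - 1.
Color : ℕ → Set
Color n = Fin (n ∸ 1)

colorℕ : ∀ {k} → Fin k → ℕ
colorℕ i = suc (toℕ i)

-- The vector of coefficients on ω₁, …, ω_{n-1}.
Weight : ℕ → Set
Weight n = Vec ℤ (n ∸ 1)

_≟ʷ_ : ∀ {k} → DecidableEquality (Vec ℤ k)
_≟ʷ_ = Vec-≡-dec ℤ._≟_

_+ʷ_ _-ʷ_ : ∀ {k} → Vec ℤ k → Vec ℤ k → Vec ℤ k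
_+ʷ_ = Vec.zipWith ℤ._+_
_-ʷ_ = Vec.zipWith ℤ._-_

-- Indexed by ℕ so that ω n 0 and ω n n are the zero weight.
ω : ∀ n → ℕ → Weight n
ω n k = Vec.tabulate λ i → if does (colorℕ i ℕ.≟ k) then 1ℤ else 0ℤ

α : ∀ n → Color n → Weight n
α n i = ((ω n (colorℕ i) +ʷ ω n (colorℕ i)) -ʷ ω n (toℕ i)) -ʷ ω n (suc (colorℕ i))

-- A Laurent polynomial in z₁, …, z_{n-1}, given by its coefficients.
Laurent : ℕ → Set
Laurent n = Weight n → ℤ

z^ : ∀ n → Weight n → Laurent n
z^ n μ ν = if does (μ ≟ʷ ν) then 1ℤ else 0ℤ

------------------------------------------------------------------------
-- Skew shapes

-- Rows are indexed from 0, so P r here is the part P_{r+1}.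
record SkewShape (m n : ℕ) : Set where
  field
    P Q          : Fin m → ℕ
    P-decreasing : ∀ {r s} → r Fin.≤ s → P s ℕ.≤ P r
    Q-decreasing : ∀ {r s} → r Fin.≤ s → Q s ℕ.≤ Q r
    Q≤P          : ∀ r → Q r ℕ.≤ P r

  columnLength : ℕ → ℕ
  columnLength c = List.length
    (List.filter (λ r → (Q r ℕ.<? c) ×-dec (c ℕ.≤? P r)) (List.allFin m))

  field
    columnLength≤n : ∀ c → columnLength c ℕ.≤ n

  rowLength : Fin m → ℕ
  rowLength r = P r ∸ Q r

-- An entry v ∈ {1, …, n} is represented by v - 1.
value : ∀ {n} → Fin n → ℕ
value e = suc (toℕ e)

-- The fillings of rows of lengths ℓ, as iterated products rather than
-- functions so that their equality is decidable.
Filling : ℕ → (k : ℕ) → (Fin k → ℕ) → Set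
Filling n zero    ℓ = ⊤
Filling n (suc k) ℓ = Vec (Fin n) (ℓ zero) × Filling n k (ℓ ∘ suc)

rowOf : ∀ {n k ℓ} → Filling n k ℓ → (r : Fin k) → Vec (Fin n) (ℓ r)
rowOf (v , F) zero    = v
rowOf (v , F) (suc r) = rowOf F r

_≟ᶠ_ : ∀ {n k ℓ} → DecidableEquality (Filling n k ℓ)
_≟ᶠ_ {k = zero}  tt tt = yes refl
_≟ᶠ_ {k = suc k} = ×-≡-dec (Vec-≡-dec Finₚ._≟_) (_≟ᶠ_ {k = k})

allVecs : ∀ n ℓ → List (Vec (Fin n) ℓ)
allVecs n zero    = [] ∷ []
allVecs n (suc ℓ) = List.cartesianProductWith _∷_ (List.allFin n) (allVecs n ℓ)

allFillings : ∀ n k ℓ → List (Filling n k ℓ)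
allFillings n zero    ℓ = tt ∷ []
allFillings n (suc k) ℓ =
  List.cartesianProduct (allVecs n (ℓ zero)) (allFillings n k (ℓ ∘ suc))

Sorted : ∀ {n ℓ} → Vec (Fin n) ℓ → Set
Sorted v = ∀ c d → c Fin.≤ d → Vec.lookup v c Fin.≤ Vec.lookup v d

count≤ : ∀ {n ℓ} → ℕ → Vec (Fin n) ℓ → ℕ
count≤ i = Vec.count (λ e → value e ℕ.≤? i)

count-yes : ∀ {n ℓ} i (x : Fin n) (xs : Vec (Fin n) ℓ) →
            value x ℕ.≤ i → count≤ i (x ∷ xs) ≡ suc (count≤ i xs)
count-yes i x xs p rewrite dec-true (value x ℕ.≤? i) p = refl

count-no : ∀ {n ℓ} i (x : Fin n) (xs : Vec (Fin n) ℓ) →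
           ¬ (value x ℕ.≤ i) → count≤ i (x ∷ xs) ≡ count≤ i xs
count-no i x xs p rewrite dec-false (value x ℕ.≤? i) p = refl

sorted-tail : ∀ {n ℓ} {x : Fin n} {xs : Vec (Fin n) ℓ} → Sorted (x ∷ xs) → Sorted xs
sorted-tail s c d c≤d = s (suc c) (suc d) (s≤s c≤d)

<count⇒value≤ : ∀ {n ℓ} i (v : Vec (Fin n) ℓ) → Sorted v → ∀ k →
                toℕ k ℕ.< count≤ i v → value (Vec.lookup v k) ℕ.≤ i
<count⇒value≤ i (x ∷ xs) s k k< with value x ℕ.≤? i
... | no x≰i = ⊥-elim (x≰i (head≤ xs s (ℕₚ.≤-<-trans z≤n
                 (subst (toℕ k ℕ.<_) (count-no i x xs x≰i) k<))))
  where
  head≤ : ∀ {ℓ} (ys : Vec (Fin _) ℓ) → Sorted (x ∷ ys) → 0 ℕ.< count≤ i ys → value x ℕ.≤ i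
  head≤ []       _ ()
  head≤ (y ∷ ys) t 0< = ℕₚ.≤-trans (s≤s (t zero (suc zero) z≤n))
    (<count⇒value≤ i (y ∷ ys) (sorted-tail {x = x} {xs = y ∷ ys} t) zero 0<)
<count⇒value≤ i (x ∷ xs) s zero    k< | yes x≤i = x≤i
<count⇒value≤ i (x ∷ xs) s (suc k) k< | yes x≤i =
  <count⇒value≤ i xs (sorted-tail {x = x} {xs = xs} s) k
    (ℕ.s<s⁻¹ (subst (suc (toℕ k) ℕ.<_) (count-yes i x xs x≤i) k<))

value≤⇒<count : ∀ {n ℓ} i (v : Vec (Fin n) ℓ) → Sorted v → ∀ k →
                value (Vec.lookup v k) ℕ.≤ i → toℕ k ℕ.< count≤ i v
value≤⇒<count i (x ∷ xs) s zero    p = subst (0 ℕ.<_) (sym (count-yes i x xs p)) z<s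
value≤⇒<count i (x ∷ xs) s (suc k) p =
  subst (suc (toℕ k) ℕ.<_)
    (sym (count-yes i x xs (ℕₚ.≤-trans (s≤s (s zero (suc k) z≤n)) p)))
    (s<s (value≤⇒<count i xs (sorted-tail {x = x} {xs = xs} s) k p))

count≤length : ∀ {n ℓ} i (v : Vec (Fin n) ℓ) → count≤ i v ℕ.≤ ℓ
count≤length i = Vecₚ.count≤n (λ e → value e ℕ.≤? i)

------------------------------------------------------------------------
-- The colored poset of semistandard tableaux, and its edge coefficients

module SkewTableaux {m n : ℕ} (shape : SkewShape m n) where

  open SkewShape shape

  -- (r , c) is the cell in column Q r + 1 + c of the r-th row.
  Cell : Set
  Cell = Σ[ r ∈ Fin m ] Fin (rowLength r)

  _≟ᶜ_ : DecidableEquality Cell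
  _≟ᶜ_ = ×-≡-dec Finₚ._≟_ Finₚ._≟_

  RowWeak : Filling n m rowLength → Set
  RowWeak F = ∀ r → Sorted (rowOf F r)

  ColumnStrict : Filling n m rowLength → Set
  ColumnStrict F = ∀ r s (c : Fin (rowLength r)) (d : Fin (rowLength s)) →
    r Fin.< s → Q r ℕ.+ toℕ c ≡ Q s ℕ.+ toℕ d →
    Vec.lookup (rowOf F r) c Fin.< Vec.lookup (rowOf F s) d

  Semistandard : Filling n m rowLength → Set
  Semistandard F = RowWeak F × ColumnStrict F

  semistandard? : Decidable Semistandard
  semistandard? F =
    (Finₚ.all? λ r → Finₚ.all? λ c → Finₚ.all? λ d →
      (c Finₚ.≤? d) →-dec (_ Finₚ.≤? _))
    ×-dec
    (Finₚ.all? λ r → Finₚ.all? λ s → Finₚ.all? λ c → Finₚ.all? λ d →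
      (r Finₚ.<? s) →-dec ((_ ℕ.≟ _) →-dec (_ Finₚ.<? _)))

  record Tableau : Set where
    constructor tableau
    field
      filling       : Filling n m rowLength
      .semistandard : Semistandard filling

    row : (r : Fin m) → Vec (Fin n) (rowLength r)
    row = rowOf filling

    entry : Cell → ℕ
    entry (r , c) = value (Vec.lookup (row r) c)

  open Tableau public

  isSemistandard : ∀ T → Semistandard (filling T)
  isSemistandard (tableau F p) = recompute (semistandard? F) p

  _≟ᵗ_ : DecidableEquality Tableau
  tableau F p ≟ᵗ tableau G q = map′ (λ { refl → refl }) (cong filling) (F ≟ᶠ G)

  tableaux : List Tableau
  tableaux = List.mapMaybe
    (λ F → Maybe.map (λ p → tableau F p) (dec⇒maybe (semistandard? F)))
    (allFillings n m rowLength)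

  #[_] : ℕ → Tableau → ℕ
  #[ k ] T = ∑ℕ (List.map
    (λ r → Vec.count (λ e → value e ℕ.≟ k) (row T r)) (List.allFin m))

  -- The coefficient of wt T on ωᵢ.
  wtᵢ : Color n → Tableau → ℤ
  wtᵢ i T = + #[ colorℕ i ] T ℤ.- + #[ suc (colorℕ i) ] T

  wt : Tableau → Weight n
  wt T = Vec.tabulate λ i → wtᵢ i T

  ϑ : Laurent n
  ϑ ν = ∑ℤ (List.map (λ T → z^ n (wt T) ν) tableaux)

  -- S →ᵢ T.  In the order in which S ≤ T iff S has entrywise the larger
  -- entries, the coverings are the pairs differing by 1 in exactly one cell;
  -- the color is the entry of T in that cell.
  record Edge (i : Color n) (S T : Tableau) : Set where
    field
      cell      : Cell
      T-entry   : entry T cell ≡ colorℕ i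
      S-entry   : entry S cell ≡ suc (entry T cell)
      elsewhere : ∀ κ → κ ≢ cell → entry S κ ≡ entry T κ

    edgeRow : Fin m
    edgeRow = proj₁ cell

  open Edge public

  edge? : ∀ i S T → Dec (Edge i S T)
  edge? i S T = map′
    (λ { (r , c , p , q , e) → record
         { cell = r , c ; T-entry = p ; S-entry = q ; elsewhere = λ { (s , d) → e s d } } })
    (λ E → proj₁ (cell E) , proj₂ (cell E) , T-entry E , S-entry E , λ s d → elsewhere E (s , d))
    (Finₚ.any? λ r → Finₚ.any? λ c →
      (_ ℕ.≟ _) ×-dec (_ ℕ.≟ _) ×-dec
      Finₚ.all? λ s → Finₚ.all? λ d → (¬? ((s , d) ≟ᶜ (r , c))) →-dec (_ ℕ.≟ _))

  edgesInto : ∀ i T → List (∃[ S ] Edge i S T)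
  edgesInto i T = List.mapMaybe
    (λ S → Maybe.map (S ,_) (dec⇒maybe (edge? i S T))) tableaux

  edgesFrom : ∀ i T → List (∃[ U ] Edge i T U)
  edgesFrom i T = List.mapMaybe
    (λ U → Maybe.map (U ,_) (dec⇒maybe (edge? i T U))) tableaux

  -- GT parallelograms.  The position (i , j) with j ∈ Cᵢ is indexed by the
  -- row r with j = pos i r; as r ranges over all rows, pos i r ranges over
  -- Cᵢ.  So g T i r is the entry of the array at (i , pos i r).
  pos : ℕ → Fin m → ℤ
  pos i r = + i ℤ.- + toℕ r

  g : Tableau → ℕ → Fin m → ℕ
  g T i r = Q r ℕ.+ count≤ i (row T r)

  -- g T i r - g T i′ s + j - k with j = pos i r and k = pos i′ s
  gap : Tableau → (i : ℕ) (r : Fin m) (i′ : ℕ) (s : Fin m) → ℤ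
  gap T i r i′ s = + g T i r ℤ.- + g T i′ s ℤ.+ pos i r ℤ.- pos i′ s

  otherRows : Fin m → List (Fin m)
  otherRows r = List.filter (λ s → ¬? (s Finₚ.≟ r)) (List.allFin m)

  -- An edge S →ᵢ T turns an i + 1 in the row r into an i, so the arrays of S
  -- and T differ exactly at the position (i , pos i r).  These are the
  -- products of the coefficients for this position.
  X-numerator X-denominator Y-numerator Y-denominator : Color n → Fin m → Tableau → ℤ
  X-numerator   i r T = ∏ℤ (List.map
    (λ s → gap T (colorℕ i) r (suc (colorℕ i)) s) (List.allFin m))
  X-denominator i r T = ∏ℤ (List.map
    (λ s → gap T (colorℕ i) r (colorℕ i) s ℤ.- 1ℤ) (otherRows r))
  Y-numerator   i r T = ∏ℤ (List.map
    (λ s → gap T (colorℕ i) r (toℕ i) s ℤ.- 1ℤ) (List.allFin m))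
  Y-denominator i r T = ∏ℤ (List.map
    (λ s → gap T (colorℕ i) r (colorℕ i) s) (otherRows r))

  g-decreasing : ∀ T i {r s} → r Fin.< s → g T i s ℕ.≤ g T i r
  g-decreasing T i {r} {s} r<s = ℕₚ.≮⇒≥ absurd
    where
    a = count≤ i (row T s)
    b = count≤ i (row T r)
    weak   = proj₁ (isSemistandard T)
    strict = proj₂ (isSemistandard T)
    Qs≤Qr = Q-decreasing (ℕₚ.<⇒≤ r<s)
    Qs≤gr = ℕₚ.≤-trans Qs≤Qr (ℕₚ.m≤m+n (Q r) b)

    gs≤Ps : g T i s ℕ.≤ P s
    gs≤Ps = ℕₚ.≤-trans (ℕₚ.+-monoʳ-≤ (Q s) (count≤length i (row T s)))
              (ℕₚ.≤-reflexive (ℕₚ.m+[n∸m]≡n (Q≤P s)))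

    module _ (gr<gs : g T i r ℕ.< g T i s) where

      d< : g T i r ∸ Q s ℕ.< a
      d< = subst (g T i r ∸ Q s ℕ.<_) (ℕₚ.m+n∸m≡n (Q s) a)
             (ℕₚ.∸-monoˡ-< gr<gs Qs≤gr)

      d<ℓ : g T i r ∸ Q s ℕ.< rowLength s
      d<ℓ = ℕₚ.<-≤-trans d< (count≤length i (row T s))

      b<ℓ : b ℕ.< rowLength r
      b<ℓ = subst (ℕ._< rowLength r) (ℕₚ.m+n∸m≡n (Q r) b)
              (ℕₚ.∸-monoˡ-<
                (ℕₚ.<-≤-trans gr<gs (ℕₚ.≤-trans gs≤Ps (P-decreasing (ℕₚ.<⇒≤ r<s))))
                (ℕₚ.m≤m+n (Q r) b))

      c : Fin (rowLength r)
      c = Fin.fromℕ< b<ℓ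

      d : Fin (rowLength s)
      d = Fin.fromℕ< d<ℓ

      sameColumn : Q r ℕ.+ toℕ c ≡ Q s ℕ.+ toℕ d
      sameColumn = trans (cong (Q r ℕ.+_) (Finₚ.toℕ-fromℕ< b<ℓ))
        (sym (trans (cong (Q s ℕ.+_) (Finₚ.toℕ-fromℕ< d<ℓ)) (ℕₚ.m+[n∸m]≡n Qs≤gr)))

      entry-d≤i : entry T (s , d) ℕ.≤ i
      entry-d≤i = <count⇒value≤ i (row T s) (weak s) d
        (subst (ℕ._< a) (sym (Finₚ.toℕ-fromℕ< d<ℓ)) d<)

      entry-c≤i : entry T (r , c) ℕ.≤ i
      entry-c≤i = ℕₚ.≤-trans (ℕₚ.<⇒≤ (s≤s (strict r s c d r<s sameColumn))) entry-d≤i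

      absurd : ⊥
      absurd = ℕₚ.<-irrefl (Finₚ.toℕ-fromℕ< b<ℓ)
        (value≤⇒<count i (row T r) (weak r) c entry-c≤i)

  -- g strictly increases at the position of an edge, and is unchanged in the
  -- other rows.
  g-edge : ∀ {i S T} (e : Edge i S T) →
           g S (colorℕ i) (edgeRow e) ℕ.< g T (colorℕ i) (edgeRow e)
  g-edge {i} {S} {T} e = ℕₚ.+-monoʳ-< (Q r) (ℕₚ.≤-<-trans
    (ℕₚ.≮⇒≥ λ c< → ℕₚ.<-irrefl refl (ℕₚ.≤-trans
      (ℕₚ.≤-reflexive (sym (trans (S-entry e) (cong suc (T-entry e)))))
      (<count⇒value≤ (colorℕ i) (row S r) (proj₁ (isSemistandard S) r) c c<)))
    (value≤⇒<count (colorℕ i) (row T r) (proj₁ (isSemistandard T) r) c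
      (ℕₚ.≤-reflexive (T-entry e))))
    where
    r = edgeRow e
    c = proj₂ (cell e)

  g-elsewhere : ∀ {i S T} (e : Edge i S T) k s → s ≢ edgeRow e → g S k s ≡ g T k s
  g-elsewhere {S = S} {T} e k s s≢r = cong (λ v → Q s ℕ.+ count≤ k v) same
    where
    same : row S s ≡ row T s
    same = trans (sym (Vecₚ.tabulate∘lookup (row S s))) (trans
      (Vecₚ.tabulate-cong λ c → Finₚ.toℕ-injective
        (ℕₚ.suc-injective (elsewhere e (s , c) (s≢r ∘ cong proj₁))))
      (Vecₚ.tabulate∘lookup (row T s)))

  shifted : Tableau → ℕ → Fin m → ℤ
  shifted T i r = + g T i r ℤ.- + toℕ r

  gap≡ : ∀ T i r s → gap T i r i s ≡ shifted T i r ℤ.- shifted T i s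
  gap≡ T i r s = identity (+ g T i r) (+ g T i s) (+ i) (+ toℕ r) (+ toℕ s)
    where
    identity : ∀ a b i r s → a ℤ.- b ℤ.+ (i ℤ.- r) ℤ.- (i ℤ.- s) ≡ (a ℤ.- r) ℤ.- (b ℤ.- s)
    identity = solve-∀

  shifted-decreasing : ∀ T i {r s} → r Fin.< s → shifted T i s ℤ.< shifted T i r
  shifted-decreasing T i r<s = ℤₚ.+-mono-≤-<
    (ℤ.+≤+ (g-decreasing T i r<s)) (ℤₚ.neg-mono-< (ℤ.+<+ r<s))

  gap≢0 : ∀ T i r s → s ≢ r → gap T i r i s ≢ 0ℤ
  gap≢0 T i r s s≢r gap≡0 with Finₚ.<-cmp r s
  ... | tri< r<s _ _ = ℤₚ.<-irrefl
    (sym (ℤₚ.i-j≡0⇒i≡j _ _ (trans (sym (gap≡ T i r s)) gap≡0))) (shifted-decreasing T i r<s)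
  ... | tri≈ _ r≡s _ = s≢r (sym r≡s)
  ... | tri> _ _ s<r = ℤₚ.<-irrefl
    (ℤₚ.i-j≡0⇒i≡j _ _ (trans (sym (gap≡ T i r s)) gap≡0)) (shifted-decreasing T i s<r)

  gap-1≡0 : ∀ T i r s → gap T i r i s ℤ.- 1ℤ ≡ 0ℤ → shifted T i r ≡ ℤ.suc (shifted T i s)
  gap-1≡0 T i r s eq = trans (identity _ _)
    (trans (cong (ℤ._+ ℤ.suc (shifted T i s))
             (trans (sym (cong (ℤ._- 1ℤ) (gap≡ T i r s))) eq))
           (ℤₚ.+-identityˡ _))
    where
    identity : ∀ a b → a ≡ (a ℤ.- b ℤ.- 1ℤ) ℤ.+ (1ℤ ℤ.+ b)
    identity = solve-∀

  gap-1≢0 : ∀ {i S T} (e : Edge i S T) s → s ≢ edgeRow e →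
            gap T (colorℕ i) (edgeRow e) (colorℕ i) s ℤ.- 1ℤ ≢ 0ℤ
  gap-1≢0 {i} {S} {T} e s s≢r eq with Finₚ.<-cmp (edgeRow e) s
  ... | tri≈ _ r≡s _ = s≢r (sym r≡s)
  ... | tri> _ _ s<r = ℤₚ.<-irrefl refl (ℤₚ.<-trans (shifted-decreasing T (colorℕ i) s<r)
          (subst (shifted T (colorℕ i) s ℤ.<_) (sym (gap-1≡0 T (colorℕ i) (edgeRow e) s eq))
            (ℤₚ.suc[i]≤j⇒i<j ℤₚ.≤-refl)))
  ... | tri< r<s _ _ = ℤₚ.<-irrefl refl (ℤₚ.<-≤-trans Sr<Tr
          (subst (ℤ._≤ shifted S (colorℕ i) r) (sym (gap-1≡0 T (colorℕ i) r s eq))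
            (ℤₚ.i<j⇒suc[i]≤j Ts<Sr)))
    where
    r = edgeRow e
    Sr<Tr : shifted S (colorℕ i) r ℤ.< shifted T (colorℕ i) r
    Sr<Tr = ℤₚ.+-monoˡ-< (ℤ.- + toℕ r) (ℤ.+<+ (g-edge e))
    Ts<Sr : shifted T (colorℕ i) s ℤ.< shifted S (colorℕ i) r
    Ts<Sr = subst (λ k → + k ℤ.- + toℕ s ℤ.< shifted S (colorℕ i) r)
      (g-elsewhere e (colorℕ i) s s≢r) (shifted-decreasing S (colorℕ i) r<s)

  ∏≢0 : ∀ {A : Set} {B : A → Set} (f : A → ℤ) (xs : List A) → All B xs →
        (∀ x → B x → f x ≢ 0ℤ) → ∏ℤ (List.map f xs) ≢ 0ℤ
  ∏≢0 f []       []       f≢0 ()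
  ∏≢0 f (x ∷ xs) (b ∷ bs) f≢0 eq with ℤₚ.i*j≡0⇒i≡0∨j≡0 (f x) eq
  ... | inj₁ fx≡0 = f≢0 x b fx≡0
  ... | inj₂ ∏≡0  = ∏≢0 f xs bs f≢0 ∏≡0

  X-denominator-nonZero : ∀ {i S T} (e : Edge i S T) →
                          ℤ.NonZero (X-denominator i (edgeRow e) T)
  X-denominator-nonZero e = ℤ.≢-nonZero
    (∏≢0 _ (otherRows (edgeRow e)) (all-filter _ (List.allFin m)) (gap-1≢0 e))

  Y-denominator-nonZero : ∀ {i S T} (e : Edge i S T) →
                          ℤ.NonZero (Y-denominator i (edgeRow e) T)
  Y-denominator-nonZero {i} {T = T} e = ℤ.≢-nonZero
    (∏≢0 _ (otherRows (edgeRow e)) (all-filter _ (List.allFin m))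
      (gap≢0 T (colorℕ i) (edgeRow e)))

  -- X e is X_{T,S} and Y e is Y_{S,T} for the edge e : S →ᵢ T.
  X Y : ∀ {i S T} → Edge i S T → ℚ
  X {i} {S} {T} e = ℚ.- (ℚ._÷_ (fromℤ (X-numerator i (edgeRow e) T))
                               (fromℤ (X-denominator i (edgeRow e) T))
                               {{X-denominator-nonZero e}})
  Y {i} {S} {T} e = ℚ._÷_ (fromℤ (Y-numerator i (edgeRow e) T))
                          (fromℤ (Y-denominator i (edgeRow e) T))
                          {{Y-denominator-nonZero e}}

  AStructured : Set
  AStructured = ∀ {i S T} → Edge i S T → wt T ≡ wt S +ʷ α n i

  _∈Component[_]_ : Tableau → Color n → Tableau → Set
  s ∈Component[ i ] t = EqClosure (Edge i) t s

  -- The rank function of the i-component of t and its length; the values of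
  -- rank off the component play no role.
  record ComponentRank (i : Color n) (t : Tableau) : Set where
    field
      rank        : Tableau → ℕ
      length      : ℕ
      rank-step   : ∀ {r s} → r ∈Component[ i ] t → s ∈Component[ i ] t →
                    Edge i r s → rank s ≡ suc (rank r)
      rank≤length : ∀ {s} → s ∈Component[ i ] t → rank s ℕ.≤ length
      rank-onto   : ∀ {k} → k ℕ.≤ length →
                    ∃[ s ] (s ∈Component[ i ] t × rank s ≡ k)

    -- mᵢ(t) = 2ρᵢ(t) - lᵢ(t)
    m-value : ℤ
    m-value = + (2 ℕ.* rank t) ℤ.- + length

  DiamondRelations : Set
  DiamondRelations = ∀ {i j R S T U} → S ≢ T →
    (RS : Edge j R S) (RT : Edge i R T) (SU : Edge i S U) (TU : Edge j T U) →
    X SU ℚ.* Y TU ≡ Y RS ℚ.* X RT  ×  X TU ℚ.* Y SU ≡ Y RT ℚ.* X RS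

  -- A component is connected, so it has at most one rank function; its
  -- existence is part of the assertion.
  CrossingRelations : Set
  CrossingRelations = ∀ i T → Σ[ ρ ∈ ComponentRank i T ]
    ∑ℚ (List.map (λ (S , e) → X e ℚ.* Y e) (edgesInto i T)) ℚ.-
    ∑ℚ (List.map (λ (U , e) → X e ℚ.* Y e) (edgesFrom i T))
    ≡ fromℤ (ComponentRank.m-value ρ)

------------------------------------------------------------------------
-- Representations of 𝔰𝔩ₙ over a field of characteristic zero
--
-- The library has no complex numbers; the ground field is an arbitrary Heyting
-- field of characteristic zero.  In it, # is the constructive form of ≠.

module _ {c ℓ₁ ℓ₂} (K : HeytingField c ℓ₁ ℓ₂) where

  open HeytingField K

  fieldRing : CommutativeRing c ℓ₁
  fieldRing = HeytingCommutativeRing.commutativeRing heytingCommutativeRing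

  open Algebra.Properties.Monoid.Mult (CommutativeRing.+-monoid fieldRing)
    using () renaming (_×_ to _×ᴷ_)

  CharacteristicZero : Set ℓ₂
  CharacteristicZero = ∀ k → (suc k ×ᴷ 1#) # 0#

module FieldDefs {c ℓ₁ ℓ₂} (K : HeytingField c ℓ₁ ℓ₂) (char0 : CharacteristicZero K) where

  open HeytingField K hiding (zero)
    renaming ( Carrier to 𝕜; refl to ≈-refl; sym to ≈-sym; trans to ≈-trans
             ; _+_ to _+ᴷ_; _*_ to _*ᴷ_; -_ to -ᴷ_; _-_ to _-ᴷ_ )

  𝕜-ring : CommutativeRing c ℓ₁
  𝕜-ring = fieldRing K

  open Algebra.Properties.Monoid.Mult (CommutativeRing.+-monoid 𝕜-ring)
    using () renaming (_×_ to _×ᴷ_)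
  open Algebra.Properties.Semiring.Sum (CommutativeRing.semiring 𝕜-ring)
    using (sum; sum-cong-≋; sum-replicate-zero; ∑-distrib-+; ∑-comm; *-distribˡ-sum)

  ι-ℤ : ℤ → 𝕜
  ι-ℤ (+ k)    = k ×ᴷ 1#
  ι-ℤ -[1+ k ] = -ᴷ (suc k ×ᴷ 1#)

  -- The embedding of ℚ.
  ι : ℚ → 𝕜
  ι q = ι-ℤ (ℚ.↥ q) *ᴷ proj₁ (#⇒invertible (char0 (ℚ.ℚ.denominator-1 q)))

  VectorSpace : ∀ a ℓ → Set _
  VectorSpace = LeftModule (CommutativeRing.ring 𝕜-ring)

  -- For finite A, the vector space with basis A; a vector is given by its
  -- coefficients.
  V[_] : ∀ {a} → Set a → VectorSpace (a ⊔ c) (a ⊔ ℓ₁)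
  V[ A ] = record
    { Carrierᴹ = A → 𝕜
    ; _≈ᴹ_     = λ v w → ∀ t → v t ≈ w t
    ; _+ᴹ_     = λ v w t → v t +ᴷ w t
    ; _*ₗ_     = λ k v t → k *ᴷ v t
    ; 0ᴹ       = λ _ → 0#
    ; -ᴹ_      = λ v t → -ᴷ v t
    ; isLeftModule = record
      { isLeftSemimodule = record
        { +ᴹ-isCommutativeMonoid = Pointwise.isCommutativeMonoid A +-isCommutativeMonoid
        ; isPreleftSemimodule = record
          { *ₗ-cong      = λ k≈l v≈w t → *-cong k≈l (v≈w t)
          ; *ₗ-zeroˡ     = λ v t → zeroˡ (v t)
          ; *ₗ-distribʳ  = λ v k l t → distribʳ (v t) k l
          ; *ₗ-identityˡ = λ v t → *-identityˡ (v t)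
          ; *ₗ-assoc     = λ k l v t → *-assoc k l (v t)
          ; *ₗ-zeroʳ     = λ k t → zeroʳ k
          ; *ₗ-distribˡ  = λ k v w t → distribˡ k (v t) (w t)
          }
        }
      ; -ᴹ‿cong    = λ v≈w t → -‿cong (v≈w t)
      ; -ᴹ‿inverse = (λ v t → -‿inverseˡ (v t)) , (λ v t → -‿inverseʳ (v t))
      }
    }

  ----------------------------------------------------------------------
  -- The Lie algebra of traceless matrices

  Matrix : ℕ → Set c
  Matrix n = Fin n → Fin n → 𝕜

  trace : ∀ {n} → Matrix n → 𝕜
  trace A = sum λ a → A a a

  _·ᵐ_ : ∀ {n} → Matrix n → Matrix n → Matrix n
  (A ·ᵐ B) a b = sum λ k → A a k *ᴷ B k b

  -- The matrix unit with its 1 in the row a and the column b.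
  unit : ∀ {n} → Fin n → Fin n → Matrix n
  unit a b a′ b′ = if does (a Finₚ.≟ a′) ∧ does (b Finₚ.≟ b′) then 1# else 0#

  record 𝔰𝔩 (n : ℕ) : Set (c ⊔ ℓ₁) where
    constructor traceless
    field
      matrix  : Matrix n
      trace≈0 : trace matrix ≈ 0#

  open 𝔰𝔩 public

  module G = Algebra.Properties.AbelianGroup (CommutativeRing.+-abelianGroup 𝕜-ring)

  sum-zero : ∀ {n} (f : Fin n → 𝕜) → (∀ a → f a ≈ 0#) → sum f ≈ 0#
  sum-zero {n} f f≈0 = ≈-trans (sum-cong-≋ f≈0) (sum-replicate-zero n)

  sum-minus : ∀ {n} (f h : Fin n → 𝕜) → sum (λ a → f a -ᴷ h a) ≈ sum f -ᴷ sum h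
  sum-minus f h = ≈-trans (∑-distrib-+ f (λ a → -ᴷ h a)) (+-congˡ
    (G.inverseʳ-unique _ _ (≈-trans (≈-sym (∑-distrib-+ h (λ a → -ᴷ h a)))
      (sum-zero (λ a → h a -ᴷ h a) λ a → -‿inverseʳ (h a)))))

  trace-commutes : ∀ {n} (A B : Matrix n) → trace (A ·ᵐ B) ≈ trace (B ·ᵐ A)
  trace-commutes A B = ≈-trans (∑-comm λ a k → A a k *ᴷ B k a)
    (sum-cong-≋ λ k → sum-cong-≋ λ a → *-comm (A a k) (B k a))

  x-x≈0 : ∀ {x y} → x ≈ y → x -ᴷ y ≈ 0#
  x-x≈0 x≈y = ≈-trans (+-congʳ x≈y) (-‿inverseʳ _)

  trace-unit : ∀ {n} (a : Fin n) → trace (unit a a) ≈ 1#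
  trace-unit {suc n} zero = ≈-trans
    (+-congˡ (sum-zero (λ k → unit {suc n} zero zero (suc k) (suc k)) λ _ → ≈-refl))
    (+-identityʳ 1#)
  trace-unit (suc a) = ≈-trans (+-identityˡ _) (trace-unit a)

  trace-unit≢ : ∀ {n} (a b : Fin n) → a ≢ b → trace (unit a b) ≈ 0#
  trace-unit≢ a b a≢b = sum-zero (λ k → unit a b k k) vanish
    where
    vanish : ∀ k → unit a b k k ≈ 0#
    vanish k with a Finₚ.≟ k | b Finₚ.≟ k
    ... | yes a≡k | yes b≡k = ⊥-elim (a≢b (trans a≡k (sym b≡k)))
    ... | yes _   | no _    = ≈-refl
    ... | no _    | _       = ≈-refl

  _≈ˢ_ : ∀ {n} → 𝔰𝔩 n → 𝔰𝔩 n → Set ℓ₁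
  A ≈ˢ B = ∀ a b → matrix A a b ≈ matrix B a b

  _+ˢ_ : ∀ {n} → 𝔰𝔩 n → 𝔰𝔩 n → 𝔰𝔩 n
  A +ˢ B = traceless (λ a b → matrix A a b +ᴷ matrix B a b)
    (≈-trans (∑-distrib-+ (λ a → matrix A a a) (λ a → matrix B a a))
      (≈-trans (+-cong (trace≈0 A) (trace≈0 B)) (+-identityˡ 0#)))

  _*ˢ_ : ∀ {n} → 𝕜 → 𝔰𝔩 n → 𝔰𝔩 n
  k *ˢ A = traceless (λ a b → k *ᴷ matrix A a b)
    (≈-trans (≈-sym (*-distribˡ-sum k (λ a → matrix A a a)))
      (≈-trans (*-congˡ (trace≈0 A)) (zeroʳ k)))

  [_,_] : ∀ {n} → 𝔰𝔩 n → 𝔰𝔩 n → 𝔰𝔩 n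
  [ A , B ] = traceless
    (λ a b → (matrix A ·ᵐ matrix B) a b -ᴷ (matrix B ·ᵐ matrix A) a b)
    (≈-trans (sum-minus (λ a → (matrix A ·ᵐ matrix B) a a) (λ a → (matrix B ·ᵐ matrix A) a a))
      (x-x≈0 (trace-commutes (matrix A) (matrix B))))

  lower upper : ∀ n → Color n → Fin n
  lower (suc n) i = Fin.inject₁ i
  upper (suc n) i = suc i

  lower≢upper : ∀ n (i : Color n) → lower n i ≢ upper n i
  lower≢upper (suc n) i eq =
    ℕₚ.1+n≢n (trans (cong toℕ (sym eq)) (Finₚ.toℕ-inject₁ i))

  -- The Chevalley generators E_{i,i+1}, E_{i+1,i} and E_{i,i} - E_{i+1,i+1}.
  x y h : ∀ {n} → Color n → 𝔰𝔩 n
  x {n} i = traceless (unit (lower n i) (upper n i)) (trace-unit≢ _ _ (lower≢upper n i))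
  y {n} i = traceless (unit (upper n i) (lower n i)) (trace-unit≢ _ _ (lower≢upper n i ∘ sym))
  h {n} i = traceless (λ a b → H₊ a b -ᴷ H₋ a b)
    (≈-trans (sum-minus (λ a → H₊ a a) (λ a → H₋ a a))
      (x-x≈0 (≈-trans (trace-unit (lower n i)) (≈-sym (trace-unit (upper n i))))))
    where
    H₊ = unit (lower n i) (lower n i)
    H₋ = unit (upper n i) (upper n i)

  module _ {a ℓ} (V : VectorSpace a ℓ) where

    open LeftModule V

    record Representation (n : ℕ) : Set (c ⊔ ℓ₁ ⊔ a ⊔ ℓ) where
      infixr 7 _∙_
      field
        _∙_       : 𝔰𝔩 n → Carrierᴹ → Carrierᴹ
        ∙-cong    : ∀ {A B v w} → A ≈ˢ B → v ≈ᴹ w → A ∙ v ≈ᴹ B ∙ w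
        ∙-+ᴹ      : ∀ A v w → A ∙ (v +ᴹ w) ≈ᴹ A ∙ v +ᴹ A ∙ w
        ∙-*ₗ      : ∀ A k v → A ∙ (k *ₗ v) ≈ᴹ k *ₗ (A ∙ v)
        +ˢ-∙      : ∀ A B v → (A +ˢ B) ∙ v ≈ᴹ A ∙ v +ᴹ B ∙ v
        *ˢ-∙      : ∀ k A v → (k *ˢ A) ∙ v ≈ᴹ k *ₗ (A ∙ v)
        bracket-∙ : ∀ A B v → [ A , B ] ∙ v ≈ᴹ A ∙ (B ∙ v) +ᴹ -ᴹ (B ∙ (A ∙ v))

    ∑ᴹ : List Carrierᴹ → Carrierᴹ
    ∑ᴹ = List.foldr _+ᴹ_ 0ᴹ

    -- The family b, indexed by the finite type I enumerated by the list is, is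
    -- a basis of the subspace W.
    record IsBasis {p q} (W : Pred Carrierᴹ p) {I : Set q} (is : List I)
                   (b : I → Carrierᴹ) : Set (c ⊔ ℓ₁ ⊔ a ⊔ ℓ ⊔ p ⊔ q) where
      field
        inside      : ∀ k → W (b k)
        spanning    : ∀ v → W v → Σ[ κ ∈ (I → 𝕜) ] (v ≈ᴹ ∑ᴹ (List.map (λ k → κ k *ₗ b k) is))
        independent : ∀ (κ : I → 𝕜) → ∑ᴹ (List.map (λ k → κ k *ₗ b k) is) ≈ᴹ 0ᴹ →
                      ∀ k → κ k ≈ 0#

    HasDimension : ∀ {p} → Pred Carrierᴹ p → ℕ → Set _
    HasDimension W d = Σ[ b ∈ (Fin d → Carrierᴹ) ] IsBasis W (List.allFin d) b

    module _ {n : ℕ} (ρ : Representation n) where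

      open Representation ρ

      WeightSpace : Weight n → Pred Carrierᴹ ℓ
      WeightSpace μ v = ∀ i → h i ∙ v ≈ᴹ ι-ℤ (Vec.lookup μ i) *ₗ v

      IsWeightVector : Weight n → Pred Carrierᴹ ℓ
      IsWeightVector μ v = ¬ (v ≈ᴹ 0ᴹ) × WeightSpace μ v

      -- χ = Σ_μ (dim V_μ) z^μ
      HasCharacter : Laurent n → Set _
      HasCharacter χ = ∀ μ → ∃[ d ] (HasDimension (WeightSpace μ) d × χ μ ≡ + d)

  ----------------------------------------------------------------------
  -- The representation on V[L]

  module _ {m n : ℕ} (shape : SkewShape m n) where

    open SkewTableaux shape

    V[L] = V[ Tableau ]

    open LeftModule V[L]

    v[_] : Tableau → Carrierᴹ
    v[ T ] U = if does (T ≟ᵗ U) then 1# else 0#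

    -- The coefficient of v[ T ].
    coefficient : Tableau → Carrierᴹ → 𝕜
    coefficient T w = w T

    module _ (ρ : Representation V[L] n) where

      open Representation ρ

      ActsByScalars : Set _
      ActsByScalars = ∀ i T →
          x i ∙ v[ T ] ≈ᴹ ∑ᴹ V[L] (List.map (λ (U , e) → ι (X e) *ₗ v[ U ]) (edgesFrom i T))
        × y i ∙ v[ T ] ≈ᴹ ∑ᴹ V[L] (List.map (λ (S , e) → ι (Y e) *ₗ v[ S ]) (edgesInto i T))
        × h i ∙ v[ T ] ≈ᴹ ι-ℤ (wtᵢ i T) *ₗ v[ T ]

      IsWeightBasis : Set _
      IsWeightBasis = IsBasis V[L] (λ _ → ⊤) tableaux v[_]
                    × (∀ T → IsWeightVector V[L] ρ (wt T) v[ T ])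

      SupportingEdge : Color n → Tableau → Tableau → Set ℓ₂
      SupportingEdge i S T = (coefficient T (x i ∙ v[ S ]) # 0#)
                           ⊎ (coefficient S (y i ∙ v[ T ]) # 0#)

      IsSupportingGraph : Set _
      IsSupportingGraph = ∀ i S T → Edge i S T ⇔ SupportingEdge i S T

      IsRepresentationDiagram : Set _
      IsRepresentationDiagram = IsSupportingGraph
        × (∀ {i S T} (e : Edge i S T) →
             coefficient T (x i ∙ v[ S ]) ≈ ι (X e)
           × coefficient S (y i ∙ v[ T ]) ≈ ι (Y e))

{-# OPTIONS --safe #-}

-- Write l, a and b for the entries of the GT parallelogram in the diagonals i,
-- i + 1 and i - 1, each shifted by its position.  An edge changes one entry, so
-- in a diamond at most one factor of each coefficient changes, and the diamond
-- relations compare these factors.  The crossing relation is the residue theorem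
-- for ∏ (z - a)(z - b - 1) / ∏ (z - l)(z - l - 1): the residues at z = l and at
-- z = l + 1 are the products X Y of the edges into T and, up to sign, from T,
-- and the residue at infinity is the weight.  Poles without an edge, or which
-- coincide, are cancelled by zeros because of interlacing.
--
-- The two relations say [xᵢ, yⱼ] = δᵢⱼ hᵢ.  The Serre relations then follow from
-- the 𝔰𝔩₂-theory of the adjoint action on operators, on which every xᵢ and yᵢ is
-- nilpotent because it moves the weights in one direction.  Iterated brackets of
-- the generators give operators for all the matrix units, and these satisfy the
-- relations of 𝔤𝔩ₙ because the set of matrix units whose brackets with all
-- others are right is closed under brackets.
module Submission where

open import Defs
open import Level using (_⊔_)
open import Function using (_∘_; mk⇔; id; case_of_)
open import Data.Bool using (true; false; if_then_else_; _∧_)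
open import Data.Empty using (⊥-elim)
open import Data.Unit using (⊤; tt)
open import Data.Product using (Σ; Σ-syntax; ∃; ∃-syntax; _×_; _,_; proj₁; proj₂)
open import Data.Sum using (_⊎_; inj₁; inj₂)
open import Data.Maybe using (Maybe; just; nothing)
import Data.Maybe as Maybe
open import Data.Nat as ℕ using (ℕ; zero; suc; _∸_; z≤n; s≤s; z<s; s<s; _≤_)
import Data.Nat.Properties as ℕₚ
open import Data.Integer as ℤ using (ℤ; +_; -[1+_]; 0ℤ; 1ℤ)
import Data.Integer.Properties as ℤₚ
open import Data.Integer.Tactic.RingSolver using (solve-∀)
open import Data.Nat.Tactic.RingSolver using () renaming (solve-∀ to solve-∀ℕ)
open import Data.Rational as ℚ using (ℚ; 0ℚ; 1ℚ)
import Data.Rational.Properties as ℚₚ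
open import Data.Rational.Unnormalised as ℚᵘ using (ℚᵘ)
import Data.Rational.Unnormalised.Properties as ℚᵘₚ
open import Data.Rational.Literals using (fromℤ)
open import Data.Fin as Fin using (Fin; zero; suc; toℕ)
import Data.Fin.Properties as Finₚ
import Data.Sum.Properties as Sumₚ
open import Data.Vec as Vec using (Vec; []; _∷_)
import Data.Vec.Properties as Vecₚ
open import Data.List as List using (List; []; _∷_)
import Data.List.Properties as Listₚ
open import Data.List.Membership.Propositional using (_∈_; _∉_)
import Data.List.Membership.Propositional.Properties as ∈ₚ
open import Data.List.Relation.Unary.Any using (here; there)
open import Data.List.Relation.Unary.All as All using (All; []; _∷_)
open import Data.List.Relation.Unary.AllPairs using ([]; _∷_)
open import Data.List.Relation.Unary.Unique.Propositional using (Unique)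
import Data.List.Relation.Unary.Unique.Propositional.Properties as Uniqueₚ
open import Relation.Nullary using (¬_; Dec; yes; no; does; contradiction)
open import Relation.Nullary.Decidable
  using (dec⇒maybe; dec-true; dec-false; ¬?; _×-dec_; _→-dec_; decidable-stable)
open import Relation.Unary using (Pred; Decidable)
open import Relation.Binary using (DecidableEquality; Setoid; WeaklyDecidable; tri<; tri≈; tri>)
open import Relation.Binary.PropositionalEquality
  using (_≡_; _≢_; refl; sym; trans; cong; cong₂; subst; subst₂; module ≡-Reasoning)
open import Relation.Binary.Construct.Closure.ReflexiveTransitive using (_◅_) renaming (ε to nil)
open import Relation.Binary.Construct.Closure.Symmetric using (fwd; bwd)
open import Algebra.Apartness.Bundles using (HeytingCommutativeRing; HeytingField)
open import Algebra.Bundles using (CommutativeMonoid; CommutativeRing; Semiring)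
import Algebra.Properties.Monoid.Mult
import Algebra.Properties.Semiring.Sum
import Algebra.Properties.Ring
import Algebra.Solver.Ring
open import Algebra.Solver.Ring.AlmostCommutativeRing using (fromCommutativeRing; _-Raw-AlmostCommutative⟶_; Induced-equivalence)
import Relation.Binary.Reasoning.Setoid

-- The crossing relation asks for `2ρ - l` of a component, whereas the residues yield the weight.
-- They agree because an edge of color `i` moves one entry of the diagonal `i` and leaves the
-- neighboring diagonals fixed: a component is a product of chains bounded by interlacing, and the
-- lower and upper bounds of these chains together sum to the two neighboring diagonals. The same
-- bounds decide in which rows an edge is missing.
--
-- 𝔰𝔩ₙ consists here of traceless matrices, so generators and relations do not yet give an action:
-- an operator is needed for every matrix. In 𝔤𝔩ₙ, with the diagonal units acting by the numbers of
-- entries, one formula covers the brackets of all pairs of matrix units, and a matrix acts by the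
-- corresponding linear combination. With `-y` in place of `y` the hypotheses are symmetric under
-- `E a b ↦ - E b a`, so the brackets with `z` follow from those with `x`.
--
-- Over a Heyting field an edge of the supporting graph has to be certified by apartness from zero.
-- The inverse of the nonzero rational number `X` supplies it.

-- Iterated operations over lists in a commutative monoid

module BigOperator {c ℓ} (M : CommutativeMonoid c ℓ) where

  open CommutativeMonoid M renaming (refl to ≈-refl; sym to ≈-sym; trans to ≈-trans)
  open import Algebra.Properties.CommutativeSemigroup commutativeSemigroup using (interchange; x∙yz≈y∙xz)

  big : ∀ {a} {A : Set a} → (A → Carrier) → List A → Carrier
  big f xs = List.foldr _∙_ ε (List.map f xs)

  module _ {a} {A : Set a} where

    big-cong-∈ : ∀ {f g : A → Carrier} xs → (∀ {x} → x ∈ xs → f x ≈ g x) → big f xs ≈ big g xs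
    big-cong-∈ []       f≈g = ≈-refl
    big-cong-∈ (x ∷ xs) f≈g = ∙-cong (f≈g (here refl)) (big-cong-∈ xs (f≈g ∘ there))

    big-cong : ∀ {f g : A → Carrier} xs → (∀ x → f x ≈ g x) → big f xs ≈ big g xs
    big-cong xs f≈g = big-cong-∈ xs λ {x} _ → f≈g x

    big-ε : ∀ {f : A → Carrier} xs → (∀ x → f x ≈ ε) → big f xs ≈ ε
    big-ε []       f≈ε = ≈-refl
    big-ε (x ∷ xs) f≈ε = ≈-trans (∙-cong (f≈ε x) (big-ε xs f≈ε)) (identityˡ ε)

    big-∙ : ∀ (f g : A → Carrier) xs → big (λ x → f x ∙ g x) xs ≈ big f xs ∙ big g xs
    big-∙ f g []       = ≈-sym (identityˡ ε)
    big-∙ f g (x ∷ xs) = ≈-trans (∙-congˡ (big-∙ f g xs)) (interchange _ _ _ _)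

    big-++ : ∀ (f : A → Carrier) xs ys → big f (xs List.++ ys) ≈ big f xs ∙ big f ys
    big-++ f []       ys = ≈-sym (identityˡ _)
    big-++ f (x ∷ xs) ys = ≈-trans (∙-congˡ (big-++ f xs ys)) (≈-sym (assoc _ _ _))

    big-homo : ∀ {f : A → Carrier} (h : Carrier → Carrier) → h ε ≈ ε →
               (∀ x y → h (x ∙ y) ≈ h x ∙ h y) →
               ∀ xs → h (big f xs) ≈ big (h ∘ f) xs
    big-homo h hε h∙ []       = hε
    big-homo h hε h∙ (x ∷ xs) = ≈-trans (h∙ _ _) (∙-congˡ (big-homo h hε h∙ xs))

    big-filter : ∀ {p} {P : Pred A p} (P? : Decidable P) (f : A → Carrier) xs →
                 big f (List.filter P? xs) ≈ big (λ x → if does (P? x) then f x else ε) xs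
    big-filter P? f [] = ≈-refl
    big-filter P? f (x ∷ xs) with does (P? x)
    ... | true  = ∙-congˡ (big-filter P? f xs)
    ... | false = ≈-trans (big-filter P? f xs) (≈-sym (identityˡ _))

    big-mapMaybe : ∀ {b} {B : Set b} (f : B → Carrier) (p : A → Maybe B) xs →
                   big f (List.mapMaybe p xs) ≈ big (Maybe.maybe′ f ε ∘ p) xs
    big-mapMaybe f p [] = ≈-refl
    big-mapMaybe f p (x ∷ xs) with p x
    ... | just y  = ∙-congˡ (big-mapMaybe f p xs)
    ... | nothing = ≈-trans (big-mapMaybe f p xs) (≈-sym (identityˡ _))

  big-map : ∀ {a b} {A : Set a} {B : Set b} (f : B → Carrier) (h : A → B) xs →
            big f (List.map h xs) ≈ big (f ∘ h) xs
  big-map f h []       = ≈-refl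
  big-map f h (x ∷ xs) = ∙-congˡ (big-map f h xs)

  big-comm : ∀ {a b} {A : Set a} {B : Set b} (f : A → B → Carrier) xs ys →
             big (λ x → big (f x) ys) xs ≈ big (λ y → big (λ x → f x y) xs) ys
  big-comm f []       ys = ≈-sym (big-ε ys λ _ → ≈-refl)
  big-comm f (x ∷ xs) ys = ≈-trans (∙-congˡ (big-comm f xs ys)) (≈-sym (big-∙ (f x) _ ys))

  module _ {a} {A : Set a} (_≟_ : DecidableEquality A) where

    -- The term of `x` is replaced by `ε` instead of deleting `x` from the list, so that lists to be
    -- compared keep their shape.
    big-remove : ∀ (f : A → Carrier) {xs} → Unique xs → ∀ {x} → x ∈ xs →
                 big f xs ≈ f x ∙ big (λ y → if does (y ≟ x) then ε else f y) xs
    big-remove f {x ∷ xs} (x∉ ∷ u) (here refl) rewrite dec-true (x ≟ x) refl =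
      ∙-congˡ (≈-trans (big-cong-∈ xs off) (≈-sym (identityˡ _)))
      where
      off : ∀ {y} → y ∈ xs → f y ≈ (if does (y ≟ x) then ε else f y)
      off {y} y∈ rewrite dec-false (y ≟ x) (λ { refl → All.lookup x∉ y∈ refl }) = ≈-refl
    big-remove f {y ∷ xs} (y∉ ∷ u) {x} (there x∈)
      rewrite dec-false (y ≟ x) (All.lookup y∉ x∈) =
      ≈-trans (∙-congˡ (big-remove f u x∈)) (x∙yz≈y∙xz _ _ _)

    big-only : ∀ (f : A → Carrier) {xs} → Unique xs → ∀ {x} → x ∈ xs →
               (∀ y → y ≢ x → f y ≈ ε) → big f xs ≈ f x
    big-only f {xs} u {x} x∈ f≈ε = ≈-trans (big-remove f u x∈)
      (≈-trans (∙-congˡ (big-ε xs off)) (identityʳ _))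
      where
      off : ∀ y → (if does (y ≟ x) then ε else f y) ≈ ε
      off y with y ≟ x
      ... | yes _   = ≈-refl
      ... | no  y≢x = f≈ε y y≢x

    -- The common cofactor `r` reduces a comparison of two products to one factor without any
    -- division, hence also where factors vanish.
    big-differ : ∀ (f g : A → Carrier) {xs} → Unique xs → ∀ {x} → x ∈ xs →
                 (∀ y → y ≢ x → f y ≈ g y) →
                 ∃[ r ] (big f xs ≈ f x ∙ r × big g xs ≈ g x ∙ r)
    big-differ f g {xs} u {x} x∈ f≈g = _ , big-remove f u x∈ ,
      ≈-trans (big-remove g u x∈) (∙-congˡ (big-cong xs off))
      where
      off : ∀ y → (if does (y ≟ x) then ε else g y) ≈ (if does (y ≟ x) then ε else f y)
      off y with y ≟ x
      ... | yes _   = ≈-refl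
      ... | no  y≢x = ≈-sym (f≈g y y≢x)

    -- Only membership matters, not the order of `ys`: this lets a sum over edges, listed by
    -- tableaux, be compared with a sum over rows.
    big-subset : ∀ {f : A → Carrier} {xs ys} → Unique xs → Unique ys → (∀ {y} → y ∈ ys → y ∈ xs) →
                 (∀ {x} → x ∉ ys → f x ≈ ε) → big f xs ≈ big f ys
    big-subset {xs = xs} {[]} _ _ _ f≈ε = big-ε xs λ _ → f≈ε λ ()
    big-subset {f} {xs} {y ∷ ys} u (y∉ ∷ v) ys⊆xs f≈ε = ≈-trans (big-remove f u (ys⊆xs (here refl)))
      (∙-congˡ (≈-trans (big-subset u v (ys⊆xs ∘ there) off) (big-cong-∈ ys same)))
      where
      off : ∀ {x} → x ∉ ys → (if does (x ≟ y) then ε else f x) ≈ ε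
      off {x} x∉ with x ≟ y
      ... | yes _   = ≈-refl
      ... | no  x≢y = f≈ε λ { (here x≡y) → x≢y x≡y ; (there x∈) → x∉ x∈ }
      same : ∀ {x} → x ∈ ys → (if does (x ≟ y) then ε else f x) ≈ f x
      same {x} x∈ with x ≟ y
      ... | yes refl = contradiction refl (All.lookup y∉ x∈)
      ... | no  _    = ≈-refl

-- Enumeration of the fillings without omissions or repetitions

mapMaybe-∈ : ∀ {a b} {A : Set a} {B : Set b} (p : A → Maybe B) {xs x y} →
             x ∈ xs → p x ≡ just y → y ∈ List.mapMaybe p xs
mapMaybe-∈ p {x ∷ xs} (here refl) eq with p x
mapMaybe-∈ p {x ∷ xs} (here refl) refl | just _ = here refl
mapMaybe-∈ p {x′ ∷ xs} (there x∈) eq with p x′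
... | just _  = there (mapMaybe-∈ p x∈ eq)
... | nothing = mapMaybe-∈ p x∈ eq

mapMaybe-∈⁻ : ∀ {a b} {A : Set a} {B : Set b} (p : A → Maybe B) xs {y} →
              y ∈ List.mapMaybe p xs → ∃[ x ] (x ∈ xs × p x ≡ just y)
mapMaybe-∈⁻ p (x ∷ xs) y∈ with p x in eq
mapMaybe-∈⁻ p (x ∷ xs) (here refl) | just _ = x , here refl , eq
mapMaybe-∈⁻ p (x ∷ xs) (there y∈)  | just _ =
  let x′ , x′∈ , eq′ = mapMaybe-∈⁻ p xs y∈ in x′ , there x′∈ , eq′
mapMaybe-∈⁻ p (x ∷ xs) y∈ | nothing =
  let x′ , x′∈ , eq′ = mapMaybe-∈⁻ p xs y∈ in x′ , there x′∈ , eq′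

mapMaybe-unique : ∀ {a b} {A : Set a} {B : Set b} (p : A → Maybe B) →
                  (∀ {x x′ y} → p x ≡ just y → p x′ ≡ just y → x ≡ x′) →
                  ∀ {xs} → Unique xs → Unique (List.mapMaybe p xs)
mapMaybe-unique p inj {[]} [] = []
mapMaybe-unique p inj {x ∷ xs} (x∉ ∷ u) with p x in eq
... | nothing = mapMaybe-unique p inj u
... | just y  = All.tabulate fresh ∷ mapMaybe-unique p inj u
  where
  fresh : ∀ {y′} → y′ ∈ List.mapMaybe p xs → y ≢ y′
  fresh y′∈ refl with mapMaybe-∈⁻ p xs y′∈
  ... | x′ , x′∈ , eq′ = All.lookup x∉ x′∈ (inj eq eq′)

allVecs-complete : ∀ {n} ℓ (v : Vec (Fin n) ℓ) → v ∈ allVecs n ℓ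
allVecs-complete zero    []      = here refl
allVecs-complete (suc ℓ) (x ∷ v) =
  ∈ₚ.∈-cartesianProductWith⁺ _∷_ (∈ₚ.∈-allFin x) (allVecs-complete ℓ v)

allVecs-unique : ∀ n ℓ → Unique (allVecs n ℓ)
allVecs-unique n zero    = [] ∷ []
allVecs-unique n (suc ℓ) = Uniqueₚ.cartesianProductWith⁺ _∷_ Vecₚ.∷-injective
  (Uniqueₚ.allFin⁺ n) (allVecs-unique n ℓ)

allFillings-complete : ∀ {n} k ℓ (F : Filling n k ℓ) → F ∈ allFillings n k ℓ
allFillings-complete zero    ℓ tt      = here refl
allFillings-complete (suc k) ℓ (v , F) =
  ∈ₚ.∈-cartesianProduct⁺ (allVecs-complete _ v) (allFillings-complete k _ F)

allFillings-unique : ∀ n k ℓ → Unique (allFillings n k ℓ)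
allFillings-unique n zero    ℓ = [] ∷ []
allFillings-unique n (suc k) ℓ =
  Uniqueₚ.cartesianProduct⁺ (allVecs-unique n (ℓ zero)) (allFillings-unique n k (ℓ ∘ suc))

fill : ∀ {n} k {ℓ : Fin k → ℕ} → (∀ r → Fin (ℓ r) → Fin n) → Filling n k ℓ
fill zero    f = tt
fill (suc k) f = Vec.tabulate (f zero) , fill k (f ∘ suc)

lookup-fill : ∀ {n} k {ℓ : Fin k → ℕ} (f : ∀ r → Fin (ℓ r) → Fin n) r c →
              Vec.lookup (rowOf (fill k f) r) c ≡ f r c
lookup-fill (suc k) f zero    c = Vecₚ.lookup∘tabulate (f zero) c
lookup-fill (suc k) f (suc r) c = lookup-fill k (f ∘ suc) r c

lookup-ext : ∀ {a} {A : Set a} {ℓ} (u v : Vec A ℓ) →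
             (∀ c → Vec.lookup u c ≡ Vec.lookup v c) → u ≡ v
lookup-ext u v eq = trans (sym (Vecₚ.tabulate∘lookup u))
  (trans (Vecₚ.tabulate-cong eq) (Vecₚ.tabulate∘lookup v))

filling-ext : ∀ {n} k {ℓ : Fin k → ℕ} (F G : Filling n k ℓ) →
              (∀ r c → Vec.lookup (rowOf F r) c ≡ Vec.lookup (rowOf G r) c) → F ≡ G
filling-ext zero    tt      tt      eq = refl
filling-ext (suc k) (u , F) (v , G) eq =
  cong₂ _,_ (lookup-ext u v (eq zero)) (filling-ext k F G (eq ∘ suc))
-- Tableaux as Gelfand-Tsetlin patterns

module ∑ℕ-Operator = BigOperator ℕₚ.+-0-commutativeMonoid

indicator : ℕ → ℕ → ℕ
indicator k j = if does (k ℕ.≟ j) then 1 else 0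

value-cases : ∀ {a b} k → a ≡ suc b →
              (k ℕ.< b × indicator k b ≡ 0) ⊎ (k ≡ b × indicator k b ≡ 1) ⊎
              (a ℕ.≤ k × indicator k b ≡ 0)
value-cases {b = b} k refl with ℕₚ.<-cmp k b
... | tri< k<b k≢b _  rewrite dec-false (k ℕ.≟ b) k≢b = inj₁ (k<b , refl)
... | tri≈ _ refl _   rewrite dec-true (k ℕ.≟ k) refl = inj₂ (inj₁ (refl , refl))
... | tri> _ k≢b k>b  rewrite dec-false (k ℕ.≟ b) k≢b = inj₂ (inj₂ (k>b , refl))

-- An entry that falls from `suc j` to `j` crosses the threshold `k = j` and no other. Hence an edge
-- changes a single entry of the parallelogram, and by one.
count≤-decrement : ∀ {n ℓ} k {j} (u v : Vec (Fin n) ℓ) c →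
  (∀ d → d ≢ c → Vec.lookup u d ≡ Vec.lookup v d) →
  value (Vec.lookup v c) ≡ j → value (Vec.lookup u c) ≡ suc j →
  count≤ k v ≡ count≤ k u ℕ.+ indicator k j
count≤-decrement k (x ∷ u) (y ∷ v) zero off refl ux
  with refl ← lookup-ext u v (λ d → off (suc d) λ ())
  with value-cases k ux
... | inj₁ (k<y , eq) rewrite eq = begin
  count≤ k (y ∷ u)            ≡⟨ count-no k y u (ℕₚ.<⇒≱ k<y) ⟩
  count≤ k u                  ≡⟨ count-no k x u (λ x≤k → ℕₚ.<⇒≱ k<y (ℕₚ.≤-trans (ℕₚ.n≤1+n _)
                                   (subst (ℕ._≤ k) ux x≤k))) ⟨
  count≤ k (x ∷ u)            ≡⟨ ℕₚ.+-identityʳ _ ⟨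
  count≤ k (x ∷ u) ℕ.+ 0      ∎
  where open ≡-Reasoning
... | inj₂ (inj₁ (refl , eq)) rewrite eq = begin
  count≤ k (y ∷ u)            ≡⟨ count-yes k y u ℕₚ.≤-refl ⟩
  suc (count≤ k u)            ≡⟨ cong suc (count-no k x u (λ x≤k → ℕₚ.1+n≰n (subst (ℕ._≤ k) ux x≤k))) ⟨
  suc (count≤ k (x ∷ u))      ≡⟨ ℕₚ.+-comm 1 _ ⟩
  count≤ k (x ∷ u) ℕ.+ 1      ∎
  where open ≡-Reasoning
... | inj₂ (inj₂ (x≤k , eq)) rewrite eq = begin
  count≤ k (y ∷ u)            ≡⟨ count-yes k y u (ℕₚ.≤-trans (ℕₚ.n≤1+n _) (subst (ℕ._≤ k) ux x≤k)) ⟩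
  suc (count≤ k u)            ≡⟨ count-yes k x u x≤k ⟨
  count≤ k (x ∷ u)            ≡⟨ ℕₚ.+-identityʳ _ ⟨
  count≤ k (x ∷ u) ℕ.+ 0      ∎
  where open ≡-Reasoning
count≤-decrement k (x ∷ u) (y ∷ v) (suc c) off vc uc
  with refl ← off zero (λ ()) | ih ← count≤-decrement k u v c (λ d d≢c → off (suc d) (d≢c ∘ Finₚ.suc-injective)) vc uc
  with value x ℕ.≤? k
... | yes p = trans (count-yes k x v p) (trans (cong suc ih) (cong (ℕ._+ _) (sym (count-yes k x u p))))
... | no p  = trans (count-no k x v p) (trans ih (cong (ℕ._+ _) (sym (count-no k x u p))))

count≤-suc : ∀ {n ℓ} k (v : Vec (Fin n) ℓ) →
             count≤ (suc k) v ≡ Vec.count (λ e → value e ℕ.≟ suc k) v ℕ.+ count≤ k v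
count≤-suc k [] = refl
count≤-suc k (x ∷ v) with ih ← count≤-suc k v with ℕₚ.<-cmp (value x) (suc k)
... | tri< x<k x≢k _ rewrite dec-false (value x ℕ.≟ suc k) x≢k =
  trans (count-yes (suc k) x v (ℕₚ.<⇒≤ x<k)) (trans (cong suc ih) (trans (sym (ℕₚ.+-suc _ _))
    (cong (Vec.count (λ e → value e ℕ.≟ suc k) v ℕ.+_) (sym (count-yes k x v (ℕ.s≤s⁻¹ x<k))))))
... | tri≈ _ x≡k _ rewrite dec-true (value x ℕ.≟ suc k) x≡k =
  trans (count-yes (suc k) x v (ℕₚ.≤-reflexive x≡k)) (trans (cong suc ih)
    (cong (suc (Vec.count (λ e → value e ℕ.≟ suc k) v) ℕ.+_)
      (sym (count-no k x v λ x≤k → ℕₚ.1+n≰n (subst (ℕ._≤ k) x≡k x≤k)))))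
... | tri> _ x≢k x>k rewrite dec-false (value x ℕ.≟ suc k) x≢k =
  trans (count-no (suc k) x v (ℕₚ.<⇒≱ x>k)) (trans ih
    (cong (Vec.count (λ e → value e ℕ.≟ suc k) v ℕ.+_)
      (sym (count-no k x v (ℕₚ.<⇒≱ (ℕₚ.<-trans (ℕₚ.n<1+n k) x>k))))))

minF maxF : ∀ {n} → Fin n → Fin n → Fin n
minF a b = if does (a Finₚ.≤? b) then a else b
maxF a b = if does (a Finₚ.≤? b) then b else a

toℕ-minF : ∀ {n} (a b : Fin n) → toℕ (minF a b) ≡ toℕ a ℕ.⊓ toℕ b
toℕ-minF a b with a Finₚ.≤? b
... | yes a≤b rewrite dec-true (a Finₚ.≤? b) a≤b = sym (ℕₚ.m≤n⇒m⊓n≡m a≤b)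
... | no  a≰b rewrite dec-false (a Finₚ.≤? b) a≰b = sym (ℕₚ.m≥n⇒m⊓n≡n (ℕₚ.≰⇒≥ a≰b))

toℕ-maxF : ∀ {n} (a b : Fin n) → toℕ (maxF a b) ≡ toℕ a ℕ.⊔ toℕ b
toℕ-maxF a b with a Finₚ.≤? b
... | yes a≤b rewrite dec-true (a Finₚ.≤? b) a≤b = sym (ℕₚ.m≤n⇒m⊔n≡n a≤b)
... | no  a≰b rewrite dec-false (a Finₚ.≤? b) a≰b = sym (ℕₚ.m≥n⇒m⊔n≡m (ℕₚ.≰⇒≥ a≰b))

color<n : ∀ {n} (i : Color n) → colorℕ i ℕ.< n
color<n {suc n} i = s≤s (Finₚ.toℕ<n i)

module Combinatorics {m n : ℕ} (shape : SkewShape m n) where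

  open SkewShape shape
  open SkewTableaux shape

  rows : List (Fin m)
  rows = List.allFin m

  tableau-ext : ∀ {S T} → (∀ κ → entry S κ ≡ entry T κ) → S ≡ T
  tableau-ext {tableau F p} {tableau G q} eq = same p q
    (filling-ext m F G λ r c → Finₚ.toℕ-injective (ℕₚ.suc-injective (eq (r , c))))
    where
    same : ∀ {F G} .(p : Semistandard F) .(q : Semistandard G) → F ≡ G → tableau F p ≡ tableau G q
    same p q refl = refl

  tableaux-complete : ∀ T → T ∈ tableaux
  tableaux-complete (tableau F p) =
    mapMaybe-∈ _ (allFillings-complete m rowLength F) found
    where
    found : Maybe.map (λ p → tableau F p) (dec⇒maybe (semistandard? F)) ≡ just (tableau F p)
    found with semistandard? F
    ... | yes q = refl
    ... | no ¬q = ⊥-elim (¬q (isSemistandard (tableau F p)))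

  tableaux-unique : Unique tableaux
  tableaux-unique = mapMaybe-unique _ (λ {F} {G} p q → trans (sym (origin F p)) (origin G q))
    (allFillings-unique n m rowLength)
    where
    origin : ∀ F {T} → Maybe.map (λ p → tableau F p) (dec⇒maybe (semistandard? F)) ≡ just T →
             filling T ≡ F
    origin F eq with semistandard? F
    origin F refl | yes _ = refl
    origin F ()   | no  _

  count⇒entry : ∀ T k r c → toℕ c ℕ.< count≤ k (row T r) → entry T (r , c) ℕ.≤ k
  count⇒entry T k r c = <count⇒value≤ k (row T r) (proj₁ (isSemistandard T) r) c

  entry⇒count : ∀ T k r c → entry T (r , c) ℕ.≤ k → toℕ c ℕ.< count≤ k (row T r)
  entry⇒count T k r c = value≤⇒<count k (row T r) (proj₁ (isSemistandard T) r) c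

  interlacing-row : ∀ T k r → g T k r ℕ.≤ g T (suc k) r
  interlacing-row T k r = ℕₚ.+-monoʳ-≤ (Q r)
    (ℕₚ.≤-trans (ℕₚ.m≤n+m _ _) (ℕₚ.≤-reflexive (sym (count≤-suc k (row T r)))))

  g≤P : ∀ T k r → g T k r ℕ.≤ P r
  g≤P T k r = ℕₚ.≤-trans (ℕₚ.+-monoʳ-≤ (Q r) (count≤length k (row T r)))
    (ℕₚ.≤-reflexive (ℕₚ.m+[n∸m]≡n (Q≤P r)))

  -- Otherwise the column `g T k r + 1` meets the row `s` in an entry at most `suc k`. Its entry in
  -- the row `r` is then at most `k` by strictness, so `g T k r` should have counted it.
  interlacing-column : ∀ T k {r s} → r Fin.< s → g T (suc k) s ℕ.≤ g T k r
  interlacing-column T k {r} {s} r<s = ℕₚ.≮⇒≥ absurd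
    where
    a = count≤ (suc k) (row T s)
    b = count≤ k (row T r)
    Qs≤gr = ℕₚ.≤-trans (Q-decreasing (ℕₚ.<⇒≤ r<s)) (ℕₚ.m≤m+n (Q r) b)

    absurd : ¬ (g T k r ℕ.< g T (suc k) s)
    absurd gr<gs = ℕₚ.<-irrefl (Finₚ.toℕ-fromℕ< b<ℓ) (entry⇒count T k r c (ℕ.s≤s⁻¹ c<))
      where
      d< : g T k r ∸ Q s ℕ.< a
      d< = subst (g T k r ∸ Q s ℕ.<_) (ℕₚ.m+n∸m≡n (Q s) a) (ℕₚ.∸-monoˡ-< gr<gs Qs≤gr)
      d<ℓ : g T k r ∸ Q s ℕ.< rowLength s
      d<ℓ = ℕₚ.<-≤-trans d< (count≤length (suc k) (row T s))
      b<ℓ : b ℕ.< rowLength r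
      b<ℓ = subst (ℕ._< rowLength r) (ℕₚ.m+n∸m≡n (Q r) b)
        (ℕₚ.∸-monoˡ-< (ℕₚ.<-≤-trans gr<gs (ℕₚ.≤-trans (g≤P T (suc k) s) (P-decreasing (ℕₚ.<⇒≤ r<s))))
          (ℕₚ.m≤m+n (Q r) b))
      c = Fin.fromℕ< b<ℓ
      d = Fin.fromℕ< d<ℓ
      column : Q r ℕ.+ toℕ c ≡ Q s ℕ.+ toℕ d
      column = trans (cong (Q r ℕ.+_) (Finₚ.toℕ-fromℕ< b<ℓ))
        (sym (trans (cong (Q s ℕ.+_) (Finₚ.toℕ-fromℕ< d<ℓ)) (ℕₚ.m+[n∸m]≡n Qs≤gr)))
      c< : entry T (r , c) ℕ.< suc k
      c< = ℕₚ.<-≤-trans (s≤s (proj₂ (isSemistandard T) r s c d r<s column))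
        (count⇒entry T (suc k) s d (subst (ℕ._< a) (sym (Finₚ.toℕ-fromℕ< d<ℓ)) d<))

  edge-g : ∀ {i S T} (e : Edge i S T) k →
           g T k (edgeRow e) ≡ g S k (edgeRow e) ℕ.+ indicator k (colorℕ i)
  edge-g {i} {S} {T} e k = trans
    (cong (Q r ℕ.+_) (count≤-decrement k (row S r) (row T r) c off (T-entry e)
      (trans (S-entry e) (cong suc (T-entry e)))))
    (sym (ℕₚ.+-assoc (Q r) _ _))
    where
    r = edgeRow e
    c = proj₂ (cell e)
    off : ∀ d → d ≢ c → Vec.lookup (row S r) d ≡ Vec.lookup (row T r) d
    off d d≢c = Finₚ.toℕ-injective (ℕₚ.suc-injective (elsewhere e (r , d) λ { refl → d≢c refl }))

  edge-g-color : ∀ {i S T} (e : Edge i S T) → g T (colorℕ i) (edgeRow e) ≡ suc (g S (colorℕ i) (edgeRow e))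
  edge-g-color {i} {S} e = trans (edge-g e (colorℕ i))
    (trans (cong (λ b → g S (colorℕ i) (edgeRow e) ℕ.+ (if b then 1 else 0)) (dec-true (colorℕ i ℕ.≟ colorℕ i) refl)) (ℕₚ.+-comm _ 1))

  edge-g-otherColor : ∀ {i S T} → Edge i S T → ∀ k r → k ≢ colorℕ i → g T k r ≡ g S k r
  edge-g-otherColor {i} {S} {T} e k r k≢i with r Finₚ.≟ edgeRow e
  ... | no r≢ = sym (g-elsewhere e k r r≢)
  ... | yes refl = trans (edge-g e k)
    (trans (cong (λ b → g S k r ℕ.+ (if b then 1 else 0)) (dec-false (k ℕ.≟ colorℕ i) k≢i)) (ℕₚ.+-identityʳ _))

  -- Up to the constant sum of `Q`, this is the number of entries at most `k`. The numbers of
  -- entries are its first differences and the weight is minus its second difference.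
  G : Tableau → ℕ → ℕ
  G T k = ∑ℕ-Operator.big (g T k) rows

  #-G : ∀ k T → #[ suc k ] T ℕ.+ G T k ≡ G T (suc k)
  #-G k T = trans (sym (∑ℕ-Operator.big-∙ (λ r → Vec.count (λ e → value e ℕ.≟ suc k) (row T r)) (g T k) rows))
    (∑ℕ-Operator.big-cong rows λ r → trans (swap (Vec.count (λ e → value e ℕ.≟ suc k) (row T r)) (Q r) (count≤ k (row T r))) (cong (Q r ℕ.+_) (sym (count≤-suc k (row T r)))))
    where
    swap : ∀ x y z → x ℕ.+ (y ℕ.+ z) ≡ y ℕ.+ (x ℕ.+ z)
    swap x y z = trans (sym (ℕₚ.+-assoc x y z)) (trans (cong (ℕ._+ z) (ℕₚ.+-comm x y)) (ℕₚ.+-assoc y x z))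

  edge-G : ∀ {i S T} → Edge i S T → ∀ k → G T k ≡ G S k ℕ.+ indicator k (colorℕ i)
  edge-G {i} {S} {T} e k
    with rest , T≡ , S≡ ← ∑ℕ-Operator.big-differ Finₚ._≟_ (g T k) (g S k) (Uniqueₚ.allFin⁺ m) (∈ₚ.∈-allFin (edgeRow e))
           (λ r r≢ → sym (g-elsewhere e k r r≢))
    = trans T≡ (trans (cong (ℕ._+ rest) (edge-g e k)) (trans (swap (g S k (edgeRow e)) _ rest) (cong (ℕ._+ _) (sym S≡))))
    where
    swap : ∀ x y z → x ℕ.+ y ℕ.+ z ≡ x ℕ.+ z ℕ.+ y
    swap x y z = trans (ℕₚ.+-assoc x y z) (trans (cong (x ℕ.+_) (ℕₚ.+-comm y z)) (sym (ℕₚ.+-assoc x z y)))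

  wtᵢ-G : ∀ i T → wtᵢ i T ≡ (+ G T (colorℕ i) ℤ.- + G T (toℕ i)) ℤ.- (+ G T (suc (colorℕ i)) ℤ.- + G T (colorℕ i))
  wtᵢ-G i T = cong₂ ℤ._-_ (difference (toℕ i)) (difference (colorℕ i))
    where
    cancel : ∀ a b → a ≡ (a ℤ.+ b) ℤ.- b
    cancel = solve-∀
    difference : ∀ k → + #[ suc k ] T ≡ + G T (suc k) ℤ.- + G T k
    difference k = trans (cancel (+ #[ suc k ] T) (+ G T k))
      (cong (λ z → + z ℤ.- + G T k) (#-G k T))

  wtᵢ-edge : ∀ {i S T} → Edge i S T → ∀ j →
    wtᵢ j T ≡ wtᵢ j S ℤ.+ (+ indicator (colorℕ j) (colorℕ i) ℤ.+ + indicator (colorℕ j) (colorℕ i)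
      ℤ.- + indicator (suc (colorℕ j)) (colorℕ i) ℤ.- + indicator (toℕ j) (colorℕ i))
  wtᵢ-edge {i} {S} {T} e j = trans (wtᵢ-G j T) (trans
    (cong₂ (λ x y → x ℤ.- y) (cong₂ (λ a b → + a ℤ.- + b) (edge-G e (colorℕ j)) (edge-G e (toℕ j)))
      (cong₂ (λ a b → + a ℤ.- + b) (edge-G e (suc (colorℕ j))) (edge-G e (colorℕ j))))
    (trans (identity (+ G S (colorℕ j)) (+ indicator (colorℕ j) (colorℕ i)) (+ G S (toℕ j)) (+ indicator (toℕ j) (colorℕ i))
             (+ G S (suc (colorℕ j))) (+ indicator (suc (colorℕ j)) (colorℕ i)))
      (cong (ℤ._+ _) (sym (wtᵢ-G j S)))))
    where
    identity : ∀ a x b y c z → ((a ℤ.+ x) ℤ.- (b ℤ.+ y)) ℤ.- ((c ℤ.+ z) ℤ.- (a ℤ.+ x)) ≡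
               ((a ℤ.- b) ℤ.- (c ℤ.- a)) ℤ.+ (x ℤ.+ x ℤ.- z ℤ.- y)
    identity = solve-∀

  lookup-α : ∀ i j → Vec.lookup (α n i) j ≡ + indicator (colorℕ j) (colorℕ i) ℤ.+ + indicator (colorℕ j) (colorℕ i)
      ℤ.- + indicator (suc (colorℕ j)) (colorℕ i) ℤ.- + indicator (toℕ j) (colorℕ i)
  lookup-α i j = trans (Vecₚ.lookup-zipWith ℤ._-_ j ((ω n (colorℕ i) +ʷ ω n (colorℕ i)) -ʷ ω n (toℕ i)) (ω n (suc (colorℕ i)))) (cong₂ ℤ._-_
    (trans (Vecₚ.lookup-zipWith ℤ._-_ j (ω n (colorℕ i) +ʷ ω n (colorℕ i)) (ω n (toℕ i))) (cong₂ ℤ._-_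
      (trans (Vecₚ.lookup-zipWith ℤ._+_ j (ω n (colorℕ i)) (ω n (colorℕ i))) (cong₂ ℤ._+_ (lookup-ω (colorℕ i)) (lookup-ω (colorℕ i))))
      (lookup-ω (toℕ i))))
    (lookup-ω (suc (colorℕ i))))
    where
    lookup-ω : ∀ k → Vec.lookup (ω n k) j ≡ + indicator (colorℕ j) k
    lookup-ω k = trans (Vecₚ.lookup∘tabulate _ j) (push (does (colorℕ j ℕ.≟ k)))
      where
      push : ∀ b → (if b then 1ℤ else 0ℤ) ≡ + (if b then 1 else 0)
      push true  = refl
      push false = refl

  aStructured : AStructured
  aStructured {i} {S} {T} e = lookup-ext _ _ λ j → begin
    Vec.lookup (wt T) j                             ≡⟨ Vecₚ.lookup∘tabulate _ j ⟩
    wtᵢ j T                                         ≡⟨ wtᵢ-edge e j ⟩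
    wtᵢ j S ℤ.+ _                                   ≡⟨ cong₂ ℤ._+_ (Vecₚ.lookup∘tabulate _ j) (lookup-α i j) ⟨
    Vec.lookup (wt S) j ℤ.+ Vec.lookup (α n i) j    ≡⟨ Vecₚ.lookup-zipWith ℤ._+_ j (wt S) (α n i) ⟨
    Vec.lookup (wt S +ʷ α n i) j                    ∎
    where open ≡-Reasoning

-- The lattice of tableaux and the existence of edges

module Lattice {m n : ℕ} (shape : SkewShape m n) where

  open SkewShape shape
  open SkewTableaux shape
  open Combinatorics shape

  strict⁻ : ∀ T {r s} (c : Fin (rowLength r)) (d : Fin (rowLength s)) → r Fin.< s →
            Q r ℕ.+ toℕ c ≡ Q s ℕ.+ toℕ d → entry T (r , c) ℕ.< entry T (s , d)
  strict⁻ T c d r<s eq = s≤s (proj₂ (isSemistandard T) _ _ c d r<s eq)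

  combine : (f : Fin n → Fin n → Fin n) →
            (∀ {a b c d} → a Fin.≤ b → c Fin.≤ d → f a c Fin.≤ f b d) →
            (∀ {a b c d} → a Fin.< b → c Fin.< d → f a c Fin.< f b d) →
            Tableau → Tableau → Tableau
  combine f mono-≤ mono-< S T = tableau (fill m entries) (weak , strict)
    where
    entries : ∀ r → Fin (rowLength r) → Fin n
    entries r c = f (Vec.lookup (row S r) c) (Vec.lookup (row T r) c)
    weak : RowWeak (fill m entries)
    weak r c d c≤d = subst₂ Fin._≤_ (sym (lookup-fill m entries r c)) (sym (lookup-fill m entries r d))
      (mono-≤ (proj₁ (isSemistandard S) r c d c≤d) (proj₁ (isSemistandard T) r c d c≤d))
    strict : ColumnStrict (fill m entries)
    strict r s c d r<s eq = subst₂ Fin._<_ (sym (lookup-fill m entries r c)) (sym (lookup-fill m entries s d))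
      (mono-< (proj₂ (isSemistandard S) r s c d r<s eq) (proj₂ (isSemistandard T) r s c d r<s eq))

  -- The order is the reverse of the entrywise one, so that the join has the
  -- smaller entries.
  infixl 7 _∨_ _∧ᵗ_
  _∨_ _∧ᵗ_ : Tableau → Tableau → Tableau
  _∨_ = combine minF
    (λ {a} {b} {c} {d} p q → subst₂ ℕ._≤_ (sym (toℕ-minF a c)) (sym (toℕ-minF b d)) (ℕₚ.⊓-mono-≤ p q))
    (λ {a} {b} {c} {d} p q → subst₂ ℕ._<_ (sym (toℕ-minF a c)) (sym (toℕ-minF b d)) (ℕₚ.⊓-mono-< p q))
  _∧ᵗ_ = combine maxF
    (λ {a} {b} {c} {d} p q → subst₂ ℕ._≤_ (sym (toℕ-maxF a c)) (sym (toℕ-maxF b d)) (ℕₚ.⊔-mono-≤ p q))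
    (λ {a} {b} {c} {d} p q → subst₂ ℕ._<_ (sym (toℕ-maxF a c)) (sym (toℕ-maxF b d)) (ℕₚ.⊔-mono-< p q))

  entry-∨ : ∀ S T κ → entry (S ∨ T) κ ≡ entry S κ ℕ.⊓ entry T κ
  entry-∨ S T (r , c) = cong suc (trans (cong toℕ (lookup-fill m _ r c)) (toℕ-minF (Vec.lookup (row S r) c) (Vec.lookup (row T r) c)))

  entry-∧ : ∀ S T κ → entry (S ∧ᵗ T) κ ≡ entry S κ ℕ.⊔ entry T κ
  entry-∧ S T (r , c) = cong suc (trans (cong toℕ (lookup-fill m _ r c)) (toℕ-maxF (Vec.lookup (row S r) c) (Vec.lookup (row T r) c)))

  edge-< : ∀ {i S T} (e : Edge i S T) → entry T (cell e) ℕ.< entry S (cell e)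
  edge-< e = ℕₚ.≤-reflexive (sym (S-entry e))

  edge-≤ : ∀ {i S T} → Edge i S T → ∀ κ → entry T κ ℕ.≤ entry S κ
  edge-≤ e κ with κ ≟ᶜ cell e
  ... | yes refl = ℕₚ.<⇒≤ (edge-< e)
  ... | no  κ≢   = ℕₚ.≤-reflexive (sym (elsewhere e κ κ≢))

  edge-cell-if-≢ : ∀ {i S T} (e : Edge i S T) {κ} → entry S κ ≢ entry T κ → κ ≡ cell e
  edge-cell-if-≢ e {κ} ≢ = decidable-stable (κ ≟ᶜ cell e) λ κ≢ → ≢ (elsewhere e κ κ≢)

  edge-cell-unique : ∀ {i j S T} (e : Edge i S T) (f : Edge j S T) → cell e ≡ cell f
  edge-cell-unique e f = edge-cell-if-≢ f (ℕₚ.<⇒≢ (edge-< e) ∘ sym)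

  edge-color-unique : ∀ {i j S T} → Edge i S T → Edge j S T → i ≡ j
  edge-color-unique {T = T} e f = Finₚ.toℕ-injective (ℕₚ.suc-injective
    (trans (sym (T-entry e)) (trans (cong (entry T) (edge-cell-unique e f)) (T-entry f))))

  -- The cell lowered from `R` to `T` is untouched from `R` to `S`, since otherwise `S ≡ T`. There
  -- `S` exceeds `T` and hence `U`, and `S` and `U` differ in one cell only.
  diamond-cell : ∀ {i i′ j j′ R S T U} → S ≢ T → Edge j R S → (RT : Edge i R T) →
                 (SU : Edge i′ S U) → Edge j′ T U → cell SU ≡ cell RT
  diamond-cell {R = R} {S} {T} {U} S≢T RS RT SU TU = sym (edge-cell-if-≢ SU
    λ Sc≡Uc → ℕₚ.<-irrefl (sym Sc≡Uc) (ℕₚ.≤-<-trans (edge-≤ TU (cell RT))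
      (ℕₚ.<-≤-trans (edge-< RT) (ℕₚ.≤-reflexive (elsewhere RS (cell RT) λ c≡ → S≢T (same c≡))))))
    where
    same : cell RT ≡ cell RS → S ≡ T
    same c≡ = tableau-ext λ κ → case κ ≟ᶜ cell RS of λ where
      (yes refl) → ℕₚ.suc-injective (trans (sym (S-entry RS))
        (trans (cong (entry R) (sym c≡)) (trans (S-entry RT) (cong (ℕ.suc ∘ entry T) c≡))))
      (no κ≢) → trans (sym (elsewhere RS κ κ≢)) (elsewhere RT κ (κ≢ ∘ λ eq → trans eq c≡))

  module _ {i j R S T} (RS : Edge j R S) (RT : Edge i R T) (S≢T : S ≢ T) where

    private
      cells-differ : cell RS ≢ cell RT
      cells-differ c≡ = S≢T (tableau-ext λ κ → case κ ≟ᶜ cell RT of λ where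
        (yes refl) → ℕₚ.suc-injective (trans (trans (cong (ℕ.suc ∘ entry S) (sym c≡)) (sym (S-entry RS)))
          (trans (cong (entry R) c≡) (S-entry RT)))
        (no κ≢) → trans (sym (elsewhere RS κ (κ≢ ∘ λ eq → trans eq c≡))) (elsewhere RT κ κ≢))

    -- The two edges out of `R` lower different cells and do not obstruct each other, because the
    -- entrywise minimum is again semistandard. So two edges out of `R` always complete to a
    -- diamond.
    join-edge : Edge i S (S ∨ T)
    join-edge = record
      { cell = cell RT
      ; T-entry = trans T≡ (T-entry RT)
      ; S-entry = trans (sym (elsewhere RS (cell RT) (cells-differ ∘ sym))) (trans (S-entry RT) (cong suc (sym T≡)))
      ; elsewhere = λ κ κ≢ → sym (trans (entry-∨ S T κ) (ℕₚ.m≤n⇒m⊓n≡m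
          (ℕₚ.≤-trans (edge-≤ RS κ) (ℕₚ.≤-reflexive (elsewhere RT κ κ≢)))))
      }
      where
      T≡ : entry (S ∨ T) (cell RT) ≡ entry T (cell RT)
      T≡ = trans (entry-∨ S T (cell RT)) (ℕₚ.m≥n⇒m⊓n≡n (ℕₚ.≤-trans (edge-≤ RT (cell RT))
        (ℕₚ.≤-reflexive (elsewhere RS (cell RT) (cells-differ ∘ sym)))))

    -- The bottom of a diamond is determined by its middle tableaux, and so is its top by `join-of`.
    -- Off the diagonal, the coefficients of the two products in a commutator are therefore single
    -- terms.
    meet-of : R ≡ S ∧ᵗ T
    meet-of = tableau-ext λ κ → sym (trans (entry-∧ S T κ) (case κ ≟ᶜ cell RS of λ where
      (yes refl) → trans (cong (entry S κ ℕ.⊔_) (sym (elsewhere RT κ cells-differ))) (ℕₚ.m≤n⇒m⊔n≡n (edge-≤ RS κ))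
      (no κ≢) → trans (cong (ℕ._⊔ entry T κ) (sym (elsewhere RS κ κ≢))) (ℕₚ.m≥n⇒m⊔n≡m (edge-≤ RT κ))))

  module _ {i j S T U} (SU : Edge i S U) (TU : Edge j T U) (S≢T : S ≢ T) where

    private
      cells-differ : cell SU ≢ cell TU
      cells-differ c≡ = S≢T (tableau-ext λ κ → case κ ≟ᶜ cell SU of λ where
        (yes refl) → trans (S-entry SU) (trans (cong (ℕ.suc ∘ entry U) c≡) (trans (sym (S-entry TU)) (cong (entry T) (sym c≡))))
        (no κ≢) → trans (elsewhere SU κ κ≢) (sym (elsewhere TU κ (κ≢ ∘ λ eq → trans eq (sym c≡)))))

    meet-edge : Edge i (S ∧ᵗ T) T
    meet-edge = record
      { cell = cell SU
      ; T-entry = trans T≡ (T-entry SU)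
      ; S-entry = trans (entry-∧ S T (cell SU)) (trans (ℕₚ.m≥n⇒m⊔n≡m (ℕₚ.≤-trans (ℕₚ.≤-reflexive T≡) (edge-≤ SU (cell SU))))
          (trans (S-entry SU) (cong suc (sym T≡))))
      ; elsewhere = λ κ κ≢ → trans (entry-∧ S T κ) (ℕₚ.m≤n⇒m⊔n≡n
          (ℕₚ.≤-trans (ℕₚ.≤-reflexive (elsewhere SU κ κ≢)) (edge-≤ TU κ)))
      }
      where
      T≡ : entry T (cell SU) ≡ entry U (cell SU)
      T≡ = elsewhere TU (cell SU) cells-differ

    join-of : U ≡ S ∨ T
    join-of = tableau-ext λ κ → sym (trans (entry-∨ S T κ) (case κ ≟ᶜ cell SU of λ where
      (yes refl) → trans (cong (entry S κ ℕ.⊓_) (elsewhere TU (cell SU) cells-differ)) (ℕₚ.m≥n⇒m⊓n≡n (edge-≤ SU κ))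
      (no κ≢) → trans (cong (ℕ._⊓ entry T κ) (elsewhere SU κ κ≢)) (ℕₚ.m≤n⇒m⊓n≡m (edge-≤ TU κ))))

  ∨-comm : ∀ S T → S ∨ T ≡ T ∨ S
  ∨-comm S T = tableau-ext λ κ → trans (entry-∨ S T κ) (trans (ℕₚ.⊓-comm (entry S κ) (entry T κ)) (sym (entry-∨ T S κ)))

  ∧-comm : ∀ S T → S ∧ᵗ T ≡ T ∧ᵗ S
  ∧-comm S T = tableau-ext λ κ → trans (entry-∧ S T κ) (trans (ℕₚ.⊔-comm (entry S κ) (entry T κ)) (sym (entry-∧ T S κ)))

  column : Cell → ℕ
  column κ = toℕ (proj₂ κ)

  cell-ext : ∀ {κ κ′ : Cell} → proj₁ κ ≡ proj₁ κ′ → column κ ≡ column κ′ → κ ≡ κ′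
  cell-ext refl eq = cong (_ ,_) (Finₚ.toℕ-injective eq)

  row-weak : ∀ T {κ κ′} → proj₁ κ ≡ proj₁ κ′ → column κ ℕ.≤ column κ′ → entry T κ ℕ.≤ entry T κ′
  row-weak T refl c≤ = s≤s (proj₁ (isSemistandard T) _ _ _ c≤)

  S-entry′ : ∀ {i S T} (e : Edge i S T) → entry S (cell e) ≡ suc (colorℕ i)
  S-entry′ e = trans (S-entry e) (cong suc (T-entry e))

  -- A later cell of the row with entry `colorℕ i` has this entry in `S` too, where it would follow
  -- the larger entry in the cell of the edge. So the row alone determines the cell of an edge into
  -- `T`.
  edge-last : ∀ {i S T} (e : Edge i S T) κ → proj₁ κ ≡ edgeRow e → entry T κ ≡ colorℕ i →
              column κ ℕ.≤ column (cell e)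
  edge-last {S = S} e κ r≡ T≡ = ℕₚ.≮⇒≥ λ c< → ℕₚ.1+n≰n (subst₂ ℕ._≤_ (S-entry′ e)
    (trans (elsewhere e κ (λ { refl → ℕₚ.<-irrefl refl c< })) T≡)
    (row-weak S (sym r≡) (ℕₚ.<⇒≤ c<)))

  edge-first : ∀ {i S T} (e : Edge i S T) κ → proj₁ κ ≡ edgeRow e → entry S κ ≡ suc (colorℕ i) →
               column (cell e) ℕ.≤ column κ
  edge-first {T = T} e κ r≡ S≡ = ℕₚ.≮⇒≥ λ c< → ℕₚ.1+n≰n (subst₂ ℕ._≤_
    (trans (sym (elsewhere e κ (λ { refl → ℕₚ.<-irrefl refl c< }))) S≡) (T-entry e)
    (row-weak T r≡ (ℕₚ.<⇒≤ c<)))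

  into-unique : ∀ {i S S′ T} (e : Edge i S T) (f : Edge i S′ T) → edgeRow e ≡ edgeRow f → S ≡ S′
  into-unique {S = S} {S′} {T} e f r≡ = tableau-ext λ κ → case κ ≟ᶜ cell e of λ where
      (yes refl) → trans (S-entry′ e) (trans (sym (S-entry′ f)) (cong (entry S′) (sym c≡)))
      (no κ≢) → trans (elsewhere e κ κ≢) (sym (elsewhere f κ (κ≢ ∘ λ eq → trans eq (sym c≡))))
    where
    c≡ : cell e ≡ cell f
    c≡ = cell-ext r≡ (ℕₚ.≤-antisym (edge-last f (cell e) r≡ (T-entry e)) (edge-last e (cell f) (sym r≡) (T-entry f)))

  from-unique : ∀ {i T U U′} (e : Edge i T U) (f : Edge i T U′) → edgeRow e ≡ edgeRow f → U ≡ U′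
  from-unique {T = T} {U} {U′} e f r≡ = tableau-ext λ κ → case κ ≟ᶜ cell e of λ where
      (yes refl) → trans (T-entry e) (trans (sym (T-entry f)) (cong (entry U′) (sym c≡)))
      (no κ≢) → trans (sym (elsewhere e κ κ≢)) (elsewhere f κ (κ≢ ∘ λ eq → trans eq (sym c≡)))
    where
    c≡ : cell e ≡ cell f
    c≡ = cell-ext r≡ (ℕₚ.≤-antisym (edge-first e (cell f) (sym r≡) (S-entry′ f)) (edge-first f (cell e) r≡ (S-entry′ e)))

  module Update (T : Tableau) (κ : Cell) (v : Fin n)
    (left  : ∀ d → d Fin.< proj₂ κ → Vec.lookup (row T (proj₁ κ)) d Fin.≤ v)
    (right : ∀ d → proj₂ κ Fin.< d → v Fin.≤ Vec.lookup (row T (proj₁ κ)) d)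
    (above : ∀ s d → s Fin.< proj₁ κ → Q s ℕ.+ toℕ d ≡ Q (proj₁ κ) ℕ.+ column κ →
             Vec.lookup (row T s) d Fin.< v)
    (below : ∀ s d → proj₁ κ Fin.< s → Q (proj₁ κ) ℕ.+ column κ ≡ Q s ℕ.+ toℕ d →
             v Fin.< Vec.lookup (row T s) d)
    where

    private
      entries : ∀ r → Fin (rowLength r) → Fin n
      entries r c = if does ((r , c) ≟ᶜ κ) then v else Vec.lookup (row T r) c

      weak′ : ∀ r c d → c Fin.≤ d → entries r c Fin.≤ entries r d
      weak′ r c d c≤d with (r , c) ≟ᶜ κ | (r , d) ≟ᶜ κ
      ... | yes refl | yes _    = ℕₚ.≤-refl
      ... | yes refl | no  d≢   = right d (Finₚ.≤∧≢⇒< c≤d λ { refl → d≢ refl })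
      ... | no  c≢   | yes refl = left c (Finₚ.≤∧≢⇒< c≤d λ { refl → c≢ refl })
      ... | no  _    | no  _    = proj₁ (isSemistandard T) r c d c≤d

      strict′ : ∀ r s c d → r Fin.< s → Q r ℕ.+ toℕ c ≡ Q s ℕ.+ toℕ d → entries r c Fin.< entries s d
      strict′ r s c d r<s eq with (r , c) ≟ᶜ κ | (s , d) ≟ᶜ κ
      ... | yes refl | yes refl = contradiction r<s (ℕₚ.<-irrefl refl)
      ... | yes refl | no  _    = below s d r<s eq
      ... | no  _    | yes refl = above r c r<s eq
      ... | no  _    | no  _    = proj₂ (isSemistandard T) r s c d r<s eq

    updated : Tableau
    updated = tableau (fill m entries)
      ( (λ r c d c≤d → subst₂ Fin._≤_ (sym (lookup-fill m entries r c)) (sym (lookup-fill m entries r d)) (weak′ r c d c≤d))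
      , (λ r s c d r<s eq → subst₂ Fin._<_ (sym (lookup-fill m entries r c)) (sym (lookup-fill m entries s d))
          (strict′ r s c d r<s eq)))

    entry-updated : entry updated κ ≡ value v
    entry-updated = cong value (trans (lookup-fill m entries (proj₁ κ) (proj₂ κ))
      (cong (if_then v else Vec.lookup (row T (proj₁ κ)) (proj₂ κ)) (dec-true (κ ≟ᶜ κ) refl)))

    entry-elsewhere : ∀ κ′ → κ′ ≢ κ → entry updated κ′ ≡ entry T κ′
    entry-elsewhere (r , c) ≢κ = cong value (trans (lookup-fill m entries r c)
      (cong (if_then v else Vec.lookup (row T r) c) (dec-false ((r , c) ≟ᶜ κ) ≢κ)))

  -- By the first hypothesis the row `r` contains an entry `colorℕ i`, and the last one is raised.
  -- It lies in the column `g T (colorℕ i) r`; by the second hypothesis the entries below it in this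
  -- column exceed the new value `suc (colorℕ i)`.
  down-step : ∀ i T r → g T (toℕ i) r ℕ.< g T (colorℕ i) r →
              (∀ s → r Fin.< s → g T (suc (colorℕ i)) s ℕ.< g T (colorℕ i) r) →
              ∃[ S ] Σ[ e ∈ Edge i S T ] (edgeRow e ≡ r)
  down-step i T r b<g a<g = U.updated , record
    { cell = r , c
    ; T-entry = c≡
    ; S-entry = trans U.entry-updated (cong suc (trans (Finₚ.toℕ-fromℕ< (color<n i)) (sym c≡)))
    ; elsewhere = U.entry-elsewhere
    } , refl
    where
    -- The position, counted from zero, of the last entry at most `colorℕ i`. The count is positive
    -- by `b<count`, so the subtraction does not truncate.
    k = count≤ (colorℕ i) (row T r) ∸ 1
    b<count : count≤ (toℕ i) (row T r) ℕ.< count≤ (colorℕ i) (row T r)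
    b<count = ℕₚ.+-cancelˡ-< (Q r) _ _ b<g
    count≡ : count≤ (colorℕ i) (row T r) ≡ suc k
    count≡ = sym (ℕₚ.m+[n∸m]≡n (ℕₚ.≤-trans (s≤s z≤n) b<count))
    k<ℓ : k ℕ.< rowLength r
    k<ℓ = ℕₚ.≤-trans (ℕₚ.≤-reflexive (sym count≡)) (count≤length (colorℕ i) (row T r))
    c : Fin (rowLength r)
    c = Fin.fromℕ< k<ℓ
    toℕ-c : toℕ c ≡ k
    toℕ-c = Finₚ.toℕ-fromℕ< k<ℓ
    c≡ : entry T (r , c) ≡ colorℕ i
    c≡ = ℕₚ.≤-antisym
      (count⇒entry T (colorℕ i) r c (ℕₚ.≤-reflexive (trans (cong suc toℕ-c) (sym count≡))))
      (ℕₚ.≰⇒> λ ≤i → ℕₚ.<⇒≱ (entry⇒count T (toℕ i) r c ≤i)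
        (ℕₚ.≤-trans (ℕ.s≤s⁻¹ (ℕₚ.≤-trans b<count (ℕₚ.≤-reflexive count≡))) (ℕₚ.≤-reflexive (sym toℕ-c))))
    g≡ : g T (colorℕ i) r ≡ suc (Q r ℕ.+ toℕ c)
    g≡ = trans (cong (Q r ℕ.+_) (trans count≡ (cong suc (sym toℕ-c)))) (ℕₚ.+-suc (Q r) _)
    -- The new entry is `suc (colorℕ i)`, which as an element of `Fin n` is represented by
    -- `colorℕ i`.
    v : Fin n
    v = Fin.fromℕ< (color<n i)
    v≡ : toℕ v ≡ colorℕ i
    v≡ = Finₚ.toℕ-fromℕ< (color<n i)
    module U = Update T (r , c) v
      (λ d d<c → ℕₚ.≤-trans (ℕ.s≤s⁻¹ (ℕₚ.≤-trans (row-weak T refl (ℕₚ.<⇒≤ d<c)) (ℕₚ.≤-reflexive c≡)))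
        (ℕₚ.≤-trans (ℕₚ.n≤1+n _) (ℕₚ.≤-reflexive (sym v≡))))
      (λ d c<d → ℕₚ.≤-trans (ℕₚ.≤-reflexive v≡) (ℕ.s≤s⁻¹ (ℕₚ.≰⇒> λ d≤i →
        ℕₚ.<⇒≱ (entry⇒count T (colorℕ i) r d d≤i)
          (ℕₚ.≤-trans (ℕₚ.≤-reflexive (trans count≡ (cong suc (sym toℕ-c)))) c<d))))
      (λ s d s<r eq → ℕₚ.<-trans (ℕ.s<s⁻¹ (strict⁻ T d c s<r eq))
        (ℕₚ.≤-reflexive (trans c≡ (sym v≡))))
      (λ s d r<s eq → ℕₚ.≤-trans (ℕₚ.≤-reflexive (cong suc v≡)) (ℕ.s≤s⁻¹ (ℕₚ.≰⇒> λ d≤ →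
        ℕₚ.<⇒≱ (ℕₚ.+-monoʳ-< (Q s) (entry⇒count T (suc (colorℕ i)) s d d≤))
          (ℕ.s≤s⁻¹ (ℕₚ.≤-trans (a<g s r<s) (ℕₚ.≤-reflexive (trans g≡ (cong suc eq))))))))

  -- Now the first entry `suc (colorℕ i)` of the row is lowered. It lies in the column
  -- `g T (colorℕ i) r + 1`, where by the second hypothesis all entries above are at most `toℕ i`,
  -- hence below the new value `colorℕ i`.
  up-step : ∀ i T r → g T (colorℕ i) r ℕ.< g T (suc (colorℕ i)) r →
            (∀ s → s Fin.< r → g T (colorℕ i) r ℕ.< g T (toℕ i) s) →
            ∃[ U ] Σ[ e ∈ Edge i T U ] (edgeRow e ≡ r)
  up-step i T r g<a g<b = U.updated , record
    { cell = r , c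
    ; T-entry = U-entry
    ; S-entry = trans c≡ (cong suc (sym U-entry))
    ; elsewhere = λ κ κ≢ → sym (U.entry-elsewhere κ κ≢)
    } , refl
    where
    k = count≤ (colorℕ i) (row T r)
    k<a : k ℕ.< count≤ (suc (colorℕ i)) (row T r)
    k<a = ℕₚ.+-cancelˡ-< (Q r) _ _ g<a
    k<ℓ : k ℕ.< rowLength r
    k<ℓ = ℕₚ.≤-trans k<a (count≤length (suc (colorℕ i)) (row T r))
    c : Fin (rowLength r)
    c = Fin.fromℕ< k<ℓ
    toℕ-c : toℕ c ≡ k
    toℕ-c = Finₚ.toℕ-fromℕ< k<ℓ
    c≡ : entry T (r , c) ≡ suc (colorℕ i)
    c≡ = ℕₚ.≤-antisym
      (count⇒entry T (suc (colorℕ i)) r c (ℕₚ.≤-trans (ℕₚ.≤-reflexive (cong suc toℕ-c)) k<a))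
      (ℕₚ.≰⇒> λ ≤i → ℕₚ.<⇒≱ (entry⇒count T (colorℕ i) r c ≤i) (ℕₚ.≤-reflexive (sym toℕ-c)))
    i<n : toℕ i ℕ.< n
    i<n = ℕₚ.<-trans (ℕₚ.n<1+n _) (color<n i)
    v : Fin n
    v = Fin.fromℕ< i<n
    v≡ : toℕ v ≡ toℕ i
    v≡ = Finₚ.toℕ-fromℕ< i<n
    v<c : v Fin.< Vec.lookup (row T r) c
    v<c = ℕₚ.≤-reflexive (trans (cong suc v≡) (sym (ℕₚ.suc-injective c≡)))
    module U = Update T (r , c) v
      (λ d d<c → ℕₚ.≤-trans (ℕ.s≤s⁻¹ (count⇒entry T (colorℕ i) r d (subst (toℕ d ℕ.<_) toℕ-c d<c)))
        (ℕₚ.≤-reflexive (sym v≡)))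
      (λ d c<d → ℕₚ.≤-trans (ℕₚ.<⇒≤ v<c) (proj₁ (isSemistandard T) r c d (ℕₚ.<⇒≤ c<d)))
      (λ s d s<r eq → ℕₚ.≤-trans
        (count⇒entry T (toℕ i) s d (ℕₚ.+-cancelˡ-< (Q s) _ _
          (subst (ℕ._< g T (toℕ i) s) (sym (trans eq (cong (Q r ℕ.+_) toℕ-c))) (g<b s s<r))))
        (ℕₚ.≤-reflexive (sym v≡)))
      (λ s d r<s eq → ℕₚ.<-trans v<c (proj₂ (isSemistandard T) r s c d r<s eq))
    U-entry : entry U.updated (r , c) ≡ colorℕ i
    U-entry = trans U.entry-updated (cong suc v≡)
-- The edge coefficients and the diamond relations

module ∑ℚ-Operator = BigOperator ℚₚ.+-0-commutativeMonoid
module ∏ℚ-Operator = BigOperator ℚₚ.*-1-commutativeMonoid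

open ∑ℚ-Operator using () renaming (big to ∑)
open ∏ℚ-Operator using () renaming (big to ∏)

-- The detour through unnormalised fractions leaves an identity of integers and avoids the gcd of
-- the normal form.
fromℤ-homo : ∀ (_∙_ : ℤ → ℤ → ℤ) (_∘′_ : ℚᵘ → ℚᵘ → ℚᵘ) (_∘″_ : ℚ → ℚ → ℚ) →
             (∀ p q → ℚ.toℚᵘ (p ∘″ q) ℚᵘ.≃ ℚ.toℚᵘ p ∘′ ℚ.toℚᵘ q) →
             (∀ a b → ℚᵘ.mkℚᵘ (a ∙ b) 0 ℚᵘ.≃ ℚᵘ.mkℚᵘ a 0 ∘′ ℚᵘ.mkℚᵘ b 0) →
             ∀ a b → fromℤ (a ∙ b) ≡ fromℤ a ∘″ fromℤ b
fromℤ-homo _ _ _ homo eq a b = ℚₚ.toℚᵘ-injective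
  (ℚᵘₚ.≃-trans (eq a b) (ℚᵘₚ.≃-sym (homo (fromℤ a) (fromℤ b))))

fromℤ-+ : ∀ a b → fromℤ (a ℤ.+ b) ≡ fromℤ a ℚ.+ fromℤ b
fromℤ-+ = fromℤ-homo ℤ._+_ ℚᵘ._+_ ℚ._+_ ℚₚ.toℚᵘ-homo-+ λ a b → ℚᵘ.*≡* (identity a b)
  where
  identity : ∀ a b → (a ℤ.+ b) ℤ.* 1ℤ ≡ (a ℤ.* 1ℤ ℤ.+ b ℤ.* 1ℤ) ℤ.* 1ℤ
  identity = solve-∀

fromℤ-* : ∀ a b → fromℤ (a ℤ.* b) ≡ fromℤ a ℚ.* fromℤ b
fromℤ-* = fromℤ-homo ℤ._*_ ℚᵘ._*_ ℚ._*_ ℚₚ.toℚᵘ-homo-* λ a b → ℚᵘ.*≡* refl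

fromℤ-neg : ∀ a → fromℤ (ℤ.- a) ≡ ℚ.- fromℤ a
fromℤ-neg (+ zero)  = refl
fromℤ-neg (+ suc _) = refl
fromℤ-neg -[1+ _ ]  = refl

fromℤ-∸ : ∀ a b → fromℤ (a ℤ.- b) ≡ fromℤ a ℚ.- fromℤ b
fromℤ-∸ a b = trans (fromℤ-+ a (ℤ.- b)) (cong (fromℤ a ℚ.+_) (fromℤ-neg b))

fromℤ-injective : ∀ {a b} → fromℤ a ≡ fromℤ b → a ≡ b
fromℤ-injective = cong ℚ.numerator

fromℤ-∏ : ∀ {A : Set} (f : A → ℤ) xs → fromℤ (∏ℤ (List.map f xs)) ≡ ∏ (fromℤ ∘ f) xs
fromℤ-∏ f []       = refl
fromℤ-∏ f (x ∷ xs) = trans (fromℤ-* (f x) _) (cong (fromℤ (f x) ℚ.*_) (fromℤ-∏ f xs))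

-- The inverse, with inv 0 = 0, so that it is multiplicative.
inv : ℚ → ℚ
inv q with q ℚₚ.≟ 0ℚ
... | yes _  = 0ℚ
... | no q≢0 = ℚ.1/_ q {{ℚ.≢-nonZero q≢0}}

inv-inverse : ∀ {q} → q ≢ 0ℚ → q ℚ.* inv q ≡ 1ℚ
inv-inverse {q} q≢0 with q ℚₚ.≟ 0ℚ
... | yes q≡0 = contradiction q≡0 q≢0
... | no  q≢0 = ℚₚ.*-inverseʳ q {{ℚ.≢-nonZero q≢0}}

÷-inv : ∀ p q .{{_ : ℚ.NonZero q}} → p ℚ.÷ q ≡ p ℚ.* inv q
÷-inv p q with q ℚₚ.≟ 0ℚ
÷-inv p q {{()}} | yes refl
... | no _ = refl

*-nonZero : ∀ {p q} → p ≢ 0ℚ → q ≢ 0ℚ → p ℚ.* q ≢ 0ℚ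
*-nonZero {p} {q} p≢0 q≢0 pq≡0 = q≢0 (begin
  q                      ≡⟨ ℚₚ.*-identityˡ q ⟨
  1ℚ ℚ.* q               ≡⟨ cong (ℚ._* q) (trans (ℚₚ.*-comm (inv p) p) (inv-inverse p≢0)) ⟨
  inv p ℚ.* p ℚ.* q      ≡⟨ ℚₚ.*-assoc (inv p) p q ⟩
  inv p ℚ.* (p ℚ.* q)    ≡⟨ cong (inv p ℚ.*_) pq≡0 ⟩
  inv p ℚ.* 0ℚ           ≡⟨ ℚₚ.*-zeroʳ (inv p) ⟩
  0ℚ                     ∎)
  where open ≡-Reasoning

*-cancelˡ-nonZero : ∀ p {q r} → p ≢ 0ℚ → p ℚ.* q ≡ p ℚ.* r → q ≡ r
*-cancelˡ-nonZero p {q} {r} p≢0 eq = trans (sym (cancel q)) (trans (cong (inv p ℚ.*_) eq) (cancel r))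
  where
  cancel : ∀ q → inv p ℚ.* (p ℚ.* q) ≡ q
  cancel q = trans (sym (ℚₚ.*-assoc (inv p) p q)) (trans
    (cong (ℚ._* q) (trans (ℚₚ.*-comm (inv p) p) (inv-inverse p≢0))) (ℚₚ.*-identityˡ q))

open import Data.Rational.Solver using () renaming (module +-*-Solver to ℚ-Solver)
open ℚ-Solver using (con) renaming (solve to solveℚ; _:=_ to _⊜_; _:+_ to _⊕_; _:*_ to _⊛_; _:-_ to _⊖_; :-_ to ⊝_)

inv-* : ∀ p q → inv (p ℚ.* q) ≡ inv p ℚ.* inv q
inv-* p q = cases (p ℚₚ.≟ 0ℚ) (q ℚₚ.≟ 0ℚ)
  where
  cases : Dec (p ≡ 0ℚ) → Dec (q ≡ 0ℚ) → inv (p ℚ.* q) ≡ inv p ℚ.* inv q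
  cases (yes refl) _          = trans (cong inv (ℚₚ.*-zeroˡ q)) (sym (ℚₚ.*-zeroˡ (inv q)))
  cases (no _)     (yes refl) = trans (cong inv (ℚₚ.*-zeroʳ p)) (sym (ℚₚ.*-zeroʳ (inv p)))
  cases (no p≢0)   (no q≢0)   = *-cancelˡ-nonZero (p ℚ.* q) (*-nonZero p≢0 q≢0) (trans
    (inv-inverse (*-nonZero p≢0 q≢0))
    (sym (trans (interchange p q (inv p) (inv q)) (cong₂ ℚ._*_ (inv-inverse p≢0) (inv-inverse q≢0)))))
    where
    interchange : ∀ a b c d → (a ℚ.* b) ℚ.* (c ℚ.* d) ≡ (a ℚ.* c) ℚ.* (b ℚ.* d)
    interchange = solveℚ 4 (λ a b c d → (a ⊛ b) ⊛ (c ⊛ d) ⊜ (a ⊛ c) ⊛ (b ⊛ d)) refl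

-- The edge coefficients as products over all rows

module Coefficients {m n : ℕ} (shape : SkewShape m n) where

  open SkewTableaux shape
  open Combinatorics shape
  open Lattice shape

  ℓ : Tableau → ℕ → Fin m → ℤ
  ℓ T k r = + g T k r ℤ.+ pos k r

  -- Opaque because fromℤ is in constructor form, so that arithmetic on L T k r
  -- would unfold to the normalisation of fractions.
  opaque

    L : Tableau → ℕ → Fin m → ℚ
    L T k r = fromℤ (ℓ T k r)

    L-ℓ : ∀ T k r → L T k r ≡ fromℤ (ℓ T k r)
    L-ℓ T k r = refl

  ℓ-< : ∀ {T k r T′ k′ r′} → g T k r ℕ.+ k ℕ.+ toℕ r′ ℕ.< g T′ k′ r′ ℕ.+ k′ ℕ.+ toℕ r → ℓ T k r ℤ.< ℓ T′ k′ r′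
  ℓ-< {T} {k} {r} {T′} {k′} {r′} lt = subst₂ ℤ._<_
    (identity (+ g T k r) (+ k) (+ toℕ r) (+ toℕ r′)) (identity′ (+ g T′ k′ r′) (+ k′) (+ toℕ r) (+ toℕ r′))
    (ℤₚ.+-monoˡ-< (ℤ.- (+ toℕ r ℤ.+ + toℕ r′)) (ℤ.+<+ lt))
    where
    identity : ∀ g k r s → g ℤ.+ k ℤ.+ s ℤ.- (r ℤ.+ s) ≡ g ℤ.+ (k ℤ.- r)
    identity = solve-∀
    identity′ : ∀ g k r s → g ℤ.+ k ℤ.+ r ℤ.- (r ℤ.+ s) ≡ g ℤ.+ (k ℤ.- s)
    identity′ = solve-∀

  gap-ℓ : ∀ T k r k′ s → gap T k r k′ s ≡ ℓ T k r ℤ.- ℓ T k′ s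
  gap-ℓ T k r k′ s = identity (+ g T k r) (+ g T k′ s) (pos k r) (pos k′ s)
    where
    identity : ∀ a b c d → a ℤ.- b ℤ.+ c ℤ.- d ≡ (a ℤ.+ c) ℤ.- (b ℤ.+ d)
    identity = solve-∀

  gap-L : ∀ T k r k′ s → fromℤ (gap T k r k′ s) ≡ L T k r ℚ.- L T k′ s
  gap-L T k r k′ s = trans (cong fromℤ (gap-ℓ T k r k′ s)) (trans (fromℤ-∸ (ℓ T k r) (ℓ T k′ s))
    (sym (cong₂ ℚ._-_ (L-ℓ T k r) (L-ℓ T k′ s))))

  gap-1-L : ∀ T k r k′ s → fromℤ (gap T k r k′ s ℤ.- 1ℤ) ≡ L T k r ℚ.- L T k′ s ℚ.- 1ℚ
  gap-1-L T k r k′ s = trans (fromℤ-∸ (gap T k r k′ s) 1ℤ) (cong (ℚ._- 1ℚ) (gap-L T k r k′ s))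

  -- The row `r` has no denominator. There `xᵈ` carries the sign of `X`; its value `- 1` is also
  -- what the general formula gives, the inverse of `0 - 1`, and in this form it will be a factor of
  -- a residue.
  xᵈ yᵈ : Tableau → Color n → Fin m → Fin m → ℚ
  xᵈ T i r s = if does (s Finₚ.≟ r) then ℚ.- 1ℚ else inv (L T (colorℕ i) r ℚ.- L T (colorℕ i) s ℚ.- 1ℚ)
  yᵈ T i r s = if does (s Finₚ.≟ r) then 1ℚ else inv (L T (colorℕ i) r ℚ.- L T (colorℕ i) s)

  xᶠ yᶠ : Tableau → Color n → Fin m → Fin m → ℚ
  xᶠ T i r s = (L T (colorℕ i) r ℚ.- L T (suc (colorℕ i)) s) ℚ.* xᵈ T i r s
  yᶠ T i r s = (L T (colorℕ i) r ℚ.- L T (toℕ i) s ℚ.- 1ℚ) ℚ.* yᵈ T i r s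

  rows-unique : Unique rows
  rows-unique = Uniqueₚ.allFin⁺ m

  -- Since `inv` is multiplicative without side conditions, the denominator can be distributed over
  -- the rows, with the value `1ℚ` in the row `r`.
  ∏-quotient : ∀ (u d : Fin m → ℤ) r →
               fromℤ (∏ℤ (List.map u rows)) ℚ.* inv (fromℤ (∏ℤ (List.map d (otherRows r)))) ≡
               ∏ (λ s → fromℤ (u s) ℚ.* (if does (s Finₚ.≟ r) then 1ℚ else inv (fromℤ (d s)))) rows
  ∏-quotient u d r = trans (cong₂ ℚ._*_ (fromℤ-∏ u rows) denominator)
    (sym (∏ℚ-Operator.big-∙ (fromℤ ∘ u) _ rows))
    where
    inv-if : ∀ s → inv (if does (¬? (s Finₚ.≟ r)) then fromℤ (d s) else 1ℚ) ≡
             (if does (s Finₚ.≟ r) then 1ℚ else inv (fromℤ (d s)))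
    inv-if s with does (s Finₚ.≟ r)
    ... | true  = refl
    ... | false = refl
    denominator : inv (fromℤ (∏ℤ (List.map d (otherRows r)))) ≡
                  ∏ (λ s → if does (s Finₚ.≟ r) then 1ℚ else inv (fromℤ (d s))) rows
    denominator = trans (cong inv (trans (fromℤ-∏ d (otherRows r))
        (∏ℚ-Operator.big-filter (λ s → ¬? (s Finₚ.≟ r)) (fromℤ ∘ d) rows)))
      (trans (∏ℚ-Operator.big-homo inv refl inv-* rows) (∏ℚ-Operator.big-cong rows inv-if))

  Y-∏ : ∀ {i S T} (e : Edge i S T) → Y e ≡ ∏ (yᶠ T i (edgeRow e)) rows
  Y-∏ {i} {S} {T} e = trans (÷-inv (fromℤ (Y-numerator i r T)) (fromℤ (Y-denominator i r T)) {{Y-denominator-nonZero e}}) (trans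
    (∏-quotient (λ s → gap T (colorℕ i) r (toℕ i) s ℤ.- 1ℤ) (λ s → gap T (colorℕ i) r (colorℕ i) s) r)
    (∏ℚ-Operator.big-cong rows λ s → cong₂ ℚ._*_ (gap-1-L T (colorℕ i) r (toℕ i) s)
      (cong (if does (s Finₚ.≟ r) then_else_ 1ℚ) (cong inv (gap-L T (colorℕ i) r (colorℕ i) s)))))
    where r = edgeRow e

  X-∏ : ∀ {i S T} (e : Edge i S T) → X e ≡ ∏ (xᶠ T i (edgeRow e)) rows
  X-∏ {i} {S} {T} e = trans (cong ℚ.-_ (trans (÷-inv (fromℤ (X-numerator i r T)) (fromℤ (X-denominator i r T)) {{X-denominator-nonZero e}}) (trans
    (∏-quotient (λ s → gap T (colorℕ i) r (suc (colorℕ i)) s) (λ s → gap T (colorℕ i) r (colorℕ i) s ℤ.- 1ℤ) r)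
    (∏ℚ-Operator.big-cong rows λ s → cong₂ ℚ._*_ (gap-L T (colorℕ i) r (suc (colorℕ i)) s)
      (cong (if does (s Finₚ.≟ r) then_else_ 1ℚ) (cong inv (gap-1-L T (colorℕ i) r (colorℕ i) s))))))) negate
    where
    r = edgeRow e
    x₊ : Fin m → ℚ
    x₊ s = (L T (colorℕ i) r ℚ.- L T (suc (colorℕ i)) s) ℚ.*
           (if does (s Finₚ.≟ r) then 1ℚ else inv (L T (colorℕ i) r ℚ.- L T (colorℕ i) s ℚ.- 1ℚ))
    off : ∀ s → s ≢ r → x₊ s ≡ xᶠ T i r s
    off s s≢r rewrite dec-false (s Finₚ.≟ r) s≢r = refl
    at : x₊ r ≡ ℚ.- xᶠ T i r r
    at rewrite dec-true (r Finₚ.≟ r) refl =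
      solveℚ 1 (λ a → a ⊛ con 1ℚ ⊜ ⊝ (a ⊛ con (ℚ.- 1ℚ))) refl (L T (colorℕ i) r ℚ.- L T (suc (colorℕ i)) r)
    negate : ℚ.- ∏ x₊ rows ≡ ∏ (xᶠ T i r) rows
    negate with ρ , x₊≡ , x≡ ← ∏ℚ-Operator.big-differ Finₚ._≟_ x₊ (xᶠ T i r) rows-unique (∈ₚ.∈-allFin r) off =
      trans (cong ℚ.-_ (trans x₊≡ (cong (ℚ._* ρ) at)))
        (trans (solveℚ 2 (λ a b → ⊝ ((⊝ a) ⊛ b) ⊜ a ⊛ b) refl (xᶠ T i r r) ρ) (sym x≡))

-- The diamond relations and the nonvanishing of `X`

module Diamond {m n : ℕ} (shape : SkewShape m n) where

  open SkewTableaux shape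
  open Combinatorics shape
  open Lattice shape
  open Coefficients shape

  L-color : ∀ {i S T} (e : Edge i S T) → L T (colorℕ i) (edgeRow e) ≡ L S (colorℕ i) (edgeRow e) ℚ.+ 1ℚ
  L-color {i} {S} {T} e = trans (L-ℓ T (colorℕ i) r) (trans (cong fromℤ (trans (cong (λ k → + k ℤ.+ pos (colorℕ i) r) (edge-g-color e))
      (identity (+ g S (colorℕ i) r) (pos (colorℕ i) r))))
    (trans (fromℤ-+ (ℓ S (colorℕ i) r) 1ℤ) (cong (ℚ._+ 1ℚ) (sym (L-ℓ S (colorℕ i) r)))))
    where
    r = edgeRow e
    identity : ∀ a b → 1ℤ ℤ.+ a ℤ.+ b ≡ a ℤ.+ b ℤ.+ 1ℤ
    identity = solve-∀

  L-otherColor : ∀ {i S T} → Edge i S T → ∀ k r → k ≢ colorℕ i → L T k r ≡ L S k r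
  L-otherColor {S = S} {T} e k r k≢ = trans (L-ℓ T k r) (trans
    (cong (λ g → fromℤ (+ g ℤ.+ pos k r)) (edge-g-otherColor e k r k≢)) (sym (L-ℓ S k r)))

  L-otherRow : ∀ {i S T} (e : Edge i S T) k {s} → s ≢ edgeRow e → L T k s ≡ L S k s
  L-otherRow {S = S} {T} e k {s} s≢ = trans (L-ℓ T k s) (trans
    (cong (λ g → fromℤ (+ g ℤ.+ pos k s)) (sym (g-elsewhere e k s s≢))) (sym (L-ℓ S k s)))

  xᶠ-cong : ∀ {T U} i r s → L U (colorℕ i) r ≡ L T (colorℕ i) r →
            L U (suc (colorℕ i)) s ≡ L T (suc (colorℕ i)) s → L U (colorℕ i) s ≡ L T (colorℕ i) s →
            xᶠ U i r s ≡ xᶠ T i r s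
  xᶠ-cong i r s eq₁ eq₂ eq₃ rewrite eq₁ | eq₂ | eq₃ = refl

  yᶠ-cong : ∀ {T U} i r s → L U (colorℕ i) r ≡ L T (colorℕ i) r →
            L U (toℕ i) s ≡ L T (toℕ i) s → L U (colorℕ i) s ≡ L T (colorℕ i) s →
            yᶠ U i r s ≡ yᶠ T i r s
  yᶠ-cong i r s eq₁ eq₂ eq₃ rewrite eq₁ | eq₂ | eq₃ = refl

  -- Moving to the opposite side of a diamond changes only the row `s` in the one product and the
  -- row `r` in the other. The rest is a pair of common cofactors, so `eq` is all that has to be
  -- checked.
  ∏-exchange : ∀ (f f′ h h′ : Fin m → ℚ) s r →
               (∀ k → k ≢ s → f k ≡ f′ k) → (∀ k → k ≢ r → h k ≡ h′ k) →
               f s ℚ.* h r ≡ h′ r ℚ.* f′ s →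
               ∏ f rows ℚ.* ∏ h rows ≡ ∏ h′ rows ℚ.* ∏ f′ rows
  ∏-exchange f f′ h h′ s r f≡ h≡ eq
    with ρ , e₁ , e₂ ← ∏ℚ-Operator.big-differ Finₚ._≟_ f f′ rows-unique (∈ₚ.∈-allFin s) f≡
       | τ , e₃ , e₄ ← ∏ℚ-Operator.big-differ Finₚ._≟_ h h′ rows-unique (∈ₚ.∈-allFin r) h≡
    = trans (cong₂ ℚ._*_ e₁ e₃) (trans (interchange (f s) ρ (h r) τ) (trans (cong (ℚ._* (ρ ℚ.* τ)) eq)
        (trans (interchange′ (h′ r) (f′ s) ρ τ) (sym (cong₂ ℚ._*_ e₄ e₂)))))
    where
    interchange : ∀ a b c d → (a ℚ.* b) ℚ.* (c ℚ.* d) ≡ (a ℚ.* c) ℚ.* (b ℚ.* d)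
    interchange = solveℚ 4 (λ a b c d → (a ⊛ b) ⊛ (c ⊛ d) ⊜ (a ⊛ c) ⊛ (b ⊛ d)) refl
    interchange′ : ∀ a b c d → (a ℚ.* b) ℚ.* (c ℚ.* d) ≡ (a ℚ.* d) ℚ.* (b ℚ.* c)
    interchange′ = solveℚ 4 (λ a b c d → (a ⊛ b) ⊛ (c ⊛ d) ⊜ (a ⊛ d) ⊛ (b ⊛ c)) refl

  diamond : ∀ {i j R S T U} → S ≢ T →
    (RS : Edge j R S) (RT : Edge i R T) (SU : Edge i S U) (TU : Edge j T U) →
    X SU ℚ.* Y TU ≡ Y RS ℚ.* X RT
  diamond {i} {j} {R} {S} {T} {U} S≢T RS RT SU TU = begin
    X SU ℚ.* Y TU                                            ≡⟨ cong₂ ℚ._*_ (X-∏ SU) (Y-∏ TU) ⟩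
    ∏ (xᶠ U i (edgeRow SU)) rows ℚ.* ∏ (yᶠ U j (edgeRow TU)) rows
      ≡⟨ cong₂ (λ r s → ∏ (xᶠ U i r) rows ℚ.* ∏ (yᶠ U j s) rows)
           (cong proj₁ (diamond-cell S≢T RS RT SU TU)) (cong proj₁ (diamond-cell (S≢T ∘ sym) RT RS TU SU)) ⟩
    ∏ (xᶠ U i r) rows ℚ.* ∏ (yᶠ U j s) rows                  ≡⟨ exchange ⟩
    ∏ (yᶠ S j s) rows ℚ.* ∏ (xᶠ T i r) rows                  ≡⟨ cong₂ ℚ._*_ (Y-∏ RS) (X-∏ RT) ⟨
    Y RS ℚ.* X RT                                            ∎
    where
    open ≡-Reasoning
    r = edgeRow RT
    s = edgeRow RS
    r≡ : edgeRow SU ≡ r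
    r≡ = cong proj₁ (diamond-cell S≢T RS RT SU TU)
    s≡ : edgeRow TU ≡ s
    s≡ = cong proj₁ (diamond-cell (S≢T ∘ sym) RT RS TU SU)

    Uᵢᵣ : L U (colorℕ i) r ≡ L S (colorℕ i) r ℚ.+ 1ℚ
    Uᵢᵣ = subst (λ r → L U (colorℕ i) r ≡ L S (colorℕ i) r ℚ.+ 1ℚ) r≡ (L-color SU)
    Uⱼₛ : L U (colorℕ j) s ≡ L T (colorℕ j) s ℚ.+ 1ℚ
    Uⱼₛ = subst (λ s → L U (colorℕ j) s ≡ L T (colorℕ j) s ℚ.+ 1ℚ) s≡ (L-color TU)
    S-row : ∀ k t → t ≢ r → L U k t ≡ L S k t
    S-row k t t≢r = L-otherRow SU k (t≢r ∘ λ eq → trans eq r≡)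
    T-row : ∀ k t → t ≢ s → L U k t ≡ L T k t
    T-row k t t≢s = L-otherRow TU k (t≢s ∘ λ eq → trans eq s≡)

    exchange : ∏ (xᶠ U i r) rows ℚ.* ∏ (yᶠ U j s) rows ≡ ∏ (yᶠ S j s) rows ℚ.* ∏ (xᶠ T i r) rows
    -- `X` of color `i` involves the diagonals `i` and `i + 1`, and `Y` of color `j` involves `j`
    -- and `j - 1`. So the edges interact only for `j = i`, through the denominators, and for
    -- `j = i + 1`, through the numerators.
    exchange with i Finₚ.≟ j
    ... | yes refl = ∏-exchange (xᶠ U i r) (xᶠ T i r) (yᶠ U i s) (yᶠ S i s) s r
        (λ k k≢s → xᶠ-cong {T} {U} i r k (T-row _ r r≢s) (T-row _ k k≢s) (T-row _ k k≢s))
        (λ k k≢r → yᶠ-cong {S} {U} i s k (S-row _ s (r≢s ∘ sym)) (S-row _ k k≢r) (S-row _ k k≢r))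
        at
      where
      r≢s : r ≢ s
      r≢s eq = S≢T (sym (from-unique RT RS eq))
      at : xᶠ U i r s ℚ.* yᶠ U i s r ≡ yᶠ S i s r ℚ.* xᶠ T i r s
      at rewrite dec-false (s Finₚ.≟ r) (r≢s ∘ sym) | dec-false (r Finₚ.≟ s) r≢s
        | sym (T-row (colorℕ i) r r≢s) | sym (S-row (colorℕ i) s (r≢s ∘ sym))
        | L-otherColor TU (suc (colorℕ i)) s ℕₚ.1+n≢n | L-otherColor SU (toℕ i) r (ℕₚ.1+n≢n ∘ sym)
        | Uᵢᵣ | Uⱼₛ = identity (L S (colorℕ i) r) (L T (colorℕ i) s) (L T (suc (colorℕ i)) s) (L S (toℕ i) r)
        where
        identity : ∀ p q a b →
          ((p ℚ.+ 1ℚ ℚ.- a) ℚ.* inv (p ℚ.+ 1ℚ ℚ.- (q ℚ.+ 1ℚ) ℚ.- 1ℚ)) ℚ.* ((q ℚ.+ 1ℚ ℚ.- b ℚ.- 1ℚ) ℚ.* inv (q ℚ.+ 1ℚ ℚ.- (p ℚ.+ 1ℚ))) ≡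
          ((q ℚ.+ 1ℚ ℚ.- b ℚ.- 1ℚ) ℚ.* inv (q ℚ.+ 1ℚ ℚ.- p)) ℚ.* ((p ℚ.+ 1ℚ ℚ.- a) ℚ.* inv (p ℚ.+ 1ℚ ℚ.- q ℚ.- 1ℚ))
        identity p q a b = begin
          (u ℚ.* inv A) ℚ.* (v ℚ.* inv B)    ≡⟨ solveℚ 4 (λ u a v b → (u ⊛ a) ⊛ (v ⊛ b) ⊜ (v ⊛ u) ⊛ (a ⊛ b)) refl u (inv A) v (inv B) ⟩
          (v ℚ.* u) ℚ.* (inv A ℚ.* inv B)    ≡⟨ cong ((v ℚ.* u) ℚ.*_) (trans (sym (inv-* A B)) (trans (cong inv AB) (inv-* C D))) ⟩
          (v ℚ.* u) ℚ.* (inv C ℚ.* inv D)    ≡⟨ solveℚ 4 (λ u a v b → (v ⊛ a) ⊛ (u ⊛ b) ⊜ (v ⊛ u) ⊛ (a ⊛ b)) refl u (inv C) v (inv D) ⟨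
          (v ℚ.* inv C) ℚ.* (u ℚ.* inv D)    ∎
          where
          u = p ℚ.+ 1ℚ ℚ.- a
          v = q ℚ.+ 1ℚ ℚ.- b ℚ.- 1ℚ
          A = p ℚ.+ 1ℚ ℚ.- (q ℚ.+ 1ℚ) ℚ.- 1ℚ
          B = q ℚ.+ 1ℚ ℚ.- (p ℚ.+ 1ℚ)
          C = q ℚ.+ 1ℚ ℚ.- p
          D = p ℚ.+ 1ℚ ℚ.- q ℚ.- 1ℚ
          -- `A` is `- C` and `B` is `- D`: the factor of `x` on one side is, up to sign, that of
          -- `y` on the other, and the two signs cancel.
          AB : A ℚ.* B ≡ C ℚ.* D
          AB = solveℚ 2 (λ p q → (p ⊕ con 1ℚ ⊖ (q ⊕ con 1ℚ) ⊖ con 1ℚ) ⊛ (q ⊕ con 1ℚ ⊖ (p ⊕ con 1ℚ)) ⊜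
                                 (q ⊕ con 1ℚ ⊖ p) ⊛ (p ⊕ con 1ℚ ⊖ q ⊖ con 1ℚ)) refl p q
    ... | no i≢j with suc (colorℕ i) ℕ.≟ colorℕ j
    ... | yes i+1≡j = ∏-exchange (xᶠ U i r) (xᶠ T i r) (yᶠ U j s) (yᶠ S j s) s r
        (λ k k≢s → xᶠ-cong {T} {U} i r k (same-T r) (T-row _ k k≢s) (same-T k))
        (λ k k≢r → yᶠ-cong {S} {U} j s k (same-S s) (S-row _ k k≢r) (same-S k))
        at
      where
      same-T : ∀ t → L U (colorℕ i) t ≡ L T (colorℕ i) t
      same-T t = L-otherColor TU (colorℕ i) t (i≢j ∘ Finₚ.toℕ-injective ∘ ℕₚ.suc-injective)
      same-S : ∀ t → L U (colorℕ j) t ≡ L S (colorℕ j) t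
      same-S t = L-otherColor SU (colorℕ j) t (i≢j ∘ sym ∘ Finₚ.toℕ-injective ∘ ℕₚ.suc-injective)
      at : xᶠ U i r s ℚ.* yᶠ U j s r ≡ yᶠ S j s r ℚ.* xᶠ T i r s
      -- With `p` and `q` the two entries before the move, the numerators are `(p - q)(q - p - 1)`
      -- on the left and `(q - p)(p - q + 1)` on the right.
      at rewrite ℕₚ.suc-injective (sym i+1≡j) | i+1≡j | sym (same-S s) | sym (same-S r) | sym (same-T r) | sym (same-T s) | Uᵢᵣ | Uⱼₛ =
        solveℚ 4 (λ p q c d → ((p ⊕ con 1ℚ ⊖ (q ⊕ con 1ℚ)) ⊛ c) ⊛ ((q ⊕ con 1ℚ ⊖ (p ⊕ con 1ℚ) ⊖ con 1ℚ) ⊛ d) ⊜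
                              ((q ⊕ con 1ℚ ⊖ p ⊖ con 1ℚ) ⊛ d) ⊛ ((p ⊕ con 1ℚ ⊖ q) ⊛ c)) refl
          (L S (colorℕ i) r) (L T (colorℕ j) s) _ _
    ... | no i+1≢j = trans (ℚₚ.*-comm (∏ (xᶠ U i r) rows) _) (cong₂ ℚ._*_
        (∏ℚ-Operator.big-cong rows λ k → yᶠ-cong {S} {U} j s k (same-S s) (L-otherColor SU (toℕ j) k (i+1≢j ∘ cong suc ∘ sym)) (same-S k))
        (∏ℚ-Operator.big-cong rows λ k → xᶠ-cong {T} {U} i r k (same-T r) (L-otherColor TU (suc (colorℕ i)) k i+1≢j) (same-T k)))
      where
      same-T : ∀ t → L U (colorℕ i) t ≡ L T (colorℕ i) t
      same-T t = L-otherColor TU (colorℕ i) t (i≢j ∘ Finₚ.toℕ-injective ∘ ℕₚ.suc-injective)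
      same-S : ∀ t → L U (colorℕ j) t ≡ L S (colorℕ j) t
      same-S t = L-otherColor SU (colorℕ j) t (i≢j ∘ sym ∘ Finₚ.toℕ-injective ∘ ℕₚ.suc-injective)

  diamondRelations : DiamondRelations
  diamondRelations S≢T RS RT SU TU = diamond S≢T RS RT SU TU , diamond (S≢T ∘ sym) RT RS TU SU

  g-weakly-decreasing : ∀ T k {r s} → s Fin.≤ r → g T k r ℕ.≤ g T k s
  g-weakly-decreasing T k {r} {s} s≤r with s Finₚ.≟ r
  ... | yes refl = ℕₚ.≤-refl
  ... | no  s≢r  = g-decreasing T k (Finₚ.≤∧≢⇒< s≤r s≢r)

  -- For rows `s ≤ r` interlacing in `T` separates the two numbers. For `r < s` it would still allow
  -- equality in the adjacent row; there interlacing is used in `S`, whose entry in the row `r` is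
  -- smaller by one.
  ℓ-≢ : ∀ {i S T} (e : Edge i S T) s → ℓ T (colorℕ i) (edgeRow e) ≢ ℓ T (suc (colorℕ i)) s
  ℓ-≢ {i} {S} {T} e s eq with ℕₚ.<-≤-connex (toℕ (edgeRow e)) (toℕ s)
  ... | inj₂ s≤r = ℤₚ.<-irrefl eq (ℓ-< {T} {k} {r} {T} {suc k} {s}
    (ℕₚ.+-mono-<-≤ (ℕₚ.+-mono-≤-< (ℕₚ.≤-trans (g-weakly-decreasing T k s≤r) (interlacing-row T k s)) (ℕₚ.n<1+n k)) s≤r))
    where
    k = colorℕ i
    r = edgeRow e
  ... | inj₁ r<s = ℤₚ.<-irrefl (sym eq) (ℓ-< {T} {suc k} {s} {T} {k} {r} (begin-strict
      g T (suc k) s ℕ.+ suc k ℕ.+ toℕ r        ≡⟨ shift (g T (suc k) s) k (toℕ r) ⟩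
      g T (suc k) s ℕ.+ k ℕ.+ suc (toℕ r)      ≡⟨ cong (λ g → g ℕ.+ k ℕ.+ suc (toℕ r)) (edge-g-otherColor e (suc k) s ℕₚ.1+n≢n) ⟩
      g S (suc k) s ℕ.+ k ℕ.+ suc (toℕ r)      ≤⟨ ℕₚ.+-mono-≤ (ℕₚ.+-monoˡ-≤ k (interlacing-column S k r<s)) r<s ⟩
      g S k r ℕ.+ k ℕ.+ toℕ s                  <⟨ ℕₚ.+-monoˡ-< (toℕ s) (ℕₚ.+-monoˡ-< k (g-edge e)) ⟩
      g T k r ℕ.+ k ℕ.+ toℕ s                  ∎))
    where
    open ℕₚ.≤-Reasoning
    k = colorℕ i
    r = edgeRow e
    shift : ∀ g k r → g ℕ.+ suc k ℕ.+ r ≡ g ℕ.+ k ℕ.+ suc r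
    shift g k r = trans (cong (ℕ._+ r) (ℕₚ.+-suc g k)) (sym (ℕₚ.+-suc (g ℕ.+ k) r))

  X-numerator≢0 : ∀ {i S T} (e : Edge i S T) → X-numerator i (edgeRow e) T ≢ 0ℤ
  X-numerator≢0 {i} {S} {T} e = ∏≢0 {B = λ _ → ⊤} _ rows (All.tabulate _) λ s _ gap≡0 →
    ℓ-≢ e s (ℤₚ.i-j≡0⇒i≡j (ℓ T (colorℕ i) (edgeRow e)) _ (trans (sym (gap-ℓ T (colorℕ i) (edgeRow e) (suc (colorℕ i)) s)) gap≡0))

  -- This makes each edge visible in the action of the `x`, as the supporting graph requires.
  X≢0 : ∀ {i S T} (e : Edge i S T) → X e ≢ 0ℚ
  X≢0 {i} {S} {T} e X≡0 = X-numerator≢0 e (fromℤ-injective (begin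
    x                           ≡⟨ ℚₚ.*-identityʳ x ⟨
    x ℚ.* 1ℚ                    ≡⟨ cong (x ℚ.*_) (trans (ℚₚ.*-comm (inv d) d) (inv-inverse d≢0)) ⟨
    x ℚ.* (inv d ℚ.* d)         ≡⟨ ℚₚ.*-assoc x (inv d) d ⟨
    x ℚ.* inv d ℚ.* d           ≡⟨ cong (ℚ._* d) (÷-inv x d {{X-denominator-nonZero e}}) ⟨
    ℚ._÷_ x d {{X-denominator-nonZero e}} ℚ.* d  ≡⟨ cong (ℚ._* d) quotient≡0 ⟩
    0ℚ ℚ.* d                    ≡⟨ ℚₚ.*-zeroˡ d ⟩
    0ℚ                          ∎))
    where
    open ≡-Reasoning
    x = fromℤ (X-numerator i (edgeRow e) T)
    d = fromℤ (X-denominator i (edgeRow e) T)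
    quotient≡0 : ℚ._÷_ x d {{X-denominator-nonZero e}} ≡ 0ℚ
    quotient≡0 = trans (solveℚ 1 (λ q → q ⊜ ⊝ (⊝ q)) refl (ℚ._÷_ x d {{X-denominator-nonZero e}})) (cong ℚ.-_ X≡0)
    d≢0 : d ≢ 0ℚ
    d≢0 d≡0 = ℕ.≢-nonZero⁻¹ _ {{X-denominator-nonZero e}} (cong ℤ.∣_∣ (fromℤ-injective d≡0))
-- Partial fractions and the crossing relations

∏-zero : ∀ {A : Set} (f : A → ℚ) {xs x} → x ∈ xs → f x ≡ 0ℚ → ∏ f xs ≡ 0ℚ
∏-zero f {x ∷ xs} (here refl) eq = trans (cong (ℚ._* ∏ f xs) eq) (ℚₚ.*-zeroˡ (∏ f xs))
∏-zero f {x ∷ xs} (there x∈)  eq = trans (cong (f x ℚ.*_) (∏-zero f x∈ eq)) (ℚₚ.*-zeroʳ (f x))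

∑-*ˡ : ∀ {A : Set} k (f : A → ℚ) xs → k ℚ.* ∑ f xs ≡ ∑ (λ x → k ℚ.* f x) xs
∑-*ˡ k f = ∑ℚ-Operator.big-homo (k ℚ.*_) (ℚₚ.*-zeroʳ k) (ℚₚ.*-distribˡ-+ k)

p-q≢0 : ∀ {p q} → p ≢ q → p ℚ.- q ≢ 0ℚ
p-q≢0 {p} {q} p≢q eq = p≢q (trans (solveℚ 2 (λ p q → p ⊜ (p ⊖ q) ⊕ q) refl p q)
  (trans (cong (ℚ._+ q) eq) (ℚₚ.+-identityˡ q)))

inv-flip : ∀ p q → inv (p ℚ.- q) ≡ ℚ.- inv (q ℚ.- p)
inv-flip p q = trans (cong inv (solveℚ 2 (λ p q → p ⊖ q ⊜ con (ℚ.- 1ℚ) ⊛ (q ⊖ p)) refl p q))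
  (trans (inv-* (ℚ.- 1ℚ) (q ℚ.- p)) (solveℚ 1 (λ a → con (ℚ.- 1ℚ) ⊛ a ⊜ ⊝ a) refl (inv (q ℚ.- p))))

-- The sum of the residues of the rational function ∏ (z - c) / (z - p) is the
-- coefficient Σ (p - c) of 1/z at infinity.  The factors with p = c count as 1;
-- only the remaining poles have to be distinct.
module PartialFractions {J : Set} (_≟_ : DecidableEquality J) (p c : J → ℚ) where

  φ : J → ℚ → ℚ
  φ k z = if does (p k ℚₚ.≟ c k) then 1ℚ else (z ℚ.- c k) ℚ.* inv (z ℚ.- p k)

  -- The factors of the residue at `p j`: in the factor of `j` itself the denominator `z - p j` is
  -- dropped, and the others are evaluated at `p j`.
  ψ : J → J → ℚ
  ψ j k = if does (k ≟ j) then p j ℚ.- c j else φ k (p j)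

  residue : List J → J → ℚ
  residue ks j = ∏ (ψ j) ks

  φ-ratio : ∀ k z → z ≢ p k → φ k z ≡ (z ℚ.- c k) ℚ.* inv (z ℚ.- p k)
  φ-ratio k z z≢p with p k ℚₚ.≟ c k
  ... | no  _   = refl
  ... | yes p≡c = sym (trans (cong (λ q → (z ℚ.- q) ℚ.* inv (z ℚ.- p k)) (sym p≡c)) (inv-inverse (p-q≢0 z≢p)))

  φ-trivial : ∀ k z → p k ≡ c k → φ k z ≡ 1ℚ
  φ-trivial k z p≡c = cong (if_then 1ℚ else (z ℚ.- c k) ℚ.* inv (z ℚ.- p k)) (dec-true (p k ℚₚ.≟ c k) p≡c)

  φ-zero : ∀ k z → p k ≢ c k → z ≡ c k → φ k z ≡ 0ℚ
  φ-zero k z p≢c z≡c = trans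
    (cong (if_then 1ℚ else (z ℚ.- c k) ℚ.* inv (z ℚ.- p k)) (dec-false (p k ℚₚ.≟ c k) p≢c))
    (trans (cong (ℚ._* inv (z ℚ.- p k)) (trans (cong (ℚ._- c k) z≡c) (ℚₚ.+-inverseʳ (c k)))) (ℚₚ.*-zeroˡ (inv (z ℚ.- p k))))

  ψ-self : ∀ j → ψ j j ≡ p j ℚ.- c j
  ψ-self j = cong (if_then p j ℚ.- c j else φ j (p j)) (dec-true (j ≟ j) refl)

  ψ-other : ∀ {j k} → k ≢ j → ψ j k ≡ φ k (p j)
  ψ-other {j} {k} k≢j = cong (if_then p j ℚ.- c j else φ k (p j)) (dec-false (k ≟ j) k≢j)

  residue-trivial : ∀ {ks j} → j ∈ ks → p j ≡ c j → residue ks j ≡ 0ℚ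
  residue-trivial {j = j} j∈ p≡c = ∏-zero (ψ j) j∈
    (trans (ψ-self j) (trans (cong (ℚ._- c j) p≡c) (ℚₚ.+-inverseʳ (c j))))

  PolesDistinct : List J → Set
  PolesDistinct ks = ∀ {j k} → j ∈ ks → k ∈ ks → j ≢ k → p j ≢ c j → p k ≢ c k → p j ≢ p k

  private
    module Step {x : J} {ks : List J} (x∉ : All (x ≢_) ks) where

      residue-head : residue (x ∷ ks) x ≡ (p x ℚ.- c x) ℚ.* ∏ (λ k → φ k (p x)) ks
      residue-head = cong₂ ℚ._*_ (ψ-self x)
        (∏ℚ-Operator.big-cong-∈ ks λ k∈ → ψ-other (All.lookup x∉ k∈ ∘ sym))

      residue-tail : ∀ {j} → j ∈ ks → residue (x ∷ ks) j ≡ φ x (p j) ℚ.* residue ks j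
      residue-tail {j} j∈ = cong (ℚ._* residue ks j) (ψ-other (All.lookup x∉ j∈))

      module Trivial (p≡c : p x ≡ c x) where

        head≡0 : residue (x ∷ ks) x ≡ 0ℚ
        head≡0 = residue-trivial {x ∷ ks} (here refl) p≡c

        tail≡ : ∀ {j} → j ∈ ks → residue (x ∷ ks) j ≡ residue ks j
        tail≡ {j} j∈ = trans (residue-tail j∈) (trans (cong (ℚ._* residue ks j) (φ-trivial x (p j) p≡c)) (ℚₚ.*-identityˡ (residue ks j)))

  -- Induction on the factors. The residue at the new pole `p x` contains the remaining product at
  -- `p x`, which the induction hypothesis expands; therefore `z` has to stay arbitrary.
  expansion : ∀ {ks} → Unique ks → PolesDistinct ks → ∀ z → (∀ {k} → k ∈ ks → p k ≢ c k → z ≢ p k) →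
              1ℚ ℚ.+ ∑ (λ j → residue ks j ℚ.* inv (z ℚ.- p j)) ks ≡ ∏ (λ k → φ k z) ks
  expansion {[]} _ _ _ _ = refl
  expansion {x ∷ ks} (x∉ ∷ u) distinct z z≢ = cases (p x ℚₚ.≟ c x)
   where
   cases : Dec (p x ≡ c x) →
           1ℚ ℚ.+ ∑ (λ j → residue (x ∷ ks) j ℚ.* inv (z ℚ.- p j)) (x ∷ ks) ≡ ∏ (λ k → φ k z) (x ∷ ks)
   cases (yes p≡c) = trans (cong (1ℚ ℚ.+_) (trans (cong₂ ℚ._+_
      (trans (cong (ℚ._* inv (z ℚ.- p x)) head≡0) (ℚₚ.*-zeroˡ (inv (z ℚ.- p x))))
      (∑ℚ-Operator.big-cong-∈ ks λ {j} j∈ → cong (ℚ._* inv (z ℚ.- p j)) (tail≡ j∈)))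
      (ℚₚ.+-identityˡ (∑ (λ j → residue ks j ℚ.* inv (z ℚ.- p j)) ks))))
    (trans (expansion u (λ j∈ k∈ → distinct (there j∈) (there k∈)) z (z≢ ∘ there))
      (sym (trans (cong (ℚ._* ∏ (λ k → φ k z) ks) (φ-trivial x z p≡c)) (ℚₚ.*-identityˡ (∏ (λ k → φ k z) ks)))))
    where open Step x∉
          open Trivial p≡c
   cases (no p≢c) = begin
      1ℚ ℚ.+ (residue (x ∷ ks) x ℚ.* A ℚ.+ ∑ (λ j → residue (x ∷ ks) j ℚ.* inv (z ℚ.- p j)) ks)
        ≡⟨ cong (λ q → 1ℚ ℚ.+ (q ℚ.* A ℚ.+ ∑ (λ j → residue (x ∷ ks) j ℚ.* inv (z ℚ.- p j)) ks))
             (trans residue-head (cong (K ℚ.*_) (sym (expansion u distinct′ (p x) px≢)))) ⟩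
      1ℚ ℚ.+ (K ℚ.* (1ℚ ℚ.+ ∑ s ks) ℚ.* A ℚ.+ ∑ (λ j → residue (x ∷ ks) j ℚ.* inv (z ℚ.- p j)) ks)
        ≡⟨ cong (λ q → 1ℚ ℚ.+ (K ℚ.* (1ℚ ℚ.+ ∑ s ks) ℚ.* A ℚ.+ q)) (∑ℚ-Operator.big-cong-∈ ks λ {j} j∈ →
             cong (ℚ._* inv (z ℚ.- p j)) (residue-tail j∈)) ⟩
      1ℚ ℚ.+ (K ℚ.* (1ℚ ℚ.+ ∑ s ks) ℚ.* A ℚ.+ ∑ t ks)
        ≡⟨ solveℚ 4 (λ k s a t → con 1ℚ ⊕ (k ⊛ (con 1ℚ ⊕ s) ⊛ a ⊕ t) ⊜ con 1ℚ ⊕ k ⊛ a ⊕ (k ⊛ a ⊛ s ⊕ t)) refl K (∑ s ks) A (∑ t ks) ⟩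
      1ℚ ℚ.+ K ℚ.* A ℚ.+ (K ℚ.* A ℚ.* ∑ s ks ℚ.+ ∑ t ks)
        ≡⟨ cong (1ℚ ℚ.+ K ℚ.* A ℚ.+_) (trans (cong (ℚ._+ ∑ t ks) (∑-*ˡ (K ℚ.* A) s ks)) (sym (∑ℚ-Operator.big-∙ (λ j → K ℚ.* A ℚ.* s j) t ks))) ⟩
      1ℚ ℚ.+ K ℚ.* A ℚ.+ ∑ (λ j → K ℚ.* A ℚ.* s j ℚ.+ t j) ks
        ≡⟨ cong (1ℚ ℚ.+ K ℚ.* A ℚ.+_) (∑ℚ-Operator.big-cong-∈ ks term) ⟩
      1ℚ ℚ.+ K ℚ.* A ℚ.+ ∑ (λ j → (1ℚ ℚ.+ K ℚ.* A) ℚ.* r j) ks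
        ≡⟨ cong (1ℚ ℚ.+ K ℚ.* A ℚ.+_) (sym (∑-*ˡ (1ℚ ℚ.+ K ℚ.* A) r ks)) ⟩
      1ℚ ℚ.+ K ℚ.* A ℚ.+ (1ℚ ℚ.+ K ℚ.* A) ℚ.* ∑ r ks
        ≡⟨ solveℚ 2 (λ k s → k ⊕ k ⊛ s ⊜ k ⊛ (con 1ℚ ⊕ s)) refl (1ℚ ℚ.+ K ℚ.* A) (∑ r ks) ⟩
      (1ℚ ℚ.+ K ℚ.* A) ℚ.* (1ℚ ℚ.+ ∑ r ks)
        ≡⟨ cong₂ ℚ._*_ ratio (expansion u distinct′ z (z≢ ∘ there)) ⟩
      φ x z ℚ.* ∏ (λ k → φ k z) ks ∎
    where
    open ≡-Reasoning
    open Step x∉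
    K = p x ℚ.- c x
    A = inv (z ℚ.- p x)
    s t r : J → ℚ
    s j = residue ks j ℚ.* inv (p x ℚ.- p j)
    t j = φ x (p j) ℚ.* residue ks j ℚ.* inv (z ℚ.- p j)
    r j = residue ks j ℚ.* inv (z ℚ.- p j)
    distinct′ : PolesDistinct ks
    distinct′ j∈ k∈ = distinct (there j∈) (there k∈)
    px≢ : ∀ {k} → k ∈ ks → p k ≢ c k → p x ≢ p k
    px≢ k∈ pk≢ = distinct (here refl) (there k∈) (All.lookup x∉ k∈) p≢c pk≢
    zA : (z ℚ.- p x) ℚ.* A ≡ 1ℚ
    zA = inv-inverse (p-q≢0 (z≢ (here refl) p≢c))
    ratio : 1ℚ ℚ.+ K ℚ.* A ≡ φ x z
    ratio = trans (cong (ℚ._+ K ℚ.* A) (sym zA)) (trans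
      (solveℚ 4 (λ z p c a → (z ⊖ p) ⊛ a ⊕ (p ⊖ c) ⊛ a ⊜ (z ⊖ c) ⊛ a) refl z (p x) (c x) A)
      (sym (φ-ratio x z (z≢ (here refl) p≢c))))
    -- Since `φ x (p j) = 1 - K / (p x - p j)`, this comes down to `1/(z - p x) - 1/(z - p j) = (p x
    -- - p j) / ((z - p x)(z - p j))`. A cancelled pair has residue zero and needs no such division.
    term : ∀ {j} → j ∈ ks → K ℚ.* A ℚ.* s j ℚ.+ t j ≡ (1ℚ ℚ.+ K ℚ.* A) ℚ.* r j
    term {j} j∈ = by-cases (p j ℚₚ.≟ c j)
     where
     by-cases : Dec (p j ≡ c j) → K ℚ.* A ℚ.* s j ℚ.+ t j ≡ (1ℚ ℚ.+ K ℚ.* A) ℚ.* r j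
     by-cases (yes pj≡) = trans (cong (λ w → K ℚ.* A ℚ.* (w ℚ.* E) ℚ.+ φ x (p j) ℚ.* w ℚ.* B) w≡0)
        (trans (solveℚ 4 (λ k f e b → k ⊛ (con 0ℚ ⊛ e) ⊕ f ⊛ con 0ℚ ⊛ b ⊜ (con 1ℚ ⊕ k) ⊛ (con 0ℚ ⊛ b)) refl (K ℚ.* A) (φ x (p j)) E B)
          (cong (λ w → (1ℚ ℚ.+ K ℚ.* A) ℚ.* (w ℚ.* B)) (sym w≡0)))
      where
      E = inv (p x ℚ.- p j)
      B = inv (z ℚ.- p j)
      w≡0 = residue-trivial j∈ pj≡
     by-cases (no pj≢) = begin
        K ℚ.* A ℚ.* (w ℚ.* E) ℚ.+ φ x (p j) ℚ.* w ℚ.* B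
          ≡⟨ cong (λ f → K ℚ.* A ℚ.* (w ℚ.* E) ℚ.+ f ℚ.* w ℚ.* B)
               (trans (φ-ratio x (p j) (px≢ j∈ pj≢ ∘ sym)) (cong ((p j ℚ.- c x) ℚ.*_) (inv-flip (p j) (p x)))) ⟩
        K ℚ.* A ℚ.* (w ℚ.* E) ℚ.+ (p j ℚ.- c x) ℚ.* (ℚ.- E) ℚ.* w ℚ.* B
          ≡⟨ solveℚ 8 (λ px pj c z a b e w → (px ⊖ c) ⊛ a ⊛ (w ⊛ e) ⊕ (pj ⊖ c) ⊛ (⊝ e) ⊛ w ⊛ b ⊜
                w ⊛ ((px ⊖ c) ⊛ e ⊛ (a ⊖ b) ⊕ (px ⊖ pj) ⊛ e ⊛ b)) refl (p x) (p j) (c x) z A B E w ⟩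
        w ℚ.* (K ℚ.* E ℚ.* (A ℚ.- B) ℚ.+ (p x ℚ.- p j) ℚ.* E ℚ.* B)
          ≡⟨ cong₂ (λ u v → w ℚ.* (K ℚ.* E ℚ.* u ℚ.+ v ℚ.* B)) A-B eE ⟩
        w ℚ.* (K ℚ.* E ℚ.* (A ℚ.* B ℚ.* (p x ℚ.- p j)) ℚ.+ 1ℚ ℚ.* B)
          ≡⟨ solveℚ 6 (λ k e a b d w → w ⊛ (k ⊛ e ⊛ (a ⊛ b ⊛ d) ⊕ con 1ℚ ⊛ b) ⊜ w ⊛ (k ⊛ a ⊛ b ⊛ (d ⊛ e) ⊕ b)) refl K E A B (p x ℚ.- p j) w ⟩
        w ℚ.* (K ℚ.* A ℚ.* B ℚ.* ((p x ℚ.- p j) ℚ.* E) ℚ.+ B)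
          ≡⟨ cong (λ v → w ℚ.* (K ℚ.* A ℚ.* B ℚ.* v ℚ.+ B)) eE ⟩
        w ℚ.* (K ℚ.* A ℚ.* B ℚ.* 1ℚ ℚ.+ B)
          ≡⟨ solveℚ 4 (λ k a b w → w ⊛ (k ⊛ a ⊛ b ⊛ con 1ℚ ⊕ b) ⊜ (con 1ℚ ⊕ k ⊛ a) ⊛ (w ⊛ b)) refl K A B w ⟩
        (1ℚ ℚ.+ K ℚ.* A) ℚ.* (w ℚ.* B) ∎
      where
      w = residue ks j
      E = inv (p x ℚ.- p j)
      B = inv (z ℚ.- p j)
      eE : (p x ℚ.- p j) ℚ.* E ≡ 1ℚ
      eE = inv-inverse (p-q≢0 (px≢ j∈ pj≢))
      bB : (z ℚ.- p j) ℚ.* B ≡ 1ℚ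
      bB = inv-inverse (p-q≢0 (z≢ (there j∈) pj≢))
      A-B : A ℚ.- B ≡ A ℚ.* B ℚ.* (p x ℚ.- p j)
      A-B = begin
        A ℚ.- B                            ≡⟨ cong₂ ℚ._-_ (ℚₚ.*-identityʳ A) (ℚₚ.*-identityʳ B) ⟨
        A ℚ.* 1ℚ ℚ.- B ℚ.* 1ℚ              ≡⟨ cong₂ (λ u v → A ℚ.* u ℚ.- B ℚ.* v) bB zA ⟨
        A ℚ.* ((z ℚ.- p j) ℚ.* B) ℚ.- B ℚ.* ((z ℚ.- p x) ℚ.* A)
          ≡⟨ solveℚ 5 (λ a b z pj px → a ⊛ ((z ⊖ pj) ⊛ b) ⊖ b ⊛ ((z ⊖ px) ⊛ a) ⊜ a ⊛ b ⊛ (px ⊖ pj)) refl A B z (p j) (p x) ⟩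
        A ℚ.* B ℚ.* (p x ℚ.- p j)          ∎

  -- No limit is taken. Adding the factor of `x` changes the residue at each old pole `p j`; these
  -- changes are cancelled by the residue at `p x`, expanded by `expansion`, up to its leading term
  -- `p x - c x`.
  residue-sum : ∀ {ks} → Unique ks → PolesDistinct ks →
                ∑ (residue ks) ks ≡ ∑ (λ k → p k ℚ.- c k) ks
  residue-sum {[]} _ _ = refl
  residue-sum {x ∷ ks} (x∉ ∷ u) distinct = cases (p x ℚₚ.≟ c x)
   where
   cases : Dec (p x ≡ c x) → ∑ (residue (x ∷ ks)) (x ∷ ks) ≡ ∑ (λ k → p k ℚ.- c k) (x ∷ ks)
   cases (yes p≡c) = cong₂ ℚ._+_
      (trans head≡0 (sym (trans (cong (ℚ._- c x) p≡c) (ℚₚ.+-inverseʳ (c x)))))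
      (trans (∑ℚ-Operator.big-cong-∈ ks tail≡) (residue-sum u λ j∈ k∈ → distinct (there j∈) (there k∈)))
    where open Step x∉
          open Trivial p≡c
   cases (no p≢c) = begin
      residue (x ∷ ks) x ℚ.+ ∑ (residue (x ∷ ks)) ks
        ≡⟨ cong₂ ℚ._+_ (trans residue-head (cong (K ℚ.*_) (sym (expansion u distinct′ (p x) px≢))))
             (∑ℚ-Operator.big-cong-∈ ks residue-tail) ⟩
      K ℚ.* (1ℚ ℚ.+ ∑ s ks) ℚ.+ ∑ t ks
        ≡⟨ solveℚ 3 (λ k s t → k ⊛ (con 1ℚ ⊕ s) ⊕ t ⊜ k ⊕ (k ⊛ s ⊕ t)) refl K (∑ s ks) (∑ t ks) ⟩
      K ℚ.+ (K ℚ.* ∑ s ks ℚ.+ ∑ t ks)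
        ≡⟨ cong (K ℚ.+_) (trans (cong (ℚ._+ ∑ t ks) (∑-*ˡ K s ks)) (sym (∑ℚ-Operator.big-∙ (λ j → K ℚ.* s j) t ks))) ⟩
      K ℚ.+ ∑ (λ j → K ℚ.* s j ℚ.+ t j) ks
        ≡⟨ cong (K ℚ.+_) (trans (∑ℚ-Operator.big-cong-∈ ks term) (residue-sum u distinct′)) ⟩
      K ℚ.+ ∑ (λ k → p k ℚ.- c k) ks ∎
    where
    open ≡-Reasoning
    open Step x∉
    K = p x ℚ.- c x
    s t : J → ℚ
    s j = residue ks j ℚ.* inv (p x ℚ.- p j)
    t j = φ x (p j) ℚ.* residue ks j
    distinct′ : PolesDistinct ks
    distinct′ j∈ k∈ = distinct (there j∈) (there k∈)
    px≢ : ∀ {k} → k ∈ ks → p k ≢ c k → p x ≢ p k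
    px≢ k∈ pk≢ = distinct (here refl) (there k∈) (All.lookup x∉ k∈) p≢c pk≢
    term : ∀ {j} → j ∈ ks → K ℚ.* s j ℚ.+ t j ≡ residue ks j
    term {j} j∈ = by-cases (p j ℚₚ.≟ c j)
     where
     by-cases : Dec (p j ≡ c j) → K ℚ.* s j ℚ.+ t j ≡ residue ks j
     by-cases (yes pj≡) = trans (cong (λ w → K ℚ.* (w ℚ.* E) ℚ.+ φ x (p j) ℚ.* w) w≡0)
        (trans (solveℚ 3 (λ k e f → k ⊛ (con 0ℚ ⊛ e) ⊕ f ⊛ con 0ℚ ⊜ con 0ℚ) refl K E (φ x (p j))) (sym w≡0))
      where
      E = inv (p x ℚ.- p j)
      w≡0 = residue-trivial j∈ pj≡
     by-cases (no pj≢) = begin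
        K ℚ.* (w ℚ.* E) ℚ.+ φ x (p j) ℚ.* w
          ≡⟨ cong (λ f → K ℚ.* (w ℚ.* E) ℚ.+ f ℚ.* w)
               (trans (φ-ratio x (p j) (px≢ j∈ pj≢ ∘ sym)) (cong ((p j ℚ.- c x) ℚ.*_) (inv-flip (p j) (p x)))) ⟩
        K ℚ.* (w ℚ.* E) ℚ.+ (p j ℚ.- c x) ℚ.* (ℚ.- E) ℚ.* w
          ≡⟨ solveℚ 5 (λ px pj c e w → (px ⊖ c) ⊛ (w ⊛ e) ⊕ (pj ⊖ c) ⊛ (⊝ e) ⊛ w ⊜ w ⊛ ((px ⊖ pj) ⊛ e)) refl (p x) (p j) (c x) E w ⟩
        w ℚ.* ((p x ℚ.- p j) ℚ.* E)    ≡⟨ cong (w ℚ.*_) (inv-inverse (p-q≢0 (px≢ j∈ pj≢))) ⟩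
        w ℚ.* 1ℚ                       ≡⟨ ℚₚ.*-identityʳ w ⟩
        w                              ∎
      where
      w = residue ks j
      E = inv (p x ℚ.- p j)

-- The residues at the poles of a tableau and its edges

next : ∀ {m} {r s : Fin m} → r Fin.< s → Σ[ t ∈ Fin m ] (toℕ t ≡ suc (toℕ r) × r Fin.< t × t Fin.≤ s)
next {r = r} {s} r<s = t , t≡ , ℕₚ.≤-reflexive (sym t≡) , ℕₚ.≤-trans (ℕₚ.≤-reflexive t≡) r<s
  where
  t = Fin.fromℕ< (ℕₚ.≤-<-trans r<s (Finₚ.toℕ<n s))
  t≡ = Finₚ.toℕ-fromℕ< (ℕₚ.≤-<-trans r<s (Finₚ.toℕ<n s))

previous : ∀ {m} {r s : Fin m} → s Fin.< r → Σ[ t ∈ Fin m ] (toℕ r ≡ suc (toℕ t) × t Fin.< r × s Fin.≤ t)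
previous {r = suc r} {s} s<r = Fin.inject₁ r , cong ℕ.suc (sym (Finₚ.toℕ-inject₁ r)) ,
  ℕₚ.≤-reflexive (cong ℕ.suc (Finₚ.toℕ-inject₁ r)) ,
  ℕₚ.≤-trans (ℕ.s≤s⁻¹ s<r) (ℕₚ.≤-reflexive (sym (Finₚ.toℕ-inject₁ r)))

module Crossing {m n : ℕ} (shape : SkewShape m n) where

  open SkewTableaux shape
  open Combinatorics shape
  open Lattice shape
  open Coefficients shape
  open Diamond shape

  +1-cancel : ∀ {p q} → p ℚ.+ 1ℚ ≡ q ℚ.+ 1ℚ → p ≡ q
  +1-cancel {p} {q} eq = trans (identity p) (trans (cong (ℚ._- 1ℚ) eq) (sym (identity q)))
    where
    identity : ∀ p → p ≡ p ℚ.+ 1ℚ ℚ.- 1ℚ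
    identity = solveℚ 1 (λ p → p ⊜ p ⊕ con 1ℚ ⊖ con 1ℚ) refl

  L-distinct : ∀ T k {r s} → r ≢ s → L T k r ≢ L T k s
  L-distinct T k {r} {s} r≢s eq = gap≢0 T k r s (r≢s ∘ sym) (trans (gap-ℓ T k r k s)
    (ℤₚ.i≡j⇒i-j≡0 (fromℤ-injective (trans (sym (L-ℓ T k r)) (trans eq (L-ℓ T k s))))))

  ℓ-suc⁻ : ∀ T k {r s} → ℓ T k r ≡ ℓ T k s ℤ.+ 1ℤ → g T k r ℕ.+ toℕ s ≡ g T k s ℕ.+ suc (toℕ r)
  ℓ-suc⁻ T k {r} {s} eq = ℤₚ.+-injective (trans (identity (+ g T k r) (+ k) (+ toℕ r) (+ toℕ s))
    (trans (cong (λ a → a ℤ.+ (+ toℕ r ℤ.+ + toℕ s ℤ.- + k)) eq) (identity′ (+ g T k s) (+ k) (+ toℕ r) (+ toℕ s))))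
    where
    identity : ∀ g k r s → g ℤ.+ s ≡ (g ℤ.+ (k ℤ.- r)) ℤ.+ (r ℤ.+ s ℤ.- k)
    identity = solve-∀
    identity′ : ∀ g k r s → (g ℤ.+ (k ℤ.- s)) ℤ.+ 1ℤ ℤ.+ (r ℤ.+ s ℤ.- k) ≡ g ℤ.+ (1ℤ ℤ.+ r)
    identity′ = solve-∀

  -- The shift makes consecutive entries of a diagonal drop by at least one, and by exactly one only
  -- where the unshifted entries agree.
  L-suc⁻ : ∀ T k {r s} → L T k r ≡ L T k s ℚ.+ 1ℚ → r Fin.< s × g T k r ≡ g T k s
  L-suc⁻ T k {r} {s} eq with ℓ-suc⁻ T k (fromℤ-injective (trans (sym (L-ℓ T k r)) (trans eq
    (trans (cong (ℚ._+ 1ℚ) (L-ℓ T k s)) (sym (fromℤ-+ (ℓ T k s) 1ℤ))))))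
  ... | g≡ with ℕₚ.<-≤-connex (toℕ r) (toℕ s)
  ... | inj₁ r<s = r<s , ℕₚ.≤-antisym
    (ℕₚ.+-cancelʳ-≤ (suc (toℕ r)) _ _ (ℕₚ.≤-trans (ℕₚ.+-monoʳ-≤ (g T k r) r<s) (ℕₚ.≤-reflexive g≡)))
    (g-weakly-decreasing T k (ℕₚ.<⇒≤ r<s))
  ... | inj₂ s≤r = contradiction g≡ (ℕₚ.<⇒≢ (ℕₚ.+-mono-≤-< (g-weakly-decreasing T k s≤r) (s≤s s≤r)))

  pos-suc : ∀ k {r s : Fin m} → toℕ s ≡ suc (toℕ r) → pos (suc k) s ≡ pos k r
  pos-suc k {r} eq = trans (cong (λ s → + suc k ℤ.- + s) eq) (identity (+ k) (+ toℕ r))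
    where
    identity : ∀ k r → 1ℤ ℤ.+ k ℤ.- (1ℤ ℤ.+ r) ≡ k ℤ.- r
    identity = solve-∀

  module _ (i : Color n) (T : Tableau) where

    private
      k = toℕ i
      ci = colorℕ i
      J = Fin m ⊎ Fin m

    -- inj₁ r is the pole which contributes the edge into T in the row r, and
    -- inj₂ r the one which contributes the edge from T in the row r.
    pole zero′ : J → ℚ
    pole  (inj₁ r) = L T ci r
    pole  (inj₂ r) = L T ci r ℚ.+ 1ℚ
    zero′ (inj₁ r) = L T k r ℚ.+ 1ℚ
    zero′ (inj₂ r) = L T (suc ci) r

    open PartialFractions (Sumₚ.≡-dec Finₚ._≟_ Finₚ._≟_) pole zero′

    poles : List J
    poles = List.map inj₁ rows List.++ List.map inj₂ rows

    poles-unique : Unique poles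
    poles-unique = Uniqueₚ.++⁺ (Uniqueₚ.map⁺ Sumₚ.inj₁-injective rows-unique)
      (Uniqueₚ.map⁺ Sumₚ.inj₂-injective rows-unique) disjoint
      where
      disjoint : ∀ {j} → ¬ (j ∈ List.map inj₁ rows × j ∈ List.map inj₂ rows)
      disjoint (j∈₁ , j∈₂) with ∈ₚ.∈-map⁻ inj₁ j∈₁ | ∈ₚ.∈-map⁻ inj₂ j∈₂
      ... | _ , _ , refl | _ , _ , ()

    -- Poles and zeros are paired within a row, so that the difference of a pair is, up to sign, the
    -- number of entries `suc l` in this row. A cancelled pair is a row without such entries.
    F-difference : ∀ l r → fromℤ (+ g T (suc l) r ℤ.- + g T l r) ≡ L T (suc l) r ℚ.- (L T l r ℚ.+ 1ℚ)
    F-difference l r = trans (cong fromℤ (identity (+ g T (suc l) r) (+ g T l r) (+ l) (+ toℕ r)))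
      (trans (fromℤ-∸ (ℓ T (suc l) r) (ℓ T l r ℤ.+ 1ℤ)) (cong₂ ℚ._-_ (sym (L-ℓ T (suc l) r))
        (trans (fromℤ-+ (ℓ T l r) 1ℤ) (cong (ℚ._+ 1ℚ) (sym (L-ℓ T l r))))))
      where
      identity : ∀ g g′ l r → g ℤ.- g′ ≡ (g ℤ.+ (1ℤ ℤ.+ l ℤ.- r)) ℤ.- (g′ ℤ.+ (l ℤ.- r) ℤ.+ 1ℤ)
      identity = solve-∀

    g≡⇒L : ∀ l r → g T (suc l) r ≡ g T l r → L T (suc l) r ≡ L T l r ℚ.+ 1ℚ
    g≡⇒L l r eq = trans (solveℚ 2 (λ a b → a ⊜ (a ⊖ b) ⊕ b) refl (L T (suc l) r) (L T l r ℚ.+ 1ℚ))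
      (trans (cong (ℚ._+ (L T l r ℚ.+ 1ℚ)) (trans (sym (F-difference l r))
        (cong fromℤ (ℤₚ.i≡j⇒i-j≡0 (cong +_ eq))))) (ℚₚ.+-identityˡ _))

    L⇒g≡ : ∀ l r → L T (suc l) r ≡ L T l r ℚ.+ 1ℚ → g T (suc l) r ≡ g T l r
    L⇒g≡ l r eq = ℤₚ.+-injective (ℤₚ.i-j≡0⇒i≡j (+ g T (suc l) r) (+ g T l r) (fromℤ-injective (trans (F-difference l r)
      (trans (cong (ℚ._- (L T l r ℚ.+ 1ℚ)) eq) (ℚₚ.+-inverseʳ (L T l r ℚ.+ 1ℚ))))))

    -- A pole in the row r and a pole in the row r + 1 can only coincide where
    -- interlacing forces the zeros to coincide with them.
    mixed-distinct : ∀ {r s} → pole (inj₂ s) ≢ zero′ (inj₂ s) → L T ci r ≢ L T ci s ℚ.+ 1ℚ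
    mixed-distinct {r} {s} nontrivial eq with L-suc⁻ T ci eq
    ... | r<s , g≡ = nontrivial (sym (g≡⇒L ci s (ℕₚ.≤-antisym
      (ℕₚ.≤-trans (interlacing-column T ci r<s) (ℕₚ.≤-reflexive g≡)) (interlacing-row T ci s))))

    distinct : PolesDistinct poles
    distinct {inj₁ r} {inj₁ s} _ _ j≢k _ _ = L-distinct T ci (j≢k ∘ cong inj₁)
    distinct {inj₂ r} {inj₂ s} _ _ j≢k _ _ = L-distinct T ci (j≢k ∘ cong inj₂) ∘ +1-cancel
    distinct {inj₁ r} {inj₂ s} _ _ _ _ nontrivial = mixed-distinct {r} {s} nontrivial
    distinct {inj₂ s} {inj₁ r} _ _ _ nontrivial _ = mixed-distinct {r} {s} nontrivial ∘ sym

    ∏-poles : ∀ f → ∏ f poles ≡ ∏ (f ∘ inj₁) rows ℚ.* ∏ (f ∘ inj₂) rows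
    ∏-poles f = trans (∏ℚ-Operator.big-++ f (List.map inj₁ rows) _)
      (cong₂ ℚ._*_ (∏ℚ-Operator.big-map f inj₁ rows) (∏ℚ-Operator.big-map f inj₂ rows))

    ∑-poles : ∀ f → ∑ f poles ≡ ∑ (f ∘ inj₁) rows ℚ.+ ∑ (f ∘ inj₂) rows
    ∑-poles f = trans (∑ℚ-Operator.big-++ f (List.map inj₁ rows) _)
      (cong₂ ℚ._+_ (∑ℚ-Operator.big-map f inj₁ rows) (∑ℚ-Operator.big-map f inj₂ rows))

    p-q-1 : ∀ p q → p ℚ.- (q ℚ.+ 1ℚ) ≡ p ℚ.- q ℚ.- 1ℚ
    p-q-1 = solveℚ 2 (λ p q → p ⊖ (q ⊕ con 1ℚ) ⊜ p ⊖ q ⊖ con 1ℚ) refl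

    *-neg-1 : ∀ {p q} → p ≡ q → p ℚ.* (ℚ.- 1ℚ) ≡ ℚ.- q
    *-neg-1 {p} refl = trans (sym (ℚₚ.neg-distribʳ-* p 1ℚ)) (cong ℚ.-_ (ℚₚ.*-identityʳ p))

    common-factor : ∀ {a b p q ρ} → a ≡ p ℚ.* ρ → b ≡ q ℚ.* ρ → p ≡ ℚ.- q → a ≡ ℚ.- b
    common-factor {q = q} {ρ} refl refl refl = sym (ℚₚ.neg-distribˡ-* q ρ)

    neg-product : ∀ {x y a b p} → y ≡ a → x ≡ ℚ.- b → p ≡ a ℚ.* b → x ℚ.* y ≡ ℚ.- p
    neg-product {a = a} {b} refl refl refl = trans (ℚₚ.*-comm (ℚ.- b) a) (sym (ℚₚ.neg-distribʳ-* a b))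

    1≢0 : 1ℚ ≢ 0ℚ
    1≢0 ()

    p≢p+1 : ∀ p → p ≢ p ℚ.+ 1ℚ
    p≢p+1 p eq = 1≢0 (trans (solveℚ 1 (λ p → con 1ℚ ⊜ (p ⊕ con 1ℚ) ⊖ p) refl p)
      (trans (cong (ℚ._- p) (sym eq)) (ℚₚ.+-inverseʳ p)))

    -- The pairs `inj₁ s` give the factors of `Y` and the pairs `inj₂ s` those of `X`. The sign of
    -- `X` is the factor of `inj₂ r`, whose pole is `z + 1`.
    residue-into : ∀ r {S} (e : Edge i S T) → edgeRow e ≡ r → X e ℚ.* Y e ≡ residue poles (inj₁ r)
    residue-into r {S} e refl = trans (ℚₚ.*-comm (X e) (Y e)) (trans (cong₂ ℚ._*_
      (trans (Y-∏ e) (∏ℚ-Operator.big-cong rows y≡)) (trans (X-∏ e) (∏ℚ-Operator.big-cong rows x≡)))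
      (sym (∏-poles (ψ (inj₁ r)))))
      where
      z = L T ci r
      y≡ : ∀ s → yᶠ T i r s ≡ ψ (inj₁ r) (inj₁ s)
      y≡ s = by-cases (s Finₚ.≟ r)
        where
        by-cases : Dec (s ≡ r) → yᶠ T i r s ≡ ψ (inj₁ r) (inj₁ s)
        by-cases (yes refl) = trans (cong (λ b → (z ℚ.- L T k r ℚ.- 1ℚ) ℚ.* (if b then 1ℚ else inv (z ℚ.- z))) (dec-true (r Finₚ.≟ r) refl))
          (trans (ℚₚ.*-identityʳ _) (trans (sym (p-q-1 z (L T k r))) (sym (ψ-self (inj₁ r)))))
        by-cases (no s≢r) = trans (cong₂ (λ a b → a ℚ.* (if b then 1ℚ else inv (z ℚ.- L T ci s)))
            (sym (p-q-1 z (L T k s))) (dec-false (s Finₚ.≟ r) s≢r))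
          (sym (trans (ψ-other (s≢r ∘ Sumₚ.inj₁-injective)) (φ-ratio (inj₁ s) z (L-distinct T ci (s≢r ∘ sym)))))
      x≡ : ∀ s → xᶠ T i r s ≡ ψ (inj₁ r) (inj₂ s)
      x≡ s = by-cases (s Finₚ.≟ r)
        where
        by-cases : Dec (s ≡ r) → xᶠ T i r s ≡ ψ (inj₁ r) (inj₂ s)
        by-cases (yes refl) = trans (cong (λ b → (z ℚ.- L T (suc ci) r) ℚ.* (if b then ℚ.- 1ℚ else inv (z ℚ.- z ℚ.- 1ℚ))) (dec-true (r Finₚ.≟ r) refl))
          (sym (trans (ψ-other {inj₁ r} {inj₂ r} λ ()) (trans (φ-ratio (inj₂ r) z (p≢p+1 z))
            (cong (λ q → (z ℚ.- L T (suc ci) r) ℚ.* inv q) (solveℚ 1 (λ z → z ⊖ (z ⊕ con 1ℚ) ⊜ con (ℚ.- 1ℚ)) refl z)))))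
        by-cases (no s≢r) = trans (cong₂ (λ a b → (z ℚ.- L T (suc ci) s) ℚ.* (if b then ℚ.- 1ℚ else inv a))
            (sym (p-q-1 z (L T ci s))) (dec-false (s Finₚ.≟ r) s≢r))
          (sym (trans (ψ-other {inj₁ r} {inj₂ s} λ ()) (φ-ratio (inj₂ s) z z≢)))
          where
          z≢ : z ≢ L T ci s ℚ.+ 1ℚ
          z≢ eq = gap-1≢0 e s s≢r (fromℤ-injective (trans (gap-1-L T ci r ci s)
            (trans (sym (p-q-1 z (L T ci s))) (trans (cong (ℚ._- (L T ci s ℚ.+ 1ℚ)) eq) (ℚₚ.+-inverseʳ (L T ci s ℚ.+ 1ℚ))))))

    -- The coefficients of an edge are evaluated at its target `U`, where the moved entry is
    -- `L T ci r + 1`, the second pole of the row. This time the pole of `inj₁ r` is `z - 1` and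
    -- contributes `1`, so the sign of `X` remains.
    residue-from : ∀ r {U} (e : Edge i T U) → edgeRow e ≡ r → X e ℚ.* Y e ≡ ℚ.- residue poles (inj₂ r)
    residue-from r {U} e refl = neg-product (trans (Y-∏ e) (∏ℚ-Operator.big-cong rows y≡))
      (trans (X-∏ e) negate) (∏-poles (ψ (inj₂ r)))
      where
      z = L T ci r ℚ.+ 1ℚ
      Uᵣ : L U ci r ≡ z
      Uᵣ = L-color e
      Uₖ : ∀ s → L U k s ≡ L T k s
      Uₖ s = L-otherColor e k s (ℕₚ.1+n≢n ∘ sym)
      Uₐ : ∀ s → L U (suc ci) s ≡ L T (suc ci) s
      Uₐ s = L-otherColor e (suc ci) s ℕₚ.1+n≢n
      Uₛ : ∀ {s} → s ≢ r → L U ci s ≡ L T ci s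
      Uₛ = L-otherRow e ci
      z≢ : ∀ {s} → s ≢ r → z ≢ L T ci s
      z≢ s≢r eq = L-distinct U ci (s≢r ∘ sym) (trans Uᵣ (trans eq (sym (Uₛ s≢r))))
      y≡ : ∀ s → yᶠ U i r s ≡ ψ (inj₂ r) (inj₁ s)
      y≡ s = by-cases (s Finₚ.≟ r)
        where
        numerator : L U ci r ℚ.- L U k s ℚ.- 1ℚ ≡ z ℚ.- (L T k s ℚ.+ 1ℚ)
        numerator = trans (cong₂ (λ a b → a ℚ.- b ℚ.- 1ℚ) Uᵣ (Uₖ s)) (sym (p-q-1 z (L T k s)))
        by-cases : Dec (s ≡ r) → yᶠ U i r s ≡ ψ (inj₂ r) (inj₁ s)
        by-cases (yes refl) = trans (cong₂ (λ a b → a ℚ.* (if b then 1ℚ else inv (L U ci r ℚ.- L U ci r))) numerator (dec-true (r Finₚ.≟ r) refl))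
          (sym (trans (ψ-other {inj₂ r} {inj₁ r} λ ()) (trans (φ-ratio (inj₁ r) z (p≢p+1 (L T ci r) ∘ sym))
            (cong (λ q → (z ℚ.- (L T k r ℚ.+ 1ℚ)) ℚ.* inv q) (solveℚ 1 (λ z → (z ⊕ con 1ℚ) ⊖ z ⊜ con 1ℚ) refl (L T ci r))))))
        by-cases (no s≢r) = trans (cong₂ (λ a b → a ℚ.* (if b then 1ℚ else inv (L U ci r ℚ.- L U ci s))) numerator (dec-false (s Finₚ.≟ r) s≢r))
          (trans (cong₂ (λ a b → (z ℚ.- (L T k s ℚ.+ 1ℚ)) ℚ.* inv (a ℚ.- b)) Uᵣ (Uₛ s≢r))
          (sym (trans (ψ-other {inj₂ r} {inj₁ s} λ ()) (φ-ratio (inj₁ s) z (z≢ s≢r)))))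
      off : ∀ s → s ≢ r → xᶠ U i r s ≡ ψ (inj₂ r) (inj₂ s)
      off s s≢r = trans (cong₂ (λ a b → a ℚ.* (if b then ℚ.- 1ℚ else inv (L U ci r ℚ.- L U ci s ℚ.- 1ℚ)))
            (cong₂ ℚ._-_ Uᵣ (Uₐ s)) (dec-false (s Finₚ.≟ r) s≢r))
          (trans (cong (λ q → (z ℚ.- L T (suc ci) s) ℚ.* inv q) (trans (cong₂ (λ a b → a ℚ.- b ℚ.- 1ℚ) Uᵣ (Uₛ s≢r)) (sym (p-q-1 z (L T ci s)))))
          (sym (trans (ψ-other {inj₂ r} {inj₂ s} (s≢r ∘ Sumₚ.inj₂-injective))
            (φ-ratio (inj₂ s) z (λ eq → L-distinct T ci (s≢r ∘ sym) (+1-cancel eq))))))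
      at : xᶠ U i r r ≡ ℚ.- ψ (inj₂ r) (inj₂ r)
      at = trans (cong (λ b → (L U ci r ℚ.- L U (suc ci) r) ℚ.* (if b then ℚ.- 1ℚ else inv (L U ci r ℚ.- L U ci r ℚ.- 1ℚ))) (dec-true (r Finₚ.≟ r) refl))
        (*-neg-1 (trans (cong₂ ℚ._-_ Uᵣ (Uₐ r)) (sym (ψ-self (inj₂ r)))))
      negate : ∏ (xᶠ U i r) rows ≡ ℚ.- ∏ (ψ (inj₂ r) ∘ inj₂) rows
      negate =
        let _ , x≡ , ψ≡ = ∏ℚ-Operator.big-differ Finₚ._≟_ (xᶠ U i r) (ψ (inj₂ r) ∘ inj₂) rows-unique (∈ₚ.∈-allFin r) off
        in common-factor x≡ ψ≡ at

    private
      ∈₁ : ∀ r → inj₁ r ∈ poles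
      ∈₁ r = ∈ₚ.∈-++⁺ˡ (∈ₚ.∈-map⁺ inj₁ (∈ₚ.∈-allFin r))
      ∈₂ : ∀ r → inj₂ r ∈ poles
      ∈₂ r = ∈ₚ.∈-++⁺ʳ (List.map inj₁ rows) (∈ₚ.∈-map⁺ inj₂ (∈ₚ.∈-allFin r))

    -- One hypothesis of `down-step` must fail. If the row has no entry `ci`, the pair `inj₁ r` is
    -- cancelled. If some row below blocks the step, then by monotonicity so does the next row `t`,
    -- with `g T ci r ≡ g T (suc ci) t`, and the zero of `inj₂ t` lies at the pole.
    residue-no-into : ∀ r → (∀ {S} (e : Edge i S T) → edgeRow e ≢ r) → residue poles (inj₁ r) ≡ 0ℚ
    residue-no-into r none = by-row (g T k r ℕ.<? g T ci r)
      where
      by-column : g T k r ℕ.< g T ci r → Dec (∀ s → r Fin.< s → g T (suc ci) s ℕ.< g T ci r) → residue poles (inj₁ r) ≡ 0ℚ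
      by-column b<g (yes a<g) = let _ , e , r≡ = down-step i T r b<g a<g in contradiction r≡ (none e)
      by-column b<g (no ¬a<g) = blocked (Finₚ.¬∀⟶∃¬ m _ (λ s → (r Finₚ.<? s) →-dec (g T (suc ci) s ℕ.<? g T ci r)) ¬a<g)
        where
        blocked : (∃[ s ] ¬ (r Fin.< s → g T (suc ci) s ℕ.< g T ci r)) → residue poles (inj₁ r) ≡ 0ℚ
        blocked (s , ¬a<g) = ∏-zero (ψ (inj₁ r)) (∈₂ t) (trans (ψ-other {inj₁ r} {inj₂ t} λ ())
          (φ-zero (inj₂ t) (L T ci r) nontrivial (trans (L-ℓ T ci r) (trans (cong fromℤ
            (cong₂ (λ a b → + a ℤ.+ b) g≡ (sym (pos-suc ci t≡)))) (sym (L-ℓ T (suc ci) t))))))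
          where
          r<s = decidable-stable (r Finₚ.<? s) λ r≮s → ¬a<g λ r<s → contradiction r<s r≮s
          t = proj₁ (next r<s)
          t≡ = proj₁ (proj₂ (next r<s))
          r<t = proj₁ (proj₂ (proj₂ (next r<s)))
          g≡ : g T ci r ≡ g T (suc ci) t
          g≡ = ℕₚ.≤-antisym (ℕₚ.≤-trans (ℕₚ.≮⇒≥ λ a<g → ¬a<g λ _ → a<g) (g-weakly-decreasing T (suc ci) (proj₂ (proj₂ (proj₂ (next r<s))))))
            (interlacing-column T ci r<t)
          -- If this zero were cancelled, then `g T ci r ≡ g T ci t`, and interlacing would bound it
          -- by `g T k r`, against `b<g`.
          nontrivial : pole (inj₂ t) ≢ zero′ (inj₂ t)
          nontrivial eq = ℕₚ.<⇒≱ b<g (ℕₚ.≤-trans (ℕₚ.≤-reflexive (trans g≡ (L⇒g≡ ci t (sym eq)))) (interlacing-column T k r<t))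
      by-row : Dec (g T k r ℕ.< g T ci r) → residue poles (inj₁ r) ≡ 0ℚ
      by-row (yes b<g) = by-column b<g (Finₚ.all? λ s → (r Finₚ.<? s) →-dec (g T (suc ci) s ℕ.<? g T ci r))
      by-row (no ¬b<g) = residue-trivial {poles} (∈₁ r) (g≡⇒L k r (ℕₚ.≤-antisym (ℕₚ.≮⇒≥ ¬b<g) (interlacing-row T k r)))

    -- The mirror image: a row above blocks the step, hence so does the adjacent row `t`, and its
    -- zero `L T k t + 1` equals the pole `L T ci r + 1`.
    residue-no-from : ∀ r → (∀ {U} (e : Edge i T U) → edgeRow e ≢ r) → residue poles (inj₂ r) ≡ 0ℚ
    residue-no-from r none = by-row (g T ci r ℕ.<? g T (suc ci) r)
      where
      by-column : g T ci r ℕ.< g T (suc ci) r → Dec (∀ s → s Fin.< r → g T ci r ℕ.< g T k s) → residue poles (inj₂ r) ≡ 0ℚ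
      by-column g<a (yes g<b) = let _ , e , r≡ = up-step i T r g<a g<b in contradiction r≡ (none e)
      by-column g<a (no ¬g<b) = blocked (Finₚ.¬∀⟶∃¬ m _ (λ s → (s Finₚ.<? r) →-dec (g T ci r ℕ.<? g T k s)) ¬g<b)
        where
        blocked : (∃[ s ] ¬ (s Fin.< r → g T ci r ℕ.< g T k s)) → residue poles (inj₂ r) ≡ 0ℚ
        blocked (s , ¬g<b) = ∏-zero (ψ (inj₂ r)) (∈₁ t) (trans (ψ-other {inj₂ r} {inj₁ t} λ ())
          (φ-zero (inj₁ t) (L T ci r ℚ.+ 1ℚ) nontrivial (cong (ℚ._+ 1ℚ) (trans (L-ℓ T ci r) (trans (cong fromℤ
            (cong₂ (λ a b → + a ℤ.+ b) g≡ (pos-suc k t≡))) (sym (L-ℓ T k t)))))))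
          where
          s<r = decidable-stable (s Finₚ.<? r) λ s≮r → ¬g<b λ s<r → contradiction s<r s≮r
          t = proj₁ (previous s<r)
          t≡ = proj₁ (proj₂ (previous s<r))
          t<r = proj₁ (proj₂ (proj₂ (previous s<r)))
          g≡ : g T ci r ≡ g T k t
          g≡ = ℕₚ.≤-antisym (interlacing-column T k t<r)
            (ℕₚ.≤-trans (g-weakly-decreasing T k (proj₂ (proj₂ (proj₂ (previous s<r))))) (ℕₚ.≮⇒≥ λ g<b → ¬g<b λ _ → g<b))
          nontrivial : pole (inj₁ t) ≢ zero′ (inj₁ t)
          nontrivial eq = ℕₚ.<⇒≱ g<a (ℕₚ.≤-trans (interlacing-column T ci t<r)
            (ℕₚ.≤-reflexive (trans (L⇒g≡ k t eq) (sym g≡))))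
      by-row : Dec (g T ci r ℕ.< g T (suc ci) r) → residue poles (inj₂ r) ≡ 0ℚ
      by-row (yes g<a) = by-column g<a (Finₚ.all? λ s → (s Finₚ.<? r) →-dec (g T ci r ℕ.<? g T k s))
      by-row (no ¬g<a) = residue-trivial {poles} (∈₂ r) (sym (g≡⇒L ci r (ℕₚ.≤-antisym (ℕₚ.≮⇒≥ ¬g<a) (interlacing-row T ci r))))

    module _ {E : Tableau → Set} (E? : ∀ S → Dec (E S)) (rowᴱ : ∀ {S} → E S → Fin m)
             (row-irrelevant : ∀ {S} (e f : E S) → rowᴱ e ≡ rowᴱ f)
             (row-injective : ∀ {S S′} (e : E S) (f : E S′) → rowᴱ e ≡ rowᴱ f → S ≡ S′) where

      -- A row carries at most one edge of the color at `T`, so the edges can be counted by rows;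
      -- rows without an edge add zero. The family `E` stands for the edges into `T` as well as for
      -- those from `T`.
      ∑-edges : (f : ∃ E → ℚ) (w : Fin m → ℚ) → (∀ {S} (e : E S) → f (S , e) ≡ w (rowᴱ e)) →
                (∀ r → (∀ {S} (e : E S) → rowᴱ e ≢ r) → w r ≡ 0ℚ) →
                ∑ f (List.mapMaybe (λ S → Maybe.map (S ,_) (dec⇒maybe (E? S))) tableaux) ≡ ∑ w rows
      ∑-edges f w f≡w w≡0 = trans (∑ℚ-Operator.big-mapMaybe f _ tableaux) (trans
        (∑ℚ-Operator.big-cong tableaux same) (trans (sym (∑ℚ-Operator.big-mapMaybe w p tableaux))
        (sym (∑ℚ-Operator.big-subset Finₚ._≟_ rows-unique (mapMaybe-unique p injective tableaux-unique)
          (λ {r} _ → ∈ₚ.∈-allFin r) (λ {r} r∉ → w≡0 r (λ {S} e eq → r∉ (mapMaybe-∈ p (tableaux-complete S) (found e eq))))))))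
        where
        p : Tableau → Maybe (Fin m)
        p S = Maybe.map rowᴱ (dec⇒maybe (E? S))
        same : ∀ S → Maybe.maybe′ f 0ℚ (Maybe.map (S ,_) (dec⇒maybe (E? S))) ≡ Maybe.maybe′ w 0ℚ (p S)
        same S with E? S
        ... | yes e = f≡w e
        ... | no  _ = refl
        found : ∀ {S r} (e : E S) → rowᴱ e ≡ r → p S ≡ just r
        found {S} e refl with E? S
        ... | yes e′ = cong just (row-irrelevant e′ e)
        ... | no ¬e  = contradiction e ¬e
        edge-at : ∀ S {r} → p S ≡ just r → Σ[ e ∈ E S ] (rowᴱ e ≡ r)
        edge-at S eq with E? S
        edge-at S refl | yes e = e , refl
        edge-at S ()   | no _
        injective : ∀ {S S′ r} → p S ≡ just r → p S′ ≡ just r → S ≡ S′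
        injective {S} {S′} eq eq′ = let e , r≡ = edge-at S eq ; f , r≡′ = edge-at S′ eq′ in
          row-injective e f (trans r≡ (sym r≡′))

    ∑-into : ∑ (λ (S , e) → X e ℚ.* Y e) (edgesInto i T) ≡ ∑ (residue poles ∘ inj₁) rows
    ∑-into = ∑-edges (λ S → edge? i S T) edgeRow (λ e f → cong proj₁ (edge-cell-unique e f)) into-unique
      _ _ (λ e → residue-into (edgeRow e) e refl) residue-no-into

    ∑-from : ∑ (λ (U , e) → X e ℚ.* Y e) (edgesFrom i T) ≡ ∑ (λ r → ℚ.- residue poles (inj₂ r)) rows
    ∑-from = ∑-edges (λ U → edge? i T U) edgeRow (λ e f → cong proj₁ (edge-cell-unique e f)) from-unique
      _ _ (λ e → residue-from (edgeRow e) e refl) (λ r none → cong ℚ.-_ (residue-no-from r none))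

    ∑-F : ∀ (f h : Fin m → ℕ) xs → ∑ (λ r → fromℤ (+ f r ℤ.- + h r)) xs ≡
          fromℤ (+ ∑ℕ-Operator.big f xs ℤ.- + ∑ℕ-Operator.big h xs)
    ∑-F f h []       = refl
    ∑-F f h (x ∷ xs) = trans (cong (fromℤ (+ f x ℤ.- + h x) ℚ.+_) (∑-F f h xs))
      (trans (sym (fromℤ-+ (+ f x ℤ.- + h x) (+ ∑ℕ-Operator.big f xs ℤ.- + ∑ℕ-Operator.big h xs)))
        (cong fromℤ (identity (+ f x) (+ h x) (+ ∑ℕ-Operator.big f xs) (+ ∑ℕ-Operator.big h xs))))
      where
      identity : ∀ a b c d → (a ℤ.- b) ℤ.+ (c ℤ.- d) ≡ (a ℤ.+ c) ℤ.- (b ℤ.+ d)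
      identity = solve-∀

    neg-∑ : ∀ {A : Set} (f : A → ℚ) xs → ℚ.- ∑ f xs ≡ ∑ (ℚ.-_ ∘ f) xs
    neg-∑ f = ∑ℚ-Operator.big-homo ℚ.-_ refl ℚₚ.neg-distrib-+

    crossing-sum : ∑ (λ (S , e) → X e ℚ.* Y e) (edgesInto i T) ℚ.- ∑ (λ (U , e) → X e ℚ.* Y e) (edgesFrom i T)
                   ≡ fromℤ (wtᵢ i T)
    crossing-sum = begin
      ∑ (λ (S , e) → X e ℚ.* Y e) (edgesInto i T) ℚ.- ∑ (λ (U , e) → X e ℚ.* Y e) (edgesFrom i T)
        ≡⟨ cong₂ ℚ._-_ ∑-into ∑-from ⟩
      ∑ (residue poles ∘ inj₁) rows ℚ.- ∑ (λ r → ℚ.- residue poles (inj₂ r)) rows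
        ≡⟨ cong (∑ (residue poles ∘ inj₁) rows ℚ.+_) (trans (neg-∑ (λ r → ℚ.- residue poles (inj₂ r)) rows)
             (∑ℚ-Operator.big-cong rows λ r → neg-neg (residue poles (inj₂ r)))) ⟩
      ∑ (residue poles ∘ inj₁) rows ℚ.+ ∑ (residue poles ∘ inj₂) rows
        ≡⟨ ∑-poles (residue poles) ⟨
      ∑ (residue poles) poles
        ≡⟨ residue-sum poles-unique distinct ⟩
      ∑ (λ j → pole j ℚ.- zero′ j) poles
        ≡⟨ ∑-poles (λ j → pole j ℚ.- zero′ j) ⟩
      ∑ (λ r → L T ci r ℚ.- (L T k r ℚ.+ 1ℚ)) rows ℚ.+ ∑ (λ r → L T ci r ℚ.+ 1ℚ ℚ.- L T (suc ci) r) rows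
        ≡⟨ cong₂ ℚ._+_ (∑ℚ-Operator.big-cong rows λ r → sym (F-difference k r))
             (trans (∑ℚ-Operator.big-cong rows λ r → trans (p-q-flip (L T ci r ℚ.+ 1ℚ) (L T (suc ci) r)) (cong ℚ.-_ (sym (F-difference ci r))))
               (sym (neg-∑ (λ r → fromℤ (+ g T (suc ci) r ℤ.- + g T ci r)) rows))) ⟩
      ∑ (λ r → fromℤ (+ g T ci r ℤ.- + g T k r)) rows ℚ.- ∑ (λ r → fromℤ (+ g T (suc ci) r ℤ.- + g T ci r)) rows
        ≡⟨ cong₂ ℚ._-_ (∑-F (g T ci) (g T k) rows) (∑-F (g T (suc ci)) (g T ci) rows) ⟩
      fromℤ (+ G T ci ℤ.- + G T k) ℚ.- fromℤ (+ G T (suc ci) ℤ.- + G T ci)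
        ≡⟨ fromℤ-∸ (+ G T ci ℤ.- + G T k) (+ G T (suc ci) ℤ.- + G T ci) ⟨
      fromℤ ((+ G T ci ℤ.- + G T k) ℤ.- (+ G T (suc ci) ℤ.- + G T ci))
        ≡⟨ cong fromℤ (wtᵢ-G i T) ⟨
      fromℤ (wtᵢ i T) ∎
      where
      open ≡-Reasoning
      neg-neg : ∀ p → ℚ.- (ℚ.- p) ≡ p
      neg-neg = solveℚ 1 (λ p → ⊝ (⊝ p) ⊜ p) refl
      p-q-flip : ∀ p q → p ℚ.- q ≡ ℚ.- (q ℚ.- p)
      p-q-flip = solveℚ 2 (λ p q → p ⊖ q ⊜ ⊝ (q ⊖ p)) refl

-- Interlacing bounds and their sums

open ∑ℕ-Operator using () renaming (big to ∑ₙ)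

∑ₙ-suc : ∀ {m} (f : Fin (suc m) → ℕ) → ∑ₙ f (List.allFin (suc m)) ≡ f zero ℕ.+ ∑ₙ (f ∘ suc) (List.allFin m)
∑ₙ-suc {m} f = cong (λ xs → f zero ℕ.+ List.foldr ℕ._+_ 0 xs)
  (trans (Listₚ.map-tabulate suc f) (sym (Listₚ.map-tabulate id (f ∘ suc))))

∑ₙ-mono : ∀ {A : Set} {f h : A → ℕ} xs → (∀ x → f x ℕ.≤ h x) → ∑ₙ f xs ℕ.≤ ∑ₙ h xs
∑ₙ-mono []       f≤h = z≤n
∑ₙ-mono (x ∷ xs) f≤h = ℕₚ.+-mono-≤ (f≤h x) (∑ₙ-mono xs f≤h)

∑ₙ-∸ : ∀ {A : Set} {f h : A → ℕ} xs → (∀ x → h x ℕ.≤ f x) → ∑ₙ (λ x → f x ∸ h x) xs ℕ.+ ∑ₙ h xs ≡ ∑ₙ f xs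
∑ₙ-∸ {f = f} {h} xs h≤f = trans (sym (∑ℕ-Operator.big-∙ (λ x → f x ∸ h x) h xs))
  (∑ℕ-Operator.big-cong xs λ x → ℕₚ.m∸n+n≡m (h≤f x))

∑ₙ-< : ∀ {m} (f h : Fin m → ℕ) → ∑ₙ f (List.allFin m) ℕ.< ∑ₙ h (List.allFin m) → ∃[ r ] (f r ℕ.< h r)
∑ₙ-< {m} f h f<h with Finₚ.any? (λ r → f r ℕ.<? h r)
... | yes found = found
... | no none = contradiction (∑ₙ-mono (List.allFin m) λ r → ℕₚ.≮⇒≥ λ f<h → none (r , f<h)) (ℕₚ.<⇒≱ f<h)

-- The bounds on a row of a Gelfand-Tsetlin pattern between the rows a above it
-- and b below it.
lowerBound : ∀ {m} (a b : Fin m → ℕ) → Fin m → ℕ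
lowerBound {suc zero}    a b zero    = b zero
lowerBound {suc (suc m)} a b zero    = b zero ℕ.⊔ a (suc zero)
lowerBound {suc (suc m)} a b (suc r) = lowerBound (a ∘ suc) (b ∘ suc) r

-- The parameter `d` replaces the missing entry of `b` above the first row. Once it bounds `a` from
-- above it has no effect; in the recursion it is the entry of `b` one row up.
upperBound : ∀ {m} → ℕ → (a b : Fin m → ℕ) → Fin m → ℕ
upperBound d a b zero    = a zero ℕ.⊓ d
upperBound d a b (suc r) = upperBound (b zero) (a ∘ suc) (b ∘ suc) r

-- The lower bound of a row and the upper bound of the next one are the maximum and the minimum of
-- the same two numbers, so together they give the sum of these. Only the first upper bound
-- `a zero ⊓ d` stays unpaired; `a zero` is added on the left to avoid a subtraction.
lowerBound-∑ : ∀ {m} d (a b : Fin (suc m) → ℕ) → let rows = List.allFin (suc m) in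
  ∑ₙ (lowerBound a b) rows ℕ.+ ∑ₙ (upperBound d a b) rows ℕ.+ a zero ≡ (a zero ℕ.⊓ d) ℕ.+ ∑ₙ a rows ℕ.+ ∑ₙ b rows
lowerBound-∑ {zero} d a b = identity (b zero) (a zero) (a zero ℕ.⊓ d)
  where
  identity : ∀ b a x → b ℕ.+ 0 ℕ.+ (x ℕ.+ 0) ℕ.+ a ≡ x ℕ.+ (a ℕ.+ 0) ℕ.+ (b ℕ.+ 0)
  identity = solve-∀ℕ
lowerBound-∑ {suc m} d a b = begin
  ∑ₙ (lowerBound a b) rows ℕ.+ ∑ₙ (upperBound d a b) rows ℕ.+ a zero
    ≡⟨ cong₂ (λ x y → x ℕ.+ y ℕ.+ a zero) (∑ₙ-suc (lowerBound a b)) (∑ₙ-suc (upperBound d a b)) ⟩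
  (b zero ℕ.⊔ a₁) ℕ.+ Λ ℕ.+ ((a zero ℕ.⊓ d) ℕ.+ Υ) ℕ.+ a zero
    ≡⟨ ℕₚ.+-cancelʳ-≡ a₁ _ _ (trans (rearrange (b zero ℕ.⊔ a₁) Λ (a zero ℕ.⊓ d) Υ (a zero) a₁)
         (trans (cong (λ x → (b zero ℕ.⊔ a₁) ℕ.+ (a zero ℕ.⊓ d) ℕ.+ a zero ℕ.+ x)
             (trans (lowerBound-∑ (b zero) (a ∘ suc) (b ∘ suc)) (cong (λ x → x ℕ.+ A ℕ.+ B) (ℕₚ.⊓-comm a₁ (b zero)))))
           (trans (rearrange′ (b zero ℕ.⊔ a₁) (a zero ℕ.⊓ d) (a zero) (b zero ℕ.⊓ a₁) A B)
             (trans (cong (λ x → x ℕ.+ (a zero ℕ.⊓ d) ℕ.+ a zero ℕ.+ A ℕ.+ B) (⊔+⊓ (b zero) a₁))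
               (rearrange″ (b zero) a₁ (a zero ℕ.⊓ d) (a zero) A B))))) ⟩
  (a zero ℕ.⊓ d) ℕ.+ (a zero ℕ.+ A) ℕ.+ (b zero ℕ.+ B)
    ≡⟨ cong₂ (λ x y → (a zero ℕ.⊓ d) ℕ.+ x ℕ.+ y) (∑ₙ-suc a) (∑ₙ-suc b) ⟨
  (a zero ℕ.⊓ d) ℕ.+ ∑ₙ a rows ℕ.+ ∑ₙ b rows ∎
  where
  open ≡-Reasoning
  rows = List.allFin (suc (suc m))
  a₁ = a (suc zero)
  Λ = ∑ₙ (lowerBound (a ∘ suc) (b ∘ suc)) (List.allFin (suc m))
  Υ = ∑ₙ (upperBound (b zero) (a ∘ suc) (b ∘ suc)) (List.allFin (suc m))
  A = ∑ₙ (a ∘ suc) (List.allFin (suc m))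
  B = ∑ₙ (b ∘ suc) (List.allFin (suc m))
  rearrange : ∀ x Λ y Υ a a₁ → x ℕ.+ Λ ℕ.+ (y ℕ.+ Υ) ℕ.+ a ℕ.+ a₁ ≡ x ℕ.+ y ℕ.+ a ℕ.+ (Λ ℕ.+ Υ ℕ.+ a₁)
  rearrange = solve-∀ℕ
  rearrange′ : ∀ x y a z A B → x ℕ.+ y ℕ.+ a ℕ.+ (z ℕ.+ A ℕ.+ B) ≡ (x ℕ.+ z) ℕ.+ y ℕ.+ a ℕ.+ A ℕ.+ B
  rearrange′ = solve-∀ℕ
  rearrange″ : ∀ b a₁ y a A B → (b ℕ.+ a₁) ℕ.+ y ℕ.+ a ℕ.+ A ℕ.+ B ≡ y ℕ.+ (a ℕ.+ A) ℕ.+ (b ℕ.+ B) ℕ.+ a₁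
  rearrange″ = solve-∀ℕ
  ⊔+⊓ : ∀ x y → (x ℕ.⊔ y) ℕ.+ (x ℕ.⊓ y) ≡ x ℕ.+ y
  ⊔+⊓ x y with ℕₚ.≤-total x y
  ... | inj₁ x≤y = trans (cong₂ ℕ._+_ (ℕₚ.m≤n⇒m⊔n≡n x≤y) (ℕₚ.m≤n⇒m⊓n≡m x≤y)) (ℕₚ.+-comm y x)
  ... | inj₂ y≤x = cong₂ ℕ._+_ (ℕₚ.m≥n⇒m⊔n≡m y≤x) (ℕₚ.m≥n⇒m⊓n≡n y≤x)

bounds-∑ : ∀ {m} (a b : Fin m → ℕ) d → (∀ r → a r ℕ.≤ d) → let rows = List.allFin m in
  ∑ₙ (lowerBound a b) rows ℕ.+ ∑ₙ (upperBound d a b) rows ≡ ∑ₙ a rows ℕ.+ ∑ₙ b rows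
bounds-∑ {zero}  a b d a≤d = refl
bounds-∑ {suc m} a b d a≤d = ℕₚ.+-cancelʳ-≡ (a zero) _ _ (trans (lowerBound-∑ d a b)
  (trans (cong (λ x → x ℕ.+ A ℕ.+ B) (ℕₚ.m≤n⇒m⊓n≡m (a≤d zero))) (trans (ℕₚ.+-assoc (a zero) A B) (ℕₚ.+-comm (a zero) (A ℕ.+ B)))))
  where
  A = ∑ₙ a (List.allFin (suc m))
  B = ∑ₙ b (List.allFin (suc m))

b≤lowerBound : ∀ {m} (a b : Fin m → ℕ) r → b r ℕ.≤ lowerBound a b r
b≤lowerBound {suc zero}    a b zero    = ℕₚ.≤-refl
b≤lowerBound {suc (suc m)} a b zero    = ℕₚ.m≤m⊔n _ _
b≤lowerBound {suc (suc m)} a b (suc r) = b≤lowerBound (a ∘ suc) (b ∘ suc) r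

a≤lowerBound : ∀ {m} (a b : Fin m → ℕ) → (∀ {r s} → r Fin.≤ s → a s ℕ.≤ a r) →
               ∀ {r s} → r Fin.< s → a s ℕ.≤ lowerBound a b r
a≤lowerBound {suc (suc m)} a b mono {zero}  {suc s} _   =
  ℕₚ.≤-trans (mono {suc zero} {suc s} (s≤s z≤n)) (ℕₚ.m≤n⊔m (b zero) _)
a≤lowerBound {suc (suc m)} a b mono {suc r} {suc s} r<s =
  a≤lowerBound (a ∘ suc) (b ∘ suc) (mono ∘ s≤s) (ℕ.s<s⁻¹ r<s)

lowerBound≤ : ∀ {m} (a b : Fin m → ℕ) r {g} → b r ℕ.≤ g → (∀ {s} → r Fin.< s → a s ℕ.≤ g) → lowerBound a b r ℕ.≤ g
lowerBound≤ {suc zero}    a b zero    b≤g a≤g = b≤g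
lowerBound≤ {suc (suc m)} a b zero    b≤g a≤g = ℕₚ.⊔-lub b≤g (a≤g {suc zero} z<s)
lowerBound≤ {suc (suc m)} a b (suc r) b≤g a≤g = lowerBound≤ (a ∘ suc) (b ∘ suc) r b≤g (a≤g ∘ s<s)

upperBound≤a : ∀ {m} d (a b : Fin m → ℕ) r → upperBound d a b r ℕ.≤ a r
upperBound≤a d a b zero    = ℕₚ.m⊓n≤m _ _
upperBound≤a d a b (suc r) = upperBound≤a (b zero) (a ∘ suc) (b ∘ suc) r

upperBound≤b : ∀ {m} d (a b : Fin m → ℕ) → (∀ {r s} → r Fin.≤ s → b s ℕ.≤ b r) →
               ∀ {r s} → s Fin.< r → upperBound d a b r ℕ.≤ b s
upperBound≤b d a b mono {suc zero}    {zero}  _   = ℕₚ.m⊓n≤n _ _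
upperBound≤b d a b mono {suc (suc r)} {zero}  _   = ℕₚ.≤-trans
  (upperBound≤b (b zero) (a ∘ suc) (b ∘ suc) (mono ∘ s≤s) {suc r} {zero} z<s) (mono {zero} {suc zero} z≤n)
upperBound≤b d a b mono {suc r}       {suc s} s<r =
  upperBound≤b (b zero) (a ∘ suc) (b ∘ suc) (mono ∘ s≤s) (ℕ.s<s⁻¹ s<r)

≤upperBound : ∀ {m} d (a b : Fin m → ℕ) r {g} → g ℕ.≤ a r → g ℕ.≤ d → (∀ {s} → s Fin.< r → g ℕ.≤ b s) →
              g ℕ.≤ upperBound d a b r
≤upperBound d a b zero    g≤a g≤d g≤b = ℕₚ.⊓-glb g≤a g≤d
≤upperBound d a b (suc r) g≤a g≤d g≤b = ≤upperBound (b zero) (a ∘ suc) (b ∘ suc) r g≤a (g≤b {zero} z<s) (g≤b ∘ s<s)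

-- The components of one color, their rank and their length

module Components {m n : ℕ} (shape : SkewShape m n) (i : Color n) where

  open SkewTableaux shape
  open Combinatorics shape
  open Lattice shape
  open Diamond shape
  open Crossing shape using (crossing-sum)

  private
    k = toℕ i
    ci = colorℕ i

  low upp : Tableau → Fin m → ℕ
  low T = lowerBound (g T (suc ci)) (g T k)
  upp T = upperBound (G T (suc ci)) (g T (suc ci)) (g T k)

  g≤G : ∀ T k r → g T k r ℕ.≤ G T k
  g≤G T k r = let rest , eq , _ = ∑ℕ-Operator.big-differ Finₚ._≟_ (g T k) (g T k) (Uniqueₚ.allFin⁺ m) (∈ₚ.∈-allFin r) (λ _ _ → refl)
    in ℕₚ.≤-trans (ℕₚ.m≤m+n (g T k r) rest) (ℕₚ.≤-reflexive (sym eq))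

  low≤g : ∀ T r → low T r ℕ.≤ g T ci r
  low≤g T r = lowerBound≤ _ _ r (interlacing-row T k r) (interlacing-column T ci)

  g≤upp : ∀ T r → g T ci r ℕ.≤ upp T r
  g≤upp T r = ≤upperBound _ _ _ r (interlacing-row T ci r) (ℕₚ.≤-trans (interlacing-row T ci r) (g≤G T (suc ci) r))
    (interlacing-column T k)

  Λ Υ : Tableau → ℕ
  Λ T = ∑ₙ (low T) rows
  Υ T = ∑ₙ (upp T) rows

  Λ+Υ : ∀ T → Λ T ℕ.+ Υ T ≡ G T (suc ci) ℕ.+ G T k
  Λ+Υ T = bounds-∑ (g T (suc ci)) (g T k) (G T (suc ci)) (g≤G T (suc ci))

  -- Edges of color `i` fix the diagonals `k` and `suc ci`, hence the bounds `low` and `upp`. Each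
  -- entry of the diagonal `ci` runs through the chain between its bounds; the heights in these
  -- chains add up to the rank, and their lengths to the length of the component.
  ρ λᶜ : Tableau → ℕ
  ρ  T = ∑ₙ (λ r → g T ci r ∸ low T r) rows
  λᶜ T = ∑ₙ (λ r → upp T r ∸ low T r) rows

  ρ+Λ : ∀ T → ρ T ℕ.+ Λ T ≡ G T ci
  ρ+Λ T = ∑ₙ-∸ rows (low≤g T)

  λ+Λ : ∀ T → λᶜ T ℕ.+ Λ T ≡ Υ T
  λ+Λ T = ∑ₙ-∸ rows λ r → ℕₚ.≤-trans (low≤g T r) (g≤upp T r)

  lowerBound-cong : ∀ {m} {a a′ b b′ : Fin m → ℕ} → (∀ r → a r ≡ a′ r) → (∀ r → b r ≡ b′ r) →
                    ∀ r → lowerBound a b r ≡ lowerBound a′ b′ r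
  lowerBound-cong {suc zero}    a≡ b≡ zero    = b≡ zero
  lowerBound-cong {suc (suc m)} a≡ b≡ zero    = cong₂ ℕ._⊔_ (b≡ zero) (a≡ (suc zero))
  lowerBound-cong {suc (suc m)} a≡ b≡ (suc r) = lowerBound-cong (a≡ ∘ suc) (b≡ ∘ suc) r

  upperBound-cong : ∀ {m d d′} {a a′ b b′ : Fin m → ℕ} → d ≡ d′ → (∀ r → a r ≡ a′ r) → (∀ r → b r ≡ b′ r) →
                    ∀ r → upperBound d a b r ≡ upperBound d′ a′ b′ r
  upperBound-cong d≡ a≡ b≡ zero    = cong₂ ℕ._⊓_ (a≡ zero) d≡
  upperBound-cong d≡ a≡ b≡ (suc r) = upperBound-cong (b≡ zero) (a≡ ∘ suc) (b≡ ∘ suc) r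

  module _ {S T} (e : Edge i S T) where

    private
      a≡ : ∀ r → g T (suc ci) r ≡ g S (suc ci) r
      a≡ r = edge-g-otherColor e (suc ci) r ℕₚ.1+n≢n
      b≡ : ∀ r → g T k r ≡ g S k r
      b≡ r = edge-g-otherColor e k r (ℕₚ.1+n≢n ∘ sym)

    edge-Λ : Λ T ≡ Λ S
    edge-Λ = ∑ℕ-Operator.big-cong rows (lowerBound-cong a≡ b≡)

    edge-Υ : Υ T ≡ Υ S
    edge-Υ = ∑ℕ-Operator.big-cong rows (upperBound-cong (∑ℕ-Operator.big-cong rows a≡) a≡ b≡)

    edge-λ : λᶜ T ≡ λᶜ S
    edge-λ = ℕₚ.+-cancelʳ-≡ (Λ S) _ _ (trans (cong (λᶜ T ℕ.+_) (sym edge-Λ))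
      (trans (λ+Λ T) (trans edge-Υ (sym (λ+Λ S)))))

    edge-ρ : ρ T ≡ suc (ρ S)
    edge-ρ = ℕₚ.+-cancelʳ-≡ (Λ S) _ _ (trans (cong (ρ T ℕ.+_) (sym edge-Λ))
      (trans (ρ+Λ T) (trans (edge-G e ci) (trans (cong (λ b → G S ci ℕ.+ (if b then 1 else 0)) (dec-true (ci ℕ.≟ ci) refl))
        (trans (ℕₚ.+-comm (G S ci) 1) (cong suc (sym (ρ+Λ S))))))))

  component-λ : ∀ {s t} → s ∈Component[ i ] t → λᶜ s ≡ λᶜ t
  component-λ nil = refl
  component-λ (fwd e ◅ p) = trans (component-λ p) (edge-λ e)
  component-λ (bwd e ◅ p) = trans (component-λ p) (sym (edge-λ e))

  ρ≤λ : ∀ T → ρ T ℕ.≤ λᶜ T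
  ρ≤λ T = ∑ₙ-mono rows λ r → ℕₚ.∸-monoˡ-≤ (low T r) (g≤upp T r)

  -- Some entry lies below its upper bound, and the two parts of this bound are the two hypotheses
  -- of `up-step`.
  up : ∀ T → ρ T ℕ.< λᶜ T → ∃[ U ] Edge i T U
  up T ρ<λ =
    let r , g<upp = ∑ₙ-< (g T ci) (upp T) (subst₂ ℕ._<_ (ρ+Λ T) (λ+Λ T) (ℕₚ.+-monoˡ-< (Λ T) ρ<λ))
        U , e , _ = up-step i T r (ℕₚ.<-≤-trans g<upp (upperBound≤a _ _ _ r))
          (λ s s<r → ℕₚ.<-≤-trans g<upp (upperBound≤b _ _ _ (g-weakly-decreasing T k) s<r))
    in U , e

  down : ∀ T → 0 ℕ.< ρ T → ∃[ S ] Edge i S T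
  down T 0<ρ =
    let r , low<g = ∑ₙ-< (low T) (g T ci) (subst (Λ T ℕ.<_) (ρ+Λ T) (ℕₚ.+-monoˡ-< (Λ T) 0<ρ))
        S , e , _ = down-step i T r (ℕₚ.≤-<-trans (b≤lowerBound (g T (suc ci)) (g T k) r) low<g)
          (λ s r<s → ℕₚ.≤-<-trans (a≤lowerBound (g T (suc ci)) (g T k) (g-weakly-decreasing T (suc ci)) r<s) low<g)
    in S , e

  climb : ∀ d {s} → ρ s ℕ.+ d ℕ.≤ λᶜ s → ∃[ t ] (t ∈Component[ i ] s × ρ t ≡ ρ s ℕ.+ d)
  climb zero    {s} _ = s , nil , sym (ℕₚ.+-identityʳ (ρ s))
  climb (suc d) {s} le = from (up s (ℕₚ.<-≤-trans (ℕₚ.m<m+n (ρ s) z<s) le))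
    where
    from : ∃[ u ] Edge i s u → ∃[ t ] (t ∈Component[ i ] s × ρ t ≡ ρ s ℕ.+ suc d)
    from (u , e) = let t , t∈ , ρt = climb d {u} (subst₂ ℕ._≤_ (sym shift) (sym (edge-λ e)) le) in
      t , fwd e ◅ t∈ , trans ρt shift
      where
      shift : ρ u ℕ.+ d ≡ ρ s ℕ.+ suc d
      shift = trans (cong (ℕ._+ d) (edge-ρ e)) (sym (ℕₚ.+-suc (ρ s) d))

  descend : ∀ d {s l} → ρ s ≡ d ℕ.+ l → ∃[ t ] (t ∈Component[ i ] s × ρ t ≡ l)
  descend zero    {s} eq = s , nil , eq
  descend (suc d) {s} {l} eq = from (down s (subst (0 ℕ.<_) (sym eq) z<s))
    where
    from : ∃[ u ] Edge i u s → ∃[ t ] (t ∈Component[ i ] s × ρ t ≡ l)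
    from (u , e) = let t , t∈ , ρt = descend d {u} (ℕₚ.suc-injective (trans (sym (edge-ρ e)) eq)) in
      t , bwd e ◅ t∈ , ρt

  componentRank : ∀ T → ComponentRank i T
  componentRank T = record
    { rank        = ρ
    ; length      = λᶜ T
    ; rank-step   = λ _ _ → edge-ρ
    ; rank≤length = λ {s} s∈ → subst (ρ s ℕ.≤_) (component-λ s∈) (ρ≤λ s)
    ; rank-onto   = onto
    }
    where
    onto : ∀ {l} → l ℕ.≤ λᶜ T → ∃[ s ] (s ∈Component[ i ] T × ρ s ≡ l)
    onto {l} l≤ with ℕₚ.≤-total l (ρ T)
    ... | inj₁ l≤ρ = descend (ρ T ∸ l) (sym (ℕₚ.m∸n+n≡m l≤ρ))
    ... | inj₂ ρ≤l = let t , t∈ , eq = climb (l ∸ ρ T) (ℕₚ.≤-trans (ℕₚ.≤-reflexive (ℕₚ.m+[n∸m]≡n ρ≤l)) l≤)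
                     in t , t∈ , trans eq (ℕₚ.m+[n∸m]≡n ρ≤l)

  -- The bounds enter `2 ρ - λᶜ` only through `Λ + Υ`, which is the sum of the neighboring
  -- diagonals; what remains is minus the second difference of `G`.
  m-value≡wtᵢ : ∀ T → ComponentRank.m-value (componentRank T) ≡ wtᵢ i T
  m-value≡wtᵢ T = begin
    + (2 ℕ.* ρ T) ℤ.- + λᶜ T
      ≡⟨ cong (λ x → + (ρ T ℕ.+ x) ℤ.- + λᶜ T) (ℕₚ.+-identityʳ (ρ T)) ⟩
    + ρ T ℤ.+ + ρ T ℤ.- + λᶜ T
      ≡⟨ identity (+ ρ T) (+ λᶜ T) (+ Λ T) ⟩
    ((+ ρ T ℤ.+ + Λ T) ℤ.+ (+ ρ T ℤ.+ + Λ T)) ℤ.- (+ Λ T ℤ.+ (+ λᶜ T ℤ.+ + Λ T))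
      ≡⟨ cong₂ (λ x y → (+ x ℤ.+ + x) ℤ.- (+ Λ T ℤ.+ + y)) (ρ+Λ T) (λ+Λ T) ⟩
    (+ G T ci ℤ.+ + G T ci) ℤ.- + (Λ T ℕ.+ Υ T)
      ≡⟨ cong (λ x → (+ G T ci ℤ.+ + G T ci) ℤ.- + x) (Λ+Υ T) ⟩
    (+ G T ci ℤ.+ + G T ci) ℤ.- (+ G T (suc ci) ℤ.+ + G T k)
      ≡⟨ identity′ (+ G T ci) (+ G T (suc ci)) (+ G T k) ⟩
    (+ G T ci ℤ.- + G T k) ℤ.- (+ G T (suc ci) ℤ.- + G T ci)
      ≡⟨ wtᵢ-G i T ⟨
    wtᵢ i T ∎
    where
    open ≡-Reasoning
    identity : ∀ r l x → r ℤ.+ r ℤ.- l ≡ ((r ℤ.+ x) ℤ.+ (r ℤ.+ x)) ℤ.- (x ℤ.+ (l ℤ.+ x))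
    identity = solve-∀
    identity′ : ∀ g a b → (g ℤ.+ g) ℤ.- (a ℤ.+ b) ≡ (g ℤ.- b) ℤ.- (a ℤ.- g)
    identity′ = solve-∀

crossingRelations : ∀ {m n} (shape : SkewShape m n) → SkewTableaux.CrossingRelations shape
crossingRelations shape i T = Components.componentRank shape i T ,
  trans (Crossing.crossing-sum shape i T) (cong fromℤ (sym (Components.m-value≡wtᵢ shape i T)))
-- Operators over the ground field

-- Turns the laws of `toℚᵘ` into equations of integers without division, which `ι-ℤ` can transport
-- to the field.
cross-multiply : ∀ q u → ℚ.toℚᵘ q ℚᵘ.≃ u → ℚ.↥ q ℤ.* ℚᵘ.↧ u ≡ ℚᵘ.↥ u ℤ.* ℚ.↧ q
cross-multiply record{} _ (ℚᵘ.*≡* eq) = eq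

↥-+ : ∀ p q → ℚ.↥ (p ℚ.+ q) ℤ.* (ℚ.↧ p ℤ.* ℚ.↧ q) ≡ (ℚ.↥ p ℤ.* ℚ.↧ q ℤ.+ ℚ.↥ q ℤ.* ℚ.↧ p) ℤ.* ℚ.↧ (p ℚ.+ q)
↥-+ p@record{} q@record{} = cross-multiply (p ℚ.+ q) _ (ℚₚ.toℚᵘ-homo-+ p q)

↥-* : ∀ p q → ℚ.↥ (p ℚ.* q) ℤ.* (ℚ.↧ p ℤ.* ℚ.↧ q) ≡ (ℚ.↥ p ℤ.* ℚ.↥ q) ℤ.* ℚ.↧ (p ℚ.* q)
↥-* p@record{} q@record{} = cross-multiply (p ℚ.* q) _ (ℚₚ.toℚᵘ-homo-* p q)

module GroundField {c ℓ₁ ℓ₂} (K : HeytingField c ℓ₁ ℓ₂) (char0 : CharacteristicZero K) where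

  open HeytingField K public hiding (zero)
    renaming ( Carrier to 𝕜; refl to ≈-refl; sym to ≈-sym; trans to ≈-trans
             ; _+_ to _+ᴷ_; _*_ to _*ᴷ_; -_ to -ᴷ_; _-_ to _-ᴷ_ )
  open FieldDefs K char0 using (𝕜-ring; ι-ℤ; ι)
  open Algebra.Properties.Monoid.Mult (CommutativeRing.+-monoid 𝕜-ring)
    using () renaming (_×_ to _×ᴷ_; ×-homo-+ to ×ᴷ-homo-+)
  open import Algebra.Properties.Semiring.Mult (CommutativeRing.semiring 𝕜-ring) using (×1-homo-*)
  open Algebra.Properties.Ring (CommutativeRing.ring 𝕜-ring) using (-‿distribˡ-*; -‿distribʳ-*; -‿involutive; -0#≈0#; -‿+-comm)
  open import Relation.Binary.Reasoning.Setoid (CommutativeRing.setoid 𝕜-ring)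

  ι-ℤ-cong : ∀ {a b} → a ≡ b → ι-ℤ a ≈ ι-ℤ b
  ι-ℤ-cong refl = ≈-refl

  ι-ℤ-neg : ∀ a → ι-ℤ (ℤ.- a) ≈ -ᴷ ι-ℤ a
  ι-ℤ-neg (+ zero)  = ≈-sym -0#≈0#
  ι-ℤ-neg (+ suc k) = ≈-refl
  ι-ℤ-neg -[1+ k ]  = ≈-sym (-‿involutive _)

  ι-ℤ-⊖ : ∀ a b → ι-ℤ (a ℤ.⊖ b) ≈ a ×ᴷ 1# -ᴷ b ×ᴷ 1#
  ι-ℤ-⊖ a       zero    = ≈-sym (≈-trans (+-congˡ -0#≈0#) (+-identityʳ _))
  ι-ℤ-⊖ zero    (suc b) = ≈-sym (+-identityˡ _)
  ι-ℤ-⊖ (suc a) (suc b) = begin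
    ι-ℤ (suc a ℤ.⊖ suc b)                        ≡⟨ cong ι-ℤ (ℤₚ.[1+m]⊖[1+n]≡m⊖n a b) ⟩
    ι-ℤ (a ℤ.⊖ b)                                ≈⟨ ι-ℤ-⊖ a b ⟩
    a ×ᴷ 1# -ᴷ b ×ᴷ 1#                           ≈⟨ +-congˡ (+-identityˡ _) ⟨
    a ×ᴷ 1# +ᴷ (0# -ᴷ b ×ᴷ 1#)                   ≈⟨ +-congˡ (+-congʳ (-‿inverseʳ 1#)) ⟨
    a ×ᴷ 1# +ᴷ ((1# -ᴷ 1#) -ᴷ b ×ᴷ 1#)           ≈⟨ +-congˡ (≈-trans (+-assoc _ _ _) (+-congˡ (-‿+-comm _ _))) ⟩
    a ×ᴷ 1# +ᴷ (1# -ᴷ (1# +ᴷ b ×ᴷ 1#))           ≈⟨ +-assoc _ _ _ ⟨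
    a ×ᴷ 1# +ᴷ 1# -ᴷ (1# +ᴷ b ×ᴷ 1#)             ≈⟨ +-congʳ (+-comm _ _) ⟩
    (1# +ᴷ a ×ᴷ 1#) -ᴷ (1# +ᴷ b ×ᴷ 1#)           ∎

  ι-ℤ-+ : ∀ a b → ι-ℤ (a ℤ.+ b) ≈ ι-ℤ a +ᴷ ι-ℤ b
  ι-ℤ-+ (+ a)    (+ b)    = ×ᴷ-homo-+ 1# a b
  ι-ℤ-+ (+ a)    -[1+ b ] = ι-ℤ-⊖ a (suc b)
  ι-ℤ-+ -[1+ a ] (+ b)    = ≈-trans (ι-ℤ-⊖ b (suc a)) (+-comm _ _)
  ι-ℤ-+ -[1+ a ] -[1+ b ] = begin
    -ᴷ (suc (suc (a ℕ.+ b)) ×ᴷ 1#)               ≡⟨ cong (λ k → -ᴷ (suc k ×ᴷ 1#)) (ℕₚ.+-suc a b) ⟨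
    -ᴷ ((suc a ℕ.+ suc b) ×ᴷ 1#)                 ≈⟨ -‿cong (×ᴷ-homo-+ 1# (suc a) (suc b)) ⟩
    -ᴷ (suc a ×ᴷ 1# +ᴷ suc b ×ᴷ 1#)              ≈⟨ -‿+-comm _ _ ⟨
    -ᴷ (suc a ×ᴷ 1#) -ᴷ suc b ×ᴷ 1#              ∎

  ι-ℤ-*⁺ : ∀ a b → ι-ℤ (+ a ℤ.* b) ≈ ι-ℤ (+ a) *ᴷ ι-ℤ b
  ι-ℤ-*⁺ a (+ b) = ≈-trans (ι-ℤ-cong (sym (ℤₚ.pos-* a b))) (×1-homo-* a b)
  ι-ℤ-*⁺ a -[1+ b ] = begin
    ι-ℤ (+ a ℤ.* -[1+ b ])                       ≡⟨ cong ι-ℤ (ℤₚ.neg-distribʳ-* (+ a) (+ suc b)) ⟨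
    ι-ℤ (ℤ.- (+ a ℤ.* + suc b))                  ≈⟨ ι-ℤ-neg (+ a ℤ.* + suc b) ⟩
    -ᴷ ι-ℤ (+ a ℤ.* + suc b)                     ≈⟨ -‿cong (ι-ℤ-*⁺ a (+ suc b)) ⟩
    -ᴷ (ι-ℤ (+ a) *ᴷ ι-ℤ (+ suc b))              ≈⟨ -‿distribʳ-* _ _ ⟩
    ι-ℤ (+ a) *ᴷ ι-ℤ -[1+ b ]                    ∎

  ι-ℤ-* : ∀ a b → ι-ℤ (a ℤ.* b) ≈ ι-ℤ a *ᴷ ι-ℤ b
  ι-ℤ-* (+ a) b = ι-ℤ-*⁺ a b
  ι-ℤ-* -[1+ a ] b = begin
    ι-ℤ (-[1+ a ] ℤ.* b)                         ≡⟨ cong ι-ℤ (ℤₚ.neg-distribˡ-* (+ suc a) b) ⟨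
    ι-ℤ (ℤ.- (+ suc a ℤ.* b))                    ≈⟨ ι-ℤ-neg (+ suc a ℤ.* b) ⟩
    -ᴷ ι-ℤ (+ suc a ℤ.* b)                       ≈⟨ -‿cong (ι-ℤ-*⁺ (suc a) b) ⟩
    -ᴷ (ι-ℤ (+ suc a) *ᴷ ι-ℤ b)                  ≈⟨ -‿distribˡ-* _ _ ⟩
    ι-ℤ -[1+ a ] *ᴷ ι-ℤ b                        ∎

  ι-ℤ-1 : ι-ℤ 1ℤ ≈ 1#
  ι-ℤ-1 = +-identityʳ 1#

  -- Equality in the field need not be decidable, so the solver takes its coefficients from ℤ.
  ι-ℤ-morphism : ℤ.+-*-rawRing -Raw-AlmostCommutative⟶ fromCommutativeRing 𝕜-ring
  ι-ℤ-morphism = record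
    { ⟦_⟧ = ι-ℤ ; +-homo = ι-ℤ-+ ; *-homo = ι-ℤ-* ; -‿homo = ι-ℤ-neg ; 0-homo = ≈-refl ; 1-homo = ι-ℤ-1 }

  ι-ℤ-weaklyDecidable : WeaklyDecidable (Induced-equivalence ι-ℤ-morphism)
  ι-ℤ-weaklyDecidable a b = Maybe.map ι-ℤ-cong (dec⇒maybe (a ℤ.≟ b))

  module 𝕜-Solver = Algebra.Solver.Ring ℤ.+-*-rawRing (fromCommutativeRing 𝕜-ring) ι-ℤ-morphism ι-ℤ-weaklyDecidable

  open 𝕜-Solver public using (solve; _:=_; _:+_; _:*_; _:-_; :-_) renaming (con to const)

  private
    D : ℕ → 𝕜
    D d = ι-ℤ (+ suc d)

    D⁻¹ : ℕ → 𝕜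
    D⁻¹ d = proj₁ (#⇒invertible (char0 d))

    D-inverse : ∀ d → D⁻¹ d *ᴷ D d ≈ 1#
    D-inverse d = ≈-trans (*-congˡ (≈-sym (≈-trans (+-congˡ -0#≈0#) (+-identityʳ _)))) (proj₁ (proj₂ (#⇒invertible (char0 d))))

  ι-ℤ-cancel : ∀ d {x y} → D d *ᴷ x ≈ D d *ᴷ y → x ≈ y
  ι-ℤ-cancel d {x} {y} eq = begin
    x                      ≈⟨ *-identityˡ x ⟨
    1# *ᴷ x                ≈⟨ *-congʳ (D-inverse d) ⟨
    D⁻¹ d *ᴷ D d *ᴷ x      ≈⟨ *-assoc _ _ _ ⟩
    D⁻¹ d *ᴷ (D d *ᴷ x)    ≈⟨ *-congˡ eq ⟩
    D⁻¹ d *ᴷ (D d *ᴷ y)    ≈⟨ *-assoc _ _ _ ⟨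
    D⁻¹ d *ᴷ D d *ᴷ y      ≈⟨ *-congʳ (D-inverse d) ⟩
    1# *ᴷ y                ≈⟨ *-identityˡ y ⟩
    y                      ∎

  ι-ℤ-torsionFree : ∀ a {x} → a ≢ 0ℤ → ι-ℤ a *ᴷ x ≈ 0# → x ≈ 0#
  ι-ℤ-torsionFree (+ zero)  a≢0 eq = contradiction refl a≢0
  ι-ℤ-torsionFree (+ suc d) a≢0 eq = ι-ℤ-cancel d (≈-trans eq (≈-sym (zeroʳ _)))
  ι-ℤ-torsionFree -[1+ d ] {x} a≢0 eq = ι-ℤ-cancel d (≈-trans
    (solve 2 (λ a b → a :* b := :- ((:- a) :* b)) ≈-refl (D d) x)
    (≈-trans (-‿cong eq) (≈-trans -0#≈0# (≈-sym (zeroʳ _)))))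

  private
    N : ℚ → 𝕜
    N q = ι-ℤ (ℚ.↥ q)

    Dℚ : ℚ → 𝕜
    Dℚ q = D (ℚ.ℚ.denominator-1 q)

  ι-denominator : ∀ q → Dℚ q *ᴷ ι q ≈ N q
  ι-denominator q = begin
    Dℚ q *ᴷ (N q *ᴷ D⁻¹ d)      ≈⟨ solve 3 (λ a b c → a :* (b :* c) := b :* (c :* a)) ≈-refl (Dℚ q) (N q) (D⁻¹ d) ⟩
    N q *ᴷ (D⁻¹ d *ᴷ Dℚ q)      ≈⟨ *-congˡ (D-inverse d) ⟩
    N q *ᴷ 1#                   ≈⟨ *-identityʳ _ ⟩
    N q                         ∎
    where d = ℚ.ℚ.denominator-1 q

  ι-fromℤ : ∀ a → ι (fromℤ a) ≈ ι-ℤ a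
  ι-fromℤ a = ι-ℤ-cancel 0 (≈-trans (ι-denominator (fromℤ a)) (≈-sym (≈-trans (*-congʳ ι-ℤ-1) (*-identityˡ _))))

  -- The equation is multiplied by the denominators of `p`, of `q` and of the normalised sum, and is
  -- then the image of `↥-+`. Cancelling them uses characteristic zero.
  ι-+ : ∀ p q → ι (p ℚ.+ q) ≈ ι p +ᴷ ι q
  ι-+ p q = ι-ℤ-cancel (dᵣ) (ι-ℤ-cancel dp (ι-ℤ-cancel dq (begin
    Dℚ q *ᴷ (Dℚ p *ᴷ (Dℚ r *ᴷ ι r))           ≈⟨ *-congˡ (*-congˡ (ι-denominator r)) ⟩
    Dℚ q *ᴷ (Dℚ p *ᴷ N r)                     ≈⟨ solve 3 (λ a b c → b :* (a :* c) := c :* (a :* b)) ≈-refl (Dℚ p) (Dℚ q) (N r) ⟩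
    N r *ᴷ (Dℚ p *ᴷ Dℚ q)                     ≈⟨ *-congˡ (ι-ℤ-* (ℚ.↧ p) (ℚ.↧ q)) ⟨
    N r *ᴷ ι-ℤ (ℚ.↧ p ℤ.* ℚ.↧ q)              ≈⟨ ι-ℤ-* (ℚ.↥ r) (ℚ.↧ p ℤ.* ℚ.↧ q) ⟨
    ι-ℤ (ℚ.↥ r ℤ.* (ℚ.↧ p ℤ.* ℚ.↧ q))         ≈⟨ ι-ℤ-cong (↥-+ p q) ⟩
    ι-ℤ ((ℚ.↥ p ℤ.* ℚ.↧ q ℤ.+ ℚ.↥ q ℤ.* ℚ.↧ p) ℤ.* ℚ.↧ r)  ≈⟨ ι-ℤ-* (ℚ.↥ p ℤ.* ℚ.↧ q ℤ.+ ℚ.↥ q ℤ.* ℚ.↧ p) (ℚ.↧ r) ⟩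
    ι-ℤ (ℚ.↥ p ℤ.* ℚ.↧ q ℤ.+ ℚ.↥ q ℤ.* ℚ.↧ p) *ᴷ Dℚ r
      ≈⟨ *-congʳ (≈-trans (ι-ℤ-+ (ℚ.↥ p ℤ.* ℚ.↧ q) (ℚ.↥ q ℤ.* ℚ.↧ p)) (+-cong (ι-ℤ-* (ℚ.↥ p) (ℚ.↧ q)) (ι-ℤ-* (ℚ.↥ q) (ℚ.↧ p)))) ⟩
    (N p *ᴷ Dℚ q +ᴷ N q *ᴷ Dℚ p) *ᴷ Dℚ r
      ≈⟨ *-congʳ (+-cong (*-congʳ (ι-denominator p)) (*-congʳ (ι-denominator q))) ⟨
    (Dℚ p *ᴷ ι p *ᴷ Dℚ q +ᴷ Dℚ q *ᴷ ι q *ᴷ Dℚ p) *ᴷ Dℚ r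
      ≈⟨ solve 5 (λ a b c x y → (a :* x :* b :+ b :* y :* a) :* c := b :* (a :* (c :* (x :+ y)))) ≈-refl (Dℚ p) (Dℚ q) (Dℚ r) (ι p) (ι q) ⟩
    Dℚ q *ᴷ (Dℚ p *ᴷ (Dℚ r *ᴷ (ι p +ᴷ ι q)))  ∎)))
    where
    r = p ℚ.+ q
    dᵣ = ℚ.ℚ.denominator-1 r
    dp = ℚ.ℚ.denominator-1 p
    dq = ℚ.ℚ.denominator-1 q

  ι-* : ∀ p q → ι (p ℚ.* q) ≈ ι p *ᴷ ι q
  ι-* p q = ι-ℤ-cancel (dᵣ) (ι-ℤ-cancel dp (ι-ℤ-cancel dq (begin
    Dℚ q *ᴷ (Dℚ p *ᴷ (Dℚ r *ᴷ ι r))           ≈⟨ *-congˡ (*-congˡ (ι-denominator r)) ⟩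
    Dℚ q *ᴷ (Dℚ p *ᴷ N r)                     ≈⟨ solve 3 (λ a b c → b :* (a :* c) := c :* (a :* b)) ≈-refl (Dℚ p) (Dℚ q) (N r) ⟩
    N r *ᴷ (Dℚ p *ᴷ Dℚ q)                     ≈⟨ *-congˡ (ι-ℤ-* (ℚ.↧ p) (ℚ.↧ q)) ⟨
    N r *ᴷ ι-ℤ (ℚ.↧ p ℤ.* ℚ.↧ q)              ≈⟨ ι-ℤ-* (ℚ.↥ r) (ℚ.↧ p ℤ.* ℚ.↧ q) ⟨
    ι-ℤ (ℚ.↥ r ℤ.* (ℚ.↧ p ℤ.* ℚ.↧ q))         ≈⟨ ι-ℤ-cong (↥-* p q) ⟩
    ι-ℤ ((ℚ.↥ p ℤ.* ℚ.↥ q) ℤ.* ℚ.↧ r)         ≈⟨ ι-ℤ-* (ℚ.↥ p ℤ.* ℚ.↥ q) (ℚ.↧ r) ⟩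
    ι-ℤ (ℚ.↥ p ℤ.* ℚ.↥ q) *ᴷ Dℚ r             ≈⟨ *-congʳ (ι-ℤ-* (ℚ.↥ p) (ℚ.↥ q)) ⟩
    (N p *ᴷ N q) *ᴷ Dℚ r                      ≈⟨ *-congʳ (*-cong (ι-denominator p) (ι-denominator q)) ⟨
    (Dℚ p *ᴷ ι p *ᴷ (Dℚ q *ᴷ ι q)) *ᴷ Dℚ r
      ≈⟨ solve 5 (λ a b c x y → (a :* x :* (b :* y)) :* c := b :* (a :* (c :* (x :* y)))) ≈-refl (Dℚ p) (Dℚ q) (Dℚ r) (ι p) (ι q) ⟩
    Dℚ q *ᴷ (Dℚ p *ᴷ (Dℚ r *ᴷ (ι p *ᴷ ι q)))  ∎)))
    where
    r = p ℚ.* q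
    dᵣ = ℚ.ℚ.denominator-1 r
    dp = ℚ.ℚ.denominator-1 p
    dq = ℚ.ℚ.denominator-1 q

  ι-neg : ∀ p → ι (ℚ.- p) ≈ -ᴷ ι p
  ι-neg p = begin
    ι (ℚ.- p)                        ≈⟨ solve 2 (λ a b → a := (a :+ b) :- b) ≈-refl (ι (ℚ.- p)) (ι p) ⟩
    (ι (ℚ.- p) +ᴷ ι p) -ᴷ ι p        ≈⟨ +-congʳ (ι-+ (ℚ.- p) p) ⟨
    ι (ℚ.- p ℚ.+ p) -ᴷ ι p           ≡⟨ cong (λ q → ι q -ᴷ ι p) (ℚₚ.+-inverseˡ p) ⟩
    ι 0ℚ -ᴷ ι p                      ≈⟨ +-congʳ (ι-fromℤ 0ℤ) ⟩
    0# -ᴷ ι p                        ≈⟨ +-identityˡ _ ⟩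
    -ᴷ ι p                           ∎

  -- Apartness is stronger than the negation of equality; it is obtained from the explicit inverse
  -- `ι (inv p)`.
  ι-#0 : ∀ {p} → p ≢ 0ℚ → ι p # 0#
  ι-#0 {p} p≢0 = invertible⇒# (ι (inv p) , ≈-trans (*-comm _ _) right , right)
    where
    right : (ι p -ᴷ 0#) *ᴷ ι (inv p) ≈ 1#
    right = begin
      (ι p -ᴷ 0#) *ᴷ ι (inv p)    ≈⟨ *-congʳ (≈-trans (+-congˡ -0#≈0#) (+-identityʳ _)) ⟩
      ι p *ᴷ ι (inv p)            ≈⟨ ι-* p (inv p) ⟨
      ι (p ℚ.* inv p)             ≡⟨ cong ι (inv-inverse p≢0) ⟩
      ι 1ℚ                        ≈⟨ ≈-trans (ι-fromℤ 1ℤ) ι-ℤ-1 ⟩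
      1#                          ∎

  #⇒≉ : ∀ {x y} → x # y → ¬ x ≈ y
  #⇒≉ x#y x≈y = #-irrefl x≈y x#y

  1≉0 : ¬ 1# ≈ 0#
  1≉0 1≈0 = #⇒≉ (char0 0) (≈-trans (+-identityʳ 1#) 1≈0)

-- Linear operators and their brackets

module Operators {c ℓ₁ ℓ₂} (K : HeytingField c ℓ₁ ℓ₂) (char0 : CharacteristicZero K) (I : Set) where

  open GroundField K char0
  open FieldDefs K char0 using (𝕜-ring; ι-ℤ)
  open Algebra.Properties.Ring (CommutativeRing.ring 𝕜-ring) using (-0#≈0#)
  open import Relation.Binary.Reasoning.Setoid (CommutativeRing.setoid 𝕜-ring)

  Vector : Set c
  Vector = I → 𝕜

  record Op : Set (c ⊔ ℓ₁) where
    no-eta-equality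
    field
      apply      : Vector → Vector
      apply-cong : ∀ {v w} → (∀ t → v t ≈ w t) → ∀ t → apply v t ≈ apply w t
      apply-+    : ∀ v w t → apply (λ s → v s +ᴷ w s) t ≈ apply v t +ᴷ apply w t
      apply-*    : ∀ k v t → apply (λ s → k *ᴷ v s) t ≈ k *ᴷ apply v t

    apply-neg : ∀ v t → apply (λ s → -ᴷ v s) t ≈ -ᴷ apply v t
    apply-neg v t = begin
      apply (λ s → -ᴷ v s) t              ≈⟨ apply-cong (λ s → solve 1 (λ a → :- a := const (ℤ.- 1ℤ) :* a) ≈-refl (v s)) t ⟩
      apply (λ s → ι-ℤ (ℤ.- 1ℤ) *ᴷ v s) t ≈⟨ apply-* (ι-ℤ (ℤ.- 1ℤ)) v t ⟩
      ι-ℤ (ℤ.- 1ℤ) *ᴷ apply v t           ≈⟨ solve 1 (λ a → const (ℤ.- 1ℤ) :* a := :- a) ≈-refl (apply v t) ⟩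
      -ᴷ apply v t                        ∎

    apply-minus : ∀ v w t → apply (λ s → v s -ᴷ w s) t ≈ apply v t -ᴷ apply w t
    apply-minus v w t = ≈-trans (apply-+ v (λ s → -ᴷ w s) t) (+-congˡ (apply-neg w t))

    apply-0 : ∀ t → apply (λ _ → 0#) t ≈ 0#
    apply-0 t = begin
      apply (λ _ → 0#) t              ≈⟨ apply-cong (λ _ → ≈-sym (zeroˡ 0#)) t ⟩
      apply (λ _ → 0# *ᴷ 0#) t        ≈⟨ apply-* 0# (λ _ → 0#) t ⟩
      0# *ᴷ apply (λ _ → 0#) t        ≈⟨ zeroˡ _ ⟩
      0#                              ∎

  open Op public

  infix 4 _≋_
  record _≋_ (A B : Op) : Set (c ⊔ ℓ₁) where
    constructor pointwise
    field at : ∀ v t → apply A v t ≈ apply B v t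

  open _≋_ public

  ≋-refl : ∀ {A} → A ≋ A
  ≋-refl = pointwise λ _ _ → ≈-refl

  ≋-reflexive : ∀ {A B} → A ≡ B → A ≋ B
  ≋-reflexive refl = ≋-refl

  ≋-sym : ∀ {A B} → A ≋ B → B ≋ A
  ≋-sym p = pointwise λ v t → ≈-sym (at p v t)

  ≋-trans : ∀ {A B C} → A ≋ B → B ≋ C → A ≋ C
  ≋-trans p q = pointwise λ v t → ≈-trans (at p v t) (at q v t)

  infixl 6 _+ᵒ_
  infixr 7 _·ᵒ_
  infix 8 -ᵒ_

  -- Opaque, so that the arguments of the operations can be inferred.
  opaque

    0ᵒ : Op
    0ᵒ = record
      { apply = λ _ _ → 0# ; apply-cong = λ _ _ → ≈-refl
      ; apply-+ = λ _ _ _ → ≈-sym (+-identityˡ 0#) ; apply-* = λ k _ _ → ≈-sym (zeroʳ k) }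

    _+ᵒ_ : Op → Op → Op
    A +ᵒ B = record
      { apply      = λ v t → apply A v t +ᴷ apply B v t
      ; apply-cong = λ v≈w t → +-cong (apply-cong A v≈w t) (apply-cong B v≈w t)
      ; apply-+    = λ v w t → ≈-trans (+-cong (apply-+ A v w t) (apply-+ B v w t))
          (solve 4 (λ a b c d → (a :+ b) :+ (c :+ d) := (a :+ c) :+ (b :+ d)) ≈-refl (apply A v t) (apply A w t) (apply B v t) (apply B w t))
      ; apply-*    = λ k v t → ≈-trans (+-cong (apply-* A k v t) (apply-* B k v t)) (≈-sym (distribˡ k _ _))
      }

    _·ᵒ_ : 𝕜 → Op → Op
    k ·ᵒ A = record
      { apply      = λ v t → k *ᴷ apply A v t
      ; apply-cong = λ v≈w t → *-congˡ (apply-cong A v≈w t)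
      ; apply-+    = λ v w t → ≈-trans (*-congˡ (apply-+ A v w t)) (distribˡ k _ _)
      ; apply-*    = λ l v t → ≈-trans (*-congˡ (apply-* A l v t))
          (solve 3 (λ k l a → k :* (l :* a) := l :* (k :* a)) ≈-refl k l (apply A v t))
      }

    -ᵒ_ : Op → Op
    -ᵒ A = record
      { apply      = λ v t → -ᴷ apply A v t
      ; apply-cong = λ v≈w t → -‿cong (apply-cong A v≈w t)
      ; apply-+    = λ v w t → ≈-trans (-‿cong (apply-+ A v w t))
          (solve 2 (λ a b → :- (a :+ b) := :- a :+ :- b) ≈-refl (apply A v t) (apply A w t))
      ; apply-*    = λ k v t → ≈-trans (-‿cong (apply-* A k v t))
          (solve 2 (λ k a → :- (k :* a) := k :* (:- a)) ≈-refl k (apply A v t))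
      }

    ⟦_,_⟧ : Op → Op → Op
    ⟦ A , B ⟧ = record
      { apply      = λ v t → apply A (apply B v) t -ᴷ apply B (apply A v) t
      ; apply-cong = λ v≈w t → +-cong (apply-cong A (apply-cong B v≈w) t) (-‿cong (apply-cong B (apply-cong A v≈w) t))
      ; apply-+    = λ v w t → ≈-trans
          (+-cong (≈-trans (apply-cong A (apply-+ B v w) t) (apply-+ A (apply B v) (apply B w) t))
            (-‿cong (≈-trans (apply-cong B (apply-+ A v w) t) (apply-+ B (apply A v) (apply A w) t))))
          (solve 4 (λ a b c d → (a :+ b) :- (c :+ d) := (a :- c) :+ (b :- d)) ≈-refl
            (apply A (apply B v) t) (apply A (apply B w) t) (apply B (apply A v) t) (apply B (apply A w) t))
      ; apply-*    = λ k v t → ≈-trans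
          (+-cong (≈-trans (apply-cong A (apply-* B k v) t) (apply-* A k (apply B v) t))
            (-‿cong (≈-trans (apply-cong B (apply-* A k v) t) (apply-* B k (apply A v) t))))
          (solve 3 (λ k a b → k :* a :- k :* b := k :* (a :- b)) ≈-refl k (apply A (apply B v) t) (apply B (apply A v) t))
      }

  opaque
    unfolding 0ᵒ _+ᵒ_ _·ᵒ_ -ᵒ_ ⟦_,_⟧

    apply-0ᵒ : ∀ v t → apply 0ᵒ v t ≡ 0#
    apply-0ᵒ v t = refl

    apply-+ᵒ : ∀ A B v t → apply (A +ᵒ B) v t ≡ apply A v t +ᴷ apply B v t
    apply-+ᵒ A B v t = refl

    apply-·ᵒ : ∀ k A v t → apply (k ·ᵒ A) v t ≡ k *ᴷ apply A v t
    apply-·ᵒ k A v t = refl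

    apply--ᵒ : ∀ A v t → apply (-ᵒ A) v t ≡ -ᴷ apply A v t
    apply--ᵒ A v t = refl

    apply-⟦⟧ : ∀ A B v t → apply ⟦ A , B ⟧ v t ≡ apply A (apply B v) t -ᴷ apply B (apply A v) t
    apply-⟦⟧ A B v t = refl

    +ᵒ-cong : ∀ {A A′ B B′} → A ≋ A′ → B ≋ B′ → A +ᵒ B ≋ A′ +ᵒ B′
    +ᵒ-cong p q = pointwise λ v t → +-cong (at p v t) (at q v t)

    ·ᵒ-cong : ∀ {k l A B} → k ≈ l → A ≋ B → k ·ᵒ A ≋ l ·ᵒ B
    ·ᵒ-cong k≈l p = pointwise λ v t → *-cong k≈l (at p v t)

    -ᵒ-cong : ∀ {A B} → A ≋ B → -ᵒ A ≋ -ᵒ B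
    -ᵒ-cong p = pointwise λ v t → -‿cong (at p v t)

    ⟦⟧-cong : ∀ {A A′ B B′} → A ≋ A′ → B ≋ B′ → ⟦ A , B ⟧ ≋ ⟦ A′ , B′ ⟧
    ⟦⟧-cong {A} {A′} {B} {B′} p q = pointwise λ v t → +-cong
      (≈-trans (at p (apply B v) t) (apply-cong A′ (at q v) t))
      (-‿cong (≈-trans (at q (apply A v) t) (apply-cong B′ (at p v) t)))

    antisymmetric : ∀ A B → ⟦ A , B ⟧ ≋ -ᵒ ⟦ B , A ⟧
    antisymmetric A B = pointwise λ v t → solve 2 (λ a b → a :- b := :- (b :- a)) ≈-refl (apply A (apply B v) t) (apply B (apply A v) t)

    ⟦⟧-self : ∀ A → ⟦ A , A ⟧ ≋ 0ᵒ
    ⟦⟧-self A = pointwise λ v t → -‿inverseʳ _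

    jacobi : ∀ A B C → ⟦ A , ⟦ B , C ⟧ ⟧ ≋ ⟦ ⟦ A , B ⟧ , C ⟧ +ᵒ ⟦ B , ⟦ A , C ⟧ ⟧
    jacobi A B C = pointwise λ v t → ≈-trans
      (+-congʳ (apply-minus A (apply B (apply C v)) (apply C (apply B v)) t))
      (≈-trans
        (solve 6 (λ abc acb bca cba bac cab → (abc :- acb) :- (bca :- cba) :=
           ((abc :- bac) :- (cab :- cba)) :+ ((bac :- bca) :- (acb :- cab))) ≈-refl
           (apply A (apply B (apply C v)) t) (apply A (apply C (apply B v)) t) (apply B (apply C (apply A v)) t)
           (apply C (apply B (apply A v)) t) (apply B (apply A (apply C v)) t) (apply C (apply A (apply B v)) t))
        (≈-sym (+-cong
          (+-congˡ (-‿cong (apply-minus C (apply A (apply B v)) (apply B (apply A v)) t)))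
          (+-congʳ (apply-minus B (apply A (apply C v)) (apply C (apply A v)) t)))))

    ⟦⟧-+ʳ : ∀ A B C → ⟦ A , B +ᵒ C ⟧ ≋ ⟦ A , B ⟧ +ᵒ ⟦ A , C ⟧
    ⟦⟧-+ʳ A B C = pointwise λ v t → ≈-trans (+-congʳ (apply-+ A (apply B v) (apply C v) t))
      (solve 4 (λ a b c d → (a :+ b) :- (c :+ d) := (a :- c) :+ (b :- d)) ≈-refl
        (apply A (apply B v) t) (apply A (apply C v) t) (apply B (apply A v) t) (apply C (apply A v) t))

    ⟦⟧-·ʳ : ∀ A k B → ⟦ A , k ·ᵒ B ⟧ ≋ k ·ᵒ ⟦ A , B ⟧
    ⟦⟧-·ʳ A k B = pointwise λ v t → ≈-trans (+-congʳ (apply-* A k (apply B v) t))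
      (solve 3 (λ k a b → k :* a :- k :* b := k :* (a :- b)) ≈-refl k (apply A (apply B v) t) (apply B (apply A v) t))

    ⟦⟧--ʳ : ∀ A B → ⟦ A , -ᵒ B ⟧ ≋ -ᵒ ⟦ A , B ⟧
    ⟦⟧--ʳ A B = pointwise λ v t → ≈-trans (+-congʳ (apply-neg A (apply B v) t))
      (solve 2 (λ a b → (:- a) :- (:- b) := :- (a :- b)) ≈-refl (apply A (apply B v) t) (apply B (apply A v) t))

    ⟦⟧-+ˡ : ∀ A B C → ⟦ A +ᵒ B , C ⟧ ≋ ⟦ A , C ⟧ +ᵒ ⟦ B , C ⟧
    ⟦⟧-+ˡ A B C = pointwise λ v t → ≈-trans (+-congˡ (-‿cong (apply-+ C (apply A v) (apply B v) t)))
      (solve 4 (λ a b c d → (a :+ b) :- (c :+ d) := (a :- c) :+ (b :- d)) ≈-refl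
        (apply A (apply C v) t) (apply B (apply C v) t) (apply C (apply A v) t) (apply C (apply B v) t))

    ⟦⟧-·ˡ : ∀ k A B → ⟦ k ·ᵒ A , B ⟧ ≋ k ·ᵒ ⟦ A , B ⟧
    ⟦⟧-·ˡ k A B = pointwise λ v t → ≈-trans (+-congˡ (-‿cong (apply-* B k (apply A v) t)))
      (solve 3 (λ k a b → k :* a :- k :* b := k :* (a :- b)) ≈-refl k (apply A (apply B v) t) (apply B (apply A v) t))

    ⟦⟧--ˡ : ∀ A B → ⟦ -ᵒ A , B ⟧ ≋ -ᵒ ⟦ A , B ⟧
    ⟦⟧--ˡ A B = pointwise λ v t → ≈-trans (+-congˡ (-‿cong (apply-neg B (apply A v) t)))
      (solve 2 (λ a b → (:- a) :- (:- b) := :- (a :- b)) ≈-refl (apply A (apply B v) t) (apply B (apply A v) t))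

    -ᵒ-zero : ∀ {A} → A ≋ 0ᵒ → -ᵒ A ≋ 0ᵒ
    -ᵒ-zero p = pointwise λ v t → ≈-trans (-‿cong (at p v t)) -0#≈0#

    -ᵒ-involutive : ∀ A → -ᵒ (-ᵒ A) ≋ A
    -ᵒ-involutive A = pointwise λ v t → solve 1 (λ a → :- (:- a) := a) ≈-refl (apply A v t)

    +ᵒ-zeroˡ : ∀ {A B} → A ≋ 0ᵒ → A +ᵒ B ≋ B
    +ᵒ-zeroˡ p = pointwise λ v t → ≈-trans (+-congʳ (at p v t)) (+-identityˡ _)

    +ᵒ-zeroʳ : ∀ {A B} → B ≋ 0ᵒ → A +ᵒ B ≋ A
    +ᵒ-zeroʳ p = pointwise λ v t → ≈-trans (+-congˡ (at p v t)) (+-identityʳ _)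

    ·ᵒ-zero : ∀ {k A} → A ≋ 0ᵒ → k ·ᵒ A ≋ 0ᵒ
    ·ᵒ-zero p = pointwise λ v t → ≈-trans (*-congˡ (at p v t)) (zeroʳ _)

    0·ᵒ : ∀ {k A} → k ≈ 0# → k ·ᵒ A ≋ 0ᵒ
    0·ᵒ k≈0 = pointwise λ v t → ≈-trans (*-congʳ k≈0) (zeroˡ _)

    ⟦⟧-zeroʳ : ∀ A {B} → B ≋ 0ᵒ → ⟦ A , B ⟧ ≋ 0ᵒ
    ⟦⟧-zeroʳ A {B} p = pointwise λ v t → ≈-trans
      (+-cong (≈-trans (apply-cong A (at p v) t) (apply-0 A t)) (-‿cong (at p (apply A v) t)))
      (-‿inverseʳ 0#)

    torsionFree : ∀ a {A} → a ≢ 0ℤ → ι-ℤ a ·ᵒ A ≋ 0ᵒ → A ≋ 0ᵒ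
    torsionFree a a≢0 p = pointwise λ v t → ι-ℤ-torsionFree a a≢0 (at p v t)

    ·ᵒ-+ : ∀ k l A → (k ·ᵒ A) +ᵒ (l ·ᵒ A) ≋ (k +ᴷ l) ·ᵒ A
    ·ᵒ-+ k l A = pointwise λ v t → ≈-sym (distribʳ _ k l)

    ·ᵒ-- : ∀ k A → -ᵒ (k ·ᵒ A) ≋ (-ᴷ k) ·ᵒ A
    ·ᵒ-- k A = pointwise λ v t → solve 2 (λ k a → :- (k :* a) := (:- k) :* a) ≈-refl k (apply A v t)

    1·ᵒ : ∀ A → 1# ·ᵒ A ≋ A
    1·ᵒ A = pointwise λ v t → *-identityˡ _

    -ᵒ-+ : ∀ A B → -ᵒ (A +ᵒ B) ≋ -ᵒ A +ᵒ -ᵒ B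
    -ᵒ-+ A B = pointwise λ v t → solve 2 (λ a b → :- (a :+ b) := (:- a) :+ (:- b)) ≈-refl (apply A v t) (apply B v t)

    -ᵒ-· : ∀ k A → -ᵒ (k ·ᵒ A) ≋ k ·ᵒ (-ᵒ A)
    -ᵒ-· k A = pointwise λ v t → solve 2 (λ k a → :- (k :* a) := k :* (:- a)) ≈-refl k (apply A v t)

    combination-neg : ∀ k l A B → k ·ᵒ (-ᵒ A) +ᵒ (-ᴷ l) ·ᵒ (-ᵒ B) ≋ l ·ᵒ B +ᵒ (-ᴷ k) ·ᵒ A
    combination-neg k l A B = pointwise λ v t →
      solve 4 (λ k l a b → k :* (:- a) :+ (:- l) :* (:- b) := l :* b :+ (:- k) :* a) ≈-refl k l (apply A v t) (apply B v t)

    -- The last step of `bracket-closed`: the scalars are Kronecker symbols there, and the terms of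
    -- `B` and `C`, which belong to the intermediate index, cancel.
    jacobi-combination : ∀ k l p q A B C E →
      (k ·ᵒ (A +ᵒ (-ᴷ l) ·ᵒ B) +ᵒ (-ᴷ p) ·ᵒ (q ·ᵒ C)) +ᵒ -ᵒ (q ·ᵒ ((-ᴷ p) ·ᵒ C) +ᵒ (-ᴷ l) ·ᵒ (k ·ᵒ B +ᵒ -ᵒ E)) ≋
      k ·ᵒ A +ᵒ (-ᴷ l) ·ᵒ E
    jacobi-combination k l p q A B C E = pointwise λ v t →
      solve 8 (λ k l p q a b c e →
          (k :* (a :+ (:- l) :* b) :+ (:- p) :* (q :* c)) :+ :- (q :* ((:- p) :* c) :+ (:- l) :* (k :* b :+ :- e)) :=
          k :* a :+ (:- l) :* e) ≈-refl k l p q (apply A v t) (apply B v t) (apply C v t) (apply E v t)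

    jacobi-nested : ∀ A B C → ⟦ ⟦ A , B ⟧ , C ⟧ ≋ ⟦ A , ⟦ B , C ⟧ ⟧ +ᵒ -ᵒ ⟦ B , ⟦ A , C ⟧ ⟧
    jacobi-nested A B C = pointwise λ v t → ≈-sym (≈-trans (+-congʳ (at (jacobi A B C) v t))
      (solve 2 (λ a b → (a :+ b) :+ :- b := a) ≈-refl (apply ⟦ ⟦ A , B ⟧ , C ⟧ v t) (apply ⟦ B , ⟦ A , C ⟧ ⟧ v t)))

    ≋-neg⇒0 : ∀ {A} → A ≋ -ᵒ A → A ≋ 0ᵒ
    ≋-neg⇒0 {A} p = torsionFree (+ 2) (λ ()) (pointwise λ v t → begin
      ι-ℤ (+ 2) *ᴷ apply A v t           ≈⟨ solve 1 (λ a → const (+ 2) :* a := a :+ a) ≈-refl (apply A v t) ⟩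
      apply A v t +ᴷ apply A v t         ≈⟨ +-congˡ (at p v t) ⟩
      apply A v t -ᴷ apply A v t         ≈⟨ -‿inverseʳ _ ⟩
      0#                                 ∎)

  ⟦⟧-congˡ : ∀ {A B B′} → B ≋ B′ → ⟦ A , B ⟧ ≋ ⟦ A , B′ ⟧
  ⟦⟧-congˡ {A} = ⟦⟧-cong {A} ≋-refl

  ⟦⟧-congʳ : ∀ {A A′ B} → A ≋ A′ → ⟦ A , B ⟧ ≋ ⟦ A′ , B ⟧
  ⟦⟧-congʳ {B = B} p = ⟦⟧-cong {B = B} p ≋-refl

  ⟦⟧-zeroˡ : ∀ {A} B → A ≋ 0ᵒ → ⟦ A , B ⟧ ≋ 0ᵒ
  ⟦⟧-zeroˡ {A} B p = ≋-trans (antisymmetric A B) (-ᵒ-zero (⟦⟧-zeroʳ B p))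

  ⟦⟧-swap-zero : ∀ {A B} → ⟦ A , B ⟧ ≋ 0ᵒ → ⟦ B , A ⟧ ≋ 0ᵒ
  ⟦⟧-swap-zero {A} {B} p = ≋-trans (antisymmetric B A) (-ᵒ-zero p)

  jacobi-zeroˡ : ∀ {A B} C → ⟦ A , B ⟧ ≋ 0ᵒ → ⟦ A , ⟦ B , C ⟧ ⟧ ≋ ⟦ B , ⟦ A , C ⟧ ⟧
  jacobi-zeroˡ {A} {B} C p = ≋-trans (jacobi A B C) (+ᵒ-zeroˡ (⟦⟧-zeroˡ C p))

  jacobi-zeroʳ : ∀ {A} B {C} → ⟦ A , C ⟧ ≋ 0ᵒ → ⟦ A , ⟦ B , C ⟧ ⟧ ≋ ⟦ ⟦ A , B ⟧ , C ⟧
  jacobi-zeroʳ {A} B {C} p = ≋-trans (jacobi A B C) (+ᵒ-zeroʳ (⟦⟧-zeroʳ B p))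

  jacobi-zero : ∀ {A B C} → ⟦ A , B ⟧ ≋ 0ᵒ → ⟦ A , C ⟧ ≋ 0ᵒ → ⟦ A , ⟦ B , C ⟧ ⟧ ≋ 0ᵒ
  jacobi-zero {A} {B} {C} p q = ≋-trans (jacobi-zeroˡ C p) (⟦⟧-zeroʳ B q)

  opSetoid : Setoid _ _
  opSetoid = record
    { Carrier = Op ; _≈_ = _≋_
    ; isEquivalence = record { refl = ≋-refl ; sym = ≋-sym ; trans = ≋-trans } }

  module ≋-Reasoning = Relation.Binary.Reasoning.Setoid opSetoid

-- The adjoint action of an 𝔰𝔩₂-triple

module GLRelations {c ℓ₁ ℓ₂} (K : HeytingField c ℓ₁ ℓ₂) (char0 : CharacteristicZero K) (I : Set) where

  open GroundField K char0
  open FieldDefs K char0 using (𝕜-ring; ι-ℤ)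
  open Operators K char0 I
  open Algebra.Properties.Ring (CommutativeRing.ring 𝕜-ring) using (-0#≈0#)

  opaque

    δ : ℕ → ℕ → 𝕜
    δ a b = if does (a ℕ.≟ b) then 1# else 0#

    δ-≡ : ∀ {a b} → a ≡ b → δ a b ≈ 1#
    δ-≡ {a} refl rewrite dec-true (a ℕ.≟ a) refl = ≈-refl

    δ-≢ : ∀ {a b} → a ≢ b → δ a b ≈ 0#
    δ-≢ {a} {b} a≢b rewrite dec-false (a ℕ.≟ b) a≢b = ≈-refl

  adᴺ : Op → ℕ → Op → Op
  adᴺ e zero    v = v
  adᴺ e (suc N) v = ⟦ e , adᴺ e N v ⟧

  -- v is a vector of weight -κ killed by z for the adjoint action of the
  -- 𝔰𝔩₂-triple (e , -z , h), so ad(e)^{κ+1} v is killed by z, too, and has the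
  -- positive weight κ + 2.  Being ad(e)-nilpotent, it vanishes.
  module _ {e z h : Op} (ez : ⟦ e , z ⟧ ≋ -ᵒ h) (he : ⟦ h , e ⟧ ≋ ι-ℤ (+ 2) ·ᵒ e)
           {v : Op} (κ : ℤ) (zv : ⟦ z , v ⟧ ≋ 0ᵒ) (hv : ⟦ h , v ⟧ ≋ ι-ℤ (ℤ.- κ) ·ᵒ v) where

    private
      w : ℕ → Op
      w j = adᴺ e j v

      hw : ∀ j → ⟦ h , w j ⟧ ≋ ι-ℤ (+ j ℤ.+ + j ℤ.- κ) ·ᵒ w j
      hw zero    = ≋-trans hv (·ᵒ-cong (ι-ℤ-cong (sym (ℤₚ.+-identityˡ (ℤ.- κ)))) ≋-refl)
      hw (suc j) = begin
        ⟦ h , ⟦ e , w j ⟧ ⟧                                       ≈⟨ jacobi h e (w j) ⟩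
        ⟦ ⟦ h , e ⟧ , w j ⟧ +ᵒ ⟦ e , ⟦ h , w j ⟧ ⟧                ≈⟨ +ᵒ-cong (≋-trans (⟦⟧-congʳ he) (⟦⟧-·ˡ _ e (w j)))
                                                                       (≋-trans (⟦⟧-congˡ (hw j)) (⟦⟧-·ʳ e _ (w j))) ⟩
        ι-ℤ (+ 2) ·ᵒ w (suc j) +ᵒ ι-ℤ (+ j ℤ.+ + j ℤ.- κ) ·ᵒ w (suc j)  ≈⟨ ·ᵒ-+ _ _ _ ⟩
        (ι-ℤ (+ 2) +ᴷ ι-ℤ (+ j ℤ.+ + j ℤ.- κ)) ·ᵒ w (suc j)       ≈⟨ ·ᵒ-cong (≈-trans (≈-sym (ι-ℤ-+ (+ 2) (+ j ℤ.+ + j ℤ.- κ))) (ι-ℤ-cong (identity (+ j) κ))) ≋-refl ⟩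
        ι-ℤ (+ suc j ℤ.+ + suc j ℤ.- κ) ·ᵒ w (suc j)              ∎
        where
        open ≋-Reasoning
        identity : ∀ j κ → + 2 ℤ.+ (j ℤ.+ j ℤ.- κ) ≡ (1ℤ ℤ.+ j) ℤ.+ (1ℤ ℤ.+ j) ℤ.- κ
        identity = solve-∀

      ze : ⟦ z , e ⟧ ≋ h
      ze = ≋-trans (antisymmetric z e) (≋-trans (-ᵒ-cong ez) (-ᵒ-involutive h))

      -- Moving `z` past each `e` leaves `h`, which acts by the weight `2 l - κ`; these weights for
      -- `l ≤ j` add up to `(j + 1)(j - κ)`.
      zw : ∀ j → ⟦ z , w (suc j) ⟧ ≋ ι-ℤ (+ suc j ℤ.* (+ j ℤ.- κ)) ·ᵒ w j
      zw zero    = ≋-trans (jacobi-zeroʳ e zv) (≋-trans (⟦⟧-congʳ ze) (≋-trans hv (·ᵒ-cong (ι-ℤ-cong (identity κ)) ≋-refl)))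
        where
        identity : ∀ κ → ℤ.- κ ≡ 1ℤ ℤ.* (0ℤ ℤ.- κ)
        identity = solve-∀
      zw (suc j) = begin
        ⟦ z , ⟦ e , w (suc j) ⟧ ⟧                                 ≈⟨ jacobi z e (w (suc j)) ⟩
        ⟦ ⟦ z , e ⟧ , w (suc j) ⟧ +ᵒ ⟦ e , ⟦ z , w (suc j) ⟧ ⟧    ≈⟨ +ᵒ-cong (≋-trans (⟦⟧-congʳ ze) (hw (suc j)))
                                                                       (≋-trans (⟦⟧-congˡ (zw j)) (⟦⟧-·ʳ e _ (w j))) ⟩
        ι-ℤ (+ suc j ℤ.+ + suc j ℤ.- κ) ·ᵒ w (suc j) +ᵒ ι-ℤ (+ suc j ℤ.* (+ j ℤ.- κ)) ·ᵒ w (suc j)  ≈⟨ ·ᵒ-+ _ _ _ ⟩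
        (ι-ℤ (+ suc j ℤ.+ + suc j ℤ.- κ) +ᴷ ι-ℤ (+ suc j ℤ.* (+ j ℤ.- κ))) ·ᵒ w (suc j)
          ≈⟨ ·ᵒ-cong (≈-trans (≈-sym (ι-ℤ-+ (+ suc j ℤ.+ + suc j ℤ.- κ) (+ suc j ℤ.* (+ j ℤ.- κ)))) (ι-ℤ-cong (identity (+ j) κ))) ≋-refl ⟩
        ι-ℤ (+ suc (suc j) ℤ.* (+ suc j ℤ.- κ)) ·ᵒ w (suc j)      ∎
        where
        open ≋-Reasoning
        identity : ∀ j κ → ((1ℤ ℤ.+ j) ℤ.+ (1ℤ ℤ.+ j) ℤ.- κ) ℤ.+ (1ℤ ℤ.+ j) ℤ.* (j ℤ.- κ) ≡ (+ 2 ℤ.+ j) ℤ.* ((1ℤ ℤ.+ j) ℤ.- κ)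
        identity = solve-∀

      -- A descent from a power known to vanish: applying `z` to `w (suc j) ≋ 0ᵒ` gives a multiple
      -- of `w j`, whose coefficient is zero only at `j = κ`. So vanishing passes down as long as
      -- `j` avoids `κ`.
      below : ∀ k {N} → w (k ℕ.+ suc N) ≋ 0ᵒ → (∀ j → N ℕ.< j → + j ≢ κ) → w (suc N) ≋ 0ᵒ
      below zero        w≋0 _   = w≋0
      below (suc k) {N} w≋0 j≢κ = below k {N} (torsionFree _ nonzero
          (≋-trans (≋-sym (zw (k ℕ.+ suc N))) (⟦⟧-zeroʳ z w≋0))) j≢κ
        where
        nonzero : + suc (k ℕ.+ suc N) ℤ.* (+ (k ℕ.+ suc N) ℤ.- κ) ≢ 0ℤ
        nonzero eq with ℤₚ.i*j≡0⇒i≡0∨j≡0 (+ suc (k ℕ.+ suc N)) eq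
        ... | inj₁ ()
        ... | inj₂ eq′ = j≢κ (k ℕ.+ suc N) (ℕₚ.m≤n+m (suc N) k) (ℤₚ.i-j≡0⇒i≡j (+ (k ℕ.+ suc N)) κ eq′)

    adᴺ-vanishes : ∀ N → (∀ j → N ℕ.< j → + j ≢ κ) → (∃[ M ] adᴺ e M v ≋ 0ᵒ) → adᴺ e (suc N) v ≋ 0ᵒ
    adᴺ-vanishes N j≢κ (M , vanish) with ℕₚ.≤-total M (suc N)
    ... | inj₁ M≤N = raise M≤N vanish
      where
      raise : ∀ {M N} → M ℕ.≤ N → w M ≋ 0ᵒ → w N ≋ 0ᵒ
      raise {M} {N} M≤N p = subst (λ N → w N ≋ 0ᵒ) (ℕₚ.m∸n+n≡m M≤N) (more (N ∸ M))
        where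
        more : ∀ k → w (k ℕ.+ M) ≋ 0ᵒ
        more zero    = p
        more (suc k) = ⟦⟧-zeroʳ e (more k)
    ... | inj₂ N<M = below (M ∸ suc N) (subst (λ M → w M ≋ 0ᵒ) (sym (ℕₚ.m∸n+n≡m N<M)) vanish) j≢κ

  -- nested z a k is the matrix unit E a (a + 1 + k), if z a is E a (a + 1).
  nested : (ℕ → Op) → ℕ → ℕ → Op
  nested z a zero    = z a
  nested z a (suc k) = ⟦ z a , nested z (suc a) k ⟧

  -- Nested brackets of operators that satisfy the Serre relations

  module Chain (z : ℕ → Op)
    (far    : ∀ {a b} → suc a ℕ.< b → ⟦ z a , z b ⟧ ≋ 0ᵒ)
    (serre⁺ : ∀ a → ⟦ z a , ⟦ z a , z (suc a) ⟧ ⟧ ≋ 0ᵒ)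
    (serre⁻ : ∀ a → ⟦ z (suc a) , ⟦ z a , z (suc a) ⟧ ⟧ ≋ 0ᵒ)
    where

    private
      F : ℕ → ℕ → Op
      F = nested z

    F-left : ∀ {i a} k → suc i ℕ.< a → ⟦ z i , F a k ⟧ ≋ 0ᵒ
    F-left zero    i<a = far i<a
    F-left (suc k) i<a = jacobi-zero (far i<a) (F-left k (ℕₚ.m<n⇒m<1+n i<a))

    F-right : ∀ {i} a k → suc (a ℕ.+ k) ℕ.< i → ⟦ z i , F a k ⟧ ≋ 0ᵒ
    F-right {i} a zero    a<i = ⟦⟧-swap-zero (far (subst (λ a → suc a ℕ.< i) (ℕₚ.+-identityʳ a) a<i))
    F-right {i} a (suc k) a<i = jacobi-zero
      (⟦⟧-swap-zero (far (ℕₚ.≤-<-trans (s≤s (ℕₚ.m≤m+n a (suc k))) a<i)))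
      (F-right (suc a) k (subst (λ b → suc b ℕ.< i) (ℕₚ.+-suc a k) a<i))

    F-extend : ∀ a k → ⟦ z (suc (a ℕ.+ k)) , F a k ⟧ ≋ -ᵒ F a (suc k)
    F-extend a zero    = subst (λ b → ⟦ z (suc b) , z a ⟧ ≋ -ᵒ F a 1) (sym (ℕₚ.+-identityʳ a)) (antisymmetric (z (suc a)) (z a))
    F-extend a (suc k) = subst (λ b → ⟦ z (suc b) , F a (suc k) ⟧ ≋ -ᵒ F a (suc (suc k))) (sym (ℕₚ.+-suc a k))
      (≋-trans (jacobi-zeroˡ (F (suc a) k) (⟦⟧-swap-zero (far (s≤s (s≤s (ℕₚ.m≤m+n a k))))))
        (≋-trans (⟦⟧-congˡ (F-extend (suc a) k)) (⟦⟧--ʳ (z a) (F (suc a) (suc k)))))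

    -- In a longer bracket `z a` and `z (suc a)` are first bracketed with each other. With this
    -- bracket `z a` commutes by `serre⁺`, and with the remaining part because its indices are far
    -- away.
    F-first : ∀ a k → ⟦ z a , F a k ⟧ ≋ 0ᵒ
    F-first a zero          = ⟦⟧-self (z a)
    F-first a (suc zero)    = serre⁺ a
    F-first a (suc (suc k)) = ≋-trans
      (⟦⟧-congˡ (jacobi-zeroʳ (z (suc a)) far′))
      (jacobi-zero (serre⁺ a) far′)
      where
      far′ : ⟦ z a , F (suc (suc a)) k ⟧ ≋ 0ᵒ
      far′ = F-left k ℕₚ.≤-refl

    -- With b = z (a + 1) and E = F (a + 2) k the bracket Z = [b, [z a, [b, E]]]
    -- equals both [[b, z a], [b, E]] and [[z a, b], [b, E]].
    F-second : ∀ a k → ⟦ z (suc a) , F a (suc k) ⟧ ≋ 0ᵒ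
    F-second a zero    = serre⁻ a
    F-second a (suc k) = ≋-neg⇒0 (begin
      ⟦ b , ⟦ z a , ⟦ b , E ⟧ ⟧ ⟧                    ≈⟨ ⟦⟧-congˡ (jacobi-zeroʳ b (F-left k ℕₚ.≤-refl)) ⟩
      ⟦ b , ⟦ ⟦ z a , b ⟧ , E ⟧ ⟧                    ≈⟨ jacobi-zeroˡ E (serre⁻ a) ⟩
      ⟦ ⟦ z a , b ⟧ , ⟦ b , E ⟧ ⟧                    ≈⟨ ⟦⟧-congʳ (antisymmetric (z a) b) ⟩
      ⟦ -ᵒ ⟦ b , z a ⟧ , ⟦ b , E ⟧ ⟧                 ≈⟨ ⟦⟧--ˡ ⟦ b , z a ⟧ ⟦ b , E ⟧ ⟩
      -ᵒ ⟦ ⟦ b , z a ⟧ , ⟦ b , E ⟧ ⟧                 ≈⟨ -ᵒ-cong (jacobi-zeroʳ (z a) (F-first (suc a) (suc k))) ⟨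
      -ᵒ ⟦ b , ⟦ z a , ⟦ b , E ⟧ ⟧ ⟧                 ∎)
      where
      open ≋-Reasoning
      b = z (suc a)
      E = F (suc (suc a)) k

    F-inside : ∀ {i} a k → a ℕ.≤ i → i ℕ.≤ a ℕ.+ k → ⟦ z i , F a k ⟧ ≋ 0ᵒ
    F-inside {i} a k a≤i i≤ with ℕₚ.<-cmp a i
    ... | tri≈ _ refl _ = F-first a k
    ... | tri> _ _ i<a  = contradiction a≤i (ℕₚ.<⇒≱ i<a)
    F-inside {i} a zero a≤i i≤ | tri< a<i _ _ = contradiction (subst (i ℕ.≤_) (ℕₚ.+-identityʳ a) i≤) (ℕₚ.<⇒≱ a<i)
    F-inside {i} a (suc k) a≤i i≤ | tri< a<i _ _ with ℕₚ.<-cmp (suc a) i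
    ... | tri≈ _ refl _ = F-second a k
    ... | tri> _ _ i<a  = contradiction a<i (ℕₚ.<⇒≱ i<a)
    ... | tri< 1+a<i _ _ = jacobi-zero (⟦⟧-swap-zero (far 1+a<i))
      (F-inside (suc a) k a<i (subst (i ℕ.≤_) (ℕₚ.+-suc a k) i≤))

    -- Weights add along the nested bracket and telescope. The function `ω` is arbitrary, to allow
    -- for a single diagonal unit, its negative, or a difference of two.
    F-weight : ∀ {h} {ω : ℕ → 𝕜} → (∀ i → ⟦ h , z i ⟧ ≋ (ω i -ᴷ ω (suc i)) ·ᵒ z i) →
               ∀ a k → ⟦ h , F a k ⟧ ≋ (ω a -ᴷ ω (suc (a ℕ.+ k))) ·ᵒ F a k
    F-weight {h} {ω} hz a zero = ≋-trans (hz a) (·ᵒ-cong (+-congˡ (-‿cong (CommutativeRing.reflexive 𝕜-ring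
      (cong (ω ∘ suc) (sym (ℕₚ.+-identityʳ a)))))) ≋-refl)
    F-weight {h} {ω} hz a (suc k) = begin
      ⟦ h , ⟦ z a , F (suc a) k ⟧ ⟧                                             ≈⟨ jacobi h (z a) (F (suc a) k) ⟩
      ⟦ ⟦ h , z a ⟧ , F (suc a) k ⟧ +ᵒ ⟦ z a , ⟦ h , F (suc a) k ⟧ ⟧
        ≈⟨ +ᵒ-cong (≋-trans (⟦⟧-congʳ (hz a)) (⟦⟧-·ˡ _ (z a) (F (suc a) k)))
             (≋-trans (⟦⟧-congˡ (F-weight {ω = ω} hz (suc a) k)) (⟦⟧-·ʳ (z a) _ (F (suc a) k))) ⟩
      (ω a -ᴷ ω (suc a)) ·ᵒ F a (suc k) +ᵒ (ω (suc a) -ᴷ ω (suc (suc a ℕ.+ k))) ·ᵒ F a (suc k)   ≈⟨ ·ᵒ-+ _ _ _ ⟩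
      ((ω a -ᴷ ω (suc a)) +ᴷ (ω (suc a) -ᴷ ω (suc (suc a ℕ.+ k)))) ·ᵒ F a (suc k)
        ≈⟨ ·ᵒ-cong (≈-trans (solve 3 (λ a b c → (a :- b) :+ (b :- c) := a :- c) ≈-refl (ω a) (ω (suc a)) (ω (suc (suc a ℕ.+ k))))
             (CommutativeRing.reflexive 𝕜-ring (cong (λ b → ω a -ᴷ ω (suc b)) (sym (ℕₚ.+-suc a k))))) ≋-refl ⟩
      (ω a -ᴷ ω (suc (a ℕ.+ suc k))) ·ᵒ F a (suc k)   ∎
      where open ≋-Reasoning
-- From Chevalley generators to 𝔤𝔩ₙ

module ChevalleySystems {c ℓ₁ ℓ₂} (K : HeytingField c ℓ₁ ℓ₂) (char0 : CharacteristicZero K) (I : Set) where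

  open GroundField K char0
  open FieldDefs K char0 using (𝕜-ring; ι-ℤ)
  open Operators K char0 I
  open GLRelations K char0 I
  open Algebra.Properties.Ring (CommutativeRing.ring 𝕜-ring) using (-0#≈0#)

  -- The operators of E i (i + 1), -E (i + 1) i and E i i in a representation of
  -- 𝔤𝔩 (N + 1).  The sign makes the relations symmetric in x and z.
  record System (N : ℕ) (x z ε : ℕ → Op) : Set (c ⊔ ℓ₁) where
    field
      x-zero      : ∀ {i} → N ℕ.≤ i → x i ≋ 0ᵒ
      z-zero      : ∀ {i} → N ℕ.≤ i → z i ≋ 0ᵒ
      xz-≢        : ∀ {i j} → i ≢ j → ⟦ x i , z j ⟧ ≋ 0ᵒ
      xz-≡        : ∀ {i} → i ℕ.< N → ⟦ x i , z i ⟧ ≋ -ᵒ (ε i +ᵒ -ᵒ ε (suc i))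
      εε          : ∀ a b → ⟦ ε a , ε b ⟧ ≋ 0ᵒ
      εx          : ∀ a i → ⟦ ε a , x i ⟧ ≋ (δ a i -ᴷ δ a (suc i)) ·ᵒ x i
      εz          : ∀ a i → ⟦ ε a , z i ⟧ ≋ (-ᴷ (δ a i -ᴷ δ a (suc i))) ·ᵒ z i
      x-nilpotent : ∀ i v → ∃[ M ] adᴺ (x i) M v ≋ 0ᵒ
      z-nilpotent : ∀ i v → ∃[ M ] adᴺ (z i) M v ≋ 0ᵒ

  -- The automorphism `E a b ↦ - E b a` of 𝔤𝔩. Whatever is proved for `x` in every system thus holds
  -- for `z`.
  dual : ∀ {N x z ε} → System N x z ε → System N z x (λ a → -ᵒ ε a)
  dual {x = x} {z} {ε} S = record
    { x-zero = z-zero ; z-zero = x-zero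
    ; xz-≢ = λ i≢j → ⟦⟧-swap-zero (xz-≢ (i≢j ∘ sym))
    ; xz-≡ = λ {i} i<N → ≋-trans (antisymmetric (z i) (x i)) (-ᵒ-cong (≋-trans (xz-≡ i<N) (-ᵒ-+ (ε i) (-ᵒ ε (suc i)))))
    ; εε = λ a b → ≋-trans (⟦⟧--ˡ (ε a) (-ᵒ ε b)) (-ᵒ-zero (≋-trans (⟦⟧--ʳ (ε a) (ε b)) (-ᵒ-zero (εε a b))))
    ; εx = λ a i → ≋-trans (⟦⟧--ˡ (ε a) (z i)) (≋-trans (-ᵒ-cong (εz a i)) (≋-trans (·ᵒ-- _ _)
        (·ᵒ-cong (solve 1 (λ a → :- (:- a) := a) ≈-refl (δ a i -ᴷ δ a (suc i))) ≋-refl)))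
    ; εz = λ a i → ≋-trans (⟦⟧--ˡ (ε a) (x i)) (≋-trans (-ᵒ-cong (εx a i)) (·ᵒ-- _ _))
    ; x-nilpotent = z-nilpotent ; z-nilpotent = x-nilpotent
    }
    where open System S

  δ-≡ℤ : ∀ {a b} → a ≡ b → δ a b ≈ ι-ℤ 1ℤ
  δ-≡ℤ a≡b = ≈-trans (δ-≡ a≡b) (≈-sym ι-ℤ-1)

  -- The Serre relations

  module Serre {N x z ε} (S : System N x z ε) where

    open System S

    h : ℕ → Op
    h i = ε i +ᵒ -ᵒ ε (suc i)

    h-weight : ∀ i j → ⟦ h i , x j ⟧ ≋ ((δ i j -ᴷ δ i (suc j)) -ᴷ (δ (suc i) j -ᴷ δ (suc i) (suc j))) ·ᵒ x j
    h-weight i j = ≋-trans (⟦⟧-+ˡ (ε i) (-ᵒ ε (suc i)) (x j)) (≋-trans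
      (+ᵒ-cong (εx i j) (≋-trans (⟦⟧--ˡ (ε (suc i)) (x j)) (≋-trans (-ᵒ-cong (εx (suc i) j)) (·ᵒ-- _ _)))) (·ᵒ-+ _ _ _))

    private
      -- The vector is `x j`, which `z i` kills for `i ≢ j`. Its weight `- κ` under `h i` is an
      -- entry of the Cartan matrix, so `M = κ` gives the exponent of the Serre relation: one for
      -- distant indices, two for adjacent ones.
      vanish : ∀ {i j} κ M → i ≢ j → i ℕ.< N →
               (δ i j -ᴷ δ i (suc j)) -ᴷ (δ (suc i) j -ᴷ δ (suc i) (suc j)) ≈ ι-ℤ (ℤ.- κ) →
               (∀ l → M ℕ.< l → + l ≢ κ) → adᴺ (x i) (suc M) (x j) ≋ 0ᵒ
      vanish {i} {j} κ M i≢j i<N weight l≢κ = adᴺ-vanishes {h = h i} (xz-≡ i<N)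
        (≋-trans (h-weight i i) (·ᵒ-cong (≈-trans
          (+-cong (+-cong (δ-≡ℤ {i} refl) (-‿cong (δ-≢ {i} (ℕₚ.1+n≢n ∘ sym)))) (-‿cong (+-cong (δ-≢ {suc i} ℕₚ.1+n≢n) (-‿cong (δ-≡ℤ {suc i} refl)))))
          (solve 0 ((const 1ℤ :- const 0ℤ) :- (const 0ℤ :- const 1ℤ) := const (+ 2)) ≈-refl)) ≋-refl))
        κ (⟦⟧-swap-zero (xz-≢ (i≢j ∘ sym))) (≋-trans (h-weight i j) (·ᵒ-cong weight ≋-refl)) M l≢κ (x-nilpotent i (x j))

    commute : ∀ {i j} → i ≢ j → i ≢ suc j → suc i ≢ j → ⟦ x i , x j ⟧ ≋ 0ᵒ
    commute {i} {j} i≢j i≢1+j 1+i≢j with i ℕ.<? N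
    ... | no i≮N  = ⟦⟧-zeroˡ (x j) (x-zero (ℕₚ.≮⇒≥ i≮N))
    ... | yes i<N = vanish 0ℤ 0 i≢j i<N (≈-trans
      (+-cong (+-cong (δ-≢ i≢j) (-‿cong (δ-≢ i≢1+j))) (-‿cong (+-cong (δ-≢ 1+i≢j) (-‿cong (δ-≢ {suc i} {suc j} (i≢j ∘ ℕₚ.suc-injective))))))
      (solve 0 ((const 0ℤ :- const 0ℤ) :- (const 0ℤ :- const 0ℤ) := const 0ℤ) ≈-refl)) λ { (suc l) _ () }

    serre⁺ : ∀ i → ⟦ x i , ⟦ x i , x (suc i) ⟧ ⟧ ≋ 0ᵒ
    serre⁺ i with i ℕ.<? N
    ... | no i≮N  = ⟦⟧-zeroˡ _ (x-zero (ℕₚ.≮⇒≥ i≮N))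
    ... | yes i<N = vanish 1ℤ 1 (ℕₚ.1+n≢n ∘ sym) i<N (≈-trans
      (+-cong (+-cong (δ-≢ {i} {suc i} (ℕₚ.1+n≢n ∘ sym)) (-‿cong (δ-≢ {i} {suc (suc i)} (ℕₚ.<⇒≢ (ℕₚ.m<n⇒m<1+n (ℕₚ.n<1+n i))))))
        (-‿cong (+-cong (δ-≡ℤ {suc i} refl) (-‿cong (δ-≢ {suc i} {suc (suc i)} (ℕₚ.1+n≢n ∘ sym))))))
      (solve 0 ((const 0ℤ :- const 0ℤ) :- (const 1ℤ :- const 0ℤ) := const (ℤ.- 1ℤ)) ≈-refl)) λ { (suc zero) (s≤s ()) ; (suc (suc l)) _ () }

    serre⁻ : ∀ i → ⟦ x (suc i) , ⟦ x i , x (suc i) ⟧ ⟧ ≋ 0ᵒ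
    serre⁻ i with suc i ℕ.<? N
    ... | no i≮N  = ⟦⟧-zeroˡ _ (x-zero (ℕₚ.≮⇒≥ i≮N))
    ... | yes i<N = ≋-trans (⟦⟧-congˡ (antisymmetric (x i) (x (suc i)))) (≋-trans (⟦⟧--ʳ (x (suc i)) ⟦ x (suc i) , x i ⟧) (-ᵒ-zero
      (vanish 1ℤ 1 ℕₚ.1+n≢n i<N (≈-trans
        (+-cong (+-cong (δ-≢ {suc i} {i} ℕₚ.1+n≢n) (-‿cong (δ-≡ℤ {suc i} refl)))
          (-‿cong (+-cong (δ-≢ {suc (suc i)} {i} (ℕₚ.<⇒≢ (ℕₚ.m<n⇒m<1+n (ℕₚ.n<1+n i)) ∘ sym)) (-‿cong (δ-≢ {suc (suc i)} {suc i} ℕₚ.1+n≢n)))))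
        (solve 0 ((const 0ℤ :- const 1ℤ) :- (const 0ℤ :- const 0ℤ) := const (ℤ.- 1ℤ)) ≈-refl)) λ { (suc zero) (s≤s ()) ; (suc (suc l)) _ () })))

    far : ∀ {a b} → suc a ℕ.< b → ⟦ x a , x b ⟧ ≋ 0ᵒ
    far {a} {b} a<b = commute (ℕₚ.<⇒≢ (ℕₚ.<-trans (ℕₚ.n<1+n a) a<b))
      (ℕₚ.<⇒≢ (ℕₚ.<-trans (ℕₚ.n<1+n a) (ℕₚ.<-trans a<b (ℕₚ.n<1+n b)))) (ℕₚ.<⇒≢ a<b)

    open Chain x far serre⁺ serre⁻ public

  -- Operators for all matrix units

  module MatrixUnits {N x z ε} (S : System N x z ε) where

    open System S
    open Serre S using (h; F-left; F-right; F-extend; F-inside; F-weight)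
    open Serre (dual S) using () renaming (F-left to F⁻-left; F-weight to F⁻-weight)

    private
      F F⁻ : ℕ → ℕ → Op
      F  = nested x
      F⁻ = nested z

    opaque

      -- `z i` stands for `- E (suc i) i`, and the bracket of two negated lower units along the
      -- chain is again a negated unit. So the sign of the lower case is the same for all lengths.
      E : ℕ → ℕ → Op
      E a b with ℕₚ.<-cmp a b
      ... | tri< _ _ _ = F a (b ∸ suc a)
      ... | tri≈ _ _ _ = ε a
      ... | tri> _ _ _ = -ᵒ F⁻ b (a ∸ suc b)

      E-upper : ∀ a k → E a (suc (a ℕ.+ k)) ≡ F a k
      E-upper a k with ℕₚ.<-cmp a (suc (a ℕ.+ k))
      ... | tri< _ _ _  = cong (F a) (ℕₚ.m+n∸m≡n a k)
      ... | tri≈ a≮ _ _ = contradiction (s≤s (ℕₚ.m≤m+n a k)) a≮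
      ... | tri> a≮ _ _ = contradiction (s≤s (ℕₚ.m≤m+n a k)) a≮

      E-diagonal : ∀ a → E a a ≡ ε a
      E-diagonal a with ℕₚ.<-cmp a a
      ... | tri< _ a≢a _ = contradiction refl a≢a
      ... | tri≈ _ _ _   = refl
      ... | tri> _ a≢a _ = contradiction refl a≢a

      E-lower : ∀ b k → E (suc (b ℕ.+ k)) b ≡ -ᵒ F⁻ b k
      E-lower b k with ℕₚ.<-cmp (suc (b ℕ.+ k)) b
      ... | tri< _ _ b≮ = contradiction (s≤s (ℕₚ.m≤m+n b k)) b≮
      ... | tri≈ _ _ b≮ = contradiction (s≤s (ℕₚ.m≤m+n b k)) b≮
      ... | tri> _ _ _  = cong (λ k → -ᵒ F⁻ b k) (ℕₚ.m+n∸m≡n b k)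

    Bracket : ℕ → ℕ → ℕ → ℕ → Set _
    Bracket a b c d = ⟦ E a b , E c d ⟧ ≋ δ b c ·ᵒ E a d +ᵒ (-ᴷ δ a d) ·ᵒ E c b

    data Position (a b : ℕ) : Set where
      upper    : ∀ k → b ≡ suc (a ℕ.+ k) → Position a b
      diagonal : a ≡ b → Position a b
      lower    : ∀ k → a ≡ suc (b ℕ.+ k) → Position a b

    position : ∀ a b → Position a b
    position a b with ℕₚ.<-cmp a b
    ... | tri< a<b _ _ = let k , eq = ℕₚ.m≤n⇒∃[o]m+o≡n a<b in upper k (sym eq)
    ... | tri≈ _ a≡b _ = diagonal a≡b
    ... | tri> _ _ b<a = let k , eq = ℕₚ.m≤n⇒∃[o]m+o≡n b<a in lower k (sym eq)

    δ-·-≡ : ∀ {a b} A → a ≡ b → δ a b ·ᵒ A ≋ A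
    δ-·-≡ A a≡b = ≋-trans (·ᵒ-cong (δ-≡ a≡b) ≋-refl) (1·ᵒ A)

    δ-·-≢ : ∀ {a b} A → a ≢ b → δ a b ·ᵒ A ≋ 0ᵒ
    δ-·-≢ A a≢b = 0·ᵒ (δ-≢ a≢b)

    -δ-·-≡ : ∀ {a b} A → a ≡ b → (-ᴷ δ a b) ·ᵒ A ≋ -ᵒ A
    -δ-·-≡ A a≡b = ≋-trans (≋-sym (·ᵒ-- _ A)) (-ᵒ-cong (δ-·-≡ A a≡b))

    -δ-·-≢ : ∀ {a b} A → a ≢ b → (-ᴷ δ a b) ·ᵒ A ≋ 0ᵒ
    -δ-·-≢ A a≢b = 0·ᵒ (≈-trans (-‿cong (δ-≢ a≢b)) -0#≈0#)

    module _ {i : ℕ} (c d : ℕ) where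

      -- This and the next two lemmas evaluate the right side of `Bracket i (suc i) c d`. Both
      -- Kronecker symbols are one only for the opposite unit `E (suc i) i`, which `x-lower` treats
      -- separately.
      both-≢ : suc i ≢ c → i ≢ d → ∀ {A} → A ≋ 0ᵒ → A ≋ δ (suc i) c ·ᵒ E i d +ᵒ (-ᴷ δ i d) ·ᵒ E c (suc i)
      both-≢ 1+i≢c i≢d A≋0 = ≋-trans A≋0 (≋-sym (≋-trans (+ᵒ-zeroˡ (δ-·-≢ _ 1+i≢c)) (-δ-·-≢ _ i≢d)))

      left-≡ : suc i ≡ c → i ≢ d → ∀ {A} → A ≋ E i d → A ≋ δ (suc i) c ·ᵒ E i d +ᵒ (-ᴷ δ i d) ·ᵒ E c (suc i)
      left-≡ 1+i≡c i≢d A≋E = ≋-trans A≋E (≋-sym (≋-trans (+ᵒ-zeroʳ (-δ-·-≢ _ i≢d)) (δ-·-≡ _ 1+i≡c)))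

      right-≡ : suc i ≢ c → i ≡ d → ∀ {A} → A ≋ -ᵒ E c (suc i) → A ≋ δ (suc i) c ·ᵒ E i d +ᵒ (-ᴷ δ i d) ·ᵒ E c (suc i)
      right-≡ 1+i≢c i≡d A≋E = ≋-trans A≋E (≋-sym (≋-trans (+ᵒ-zeroˡ (δ-·-≢ _ 1+i≢c)) (-δ-·-≡ _ i≡d)))

    E-simple : ∀ i → E i (suc i) ≡ x i
    E-simple i = trans (cong (λ j → E i (suc j)) (sym (ℕₚ.+-identityʳ i))) (E-upper i 0)

    x-upper : ∀ i c k → ⟦ x i , F c k ⟧ ≋ δ (suc i) c ·ᵒ E i (suc (c ℕ.+ k)) +ᵒ (-ᴷ δ i (suc (c ℕ.+ k))) ·ᵒ E c (suc i)
    x-upper i c k with ℕₚ.<-cmp (suc i) c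
    ... | tri< 1+i<c 1+i≢c _ = both-≢ c _ 1+i≢c (ℕₚ.<⇒≢ (ℕₚ.<-trans (ℕₚ.n<1+n i) (ℕₚ.<-trans 1+i<c (s≤s (ℕₚ.m≤m+n c k))))) (F-left k 1+i<c)
    ... | tri≈ _ refl _ = left-≡ (suc i) _ refl (ℕₚ.<⇒≢ (ℕₚ.<-trans (ℕₚ.n<1+n i) (s≤s (ℕₚ.m≤m+n (suc i) k))))
      (≋-reflexive (sym (trans (cong (λ j → E i (suc j)) (sym (ℕₚ.+-suc i k))) (E-upper i (suc k)))))
    ... | tri> _ 1+i≢c c<1+i with ℕₚ.<-cmp i (suc (c ℕ.+ k))
    ...   | tri< i<d i≢d _ = both-≢ c _ 1+i≢c i≢d (F-inside c k (ℕ.s≤s⁻¹ c<1+i) (ℕ.s≤s⁻¹ i<d))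
    ...   | tri≈ _ refl _  = right-≡ c _ 1+i≢c refl (≋-trans (F-extend c k)
      (-ᵒ-cong (≋-reflexive (sym (trans (cong (λ j → E c (suc j)) (sym (ℕₚ.+-suc c k))) (E-upper c (suc k)))))))
    ...   | tri> _ i≢d d<i = both-≢ c _ 1+i≢c i≢d (F-right c k d<i)

    x-diagonal : ∀ i c → ⟦ x i , ε c ⟧ ≋ δ (suc i) c ·ᵒ E i c +ᵒ (-ᴷ δ i c) ·ᵒ E c (suc i)
    x-diagonal i c = ≋-trans (antisymmetric (x i) (ε c)) (≋-trans (-ᵒ-cong (εx c i)) (≋-trans (·ᵒ-- _ (x i)) by-cases))
      where
      by-cases : (-ᴷ (δ c i -ᴷ δ c (suc i))) ·ᵒ x i ≋ δ (suc i) c ·ᵒ E i c +ᵒ (-ᴷ δ i c) ·ᵒ E c (suc i)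
      by-cases with i ℕ.≟ c | suc i ℕ.≟ c
      ... | yes refl | yes ()
      ... | yes refl | no 1+i≢c = right-≡ i i 1+i≢c refl (≋-trans
        (·ᵒ-cong (-‿cong (≈-trans (+-cong (δ-≡ {i} refl) (≈-trans (-‿cong (δ-≢ {i} (1+i≢c ∘ sym))) -0#≈0#)) (+-identityʳ 1#))) ≋-refl)
        (≋-trans (≋-sym (·ᵒ-- 1# (x i))) (-ᵒ-cong (≋-trans (1·ᵒ (x i)) (≋-reflexive (sym (E-simple i)))))))
      ... | no i≢c | yes refl = left-≡ (suc i) (suc i) refl i≢c (≋-trans
        (·ᵒ-cong (≈-trans (-‿cong (≈-trans (+-cong (δ-≢ {suc i} {i} (i≢c ∘ sym)) (-‿cong (δ-≡ {suc i} refl))) (+-identityˡ _)))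
          (solve 1 (λ a → :- (:- a) := a) ≈-refl 1#)) ≋-refl)
        (≋-trans (1·ᵒ (x i)) (≋-reflexive (sym (E-simple i)))))
      ... | no i≢c | no 1+i≢c = both-≢ c c 1+i≢c i≢c (0·ᵒ (≈-trans (-‿cong (≈-trans
        (+-cong (δ-≢ {c} {i} (i≢c ∘ sym)) (-‿cong (δ-≢ {c} {suc i} (1+i≢c ∘ sym)))) (-‿inverseʳ 0#))) -0#≈0#))

    z-weight : ∀ a i → ⟦ ε a , z i ⟧ ≋ ((-ᴷ δ a i) -ᴷ (-ᴷ δ a (suc i))) ·ᵒ z i
    z-weight a i = ≋-trans (εz a i) (·ᵒ-cong (solve 2 (λ a b → :- (a :- b) := (:- a) :- (:- b)) ≈-refl (δ a i) (δ a (suc i))) ≋-refl)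

    hz-weight : ∀ a i → ⟦ h a , z i ⟧ ≋ ((δ (suc a) i -ᴷ δ a i) -ᴷ (δ (suc a) (suc i) -ᴷ δ a (suc i))) ·ᵒ z i
    hz-weight a i = ≋-trans (⟦⟧-+ˡ (ε a) (-ᵒ ε (suc a)) (z i)) (≋-trans
      (+ᵒ-cong (εz a i) (≋-trans (⟦⟧--ˡ (ε (suc a)) (z i)) (≋-trans (-ᵒ-cong (εz (suc a) i)) (·ᵒ-- _ _))))
      (≋-trans (·ᵒ-+ _ _ _) (·ᵒ-cong (solve 4 (λ a b c d → (:- (a :- b)) :+ (:- (:- (c :- d))) := (c :- a) :- (d :- b)) ≈-refl
        (δ a i) (δ a (suc i)) (δ (suc a) i) (δ (suc a) (suc i))) ≋-refl)))

    -- `E i (suc i)` meets a lower unit only in the first and the last generator of its nested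
    -- bracket. For `i = suc d` just inside, the inner bracket is the first case of a shorter one;
    -- it leaves indices from `suc (suc d)` on, with which `z d` commutes. Hence the mutual
    -- recursion.
    ⟦x,F⁻⟧-zero  : ∀ i d k → i ≢ d → i ≢ d ℕ.+ k → ⟦ x i , F⁻ d k ⟧ ≋ 0ᵒ
    ⟦x,F⁻⟧-first : ∀ d k → d ℕ.< N → ⟦ x d , F⁻ d (suc k) ⟧ ≋ -ᵒ F⁻ (suc d) k

    ⟦x,F⁻⟧-zero i d zero    i≢d _ = xz-≢ i≢d
    ⟦x,F⁻⟧-zero i d (suc k) i≢d i≢d+k = ≋-trans (jacobi-zeroˡ (F⁻ (suc d) k) (xz-≢ i≢d)) (inner (i ℕ.≟ suc d) k i≢d+k)
      where
      inner : Dec (i ≡ suc d) → ∀ k → i ≢ d ℕ.+ suc k → ⟦ z d , ⟦ x i , F⁻ (suc d) k ⟧ ⟧ ≋ 0ᵒ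
      inner (no i≢1+d) k i≢ = ⟦⟧-zeroʳ (z d) (⟦x,F⁻⟧-zero i (suc d) k i≢1+d (i≢ ∘ λ eq → trans eq (sym (ℕₚ.+-suc d k))))
      inner (yes refl) zero i≢ = contradiction (ℕₚ.+-comm 1 d) i≢
      inner (yes refl) (suc k) i≢ with suc d ℕ.<? N
      ... | yes d<N = ≋-trans (⟦⟧-congˡ (⟦x,F⁻⟧-first (suc d) k d<N))
        (≋-trans (⟦⟧--ʳ (z d) (F⁻ (suc (suc d)) k)) (-ᵒ-zero (F⁻-left k ℕₚ.≤-refl)))
      ... | no d≮N  = ⟦⟧-zeroʳ (z d) (⟦⟧-zeroˡ (F⁻ (suc d) (suc k)) (x-zero (ℕₚ.≮⇒≥ d≮N)))

    ⟦x,F⁻⟧-first d k d<N = begin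
      ⟦ x d , ⟦ z d , F⁻ (suc d) k ⟧ ⟧
        ≈⟨ jacobi-zeroʳ (z d) (⟦x,F⁻⟧-zero d (suc d) k (ℕₚ.1+n≢n ∘ sym) (ℕₚ.<⇒≢ (s≤s (ℕₚ.m≤m+n d k)))) ⟩
      ⟦ ⟦ x d , z d ⟧ , F⁻ (suc d) k ⟧                    ≈⟨ ⟦⟧-congʳ (xz-≡ d<N) ⟩
      ⟦ -ᵒ h d , F⁻ (suc d) k ⟧                           ≈⟨ ⟦⟧--ˡ (h d) (F⁻ (suc d) k) ⟩
      -ᵒ ⟦ h d , F⁻ (suc d) k ⟧                           ≈⟨ -ᵒ-cong (F⁻-weight {h d} {λ i → δ (suc d) i -ᴷ δ d i} (hz-weight d) (suc d) k) ⟩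
      -ᵒ (((δ (suc d) (suc d) -ᴷ δ d (suc d)) -ᴷ (δ (suc d) e -ᴷ δ d e)) ·ᵒ F⁻ (suc d) k)
        ≈⟨ -ᵒ-cong (≋-trans (·ᵒ-cong (≈-trans (+-cong (+-cong (δ-≡ℤ {suc d} refl) (-‿cong (δ-≢ {d} {suc d} (ℕₚ.1+n≢n ∘ sym))))
             (-‿cong (+-cong (δ-≢ {suc d} {e} (ℕₚ.<⇒≢ (s≤s (s≤s (ℕₚ.m≤m+n d k))))) (-‿cong (δ-≢ {d} {e} (ℕₚ.<⇒≢ (ℕₚ.m<n⇒m<1+n (s≤s (ℕₚ.m≤m+n d k))))))))) unit-weight) ≋-refl) (1·ᵒ _)) ⟩
      -ᵒ F⁻ (suc d) k                                     ∎
      where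
      open ≋-Reasoning
      e = suc (suc d ℕ.+ k)
      unit-weight : (ι-ℤ 1ℤ -ᴷ 0#) -ᴷ (0# -ᴷ 0#) ≈ 1#
      unit-weight = ≈-trans (solve 0 ((const 1ℤ :- const 0ℤ) :- (const 0ℤ :- const 0ℤ) := const 1ℤ) ≈-refl) ι-ℤ-1

    ⟦x,F⁻⟧-last : ∀ d k → suc (d ℕ.+ k) ℕ.< N → ⟦ x (suc (d ℕ.+ k)) , F⁻ d (suc k) ⟧ ≋ F⁻ d k
    ⟦x,F⁻⟧-last d zero i<N = subst (λ b → suc b ℕ.< N → ⟦ x (suc b) , F⁻ d 1 ⟧ ≋ z d) (sym (ℕₚ.+-identityʳ d)) base i<N
      where
      open ≋-Reasoning
      base : suc d ℕ.< N → ⟦ x (suc d) , ⟦ z d , z (suc d) ⟧ ⟧ ≋ z d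
      base d<N = begin
        ⟦ x (suc d) , ⟦ z d , z (suc d) ⟧ ⟧      ≈⟨ jacobi-zeroˡ (z (suc d)) (xz-≢ ℕₚ.1+n≢n) ⟩
        ⟦ z d , ⟦ x (suc d) , z (suc d) ⟧ ⟧      ≈⟨ ⟦⟧-congˡ (xz-≡ d<N) ⟩
        ⟦ z d , -ᵒ h (suc d) ⟧                   ≈⟨ ⟦⟧--ʳ (z d) (h (suc d)) ⟩
        -ᵒ ⟦ z d , h (suc d) ⟧                   ≈⟨ antisymmetric (h (suc d)) (z d) ⟨
        ⟦ h (suc d) , z d ⟧                      ≈⟨ hz-weight (suc d) d ⟩
        ((δ (suc (suc d)) d -ᴷ δ (suc d) d) -ᴷ (δ (suc (suc d)) (suc d) -ᴷ δ (suc d) (suc d))) ·ᵒ z d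
          ≈⟨ ·ᵒ-cong (≈-trans (+-cong (+-cong (δ-≢ {suc (suc d)} {d} (ℕₚ.<⇒≢ (ℕₚ.m<n⇒m<1+n (ℕₚ.n<1+n d)) ∘ sym)) (-‿cong (δ-≢ {suc d} {d} ℕₚ.1+n≢n)))
               (-‿cong (+-cong (δ-≢ {suc (suc d)} {suc d} ℕₚ.1+n≢n) (-‿cong (δ-≡ℤ {suc d} refl)))))
               (≈-trans (solve 0 ((const 0ℤ :- const 0ℤ) :- (const 0ℤ :- const 1ℤ) := const 1ℤ) ≈-refl) ι-ℤ-1)) ≋-refl ⟩
        1# ·ᵒ z d                                ≈⟨ 1·ᵒ (z d) ⟩
        z d                                      ∎
    ⟦x,F⁻⟧-last d (suc k) i<N = ≋-trans
      (jacobi-zeroˡ (F⁻ (suc d) (suc k)) (xz-≢ {suc (d ℕ.+ suc k)} {d} (ℕₚ.<⇒≢ (s≤s (ℕₚ.m≤m+n d (suc k))) ∘ sym)))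
      (⟦⟧-congˡ (subst (λ b → suc b ℕ.< N → ⟦ x (suc b) , F⁻ (suc d) (suc k) ⟧ ≋ F⁻ (suc d) k) (sym (ℕₚ.+-suc d k)) (⟦x,F⁻⟧-last (suc d) k) i<N))

    x-lower : ∀ {i} → i ℕ.< N → ∀ d k → ⟦ x i , -ᵒ F⁻ d k ⟧ ≋
              δ (suc i) (suc (d ℕ.+ k)) ·ᵒ E i d +ᵒ (-ᴷ δ i d) ·ᵒ E (suc (d ℕ.+ k)) (suc i)
    x-lower {i} i<N d k = ≋-trans (⟦⟧--ʳ (x i) (F⁻ d k)) (by-cases k (i ℕ.≟ d) (i ℕ.≟ d ℕ.+ k))
      where
      by-cases : ∀ k → Dec (i ≡ d) → Dec (i ≡ d ℕ.+ k) → -ᵒ ⟦ x i , F⁻ d k ⟧ ≋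
        δ (suc i) (suc (d ℕ.+ k)) ·ᵒ E i d +ᵒ (-ᴷ δ i d) ·ᵒ E (suc (d ℕ.+ k)) (suc i)
      by-cases k (no i≢d) (no i≢d+k) = both-≢ (suc (d ℕ.+ k)) d (i≢d+k ∘ ℕₚ.suc-injective) i≢d (-ᵒ-zero (⟦x,F⁻⟧-zero i d k i≢d i≢d+k))
      by-cases zero (no i≢d) (yes i≡d) = contradiction (trans i≡d (ℕₚ.+-identityʳ d)) i≢d
      by-cases zero (yes i≡d) (no i≢d) = contradiction (trans i≡d (sym (ℕₚ.+-identityʳ d))) i≢d
      by-cases zero (yes refl) (yes _) = begin
        -ᵒ ⟦ x i , z i ⟧                         ≈⟨ -ᵒ-cong (xz-≡ i<N) ⟩
        -ᵒ (-ᵒ (ε i +ᵒ -ᵒ ε (suc i)))            ≈⟨ -ᵒ-involutive _ ⟩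
        ε i +ᵒ -ᵒ ε (suc i)                      ≈⟨ +ᵒ-cong (≋-reflexive (E-diagonal i)) (-ᵒ-cong (≋-reflexive
          (trans (cong (λ j → E (suc j) (suc i)) (ℕₚ.+-identityʳ i)) (E-diagonal (suc i))))) ⟨
        E i i +ᵒ -ᵒ E (suc (i ℕ.+ 0)) (suc i)    ≈⟨ +ᵒ-cong (δ-·-≡ (E i i) (cong suc (sym (ℕₚ.+-identityʳ i)))) (-δ-·-≡ {i} _ refl) ⟨
        δ (suc i) (suc (i ℕ.+ 0)) ·ᵒ E i i +ᵒ (-ᴷ δ i i) ·ᵒ E (suc (i ℕ.+ 0)) (suc i)   ∎
        where open ≋-Reasoning
      by-cases (suc k) (yes refl) _ = right-≡ (suc (i ℕ.+ suc k)) i (ℕₚ.<⇒≢ (s≤s (ℕₚ.m<m+n i z<s))) refl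
        (-ᵒ-cong (≋-trans (⟦x,F⁻⟧-first i k i<N) (≋-reflexive (sym
          (trans (cong (λ j → E (suc j) (suc i)) (ℕₚ.+-suc i k)) (E-lower (suc i) k))))))
      by-cases (suc k) (no i≢d) (yes refl) = left-≡ (suc (d ℕ.+ suc k)) d refl i≢d (≋-trans (-ᵒ-cong
          (subst (λ b → b ℕ.< N → ⟦ x b , F⁻ d (suc k) ⟧ ≋ F⁻ d k) (sym (ℕₚ.+-suc d k)) (⟦x,F⁻⟧-last d k) i<N))
        (≋-reflexive (sym (trans (cong (λ j → E j d) (ℕₚ.+-suc d k)) (E-lower d k)))))

    x-bracket : ∀ {i} → i ℕ.< N → ∀ a b → Bracket i (suc i) a b
    x-bracket {i} i<N a b = ≋-trans (⟦⟧-congʳ (≋-reflexive (E-simple i))) (by-position (position a b))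
      where
      by-position : Position a b → ⟦ x i , E a b ⟧ ≋ δ (suc i) a ·ᵒ E i b +ᵒ (-ᴷ δ i b) ·ᵒ E a (suc i)
      by-position (upper k refl)  = ≋-trans (⟦⟧-congˡ (≋-reflexive (E-upper a k))) (x-upper i a k)
      by-position (diagonal refl) = ≋-trans (⟦⟧-congˡ (≋-reflexive (E-diagonal a))) (x-diagonal i a)
      by-position (lower k refl)  = ≋-trans (⟦⟧-congˡ (≋-reflexive (E-lower b k))) (x-lower i<N b k)

    diagonal-bracket : ∀ a b c → Bracket a a b c
    diagonal-bracket a b c = ≋-trans (⟦⟧-congʳ (≋-reflexive (E-diagonal a)))
      (≋-trans (weight (position b c)) (≋-trans (≋-sym (·ᵒ-+ _ _ (E b c))) (+ᵒ-cong left right)))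
      where
      left : δ a b ·ᵒ E b c ≋ δ a b ·ᵒ E a c
      left with a ℕ.≟ b
      ... | yes refl = ≋-refl
      ... | no  a≢b  = ≋-trans (δ-·-≢ _ a≢b) (≋-sym (δ-·-≢ _ a≢b))
      right : (-ᴷ δ a c) ·ᵒ E b c ≋ (-ᴷ δ a c) ·ᵒ E b a
      right with a ℕ.≟ c
      ... | yes refl = ≋-refl
      ... | no  a≢c  = ≋-trans (-δ-·-≢ _ a≢c) (≋-sym (-δ-·-≢ _ a≢c))
      weight : Position b c → ⟦ ε a , E b c ⟧ ≋ (δ a b -ᴷ δ a c) ·ᵒ E b c
      weight (upper k refl) = ≋-trans (⟦⟧-congˡ (≋-reflexive (E-upper b k)))
        (≋-trans (F-weight {ε a} {δ a} (εx a) b k) (·ᵒ-cong ≈-refl (≋-reflexive (sym (E-upper b k)))))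
      weight (diagonal refl) = ≋-trans (⟦⟧-congˡ (≋-reflexive (E-diagonal b))) (≋-trans (εε a b) (≋-sym (0·ᵒ (-‿inverseʳ (δ a b)))))
      weight (lower k refl) = ≋-trans (⟦⟧-congˡ (≋-reflexive (E-lower c k)))
        (≋-trans (⟦⟧--ʳ (ε a) (F⁻ c k)) (≋-trans (-ᵒ-cong (F⁻-weight {ε a} {λ i → -ᴷ δ a i} (z-weight a) c k))
          (≋-trans (-ᵒ-· _ (F⁻ c k)) (·ᵒ-cong (solve 2 (λ a b → (:- a) :- (:- b) := b :- a) ≈-refl (δ a c) (δ a (suc (c ℕ.+ k))))
            (≋-reflexive (sym (E-lower c k)))))))

    -- For `a ≢ c` the unit `E a c` is exactly the bracket of `E a b` and `E b c`, without a second
    -- term, so the Jacobi identity computes its brackets from theirs.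
    bracket-closed : ∀ {a b c} → a ≢ c → (∀ p q → Bracket a b p q) → (∀ p q → Bracket b c p q) → ∀ p q → Bracket a c p q
    bracket-closed {a} {b} {c} a≢c P-ab P-bc p q = begin
      ⟦ E a c , E p q ⟧                               ≈⟨ ⟦⟧-congʳ product ⟨
      ⟦ ⟦ E a b , E b c ⟧ , E p q ⟧                   ≈⟨ jacobi-nested _ _ _ ⟩
      ⟦ E a b , ⟦ E b c , E p q ⟧ ⟧ +ᵒ -ᵒ ⟦ E b c , ⟦ E a b , E p q ⟧ ⟧
        ≈⟨ +ᵒ-cong (≋-trans (⟦⟧-congˡ (P-bc p q)) (≋-trans (⟦⟧-+ʳ _ _ _) (+ᵒ-cong
               (≋-trans (⟦⟧-·ʳ _ _ _) (·ᵒ-cong ≈-refl (≋-trans (P-ab b q) (+ᵒ-cong (δ-·-≡ {b} _ refl) ≋-refl))))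
               (≋-trans (⟦⟧-·ʳ _ _ _) (·ᵒ-cong ≈-refl (≋-trans (P-ab p c) (+ᵒ-zeroʳ (-δ-·-≢ _ a≢c))))))))
             (-ᵒ-cong (≋-trans (⟦⟧-congˡ (P-ab p q)) (≋-trans (⟦⟧-+ʳ _ _ _) (+ᵒ-cong
               (≋-trans (⟦⟧-·ʳ _ _ _) (·ᵒ-cong ≈-refl (≋-trans (P-bc a q) (+ᵒ-zeroˡ (δ-·-≢ _ (a≢c ∘ sym))))))
               (≋-trans (⟦⟧-·ʳ _ _ _) (·ᵒ-cong ≈-refl (≋-trans (P-bc p b) (+ᵒ-cong ≋-refl (-δ-·-≡ {b} _ refl))))))))) ⟩
      (δ c p ·ᵒ (E a q +ᵒ (-ᴷ δ a q) ·ᵒ E b b) +ᵒ (-ᴷ δ b q) ·ᵒ (δ b p ·ᵒ E a c)) +ᵒ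
        -ᵒ (δ b p ·ᵒ ((-ᴷ δ b q) ·ᵒ E a c) +ᵒ (-ᴷ δ a q) ·ᵒ (δ c p ·ᵒ E b b +ᵒ -ᵒ E p c))
        ≈⟨ jacobi-combination (δ c p) (δ a q) (δ b q) (δ b p) (E a q) (E b b) (E a c) (E p c) ⟩
      δ c p ·ᵒ E a q +ᵒ (-ᴷ δ a q) ·ᵒ E p c           ∎
      where
      open ≋-Reasoning
      product : ⟦ E a b , E b c ⟧ ≋ E a c
      product = ≋-trans (P-ab b c) (≋-trans (+ᵒ-zeroʳ (-δ-·-≢ _ a≢c)) (δ-·-≡ {b} _ refl))

  module _ {N x z ε} (S : System N x z ε) where

    open MatrixUnits S
    private module M⁻ = MatrixUnits (dual S)

    E-dual : ∀ a b → M⁻.E a b ≋ -ᵒ E b a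
    E-dual a b with position a b
    ... | upper k refl = ≋-trans (≋-reflexive (M⁻.E-upper a k)) (≋-sym (≋-trans (-ᵒ-cong (≋-reflexive (E-lower a k))) (-ᵒ-involutive _)))
    ... | diagonal refl = ≋-trans (≋-reflexive (M⁻.E-diagonal a)) (-ᵒ-cong (≋-reflexive (sym (E-diagonal a))))
    ... | lower k refl = ≋-trans (≋-reflexive (M⁻.E-lower b k)) (-ᵒ-cong (≋-reflexive (sym (E-upper b k))))

    z-bracket : ∀ {i} → i ℕ.< N → ∀ a b → Bracket (suc i) i a b
    z-bracket {i} i<N a b = begin
      ⟦ E (suc i) i , E a b ⟧                          ≈⟨ -ᵒ-involutive _ ⟨
      -ᵒ (-ᵒ ⟦ E (suc i) i , E a b ⟧)                  ≈⟨ -ᵒ-cong (⟦⟧--ʳ _ _) ⟨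
      -ᵒ ⟦ E (suc i) i , -ᵒ E a b ⟧                    ≈⟨ ⟦⟧--ˡ _ _ ⟨
      ⟦ -ᵒ E (suc i) i , -ᵒ E a b ⟧                    ≈⟨ ⟦⟧-cong (E-dual i (suc i)) (E-dual b a) ⟨
      ⟦ M⁻.E i (suc i) , M⁻.E b a ⟧                    ≈⟨ M⁻.x-bracket i<N b a ⟩
      δ (suc i) b ·ᵒ M⁻.E i a +ᵒ (-ᴷ δ i a) ·ᵒ M⁻.E b (suc i)
        ≈⟨ +ᵒ-cong (·ᵒ-cong ≈-refl (E-dual i a)) (·ᵒ-cong ≈-refl (E-dual b (suc i))) ⟩
      δ (suc i) b ·ᵒ (-ᵒ E a i) +ᵒ (-ᴷ δ i a) ·ᵒ (-ᵒ E (suc i) b)   ≈⟨ combination-neg (δ (suc i) b) (δ i a) (E a i) (E (suc i) b) ⟩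
      δ i a ·ᵒ E (suc i) b +ᵒ (-ᴷ δ (suc i) b) ·ᵒ E a i             ∎
      where open ≋-Reasoning

    bracket : ∀ {a b} → a ℕ.≤ N → b ℕ.≤ N → ∀ c d → Bracket a b c d
    bracket {a} {b} a≤N b≤N with position a b
    ... | diagonal refl = diagonal-bracket a
    ... | upper k refl = rising a k b≤N
      where
      rising : ∀ a k → suc (a ℕ.+ k) ℕ.≤ N → ∀ c d → Bracket a (suc (a ℕ.+ k)) c d
      rising a zero    b≤N = subst (λ b → suc b ℕ.≤ N → ∀ c d → Bracket a (suc b) c d) (sym (ℕₚ.+-identityʳ a)) x-bracket b≤N
      rising a (suc k) b≤N = bracket-closed (ℕₚ.<⇒≢ (s≤s (ℕₚ.m≤m+n a (suc k)))) (x-bracket (ℕₚ.≤-trans (s≤s (ℕₚ.m≤m+n a (suc k))) b≤N))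
        (subst (λ b → suc b ℕ.≤ N → ∀ c d → Bracket (suc a) (suc b) c d) (sym (ℕₚ.+-suc a k)) (rising (suc a) k) b≤N)
    ... | lower k refl = falling b k a≤N
      where
      falling : ∀ b k → suc (b ℕ.+ k) ℕ.≤ N → ∀ c d → Bracket (suc (b ℕ.+ k)) b c d
      falling b zero    a≤N = subst (λ a → suc a ℕ.≤ N → ∀ c d → Bracket (suc a) b c d) (sym (ℕₚ.+-identityʳ b)) z-bracket a≤N
      falling b (suc k) a≤N = bracket-closed (ℕₚ.<⇒≢ (s≤s (ℕₚ.m≤m+n b (suc k))) ∘ sym)
        (subst (λ a → suc a ℕ.≤ N → ∀ c d → Bracket (suc a) (suc b) c d) (sym (ℕₚ.+-suc b k)) (falling (suc b) k) a≤N)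
        (z-bracket (ℕₚ.≤-trans (s≤s (ℕₚ.m≤m+n b (suc k))) a≤N))
-- The representation on the tableaux

module TableauOperators {c ℓ₁ ℓ₂} (K : HeytingField c ℓ₁ ℓ₂) (char0 : CharacteristicZero K)
                        {m n : ℕ} (shape : SkewShape m n) where

  open SkewTableaux shape
  open Combinatorics shape
  open Lattice shape
  open Coefficients shape using (X-∏; Y-∏)
  open Diamond shape using (diamond)
  open Crossing shape using (crossing-sum)
  open GroundField K char0
  open FieldDefs K char0 using (𝕜-ring; ι-ℤ; ι)
  open Operators K char0 Tableau
  open GLRelations K char0 Tableau
  open ChevalleySystems K char0 Tableau
  open Algebra.Properties.Ring (CommutativeRing.ring 𝕜-ring) using (-0#≈0#)
  open import Relation.Binary.Reasoning.Setoid (CommutativeRing.setoid 𝕜-ring)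

  module ∑ᴷ-Operator = BigOperator (CommutativeRing.+-commutativeMonoid 𝕜-ring)
  open ∑ᴷ-Operator using () renaming (big to ∑ᴷ) public

  ∑ᴷ-*ˡ : ∀ {A : Set} k (f : A → 𝕜) xs → k *ᴷ ∑ᴷ f xs ≈ ∑ᴷ (λ x → k *ᴷ f x) xs
  ∑ᴷ-*ˡ k f = ∑ᴷ-Operator.big-homo (k *ᴷ_) (zeroʳ k) (distribˡ k)

  ∑ᴷ-*ʳ : ∀ {A : Set} (f : A → 𝕜) k xs → ∑ᴷ f xs *ᴷ k ≈ ∑ᴷ (λ x → f x *ᴷ k) xs
  ∑ᴷ-*ʳ f k = ∑ᴷ-Operator.big-homo (_*ᴷ k) (zeroˡ k) (λ x y → distribʳ k x y)

  ∑ᴷ-minus : ∀ {A : Set} (f h : A → 𝕜) xs → ∑ᴷ f xs -ᴷ ∑ᴷ h xs ≈ ∑ᴷ (λ x → f x -ᴷ h x) xs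
  ∑ᴷ-minus f h xs = ≈-trans (+-congˡ (∑ᴷ-Operator.big-homo -ᴷ_ -0#≈0# (λ x y → solve 2 (λ x y → :- (x :+ y) := (:- x) :+ (:- y)) ≈-refl x y) xs))
    (≈-sym (∑ᴷ-Operator.big-∙ f (λ x → -ᴷ h x) xs))

  ∑ᴷ-only : ∀ (f : Tableau → 𝕜) T → (∀ S → S ≢ T → f S ≈ 0#) → ∑ᴷ f tableaux ≈ f T
  ∑ᴷ-only f T = ∑ᴷ-Operator.big-only _≟ᵗ_ f tableaux-unique (tableaux-complete T)

  ι-∑ : ∀ {A : Set} (f : A → ℚ) xs → ι (∑ f xs) ≈ ∑ᴷ (ι ∘ f) xs
  ι-∑ f []       = ι-fromℤ 0ℤ
  ι-∑ f (x ∷ xs) = ≈-trans (ι-+ (f x) (∑ f xs)) (+-congˡ (ι-∑ f xs))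

  -- Edges with the same ends have the same cell, and in its product form `X` depends on the edge
  -- only through the row of the cell.
  X-irrelevant : ∀ {i S T} (e f : Edge i S T) → X e ≡ X f
  X-irrelevant {i} {S} {T} e f = trans (X-∏ e) (trans
    (cong (λ κ → ∏ (Coefficients.xᶠ shape T i (proj₁ κ)) rows) (edge-cell-unique e f)) (sym (X-∏ f)))

  Y-irrelevant : ∀ {i S T} (e f : Edge i S T) → Y e ≡ Y f
  Y-irrelevant {i} {S} {T} e f = trans (Y-∏ e) (trans
    (cong (λ κ → ∏ (Coefficients.yᶠ shape T i (proj₁ κ)) rows) (edge-cell-unique e f)) (sym (Y-∏ f)))

  Xᶜ Yᶜ : Color n → Tableau → Tableau → 𝕜
  Xᶜ i S T with edge? i S T
  ... | yes e = ι (X e)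
  ... | no  _ = 0#
  Yᶜ i S T with edge? i S T
  ... | yes e = ι (Y e)
  ... | no  _ = 0#

  Xᶜ-edge : ∀ {i S T} (e : Edge i S T) → Xᶜ i S T ≈ ι (X e)
  Xᶜ-edge {i} {S} {T} e with edge? i S T
  ... | yes f = CommutativeRing.reflexive 𝕜-ring (cong ι (X-irrelevant f e))
  ... | no ¬e = contradiction e ¬e

  Yᶜ-edge : ∀ {i S T} (e : Edge i S T) → Yᶜ i S T ≈ ι (Y e)
  Yᶜ-edge {i} {S} {T} e with edge? i S T
  ... | yes f = CommutativeRing.reflexive 𝕜-ring (cong ι (Y-irrelevant f e))
  ... | no ¬e = contradiction e ¬e

  Xᶜ-no : ∀ {i S T} → ¬ Edge i S T → Xᶜ i S T ≈ 0#
  Xᶜ-no {i} {S} {T} ¬e with edge? i S T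
  ... | yes e = contradiction e ¬e
  ... | no _  = ≈-refl

  Yᶜ-no : ∀ {i S T} → ¬ Edge i S T → Yᶜ i S T ≈ 0#
  Yᶜ-no {i} {S} {T} ¬e with edge? i S T
  ... | yes e = contradiction e ¬e
  ... | no _  = ≈-refl

  XY-no : ∀ {i j R S T U} → ¬ (Edge i R S × Edge j T U) → Xᶜ i R S *ᴷ Yᶜ j T U ≈ 0#
  XY-no {i} {j} {R} {S} {T} {U} ¬both with edge? i R S
  ... | no _  = zeroˡ _
  ... | yes e = ≈-trans (*-congˡ (Yᶜ-no λ f → ¬both (e , f))) (zeroʳ _)

  -- The source comes first: `a S T` is the coefficient of the basis vector of `T` in the image of
  -- that of `S`.
  matrixOp : (Tableau → Tableau → 𝕜) → Op
  matrixOp a = record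
    { apply      = λ v T → ∑ᴷ (λ S → a S T *ᴷ v S) tableaux
    ; apply-cong = λ v≈w T → ∑ᴷ-Operator.big-cong tableaux λ S → *-congˡ (v≈w S)
    ; apply-+    = λ v w T → ≈-trans (∑ᴷ-Operator.big-cong tableaux λ S → distribˡ (a S T) (v S) (w S))
        (∑ᴷ-Operator.big-∙ (λ S → a S T *ᴷ v S) (λ S → a S T *ᴷ w S) tableaux)
    ; apply-*    = λ k v T → ≈-trans (∑ᴷ-Operator.big-cong tableaux λ S → solve 3 (λ a k v → a :* (k :* v) := k :* (a :* v)) ≈-refl (a S T) k (v S))
        (≈-sym (∑ᴷ-*ˡ k (λ S → a S T *ᴷ v S) tableaux))
    }

  matrixOp-∘ : ∀ a b v T → apply (matrixOp a) (apply (matrixOp b) v) T ≈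
               ∑ᴷ (λ S → ∑ᴷ (λ R → a R T *ᴷ b S R) tableaux *ᴷ v S) tableaux
  matrixOp-∘ a b v T = begin
    ∑ᴷ (λ R → a R T *ᴷ ∑ᴷ (λ S → b S R *ᴷ v S) tableaux) tableaux
      ≈⟨ ∑ᴷ-Operator.big-cong tableaux (λ R → ≈-trans (∑ᴷ-*ˡ (a R T) (λ S → b S R *ᴷ v S) tableaux)
           (∑ᴷ-Operator.big-cong tableaux λ S → ≈-sym (*-assoc (a R T) (b S R) (v S)))) ⟩
    ∑ᴷ (λ R → ∑ᴷ (λ S → a R T *ᴷ b S R *ᴷ v S) tableaux) tableaux
      ≈⟨ ∑ᴷ-Operator.big-comm (λ R S → a R T *ᴷ b S R *ᴷ v S) tableaux tableaux ⟩
    ∑ᴷ (λ S → ∑ᴷ (λ R → a R T *ᴷ b S R *ᴷ v S) tableaux) tableaux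
      ≈⟨ ∑ᴷ-Operator.big-cong tableaux (λ S → ≈-sym (∑ᴷ-*ʳ (λ R → a R T *ᴷ b S R) (v S) tableaux)) ⟩
    ∑ᴷ (λ S → ∑ᴷ (λ R → a R T *ᴷ b S R) tableaux *ᴷ v S) tableaux ∎

  xᵒ yᵒ : Color n → Op
  xᵒ i = matrixOp (Xᶜ i)
  yᵒ i = matrixOp (λ T S → Yᶜ i S T)

  -- The diagonal unit with index `a`, counted from zero, acts by the number of entries `suc a`.
  -- These are weights for 𝔤𝔩ₙ whose differences are the weights for 𝔰𝔩ₙ.
  εᵒ : ℕ → Op
  εᵒ a = record
    { apply      = λ v T → ι-ℤ (+ #[ suc a ] T) *ᴷ v T
    ; apply-cong = λ v≈w T → *-congˡ (v≈w T)
    ; apply-+    = λ v w T → distribˡ _ (v T) (w T)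
    ; apply-*    = λ k v T → solve 3 (λ a k v → a :* (k :* v) := k :* (a :* v)) ≈-refl (ι-ℤ (+ #[ suc a ] T)) k (v T)
    }

  -- The coefficients at `U` of the images of the basis vector of `W` under `xᵒ i` after `yᵒ j`, and
  -- under `yᵒ j` after `xᵒ i`.
  downUp upDown : Color n → Color n → Tableau → Tableau → 𝕜
  downUp i j U W = ∑ᴷ (λ R → Xᶜ i R U *ᴷ Yᶜ j R W) tableaux
  upDown i j U W = ∑ᴷ (λ S → Yᶜ j U S *ᴷ Xᶜ i W S) tableaux

  -- Only the meet can be passed on the way down and up, and only the join on the way up and down.
  -- Either both paths exist, and the diamond relation compares them, or neither does.
  downUp≈upDown : ∀ i j {U W} → W ≢ U → downUp i j U W ≈ upDown i j U W
  downUp≈upDown i j {U} {W} W≢U = begin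
    downUp i j U W                    ≈⟨ ∑ᴷ-only _ M (λ R R≢M → XY-no λ (e , f) → R≢M (meet-of f e W≢U)) ⟩
    Xᶜ i M U *ᴷ Yᶜ j M W              ≈⟨ compare (edge? i M U ×-dec edge? j M W) ⟩
    Xᶜ i W J *ᴷ Yᶜ j U J              ≈⟨ *-comm _ _ ⟩
    Yᶜ j U J *ᴷ Xᶜ i W J              ≈⟨ ∑ᴷ-only (λ S → Yᶜ j U S *ᴷ Xᶜ i W S) J (λ S S≢J → ≈-trans (*-comm _ _)
                                           (XY-no λ (e , f) → S≢J (join-of e f W≢U))) ⟨
    upDown i j U W                    ∎
    where
    M = W ∧ᵗ U
    J = W ∨ U
    compare : Dec (Edge i M U × Edge j M W) → Xᶜ i M U *ᴷ Yᶜ j M W ≈ Xᶜ i W J *ᴷ Yᶜ j U J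
    compare (yes (e , f)) = begin
      Xᶜ i M U *ᴷ Yᶜ j M W            ≈⟨ *-cong (Xᶜ-edge e) (Yᶜ-edge f) ⟩
      ι (X e) *ᴷ ι (Y f)              ≈⟨ ι-* (X e) (Y f) ⟨
      ι (X e ℚ.* Y f)                 ≡⟨ cong ι (trans (ℚₚ.*-comm (X e) (Y f)) (sym (diamond W≢U f e WJ UJ))) ⟩
      ι (X WJ ℚ.* Y UJ)               ≈⟨ ι-* (X WJ) (Y UJ) ⟩
      ι (X WJ) *ᴷ ι (Y UJ)            ≈⟨ *-cong (Xᶜ-edge WJ) (Yᶜ-edge UJ) ⟨
      Xᶜ i W J *ᴷ Yᶜ j U J            ∎
      where
      WJ : Edge i W J
      WJ = join-edge f e W≢U
      UJ : Edge j U J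
      UJ = subst (Edge j U) (∨-comm U W) (join-edge e f (W≢U ∘ sym))
    compare (no ¬both) = ≈-trans (XY-no ¬both) (≈-sym (XY-no λ (e , f) →
      ¬both (meet-edge e f W≢U , subst (λ M → Edge j M W) (∧-comm U W) (meet-edge f e (W≢U ∘ sym)))))

  diagonal-≢ : ∀ {i j} → i ≢ j → ∀ U → downUp i j U U ≈ upDown i j U U
  diagonal-≢ i≢j U = ≈-trans (∑ᴷ-Operator.big-ε tableaux λ R → XY-no λ (e , f) → i≢j (edge-color-unique e f))
    (≈-sym (∑ᴷ-Operator.big-ε tableaux λ S → ≈-trans (*-comm _ _) (XY-no λ (e , f) → i≢j (edge-color-unique e f))))

  ∑-edgesInto : ∀ i T (f : Tableau → 𝕜) (h : ∀ {S} → Edge i S T → 𝕜) → (∀ {S} (e : Edge i S T) → f S ≈ h e) →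
    (∀ S → ¬ Edge i S T → f S ≈ 0#) → ∑ᴷ f tableaux ≈ ∑ᴷ (λ (S , e) → h {S} e) (edgesInto i T)
  ∑-edgesInto i T f h f≈h f≈0 = ≈-sym (≈-trans (∑ᴷ-Operator.big-mapMaybe (λ (S , e) → h {S} e) _ tableaux)
    (∑ᴷ-Operator.big-cong tableaux same))
    where
    same : ∀ S → Maybe.maybe′ (λ (S , e) → h {S} e) 0# (Maybe.map (S ,_) (dec⇒maybe (edge? i S T))) ≈ f S
    same S with edge? i S T
    ... | yes e = ≈-sym (f≈h e)
    ... | no ¬e = ≈-sym (f≈0 S ¬e)

  ∑-edgesFrom : ∀ i T (f : Tableau → 𝕜) (h : ∀ {U} → Edge i T U → 𝕜) → (∀ {U} (e : Edge i T U) → f U ≈ h e) →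
    (∀ U → ¬ Edge i T U → f U ≈ 0#) → ∑ᴷ f tableaux ≈ ∑ᴷ (λ (U , e) → h {U} e) (edgesFrom i T)
  ∑-edgesFrom i T f h f≈h f≈0 = ≈-sym (≈-trans (∑ᴷ-Operator.big-mapMaybe (λ (U , e) → h {U} e) _ tableaux)
    (∑ᴷ-Operator.big-cong tableaux same))
    where
    same : ∀ U → Maybe.maybe′ (λ (U , e) → h {U} e) 0# (Maybe.map (U ,_) (dec⇒maybe (edge? i T U))) ≈ f U
    same U with edge? i T U
    ... | yes e = ≈-sym (f≈h e)
    ... | no ¬e = ≈-sym (f≈0 U ¬e)

  XY-edge : ∀ {i S T} (e : Edge i S T) → Xᶜ i S T *ᴷ Yᶜ i S T ≈ ι (X e ℚ.* Y e)
  XY-edge e = ≈-trans (*-cong (Xᶜ-edge e) (Yᶜ-edge e)) (≈-sym (ι-* (X e) (Y e)))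

  diagonal-≡ : ∀ i U → downUp i i U U -ᴷ upDown i i U U ≈ ι-ℤ (wtᵢ i U)
  diagonal-≡ i U = begin
    downUp i i U U -ᴷ upDown i i U U
      ≈⟨ +-cong (∑-edgesInto i U _ (λ e → ι (X e ℚ.* Y e)) XY-edge (λ R ¬e → XY-no (¬e ∘ proj₁)))
           (-‿cong (∑-edgesFrom i U _ (λ e → ι (X e ℚ.* Y e)) (λ e → ≈-trans (*-comm _ _) (XY-edge e))
             (λ S ¬e → ≈-trans (*-comm _ _) (XY-no (¬e ∘ proj₁))))) ⟩
    ∑ᴷ (λ (S , e) → ι (X e ℚ.* Y e)) (edgesInto i U) -ᴷ ∑ᴷ (λ (S , e) → ι (X e ℚ.* Y e)) (edgesFrom i U)
      ≈⟨ +-cong (ι-∑ (λ (S , e) → X e ℚ.* Y e) (edgesInto i U)) (-‿cong (ι-∑ (λ (S , e) → X e ℚ.* Y e) (edgesFrom i U))) ⟨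
    ι into -ᴷ ι from
      ≈⟨ +-congˡ (ι-neg from) ⟨
    ι into +ᴷ ι (ℚ.- from)
      ≈⟨ ι-+ into (ℚ.- from) ⟨
    ι (into ℚ.- from)
      ≡⟨ cong ι (crossing-sum i U) ⟩
    ι (fromℤ (wtᵢ i U))
      ≈⟨ ι-fromℤ (wtᵢ i U) ⟩
    ι-ℤ (wtᵢ i U) ∎
    where
    into = ∑ (λ (S , e) → X e ℚ.* Y e) (edgesInto i U)
    from = ∑ (λ (S , e) → X e ℚ.* Y e) (edgesFrom i U)

  xy-expand : ∀ i j v U → apply ⟦ xᵒ i , yᵒ j ⟧ v U ≈ ∑ᴷ (λ W → (downUp i j U W -ᴷ upDown i j U W) *ᴷ v W) tableaux
  xy-expand i j v U = begin
    apply ⟦ xᵒ i , yᵒ j ⟧ v U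
      ≡⟨ apply-⟦⟧ (xᵒ i) (yᵒ j) v U ⟩
    apply (xᵒ i) (apply (yᵒ j) v) U -ᴷ apply (yᵒ j) (apply (xᵒ i) v) U
      ≈⟨ +-cong (matrixOp-∘ (Xᶜ i) (λ T S → Yᶜ j S T) v U) (-‿cong (matrixOp-∘ (λ T S → Yᶜ j S T) (Xᶜ i) v U)) ⟩
    ∑ᴷ (λ W → downUp i j U W *ᴷ v W) tableaux -ᴷ ∑ᴷ (λ W → upDown i j U W *ᴷ v W) tableaux
      ≈⟨ ∑ᴷ-minus _ _ tableaux ⟩
    ∑ᴷ (λ W → downUp i j U W *ᴷ v W -ᴷ upDown i j U W *ᴷ v W) tableaux
      ≈⟨ ∑ᴷ-Operator.big-cong tableaux (λ W → solve 3 (λ a b v → a :* v :- b :* v := (a :- b) :* v) ≈-refl (downUp i j U W) (upDown i j U W) (v W)) ⟩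
    ∑ᴷ (λ W → (downUp i j U W -ᴷ upDown i j U W) *ᴷ v W) tableaux ∎

  zero-coefficient : ∀ {a b} v → a ≈ b → (a -ᴷ b) *ᴷ v ≈ 0#
  zero-coefficient {a} {b} v a≈b = ≈-trans (*-congʳ (≈-trans (+-congʳ a≈b) (-‿inverseʳ b))) (zeroˡ v)

  xy-≢ : ∀ {i j} → i ≢ j → ⟦ xᵒ i , yᵒ j ⟧ ≋ 0ᵒ
  xy-≢ {i} {j} i≢j = pointwise λ v U → ≈-trans (xy-expand i j v U) (≈-trans
    (∑ᴷ-Operator.big-ε tableaux λ W → zero-coefficient (v W) (vanish U W))
    (CommutativeRing.reflexive 𝕜-ring (sym (apply-0ᵒ v U))))
    where
    vanish : ∀ U W → downUp i j U W ≈ upDown i j U W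
    vanish U W with W ≟ᵗ U
    ... | yes refl = diagonal-≢ i≢j W
    ... | no  W≢U  = downUp≈upDown i j W≢U

  xy-≡ : ∀ i → ⟦ xᵒ i , yᵒ i ⟧ ≋ εᵒ (toℕ i) +ᵒ -ᵒ εᵒ (suc (toℕ i))
  xy-≡ i = pointwise λ v U → begin
    apply ⟦ xᵒ i , yᵒ i ⟧ v U                  ≈⟨ xy-expand i i v U ⟩
    ∑ᴷ (λ W → (downUp i i U W -ᴷ upDown i i U W) *ᴷ v W) tableaux
      ≈⟨ ∑ᴷ-only _ U (λ W W≢U → zero-coefficient (v W) (downUp≈upDown i i W≢U)) ⟩
    (downUp i i U U -ᴷ upDown i i U U) *ᴷ v U  ≈⟨ *-congʳ (diagonal-≡ i U) ⟩
    ι-ℤ (wtᵢ i U) *ᴷ v U                       ≈⟨ weight v U ⟩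
    apply (εᵒ (toℕ i)) v U -ᴷ apply (εᵒ (suc (toℕ i))) v U  ≡⟨ cong (apply (εᵒ (toℕ i)) v U +ᴷ_) (apply--ᵒ (εᵒ (suc (toℕ i))) v U) ⟨
    apply (εᵒ (toℕ i)) v U +ᴷ apply (-ᵒ εᵒ (suc (toℕ i))) v U  ≡⟨ apply-+ᵒ (εᵒ (toℕ i)) (-ᵒ εᵒ (suc (toℕ i))) v U ⟨
    apply (εᵒ (toℕ i) +ᵒ -ᵒ εᵒ (suc (toℕ i))) v U ∎
    where
    weight : ∀ v U → ι-ℤ (wtᵢ i U) *ᴷ v U ≈ apply (εᵒ (toℕ i)) v U -ᴷ apply (εᵒ (suc (toℕ i))) v U
    weight v U = ≈-trans (*-congʳ (≈-trans (ι-ℤ-+ (+ #[ colorℕ i ] U) (ℤ.- + #[ suc (colorℕ i) ] U)) (+-congˡ (ι-ℤ-neg (+ #[ suc (colorℕ i) ] U)))))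
      (solve 3 (λ a b v → (a :- b) :* v := a :* v :- b :* v) ≈-refl (ι-ℤ (+ #[ colorℕ i ] U)) (ι-ℤ (+ #[ suc (colorℕ i) ] U)) (v U))

  εε-commute : ∀ a b → ⟦ εᵒ a , εᵒ b ⟧ ≋ 0ᵒ
  εε-commute a b = pointwise λ v T → ≈-trans (CommutativeRing.reflexive 𝕜-ring (apply-⟦⟧ (εᵒ a) (εᵒ b) v T)) (≈-trans
    (solve 3 (λ a b v → a :* (b :* v) :- b :* (a :* v) := const 0ℤ) ≈-refl (ι-ℤ (+ #[ suc a ] T)) (ι-ℤ (+ #[ suc b ] T)) (v T))
    (CommutativeRing.reflexive 𝕜-ring (sym (apply-0ᵒ v T))))

  indicator-δ : ∀ a b → ι-ℤ (+ indicator a b) ≈ δ a b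
  indicator-δ a b = by-cases (a ℕ.≟ b)
    where
    by-cases : Dec (a ≡ b) → ι-ℤ (+ indicator a b) ≈ δ a b
    by-cases (yes a≡b) = ≈-trans (≈-trans (ι-ℤ-cong (cong (λ d → + (if d then 1 else 0)) (dec-true (a ℕ.≟ b) a≡b))) ι-ℤ-1) (≈-sym (δ-≡ a≡b))
    by-cases (no a≢b)  = ≈-trans (ι-ℤ-cong (cong (λ d → + (if d then 1 else 0)) (dec-false (a ℕ.≟ b) a≢b))) (≈-sym (δ-≢ a≢b))

  #-edge : ∀ {i S T} → Edge i S T → ∀ a →
           ι-ℤ (+ #[ suc a ] T) -ᴷ ι-ℤ (+ #[ suc a ] S) ≈ δ a (toℕ i) -ᴷ δ a (suc (toℕ i))
  #-edge {i} {S} {T} e a = begin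
    ι-ℤ (+ #[ suc a ] T) -ᴷ ι-ℤ (+ #[ suc a ] S)
      ≈⟨ +-congˡ (ι-ℤ-neg (+ #[ suc a ] S)) ⟨
    ι-ℤ (+ #[ suc a ] T) +ᴷ ι-ℤ (ℤ.- + #[ suc a ] S)
      ≈⟨ ι-ℤ-+ (+ #[ suc a ] T) (ℤ.- + #[ suc a ] S) ⟨
    ι-ℤ (+ #[ suc a ] T ℤ.- + #[ suc a ] S)
      ≈⟨ ι-ℤ-cong difference ⟩
    ι-ℤ (+ indicator a (toℕ i) ℤ.- + indicator a (suc (toℕ i)))
      ≈⟨ ι-ℤ-+ (+ indicator a (toℕ i)) (ℤ.- + indicator a (suc (toℕ i))) ⟩
    ι-ℤ (+ indicator a (toℕ i)) +ᴷ ι-ℤ (ℤ.- + indicator a (suc (toℕ i)))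
      ≈⟨ +-cong (indicator-δ a (toℕ i)) (≈-trans (ι-ℤ-neg (+ indicator a (suc (toℕ i)))) (-‿cong (indicator-δ a (suc (toℕ i))))) ⟩
    δ a (toℕ i) -ᴷ δ a (suc (toℕ i)) ∎
    where
    cancel : ∀ a b c d → a ℤ.- c ≡ ((a ℤ.+ b) ℤ.- b) ℤ.- ((c ℤ.+ d) ℤ.- d)
    cancel = solve-∀
    identity : ∀ g g′ x y → ((g ℤ.+ x) ℤ.- (g′ ℤ.+ y)) ℤ.- (g ℤ.- g′) ≡ x ℤ.- y
    identity = solve-∀
    difference : + #[ suc a ] T ℤ.- + #[ suc a ] S ≡ + indicator a (toℕ i) ℤ.- + indicator a (suc (toℕ i))
    difference = trans (cancel (+ #[ suc a ] T) (+ G T a) (+ #[ suc a ] S) (+ G S a)) (trans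
      (cong₂ (λ x y → (+ x ℤ.- + G T a) ℤ.- (+ y ℤ.- + G S a)) (trans (#-G a T) (edge-G e (suc a))) (#-G a S))
      (trans (cong (λ x → (+ (G S (suc a) ℕ.+ indicator a (toℕ i)) ℤ.- + x) ℤ.- (+ G S (suc a) ℤ.- + G S a)) (edge-G e a))
        (identity (+ G S (suc a)) (+ G S a) (+ indicator a (toℕ i)) (+ indicator a (suc (toℕ i))))))

  ε-matrixOp : ∀ a (M : Tableau → Tableau → 𝕜) k → (∀ S T → (ι-ℤ (+ #[ suc a ] T) -ᴷ ι-ℤ (+ #[ suc a ] S)) *ᴷ M S T ≈ k *ᴷ M S T) →
               ⟦ εᵒ a , matrixOp M ⟧ ≋ k ·ᵒ matrixOp M
  ε-matrixOp a M k weight = pointwise λ v T → begin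
    apply ⟦ εᵒ a , matrixOp M ⟧ v T              ≡⟨ apply-⟦⟧ (εᵒ a) (matrixOp M) v T ⟩
    w T *ᴷ ∑ᴷ (λ S → M S T *ᴷ v S) tableaux -ᴷ ∑ᴷ (λ S → M S T *ᴷ (w S *ᴷ v S)) tableaux
      ≈⟨ ≈-trans (+-congʳ (∑ᴷ-*ˡ (w T) _ tableaux)) (∑ᴷ-minus _ _ tableaux) ⟩
    ∑ᴷ (λ S → w T *ᴷ (M S T *ᴷ v S) -ᴷ M S T *ᴷ (w S *ᴷ v S)) tableaux
      ≈⟨ ∑ᴷ-Operator.big-cong tableaux (λ S → ≈-trans
           (solve 4 (λ a b m v → a :* (m :* v) :- m :* (b :* v) := ((a :- b) :* m) :* v) ≈-refl (w T) (w S) (M S T) (v S))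
           (≈-trans (*-congʳ (weight S T)) (*-assoc k (M S T) (v S)))) ⟩
    ∑ᴷ (λ S → k *ᴷ (M S T *ᴷ v S)) tableaux      ≈⟨ ∑ᴷ-*ˡ k _ tableaux ⟨
    k *ᴷ ∑ᴷ (λ S → M S T *ᴷ v S) tableaux        ≡⟨ apply-·ᵒ k (matrixOp M) v T ⟨
    apply (k ·ᵒ matrixOp M) v T                  ∎
    where
    w : Tableau → 𝕜
    w T = ι-ℤ (+ #[ suc a ] T)

  εx-weight : ∀ a i → ⟦ εᵒ a , xᵒ i ⟧ ≋ (δ a (toℕ i) -ᴷ δ a (suc (toℕ i))) ·ᵒ xᵒ i
  εx-weight a i = ε-matrixOp a (Xᶜ i) _ λ S T → by-cases S T (edge? i S T)
    where
    by-cases : ∀ S T → Dec (Edge i S T) → (ι-ℤ (+ #[ suc a ] T) -ᴷ ι-ℤ (+ #[ suc a ] S)) *ᴷ Xᶜ i S T ≈ (δ a (toℕ i) -ᴷ δ a (suc (toℕ i))) *ᴷ Xᶜ i S T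
    by-cases S T (yes e) = *-congʳ (#-edge e a)
    by-cases S T (no ¬e) = ≈-trans (*-congˡ (Xᶜ-no ¬e)) (≈-trans (zeroʳ _) (≈-sym (≈-trans (*-congˡ (Xᶜ-no ¬e)) (zeroʳ _))))

  εy-weight : ∀ a i → ⟦ εᵒ a , yᵒ i ⟧ ≋ (-ᴷ (δ a (toℕ i) -ᴷ δ a (suc (toℕ i)))) ·ᵒ yᵒ i
  εy-weight a i = ε-matrixOp a (λ T S → Yᶜ i S T) _ λ T S → by-cases T S (edge? i S T)
    where
    by-cases : ∀ T S → Dec (Edge i S T) → (ι-ℤ (+ #[ suc a ] S) -ᴷ ι-ℤ (+ #[ suc a ] T)) *ᴷ Yᶜ i S T ≈ (-ᴷ (δ a (toℕ i) -ᴷ δ a (suc (toℕ i)))) *ᴷ Yᶜ i S T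
    by-cases T S (yes e) = *-congʳ (≈-trans (solve 2 (λ a b → a :- b := :- (b :- a)) ≈-refl _ _) (-‿cong (#-edge e a)))
    by-cases T S (no ¬e) = ≈-trans (*-congˡ (Yᶜ-no ¬e)) (≈-trans (zeroʳ _) (≈-sym (≈-trans (*-congˡ (Yᶜ-no ¬e)) (zeroʳ _))))

  -- Each bracket with e improves by one the amount by which an operator raises
  -- the filtration by φ; no operator lowers it by more than B.
  module _ (φ : Tableau → ℕ) (B : ℕ) (φ≤B : ∀ T → φ T ℕ.≤ B) where

    VanishesBelow : ℕ → (Tableau → 𝕜) → Set _
    VanishesBelow k v = ∀ T → φ T ℕ.< k → v T ≈ 0#

    module _ {e : Op} (raises : ∀ k {v} → VanishesBelow k v → VanishesBelow (suc k) (apply e v)) where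

      private
        shift : ∀ M A k v → VanishesBelow k v → ∀ T → φ T ℕ.+ B ℕ.< k ℕ.+ M → apply (adᴺ e M A) v T ≈ 0#
        -- Here the condition gives `B < k`, so `v` vanishes on all tableaux.
        shift zero A k v v≈0 T lt = ≈-trans (apply-cong A (λ S → v≈0 S (ℕₚ.≤-<-trans (φ≤B S)
          (ℕₚ.≤-<-trans (ℕₚ.m≤n+m B (φ T)) (subst (φ T ℕ.+ B ℕ.<_) (ℕₚ.+-identityʳ k) lt)))) T) (apply-0 A T)
        shift (suc M) A k v v≈0 T lt = begin
          apply ⟦ e , adᴺ e M A ⟧ v T                                               ≡⟨ apply-⟦⟧ e (adᴺ e M A) v T ⟩
          apply e (apply (adᴺ e M A) v) T -ᴷ apply (adᴺ e M A) (apply e v) T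
            ≈⟨ +-cong (raises (k ℕ.+ M ∸ B) (λ S lt′ → shift M A k v v≈0 S (ℕₚ.m≤o∸n⇒m+n≤o (suc (φ S)) B≤ lt′)) T
                        (s≤s (ℕₚ.m+n≤o⇒m≤o∸n (φ T) lt″)))
                 (-‿cong (shift M A (suc k) (apply e v) (raises k v≈0) T (subst (φ T ℕ.+ B ℕ.<_) (ℕₚ.+-suc k M) lt))) ⟩
          0# -ᴷ 0#                                                                  ≈⟨ -‿inverseʳ 0# ⟩
          0#                                                                        ∎
          where
          lt″ : φ T ℕ.+ B ℕ.≤ k ℕ.+ M
          lt″ = ℕ.s≤s⁻¹ (subst (φ T ℕ.+ B ℕ.<_) (ℕₚ.+-suc k M) lt)
          B≤ : B ℕ.≤ k ℕ.+ M
          B≤ = ℕₚ.≤-trans (ℕₚ.m≤n+m B (φ T)) lt″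

      ad-nilpotent : ∀ A → ∃[ M ] adᴺ e M A ≋ 0ᵒ
      -- Every `v` vanishes below zero. With `k = 0` the condition of `shift` reads `φ T + B < M`,
      -- and `φ T` is at most `B`.
      ad-nilpotent A = suc (B ℕ.+ B) , pointwise λ v T → ≈-trans
        (shift (suc (B ℕ.+ B)) A 0 v (λ _ ()) T (s≤s (ℕₚ.+-monoˡ-≤ B (φ≤B T))))
        (CommutativeRing.reflexive 𝕜-ring (sym (apply-0ᵒ v T)))

  module _ (i : Color n) where

    private
      B = ∑ₙ (SkewShape.P shape) rows
      φ = λ T → G T (colorℕ i)

      φ≤B : ∀ T → φ T ℕ.≤ B
      φ≤B T = ∑ₙ-mono rows (g≤P T (colorℕ i))

      φ-edge : ∀ {S T} → Edge i S T → φ T ≡ suc (φ S)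
      φ-edge {S} e = trans (edge-G e (colorℕ i)) (trans
        (cong (λ b → φ S ℕ.+ (if b then 1 else 0)) (dec-true (colorℕ i ℕ.≟ colorℕ i) refl)) (ℕₚ.+-comm (φ S) 1))

      *-zero : ∀ {a b} → b ≈ 0# → a *ᴷ b ≈ 0#
      *-zero b≈0 = ≈-trans (*-congˡ b≈0) (zeroʳ _)

    xᵒ-nilpotent : ∀ A → ∃[ M ] adᴺ (xᵒ i) M A ≋ 0ᵒ
    xᵒ-nilpotent = ad-nilpotent φ B φ≤B λ k {v} v≈0 T φT<1+k → ∑ᴷ-Operator.big-ε tableaux λ S → term k v v≈0 S T φT<1+k (edge? i S T)
      where
      term : ∀ k v → VanishesBelow φ B φ≤B k v → ∀ S T → φ T ℕ.< suc k → Dec (Edge i S T) → Xᶜ i S T *ᴷ v S ≈ 0#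
      term k v v≈0 S T lt (yes e) = *-zero (v≈0 S (ℕ.s≤s⁻¹ (subst (ℕ._< suc k) (φ-edge e) lt)))
      term k v v≈0 S T lt (no ¬e) = ≈-trans (*-congʳ (Xᶜ-no ¬e)) (zeroˡ _)

    -yᵒ-nilpotent : ∀ A → ∃[ M ] adᴺ (-ᵒ yᵒ i) M A ≋ 0ᵒ
    -- `y` lowers `φ`, so the reversed filtration by `B ∸ φ T` is used.
    -yᵒ-nilpotent = ad-nilpotent (λ T → B ∸ φ T) B (λ T → ℕₚ.m∸n≤m B (φ T)) λ k {v} v≈0 S lt →
      ≈-trans (CommutativeRing.reflexive 𝕜-ring (apply--ᵒ (yᵒ i) v S)) (≈-trans
        (-‿cong (∑ᴷ-Operator.big-ε tableaux λ T → term k v v≈0 S T lt (edge? i S T))) -0#≈0#)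
      where
      term : ∀ k v → VanishesBelow (λ T → B ∸ φ T) B (λ T → ℕₚ.m∸n≤m B (φ T)) k v →
             ∀ S T → B ∸ φ S ℕ.< suc k → Dec (Edge i S T) → Yᶜ i S T *ᴷ v T ≈ 0#
      term k v v≈0 S T lt (yes e) = *-zero (v≈0 T (ℕ.s≤s⁻¹ (ℕₚ.≤-<-trans smaller lt)))
        where
        smaller : suc (B ∸ φ T) ℕ.≤ B ∸ φ S
        smaller = ℕₚ.≤-reflexive (trans (sym (ℕₚ.+-∸-assoc 1 (φ≤B T))) (cong (suc B ∸_) (φ-edge e)))
      term k v v≈0 S T lt (no ¬e) = ≈-trans (*-congʳ (Yᶜ-no ¬e)) (zeroˡ _)

  N : ℕ
  N = n ∸ 1

  opaque

    -- With natural numbers as indices and the zero operator out of range, the nested brackets need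
    -- no bounds on their indices.
    atColor : (Color n → Op) → ℕ → Op
    atColor f i with i ℕ.<? N
    ... | yes i<N = f (Fin.fromℕ< i<N)
    ... | no  _   = 0ᵒ

    atColor-toℕ : ∀ f i → atColor f (toℕ i) ≡ f i
    atColor-toℕ f i with toℕ i ℕ.<? N
    ... | yes i<N = cong f (Finₚ.fromℕ<-toℕ i i<N)
    ... | no  i≮N = contradiction (Finₚ.toℕ<n i) i≮N

    atColor-zero : ∀ f {i} → N ℕ.≤ i → atColor f i ≋ 0ᵒ
    atColor-zero f {i} N≤i with i ℕ.<? N
    ... | yes i<N = contradiction i<N (ℕₚ.≤⇒≯ N≤i)
    ... | no  _   = ≋-refl

  data Index : ℕ → Set where
    color  : ∀ j → Index (toℕ {N} j)
    noColor : ∀ {i} → N ℕ.≤ i → Index i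

  index : ∀ i → Index i
  index i with i ℕ.<? N
  ... | yes i<N = subst Index (Finₚ.toℕ-fromℕ< i<N) (color (Fin.fromℕ< i<N))
  ... | no  i≮N = noColor (ℕₚ.≮⇒≥ i≮N)

  -yᵒ : Color n → Op
  -yᵒ i = -ᵒ yᵒ i

  xᴺ zᴺ : ℕ → Op
  xᴺ = atColor xᵒ
  zᴺ = atColor -yᵒ

  xᴺ-≋ : ∀ j → xᴺ (toℕ j) ≋ xᵒ j
  xᴺ-≋ j = ≋-reflexive (atColor-toℕ xᵒ j)

  zᴺ-≋ : ∀ j → zᴺ (toℕ j) ≋ -yᵒ j
  zᴺ-≋ j = ≋-reflexive (atColor-toℕ -yᵒ j)

  ad-zero-nilpotent : ∀ {e} → e ≋ 0ᵒ → ∀ A → ∃[ M ] adᴺ e M A ≋ 0ᵒ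
  ad-zero-nilpotent e≋0 A = 1 , ⟦⟧-zeroˡ A e≋0

  xz-≢ : ∀ {i j} → Index i → Index j → i ≢ j → ⟦ xᴺ i , zᴺ j ⟧ ≋ 0ᵒ
  xz-≢ {j = j} (noColor N≤i) _ _  = ⟦⟧-zeroˡ (zᴺ j) (atColor-zero xᵒ N≤i)
  xz-≢ {i} (color _) (noColor N≤j) _ = ⟦⟧-zeroʳ (xᴺ i) (atColor-zero -yᵒ N≤j)
  xz-≢ (color a) (color b) i≢j = ≋-trans (⟦⟧-cong (xᴺ-≋ a) (zᴺ-≋ b))
    (≋-trans (⟦⟧--ʳ (xᵒ a) (yᵒ b)) (-ᵒ-zero (xy-≢ (i≢j ∘ cong toℕ))))

  xz-≡ : ∀ {i} → Index i → i ℕ.< N → ⟦ xᴺ i , zᴺ i ⟧ ≋ -ᵒ (εᵒ i +ᵒ -ᵒ εᵒ (suc i))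
  xz-≡ (noColor N≤i) i<N = contradiction i<N (ℕₚ.≤⇒≯ N≤i)
  xz-≡ (color a) _ = ≋-trans (⟦⟧-cong (xᴺ-≋ a) (zᴺ-≋ a)) (≋-trans (⟦⟧--ʳ (xᵒ a) (yᵒ a)) (-ᵒ-cong (xy-≡ a)))

  εx-≋ : ∀ a {i} → Index i → ⟦ εᵒ a , xᴺ i ⟧ ≋ (δ a i -ᴷ δ a (suc i)) ·ᵒ xᴺ i
  εx-≋ a (noColor N≤i) = ≋-trans (⟦⟧-zeroʳ (εᵒ a) (atColor-zero xᵒ N≤i)) (≋-sym (·ᵒ-zero (atColor-zero xᵒ N≤i)))
  εx-≋ a (color j) = ≋-trans (⟦⟧-congˡ (xᴺ-≋ j)) (≋-trans (εx-weight a j) (·ᵒ-cong ≈-refl (≋-sym (xᴺ-≋ j))))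

  εz-≋ : ∀ a {i} → Index i → ⟦ εᵒ a , zᴺ i ⟧ ≋ (-ᴷ (δ a i -ᴷ δ a (suc i))) ·ᵒ zᴺ i
  εz-≋ a (noColor N≤i) = ≋-trans (⟦⟧-zeroʳ (εᵒ a) (atColor-zero -yᵒ N≤i)) (≋-sym (·ᵒ-zero (atColor-zero -yᵒ N≤i)))
  εz-≋ a (color j) = ≋-trans (⟦⟧-congˡ (zᴺ-≋ j)) (≋-trans (⟦⟧--ʳ (εᵒ a) (yᵒ j)) (≋-trans (-ᵒ-cong (εy-weight a j))
    (≋-trans (-ᵒ-· _ (yᵒ j)) (·ᵒ-cong ≈-refl (≋-sym (zᴺ-≋ j))))))

  xᴺ-nilpotent : ∀ {i} → Index i → ∀ v → ∃[ M ] adᴺ (xᴺ i) M v ≋ 0ᵒ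
  xᴺ-nilpotent (noColor N≤i) v = ad-zero-nilpotent (atColor-zero xᵒ N≤i) v
  xᴺ-nilpotent (color j) v = subst (λ e → ∃[ M ] adᴺ e M v ≋ 0ᵒ) (sym (atColor-toℕ xᵒ j)) (xᵒ-nilpotent j v)

  zᴺ-nilpotent : ∀ {i} → Index i → ∀ v → ∃[ M ] adᴺ (zᴺ i) M v ≋ 0ᵒ
  zᴺ-nilpotent (noColor N≤i) v = ad-zero-nilpotent (atColor-zero -yᵒ N≤i) v
  zᴺ-nilpotent (color j) v = subst (λ e → ∃[ M ] adᴺ e M v ≋ 0ᵒ) (sym (atColor-toℕ -yᵒ j)) (-yᵒ-nilpotent j v)

  system : System N xᴺ zᴺ εᵒ
  system = record
    { x-zero      = atColor-zero xᵒ
    ; z-zero      = atColor-zero -yᵒ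
    ; xz-≢        = λ {i} {j} → xz-≢ (index i) (index j)
    ; xz-≡        = λ {i} → xz-≡ (index i)
    ; εε          = εε-commute
    ; εx          = λ a i → εx-≋ a (index i)
    ; εz          = λ a i → εz-≋ a (index i)
    ; x-nilpotent = λ i → xᴺ-nilpotent (index i)
    ; z-nilpotent = λ i → zᴺ-nilpotent (index i)
    }

-- The representation, its weight basis and its character

lookup-injective : ∀ {A : Set} {xs : List A} → Unique xs → ∀ j k → List.lookup xs j ≡ List.lookup xs k → j ≡ k
lookup-injective (x∉ ∷ u) zero    zero    eq = refl
lookup-injective (x∉ ∷ u) zero    (suc k) eq = contradiction eq (All.lookup x∉ (∈ₚ.∈-lookup k))
lookup-injective (x∉ ∷ u) (suc j) zero    eq = contradiction (sym eq) (All.lookup x∉ (∈ₚ.∈-lookup j))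
lookup-injective (x∉ ∷ u) (suc j) (suc k) eq = cong suc (lookup-injective u j k eq)

module TableauRepresentation {c ℓ₁ ℓ₂} (K : HeytingField c ℓ₁ ℓ₂) (char0 : CharacteristicZero K)
                             {m n : ℕ} (shape : SkewShape m n) where

  open SkewTableaux shape
  open GroundField K char0
  open FieldDefs K char0
  open Operators K char0 Tableau
  open GLRelations K char0 Tableau using (δ; δ-≡; δ-≢)
  open ChevalleySystems K char0 Tableau
  open TableauOperators K char0 shape
  open MatrixUnits system using (E; E-simple; E-lower; E-diagonal)
  open Algebra.Properties.Semiring.Sum (CommutativeRing.semiring 𝕜-ring)
    using (sum; sum-cong-≋; ∑-distrib-+; ∑-comm; *-distribˡ-sum; *-distribʳ-sum)
  open import Algebra.Apartness.Properties.HeytingCommutativeRing heytingCommutativeRing using (#-congʳ)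
  open import Relation.Binary.Reasoning.Setoid (CommutativeRing.setoid 𝕜-ring)

  ∑₂ : (Fin n → Fin n → 𝕜) → 𝕜
  ∑₂ f = sum λ a → sum λ b → f a b

  ∑₂-cong : ∀ {f h : Fin n → Fin n → 𝕜} → (∀ a b → f a b ≈ h a b) → ∑₂ f ≈ ∑₂ h
  ∑₂-cong f≈h = sum-cong-≋ λ a → sum-cong-≋ λ b → f≈h a b

  ∑₂-+ : ∀ f h → ∑₂ (λ a b → f a b +ᴷ h a b) ≈ ∑₂ f +ᴷ ∑₂ h
  ∑₂-+ f h = ≈-trans (sum-cong-≋ λ a → ∑-distrib-+ (f a) (h a)) (∑-distrib-+ (λ a → sum (f a)) (λ a → sum (h a)))

  ∑₂-minus : ∀ f h → ∑₂ (λ a b → f a b -ᴷ h a b) ≈ ∑₂ f -ᴷ ∑₂ h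
  ∑₂-minus f h = ≈-trans (sum-cong-≋ λ a → sum-minus (f a) (h a)) (sum-minus (λ a → sum (f a)) (λ a → sum (h a)))

  ∑₂-*ˡ : ∀ k f → k *ᴷ ∑₂ f ≈ ∑₂ (λ a b → k *ᴷ f a b)
  ∑₂-*ˡ k f = ≈-trans (*-distribˡ-sum k (λ a → sum (f a))) (sum-cong-≋ λ a → *-distribˡ-sum k (f a))

  ∑₂-sum-comm : ∀ (f : Fin n → Fin n → Fin n → 𝕜) → ∑₂ (λ a b → sum (f a b)) ≈ sum (λ c → ∑₂ (λ a b → f a b c))
  ∑₂-sum-comm f = ≈-trans (sum-cong-≋ λ a → ∑-comm (f a)) (∑-comm λ a c → sum λ b → f a b c)

  ∑₂-comm : ∀ (f : Fin n → Fin n → Fin n → Fin n → 𝕜) →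
            ∑₂ (λ a b → ∑₂ (λ c d → f a b c d)) ≈ ∑₂ (λ c d → ∑₂ (λ a b → f a b c d))
  ∑₂-comm f = ≈-trans (∑₂-sum-comm λ a b c → sum (f a b c)) (sum-cong-≋ λ c → ∑₂-sum-comm λ a b → f a b c)

  sum-only : ∀ {k} (f : Fin k → 𝕜) a → (∀ b → b ≢ a → f b ≈ 0#) → sum f ≈ f a
  sum-only f zero    f≈0 = ≈-trans (+-congˡ (sum-zero (f ∘ suc) λ b → f≈0 (suc b) λ ())) (+-identityʳ _)
  sum-only f (suc a) f≈0 = ≈-trans (+-cong (f≈0 zero λ ()) (sum-only (f ∘ suc) a λ b b≢a → f≈0 (suc b) (b≢a ∘ Finₚ.suc-injective)))
    (+-identityˡ _)

  sum-δ : ∀ (f : Fin n → 𝕜) a → sum (λ b → δ (toℕ a) (toℕ b) *ᴷ f b) ≈ f a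
  sum-δ f a = ≈-trans (sum-only (λ b → δ (toℕ a) (toℕ b) *ᴷ f b) a λ b b≢a → ≈-trans (*-congʳ (δ-≢ (b≢a ∘ sym ∘ Finₚ.toℕ-injective))) (zeroˡ (f b)))
    (≈-trans (*-congʳ (δ-≡ {toℕ a} refl)) (*-identityˡ (f a)))

  ∑₂-unit : ∀ (p q : Fin n) (f : Fin n → Fin n → 𝕜) → ∑₂ (λ a b → unit p q a b *ᴷ f a b) ≈ f p q
  ∑₂-unit p q f = ≈-trans (sum-only (λ a → sum λ b → unit p q a b *ᴷ f a b) p λ a a≢p → sum-zero (λ b → unit p q a b *ᴷ f a b) λ b →
      ≈-trans (*-congʳ (CommutativeRing.reflexive 𝕜-ring (cong (λ d → if d ∧ does (q Finₚ.≟ b) then 1# else 0#) (dec-false (p Finₚ.≟ a) (a≢p ∘ sym))))) (zeroˡ (f a b)))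
    (≈-trans (sum-only (λ b → unit p q p b *ᴷ f p b) q λ b b≢q → ≈-trans (*-congʳ (CommutativeRing.reflexive 𝕜-ring
        (cong₂ (λ d e → if d ∧ e then 1# else 0#) (dec-true (p Finₚ.≟ p) refl) (dec-false (q Finₚ.≟ b) (b≢q ∘ sym))))) (zeroˡ (f p b)))
      (≈-trans (*-congʳ (CommutativeRing.reflexive 𝕜-ring
        (cong₂ (λ d e → if d ∧ e then 1# else 0#) (dec-true (p Finₚ.≟ p) refl) (dec-true (q Finₚ.≟ q) refl)))) (*-identityˡ (f p q))))

  apply-sum : ∀ {k} A (f : Fin k → Vector) t → apply A (λ s → sum (λ a → f a s)) t ≈ sum (λ a → apply A (f a) t)
  apply-sum {zero}  A f t = apply-0 A t
  apply-sum {suc k} A f t = ≈-trans (apply-+ A (f zero) (λ s → sum (λ a → f (suc a) s)) t) (+-congˡ (apply-sum A (f ∘ suc) t))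

  apply-∑₂ : ∀ A (f : Fin n → Fin n → Vector) t → apply A (λ s → ∑₂ (λ a b → f a b s)) t ≈ ∑₂ (λ a b → apply A (f a b) t)
  apply-∑₂ A f t = ≈-trans (apply-sum A (λ a s → sum (λ b → f a b s)) t) (sum-cong-≋ λ a → apply-sum A (f a) t)

  Eᶠ : Fin n → Fin n → Op
  Eᶠ a b = E (toℕ a) (toℕ b)

  toℕ≤N : ∀ (a : Fin n) → toℕ a ℕ.≤ N
  toℕ≤N a = ℕₚ.∸-monoˡ-≤ 1 (Finₚ.toℕ<n a)

  commutator : ∀ a b c d v t → apply (Eᶠ a b) (apply (Eᶠ c d) v) t -ᴷ apply (Eᶠ c d) (apply (Eᶠ a b) v) t ≈
    δ (toℕ b) (toℕ c) *ᴷ apply (Eᶠ a d) v t -ᴷ δ (toℕ a) (toℕ d) *ᴷ apply (Eᶠ c b) v t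
  commutator a b c d v t = begin
    apply (Eᶠ a b) (apply (Eᶠ c d) v) t -ᴷ apply (Eᶠ c d) (apply (Eᶠ a b) v) t   ≡⟨ apply-⟦⟧ (Eᶠ a b) (Eᶠ c d) v t ⟨
    apply ⟦ Eᶠ a b , Eᶠ c d ⟧ v t                                               ≈⟨ at (bracket system (toℕ≤N a) (toℕ≤N b) (toℕ c) (toℕ d)) v t ⟩
    apply (δ (toℕ b) (toℕ c) ·ᵒ Eᶠ a d +ᵒ (-ᴷ δ (toℕ a) (toℕ d)) ·ᵒ Eᶠ c b) v t   ≡⟨ apply-+ᵒ _ _ v t ⟩
    apply (δ (toℕ b) (toℕ c) ·ᵒ Eᶠ a d) v t +ᴷ apply ((-ᴷ δ (toℕ a) (toℕ d)) ·ᵒ Eᶠ c b) v t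
      ≡⟨ cong₂ _+ᴷ_ (apply-·ᵒ (δ (toℕ b) (toℕ c)) (Eᶠ a d) v t) (apply-·ᵒ (-ᴷ δ (toℕ a) (toℕ d)) (Eᶠ c b) v t) ⟩
    δ (toℕ b) (toℕ c) *ᴷ apply (Eᶠ a d) v t +ᴷ (-ᴷ δ (toℕ a) (toℕ d)) *ᴷ apply (Eᶠ c b) v t
      ≈⟨ +-congˡ (solve 2 (λ k a → (:- k) :* a := :- (k :* a)) ≈-refl (δ (toℕ a) (toℕ d)) (apply (Eᶠ c b) v t)) ⟩
    δ (toℕ b) (toℕ c) *ᴷ apply (Eᶠ a d) v t -ᴷ δ (toℕ a) (toℕ d) *ᴷ apply (Eᶠ c b) v t   ∎

  δ-sym : ∀ a b → δ a b ≈ δ b a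
  δ-sym a b with a ℕ.≟ b
  ... | yes refl = ≈-refl
  ... | no  a≢b  = ≈-trans (δ-≢ a≢b) (≈-sym (δ-≢ (a≢b ∘ sym)))

  opaque

    -- Linear extension from the matrix units to all matrices; the representation of 𝔰𝔩ₙ is its
    -- restriction.
    action : Matrix n → Vector → Vector
    action A v t = ∑₂ λ a b → A a b *ᴷ apply (Eᶠ a b) v t

    action-∘ : ∀ A B v t → action A (action B v) t ≈
               ∑₂ (λ a b → ∑₂ (λ c d → A a b *ᴷ B c d *ᴷ apply (Eᶠ a b) (apply (Eᶠ c d) v) t))
    action-∘ A B v t = ∑₂-cong λ a b → ≈-trans
      (*-congˡ (≈-trans (apply-∑₂ (Eᶠ a b) (λ c d s → B c d *ᴷ apply (Eᶠ c d) v s) t)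
        (∑₂-cong λ c d → apply-* (Eᶠ a b) (B c d) (apply (Eᶠ c d) v) t)))
      (≈-trans (∑₂-*ˡ (A a b) _) (∑₂-cong λ c d → ≈-sym (*-assoc (A a b) (B c d) _)))

    contract : ∀ A B v t → ∑₂ (λ a b → ∑₂ (λ c d → A a b *ᴷ B c d *ᴷ (δ (toℕ b) (toℕ c) *ᴷ apply (Eᶠ a d) v t))) ≈
               action (A ·ᵐ B) v t
    contract A B v t = sum-cong-≋ λ a → begin
      sum (λ b → sum λ c → sum λ d → A a b *ᴷ B c d *ᴷ (δ (toℕ b) (toℕ c) *ᴷ e a d))
        ≈⟨ sum-cong-≋ (λ b → ≈-trans
             (sum-cong-≋ λ c → ≈-trans
               (sum-cong-≋ λ d → solve 4 (λ a b k e → (a :* b) :* (k :* e) := k :* (a :* b :* e)) ≈-refl (A a b) (B c d) (δ (toℕ b) (toℕ c)) (e a d))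
               (≈-sym (*-distribˡ-sum (δ (toℕ b) (toℕ c)) (λ d → A a b *ᴷ B c d *ᴷ e a d))))
             (sum-δ (λ c → sum λ d → A a b *ᴷ B c d *ᴷ e a d) b)) ⟩
      sum (λ b → sum λ d → A a b *ᴷ B b d *ᴷ e a d)
        ≈⟨ ∑-comm (λ b d → A a b *ᴷ B b d *ᴷ e a d) ⟩
      sum (λ d → sum λ b → A a b *ᴷ B b d *ᴷ e a d)
        ≈⟨ sum-cong-≋ (λ d → ≈-sym (*-distribʳ-sum (e a d) (λ b → A a b *ᴷ B b d))) ⟩
      sum (λ d → (A ·ᵐ B) a d *ᴷ e a d) ∎
      where
      e : Fin n → Fin n → 𝕜
      e a d = apply (Eᶠ a d) v t

    -- Both sides are bilinear, so `commutator` for matrix units suffices. Summing its Kronecker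
    -- symbols with `contract` rebuilds the two matrix products, the second one after the pairs of
    -- indices are exchanged.
    action-bracket : ∀ (A B : Matrix n) v t →
      action (λ a b → (A ·ᵐ B) a b -ᴷ (B ·ᵐ A) a b) v t ≈ action A (action B v) t -ᴷ action B (action A v) t
    action-bracket A B v t = ≈-sym (begin
      action A (action B v) t -ᴷ action B (action A v) t
        ≈⟨ +-cong (action-∘ A B v t) (-‿cong (≈-trans (action-∘ B A v t) (∑₂-comm λ c d a b → B c d *ᴷ A a b *ᴷ EE c d a b))) ⟩
      ∑₂ (λ a b → ∑₂ (λ c d → A a b *ᴷ B c d *ᴷ EE a b c d)) -ᴷ ∑₂ (λ a b → ∑₂ (λ c d → B c d *ᴷ A a b *ᴷ EE c d a b))
        ≈⟨ ≈-trans (∑₂-cong λ a b → ∑₂-minus (λ c d → A a b *ᴷ B c d *ᴷ EE a b c d) (λ c d → B c d *ᴷ A a b *ᴷ EE c d a b))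
             (∑₂-minus (λ a b → ∑₂ (λ c d → A a b *ᴷ B c d *ᴷ EE a b c d)) (λ a b → ∑₂ (λ c d → B c d *ᴷ A a b *ᴷ EE c d a b))) ⟨
      ∑₂ (λ a b → ∑₂ (λ c d → A a b *ᴷ B c d *ᴷ EE a b c d -ᴷ B c d *ᴷ A a b *ᴷ EE c d a b))
        ≈⟨ ∑₂-cong (λ a b → ∑₂-cong λ c d → ≈-trans
             (solve 4 (λ a b x y → a :* b :* x :- b :* a :* y := a :* b :* (x :- y)) ≈-refl (A a b) (B c d) (EE a b c d) (EE c d a b))
             (≈-trans (*-congˡ (commutator a b c d v t))
               (solve 6 (λ a b k l x y → a :* b :* (k :* x :- l :* y) := a :* b :* (k :* x) :- b :* a :* (l :* y)) ≈-refl
                 (A a b) (B c d) (δ (toℕ b) (toℕ c)) (δ (toℕ a) (toℕ d)) (e a d) (e c b)))) ⟩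
      ∑₂ (λ a b → ∑₂ (λ c d → A a b *ᴷ B c d *ᴷ (δ (toℕ b) (toℕ c) *ᴷ e a d) -ᴷ B c d *ᴷ A a b *ᴷ (δ (toℕ a) (toℕ d) *ᴷ e c b)))
        ≈⟨ ≈-trans (∑₂-cong λ a b → ∑₂-minus (λ c d → A a b *ᴷ B c d *ᴷ (δ (toℕ b) (toℕ c) *ᴷ e a d)) (λ c d → B c d *ᴷ A a b *ᴷ (δ (toℕ a) (toℕ d) *ᴷ e c b)))
             (∑₂-minus (λ a b → ∑₂ λ c d → A a b *ᴷ B c d *ᴷ (δ (toℕ b) (toℕ c) *ᴷ e a d)) (λ a b → ∑₂ λ c d → B c d *ᴷ A a b *ᴷ (δ (toℕ a) (toℕ d) *ᴷ e c b))) ⟩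
      ∑₂ (λ a b → ∑₂ (λ c d → A a b *ᴷ B c d *ᴷ (δ (toℕ b) (toℕ c) *ᴷ e a d))) -ᴷ ∑₂ (λ a b → ∑₂ (λ c d → B c d *ᴷ A a b *ᴷ (δ (toℕ a) (toℕ d) *ᴷ e c b)))
        ≈⟨ +-cong (contract A B v t) (-‿cong (≈-trans (∑₂-comm λ a b c d → B c d *ᴷ A a b *ᴷ (δ (toℕ a) (toℕ d) *ᴷ e c b))
             (≈-trans (∑₂-cong λ c d → ∑₂-cong λ a b → *-congˡ (*-congʳ (δ-sym (toℕ a) (toℕ d)))) (contract B A v t)))) ⟩
      action (A ·ᵐ B) v t -ᴷ action (B ·ᵐ A) v t
        ≈⟨ ∑₂-minus (λ a b → (A ·ᵐ B) a b *ᴷ e a b) (λ a b → (B ·ᵐ A) a b *ᴷ e a b) ⟨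
      ∑₂ (λ a b → (A ·ᵐ B) a b *ᴷ e a b -ᴷ (B ·ᵐ A) a b *ᴷ e a b)
        ≈⟨ ∑₂-cong (λ a b → solve 3 (λ x y e → x :* e :- y :* e := (x :- y) :* e) ≈-refl ((A ·ᵐ B) a b) ((B ·ᵐ A) a b) (e a b)) ⟩
      action (λ a b → (A ·ᵐ B) a b -ᴷ (B ·ᵐ A) a b) v t ∎)
      where
      e : Fin n → Fin n → 𝕜
      e a b = apply (Eᶠ a b) v t
      EE : Fin n → Fin n → Fin n → Fin n → 𝕜
      EE a b c d = apply (Eᶠ a b) (apply (Eᶠ c d) v) t

    representation : Representation V[ Tableau ] n
    representation = record
      { _∙_       = λ A v → action (matrix A) v
      ; ∙-cong    = λ A≈B v≈w t → ∑₂-cong λ a b → *-cong (A≈B a b) (apply-cong (Eᶠ a b) v≈w t)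
      ; ∙-+ᴹ      = λ A v w t → ≈-trans
          (∑₂-cong λ a b → ≈-trans (*-congˡ (apply-+ (Eᶠ a b) v w t)) (distribˡ (matrix A a b) _ _))
          (∑₂-+ (λ a b → matrix A a b *ᴷ apply (Eᶠ a b) v t) (λ a b → matrix A a b *ᴷ apply (Eᶠ a b) w t))
      ; ∙-*ₗ      = λ A k v t → ≈-trans
          (∑₂-cong λ a b → ≈-trans (*-congˡ (apply-* (Eᶠ a b) k v t))
            (solve 3 (λ a k e → a :* (k :* e) := k :* (a :* e)) ≈-refl (matrix A a b) k (apply (Eᶠ a b) v t)))
          (≈-sym (∑₂-*ˡ k (λ a b → matrix A a b *ᴷ apply (Eᶠ a b) v t)))
      ; +ˢ-∙      = λ A B v t → ≈-trans
          (∑₂-cong λ a b → distribʳ (apply (Eᶠ a b) v t) (matrix A a b) (matrix B a b))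
          (∑₂-+ (λ a b → matrix A a b *ᴷ apply (Eᶠ a b) v t) (λ a b → matrix B a b *ᴷ apply (Eᶠ a b) v t))
      ; *ˢ-∙      = λ k A v t → ≈-trans
          (∑₂-cong λ a b → *-assoc k (matrix A a b) (apply (Eᶠ a b) v t))
          (≈-sym (∑₂-*ˡ k (λ a b → matrix A a b *ᴷ apply (Eᶠ a b) v t)))
      ; bracket-∙ = λ A B v t → action-bracket (matrix A) (matrix B) v t
      }

  open Representation representation

  toℕ-lower : ∀ k (i : Color k) → toℕ (lower k i) ≡ toℕ i
  toℕ-lower (suc k) i = Finₚ.toℕ-inject₁ i

  toℕ-upper : ∀ k (i : Color k) → toℕ (upper k i) ≡ suc (toℕ i)
  toℕ-upper (suc k) i = refl

  ∑₂-unit-difference : ∀ (p q : Fin n) (f : Fin n → Fin n → 𝕜) →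
    ∑₂ (λ a b → (unit p p a b -ᴷ unit q q a b) *ᴷ f a b) ≈ f p p -ᴷ f q q
  ∑₂-unit-difference p q f = begin
    ∑₂ (λ a b → (unit p p a b -ᴷ unit q q a b) *ᴷ f a b)
      ≈⟨ ∑₂-cong (λ a b → solve 3 (λ x y e → (x :- y) :* e := x :* e :- y :* e) ≈-refl (unit p p a b) (unit q q a b) (f a b)) ⟩
    ∑₂ (λ a b → unit p p a b *ᴷ f a b -ᴷ unit q q a b *ᴷ f a b)
      ≈⟨ ∑₂-minus (λ a b → unit p p a b *ᴷ f a b) (λ a b → unit q q a b *ᴷ f a b) ⟩
    ∑₂ (λ a b → unit p p a b *ᴷ f a b) -ᴷ ∑₂ (λ a b → unit q q a b *ᴷ f a b)
      ≈⟨ +-cong (∑₂-unit p p f) (-‿cong (∑₂-unit q q f)) ⟩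
    f p p -ᴷ f q q ∎

  wtᵢ-* : ∀ i t (k : 𝕜) → ι-ℤ (+ #[ colorℕ i ] t) *ᴷ k -ᴷ ι-ℤ (+ #[ suc (colorℕ i) ] t) *ᴷ k ≈ ι-ℤ (wtᵢ i t) *ᴷ k
  wtᵢ-* i t k = ≈-trans
    (solve 3 (λ a b v → a :* v :- b :* v := (a :- b) :* v) ≈-refl (ι-ℤ (+ #[ colorℕ i ] t)) (ι-ℤ (+ #[ suc (colorℕ i) ] t)) k)
    (*-congʳ (≈-sym (≈-trans (ι-ℤ-+ (+ #[ colorℕ i ] t) (ℤ.- + #[ suc (colorℕ i) ] t)) (+-congˡ (ι-ℤ-neg (+ #[ suc (colorℕ i) ] t))))))

  opaque
    unfolding action representation

    E-x : ∀ i → Eᶠ (lower n i) (upper n i) ≋ xᵒ i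
    E-x i = ≋-reflexive (trans (cong₂ E (toℕ-lower n i) (toℕ-upper n i)) (trans (E-simple (toℕ i)) (atColor-toℕ xᵒ i)))

    x-∙ : ∀ i v t → (x i ∙ v) t ≈ apply (xᵒ i) v t
    x-∙ i v t = ≈-trans (∑₂-unit (lower n i) (upper n i) (λ a b → apply (Eᶠ a b) v t)) (at (E-x i) v t)

    E-y : ∀ i → Eᶠ (upper n i) (lower n i) ≋ yᵒ i
    E-y i = ≋-trans (≋-reflexive (trans (cong₂ E (toℕ-upper n i) (toℕ-lower n i)) (trans (cong (λ k → E (suc k) (toℕ i)) (sym (ℕₚ.+-identityʳ (toℕ i))))
      (E-lower (toℕ i) 0)))) (≋-trans (-ᵒ-cong (zᴺ-≋ i)) (-ᵒ-involutive (yᵒ i)))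

    y-∙ : ∀ i v t → (y i ∙ v) t ≈ apply (yᵒ i) v t
    y-∙ i v t = ≈-trans (∑₂-unit (upper n i) (lower n i) (λ a b → apply (Eᶠ a b) v t)) (at (E-y i) v t)

    E-lower-diagonal : ∀ i → Eᶠ (lower n i) (lower n i) ≋ εᵒ (toℕ i)
    E-lower-diagonal i = ≋-reflexive (trans (cong₂ E (toℕ-lower n i) (toℕ-lower n i)) (E-diagonal (toℕ i)))

    E-upper-diagonal : ∀ i → Eᶠ (upper n i) (upper n i) ≋ εᵒ (suc (toℕ i))
    E-upper-diagonal i = ≋-reflexive (trans (cong₂ E (toℕ-upper n i) (toℕ-upper n i)) (E-diagonal (suc (toℕ i))))

    h-∙ : ∀ i v t → (h i ∙ v) t ≈ ι-ℤ (wtᵢ i t) *ᴷ v t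
    h-∙ i v t = ≈-trans (∑₂-unit-difference (lower n i) (upper n i) (λ a b → apply (Eᶠ a b) v t))
      (≈-trans (+-cong (at (E-lower-diagonal i) v t) (-‿cong (at (E-upper-diagonal i) v t))) (wtᵢ-* i t (v t)))

  private
    b[_] : Tableau → Vector
    b[ T ] = v[_] shape T

  b-self : ∀ T → b[ T ] T ≈ 1#
  b-self T = CommutativeRing.reflexive 𝕜-ring (cong (if_then 1# else 0#) (dec-true (T ≟ᵗ T) refl))

  b-other : ∀ {T U} → T ≢ U → b[ T ] U ≈ 0#
  b-other {T} {U} T≢U = CommutativeRing.reflexive 𝕜-ring (cong (if_then 1# else 0#) (dec-false (T ≟ᵗ U) T≢U))

  ∑-b : ∀ (f : Tableau → 𝕜) U → ∑ᴷ (λ T → f T *ᴷ b[ T ] U) tableaux ≈ f U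
  ∑-b f U = ≈-trans (∑ᴷ-only _ U λ T T≢U → ≈-trans (*-congˡ (b-other T≢U)) (zeroʳ (f T)))
    (≈-trans (*-congˡ (b-self U)) (*-identityʳ (f U)))

  matrixOp-b : ∀ M T U → apply (matrixOp M) b[ T ] U ≈ M T U
  matrixOp-b M T U = ≈-trans (∑ᴷ-only (λ S → M S U *ᴷ b[ T ] S) T λ S S≢T → ≈-trans (*-congˡ (b-other (S≢T ∘ sym))) (zeroʳ (M S U)))
    (≈-trans (*-congˡ (b-self T)) (*-identityʳ (M T U)))

  x-b : ∀ i S T → (x i ∙ b[ S ]) T ≈ Xᶜ i S T
  x-b i S T = ≈-trans (x-∙ i b[ S ] T) (matrixOp-b (Xᶜ i) S T)

  y-b : ∀ i S T → (y i ∙ b[ T ]) S ≈ Yᶜ i S T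
  y-b i S T = ≈-trans (y-∙ i b[ T ] S) (matrixOp-b (λ T S → Yᶜ i S T) T S)

  ∑ᴹ-at : ∀ {A : Set} (f : A → Vector) xs t → ∑ᴹ V[ Tableau ] (List.map f xs) t ≡ ∑ᴷ (λ a → f a t) xs
  ∑ᴹ-at f []       t = refl
  ∑ᴹ-at f (a ∷ xs) t = cong (f a t +ᴷ_) (∑ᴹ-at f xs t)

  h-b : ∀ i T t → (h i ∙ b[ T ]) t ≈ ι-ℤ (wtᵢ i T) *ᴷ b[ T ] t
  h-b i T t = ≈-trans (h-∙ i b[ T ] t) (by-cases (T ≟ᵗ t))
    where
    by-cases : Dec (T ≡ t) → ι-ℤ (wtᵢ i t) *ᴷ b[ T ] t ≈ ι-ℤ (wtᵢ i T) *ᴷ b[ T ] t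
    by-cases (yes refl) = ≈-refl
    by-cases (no T≢t)   = ≈-trans (*-congˡ (b-other T≢t)) (≈-trans (zeroʳ _) (≈-sym (≈-trans (*-congˡ (b-other T≢t)) (zeroʳ _))))

  actsByScalars : ActsByScalars shape representation
  actsByScalars i T = x-acts , y-acts , h-b i T
    where
    x-acts : ∀ U → (x i ∙ b[ T ]) U ≈ ∑ᴹ V[ Tableau ] (List.map (λ (S , e) t → ι (X e) *ᴷ b[ S ] t) (edgesFrom i T)) U
    x-acts U = ≈-trans (x-b i T U) (≈-trans (≈-sym (∑-b (Xᶜ i T) U)) (≈-trans
      (∑-edgesFrom i T (λ S → Xᶜ i T S *ᴷ b[ S ] U) (λ {S} e → ι (X e) *ᴷ b[ S ] U) (λ e → *-congʳ (Xᶜ-edge e))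
        (λ S ¬e → ≈-trans (*-congʳ (Xᶜ-no ¬e)) (zeroˡ _)))
      (CommutativeRing.reflexive 𝕜-ring (sym (∑ᴹ-at (λ (S , e) t → ι (X e) *ᴷ b[ S ] t) (edgesFrom i T) U)))))
    y-acts : ∀ U → (y i ∙ b[ T ]) U ≈ ∑ᴹ V[ Tableau ] (List.map (λ (S , e) t → ι (Y e) *ᴷ b[ S ] t) (edgesInto i T)) U
    y-acts U = ≈-trans (y-b i U T) (≈-trans (≈-sym (∑-b (λ S → Yᶜ i S T) U)) (≈-trans
      (∑-edgesInto i T (λ S → Yᶜ i S T *ᴷ b[ S ] U) (λ {S} e → ι (Y e) *ᴷ b[ S ] U) (λ e → *-congʳ (Yᶜ-edge e))
        (λ S ¬e → ≈-trans (*-congʳ (Yᶜ-no ¬e)) (zeroˡ _)))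
      (CommutativeRing.reflexive 𝕜-ring (sym (∑ᴹ-at (λ (S , e) t → ι (Y e) *ᴷ b[ S ] t) (edgesInto i T) U)))))

  b-weight : ∀ T {μ} → wt T ≡ μ → WeightSpace V[ Tableau ] representation μ b[ T ]
  b-weight T refl i t = ≈-trans (h-b i T t) (*-congʳ (ι-ℤ-cong (sym (Vecₚ.lookup∘tabulate (λ i → wtᵢ i T) i))))

  isWeightBasis : IsWeightBasis shape representation
  isWeightBasis = record
    { inside      = λ _ → tt
    ; spanning    = λ v _ → v , λ t → ≈-sym (≈-trans (CommutativeRing.reflexive 𝕜-ring (∑ᴹ-at (λ T t → v T *ᴷ b[ T ] t) tableaux t)) (∑-b v t))
    ; independent = λ κ κ≈0 T → ≈-trans (≈-sym (∑-b κ T))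
        (≈-trans (CommutativeRing.reflexive 𝕜-ring (sym (∑ᴹ-at (λ T t → κ T *ᴷ b[ T ] t) tableaux T))) (κ≈0 T))
    } , λ T → (λ b≈0 → 1≉0 (≈-trans (≈-sym (b-self T)) (b≈0 T))) , b-weight T refl

  module _ (μ : Weight n) where

    private
      hasWeight? : Decidable (λ T → wt T ≡ μ)
      hasWeight? T = wt T ≟ʷ μ

      Tμ : List Tableau
      Tμ = List.filter hasWeight? tableaux

    -- Some coordinate of `wt T` differs from that of `μ`. Their difference is a nonzero integer
    -- that annihilates `v T`, which characteristic zero excludes unless `v T` is zero.
    weightVector-vanishes : ∀ v → WeightSpace V[ Tableau ] representation μ v → ∀ T → wt T ≢ μ → v T ≈ 0#
    weightVector-vanishes v v∈ T wt≢μ = ι-ℤ-torsionFree (wtᵢ i T ℤ.- Vec.lookup μ i) (≢ ∘ ℤₚ.i-j≡0⇒i≡j (wtᵢ i T) (Vec.lookup μ i)) (begin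
      ι-ℤ (wtᵢ i T ℤ.- Vec.lookup μ i) *ᴷ v T
        ≈⟨ *-congʳ (≈-trans (ι-ℤ-+ (wtᵢ i T) (ℤ.- Vec.lookup μ i)) (+-congˡ (ι-ℤ-neg (Vec.lookup μ i)))) ⟩
      (ι-ℤ (wtᵢ i T) -ᴷ ι-ℤ (Vec.lookup μ i)) *ᴷ v T
        ≈⟨ solve 3 (λ a b v → (a :- b) :* v := a :* v :- b :* v) ≈-refl (ι-ℤ (wtᵢ i T)) (ι-ℤ (Vec.lookup μ i)) (v T) ⟩
      ι-ℤ (wtᵢ i T) *ᴷ v T -ᴷ ι-ℤ (Vec.lookup μ i) *ᴷ v T
        ≈⟨ +-congʳ (≈-trans (≈-sym (h-∙ i v T)) (v∈ i T)) ⟩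
      ι-ℤ (Vec.lookup μ i) *ᴷ v T -ᴷ ι-ℤ (Vec.lookup μ i) *ᴷ v T
        ≈⟨ -‿inverseʳ _ ⟩
      0# ∎)
      where
      differ : ∃[ i ] wtᵢ i T ≢ Vec.lookup μ i
      differ = Finₚ.¬∀⟶∃¬ N _ (λ i → wtᵢ i T ℤ.≟ Vec.lookup μ i) λ same →
        wt≢μ (lookup-ext _ _ λ i → trans (Vecₚ.lookup∘tabulate (λ i → wtᵢ i T) i) (same i))
      i = proj₁ differ
      ≢ = proj₂ differ

    ∑-lookup : ∀ (f : Tableau → 𝕜) xs → ∑ᴷ (f ∘ List.lookup xs) (List.allFin (List.length xs)) ≡ ∑ᴷ f xs
    ∑-lookup f xs = cong (List.foldr _+ᴷ_ 0#) (trans (Listₚ.map-tabulate id (f ∘ List.lookup xs))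
      (trans (sym (Listₚ.map-tabulate (List.lookup xs) f)) (cong (List.map f) (Listₚ.tabulate-lookup xs))))

    weightSpace-basis : IsBasis V[ Tableau ] (WeightSpace V[ Tableau ] representation μ) (List.allFin (List.length Tμ))
                          (λ k → b[ List.lookup Tμ k ])
    weightSpace-basis = record { inside = inside ; spanning = spanning ; independent = independent }
      where
      inside : ∀ k → WeightSpace V[ Tableau ] representation μ b[ List.lookup Tμ k ]
      inside k = b-weight (List.lookup Tμ k) (proj₂ (∈ₚ.∈-filter⁻ hasWeight? {xs = tableaux} (∈ₚ.∈-lookup {xs = Tμ} k)))

      spanning : ∀ v → WeightSpace V[ Tableau ] representation μ v →
        Σ[ κ ∈ (Fin (List.length Tμ) → 𝕜) ] (∀ t → v t ≈ ∑ᴹ V[ Tableau ] (List.map (λ k t → κ k *ᴷ b[ List.lookup Tμ k ] t) (List.allFin (List.length Tμ))) t)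
      spanning v v∈ = v ∘ List.lookup Tμ , λ t → ≈-sym (begin
        ∑ᴹ V[ Tableau ] (List.map (λ k t → v (List.lookup Tμ k) *ᴷ b[ List.lookup Tμ k ] t) (List.allFin (List.length Tμ))) t
          ≡⟨ ∑ᴹ-at (λ k t → v (List.lookup Tμ k) *ᴷ b[ List.lookup Tμ k ] t) (List.allFin (List.length Tμ)) t ⟩
        ∑ᴷ (λ k → v (List.lookup Tμ k) *ᴷ b[ List.lookup Tμ k ] t) (List.allFin (List.length Tμ))
          ≡⟨ ∑-lookup (λ T → v T *ᴷ b[ T ] t) Tμ ⟩
        ∑ᴷ (λ T → v T *ᴷ b[ T ] t) Tμ
          ≈⟨ ∑ᴷ-Operator.big-filter hasWeight? (λ T → v T *ᴷ b[ T ] t) tableaux ⟩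
        ∑ᴷ (λ T → if does (hasWeight? T) then v T *ᴷ b[ T ] t else 0#) tableaux
          ≈⟨ ∑ᴷ-Operator.big-cong tableaux (restrict t) ⟩
        ∑ᴷ (λ T → v T *ᴷ b[ T ] t) tableaux
          ≈⟨ ∑-b v t ⟩
        v t ∎)
        where
        restrict : ∀ t T → (if does (hasWeight? T) then v T *ᴷ b[ T ] t else 0#) ≈ v T *ᴷ b[ T ] t
        restrict t T = by-cases (hasWeight? T)
          where
          by-cases : (d : Dec (wt T ≡ μ)) → (if does d then v T *ᴷ b[ T ] t else 0#) ≈ v T *ᴷ b[ T ] t
          by-cases (yes _)    = ≈-refl
          by-cases (no wt≢μ) = ≈-sym (≈-trans (*-congʳ (weightVector-vanishes v v∈ T wt≢μ)) (zeroˡ _))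

      independent : ∀ (κ : Fin (List.length Tμ) → 𝕜) →
        (∀ t → ∑ᴹ V[ Tableau ] (List.map (λ k t → κ k *ᴷ b[ List.lookup Tμ k ] t) (List.allFin (List.length Tμ))) t ≈ 0#) → ∀ k → κ k ≈ 0#
      independent κ κ≈0 k = begin
        κ k                                     ≈⟨ *-identityʳ (κ k) ⟨
        κ k *ᴷ 1#                               ≈⟨ *-congˡ (b-self (List.lookup Tμ k)) ⟨
        κ k *ᴷ b[ List.lookup Tμ k ] (List.lookup Tμ k)
          ≈⟨ ∑ᴷ-Operator.big-only Finₚ._≟_ (λ j → κ j *ᴷ b[ List.lookup Tμ j ] (List.lookup Tμ k)) (Uniqueₚ.allFin⁺ _) (∈ₚ.∈-allFin k)
               (λ j j≢k → ≈-trans (*-congˡ (b-other (j≢k ∘ lookup-injective (Uniqueₚ.filter⁺ hasWeight? (Combinatorics.tableaux-unique shape)) j k))) (zeroʳ (κ j))) ⟨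
        ∑ᴷ (λ j → κ j *ᴷ b[ List.lookup Tμ j ] (List.lookup Tμ k)) (List.allFin (List.length Tμ))
          ≡⟨ ∑ᴹ-at (λ j t → κ j *ᴷ b[ List.lookup Tμ j ] t) (List.allFin (List.length Tμ)) (List.lookup Tμ k) ⟨
        ∑ᴹ V[ Tableau ] (List.map (λ j t → κ j *ᴷ b[ List.lookup Tμ j ] t) (List.allFin (List.length Tμ))) (List.lookup Tμ k)
          ≈⟨ κ≈0 (List.lookup Tμ k) ⟩
        0# ∎

    ϑ-length : ϑ μ ≡ + List.length Tμ
    ϑ-length = count tableaux
      where
      count : ∀ xs → ∑ℤ (List.map (λ T → z^ n (wt T) μ) xs) ≡ + List.length (List.filter hasWeight? xs)
      count []       = refl
      count (T ∷ xs) with does (wt T ≟ʷ μ)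
      ... | true  = cong (λ k → 1ℤ ℤ.+ k) (count xs)
      ... | false = trans (ℤₚ.+-identityˡ _) (count xs)

  hasCharacter : HasCharacter V[ Tableau ] representation ϑ
  hasCharacter μ = _ , (_ , weightSpace-basis μ) , ϑ-length μ

  isRepresentationDiagram : IsRepresentationDiagram shape representation
  isRepresentationDiagram = (λ i S T → mk⇔ supporting (edge i S T)) , λ {i} {S} {T} e →
    ≈-trans (x-b i S T) (Xᶜ-edge e) , ≈-trans (y-b i S T) (Yᶜ-edge e)
    where
    supporting : ∀ {i S T} → Edge i S T → SupportingEdge shape representation i S T
    -- The coefficient of `x` certifies the edge, since it is the image of the nonzero rational
    -- number `X e`.
    supporting {i} {S} {T} e = inj₁ (#-congʳ (≈-sym (≈-trans (x-b i S T) (Xᶜ-edge e))) (ι-#0 (Diamond.X≢0 shape e)))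
    edge : ∀ i S T → SupportingEdge shape representation i S T → Edge i S T
    -- Edges are decidable, so it is enough to refute the absence of one: the coefficient would then
    -- be zero, against its apartness from zero.
    edge i S T (inj₁ x#0) = decidable-stable (edge? i S T) λ ¬e → #⇒≉ x#0 (≈-trans (x-b i S T) (Xᶜ-no ¬e))
    edge i S T (inj₂ y#0) = decidable-stable (edge? i S T) λ ¬e → #⇒≉ y#0 (≈-trans (y-b i S T) (Yᶜ-no ¬e))

theorem6p4 : ∀ {c ℓ₁ ℓ₂} (m n : ℕ) → 2 ≤ n → n ≤ m →
    (shape : SkewShape m n) (K : HeytingField c ℓ₁ ℓ₂) (char0 : CharacteristicZero K) →
    let open SkewTableaux shape
        open FieldDefs K char0 in
    AStructured × DiamondRelations × CrossingRelations ×
    (Σ[ ρ ∈ Representation V[ Tableau ] n ]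
      (ActsByScalars shape ρ × IsWeightBasis shape ρ ×
       HasCharacter V[ Tableau ] ρ ϑ × IsRepresentationDiagram shape ρ))
theorem6p4 m n _ _ shape K char0 =
    Combinatorics.aStructured shape
  , Diamond.diamondRelations shape
  , crossingRelations shape
  , R.representation , R.actsByScalars , R.isWeightBasis , R.hasCharacter , R.isRepresentationDiagram
  where module R = TableauRepresentation K char0 shape
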